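{- Fix any $\mathbf s\in{\rm Score}(C_n)$. Then lazy simple random walk on the Coxeter interchange graph ${\rm IntGr}(C_n,\mathbf s)$ is rapidly mixing. If ${\rm IntGr}(C_n,\mathbf s)$ contains no crystals ($\gamma=0$), then $t_{\rm mix}=O(d\log n)$; otherwise $t_{\rm mix}=O(\gamma d\log n)$. Here $d$ is the degree of ${\rm IntGr}(C_n,\mathbf s)$, $\gamma$ is its maximal crystal degree, and the implied constants do not depend on $n$ or $\mathbf s$.
   Context: Vectors: $\mathbf e^{\pm}_{ij}=\mathbf e_i\pm\mathbf e_j$ ($i>j$), $\mathbf e^\ell_i=2\mathbf e_i$ for negative edges $e^-_{ij}$, positive edges $e^+_{ij}$, loops $e^\ell_i$. $\mathcal K_{C_n}$ is the signed graph on $[n]$ with all negative and positive edges (one of each per pair) and all loops. A Coxeter tournament on $\mathcal K_{C_n}$ is $(w_e)$, $w_e\in\{0,1\}$, over its edges (games); score $\sum_e(w_e-\frac12)\mathbf e$; a sub-tournament is neutral if this sum over its games is $\mathbf 0$; $\mathcal T*\mathcal X$ flips outcomes of the games of $\mathcal X$. ${\rm Score}(C_n)$ = set of score sequences of tournaments on $\mathcal K_{C_n}$. A copy of a type-$C_n$ generator is a neutral sub-tournament whose games are either (neutral triangle) three negative edges pairwise joining three distinct vertices, or one negative and two positive edges pairwise joining three distinct vertices, or (neutral clover) $e^-_{ij},e^+_{ij},e^\ell_i$. ${\rm IntGr}(C_n,\mathbf s)$: multigraph on tournaments on $\mathcal K_{C_n}$ with score $\mathbf s$, $\mathcal T_1,\mathcal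 T_2$ joined iff $\mathcal T_2=\mathcal T_1*\mathcal G$ for a generator copy $\mathcal G\subseteq\mathcal T_1$ (double edge if clover, single otherwise). It is known to be regular; $d$ is its common degree (double edges counted twice). For $\mathcal T_1,\mathcal T_2$ at distance two, $N(\mathcal T_1,\mathcal T_2)$ is the union of all paths of length two between them, and $\hat N(\mathcal T_1,\mathcal T_2)$ is the union of $N(\mathcal T_1',\mathcal T_2')$ over all pairs of vertices of $N(\mathcal T_1,\mathcal T_2)$ at distance two. A crystal is such an extended network isomorphic to the multigraph on six distinct vertices $a,b,c,d,y,z$ with single edges $ab,bc,cd,da$ and double edges $ay,cy,bz,dz$ (no other edges). The crystal degree of a double edge is the number of crystals containing it, and $\gamma$ is the maximum crystal degree over all double edges. Lazy simple random walk: stay put with probability $1/2$, otherwise traverse an edge chosen uniformly among those incident to the current vertex (double edges counted twice). Mixing time $t_{\rm mix}=\min\{t:\max_x\frac12\sum_y|P^t(x,y)-\pi(y)|\le1/4\}$, $\pi$ the stationary distribution. -}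

module Defs where

open import Data.Bool using (Bool; true; false; not; _∧_; _∨_; if_then_else_)
open import Data.Nat as ℕ using (ℕ; zero; suc; _≡ᵇ_; _<ᵇ_)
open import Data.Fin using (Fin; toℕ)
open import Data.Fin.Properties using () renaming (_≟_ to _≟F_)
open import Data.Integer as ℤ using (ℤ; +_; -[1+_])
open import Data.Rational as ℚ using (ℚ; 0ℚ; 1ℚ; ½)
open import Data.List as List using (List; []; _∷_; _++_; concatMap; length; allFin)
open import Data.List.Membership.Propositional using (_∈_)
open import Data.Bool.ListAction using (any)
open import Data.Nat.ListAction using (sum)
open import Data.List.Relation.Unary.Unique.Propositional using (Unique)
open import Data.Vec as Vec using (Vec; tabulate; zipWith; replicate; toList; fromList)
open import Data.Vec.Properties using (≡-dec)
open import Data.Product using (Σ; _×_; _,_)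
open import Data.Sum using (_⊎_)
open import Relation.Nullary using (does)
open import Relation.Binary.PropositionalEquality using (_≡_)

_==F_ : {n : ℕ} → Fin n → Fin n → Bool
i ==F j = does (i ≟F j)

anyF : {K : ℕ} → (Fin K → Bool) → Bool
anyF {K} f = any f (allFin K)

sumℕ : {K : ℕ} → (Fin K → ℕ) → ℕ
sumℕ {K} f = sum (List.map f (allFin K))

sumℚ : {K : ℕ} → (Fin K → ℚ) → ℚ
sumℚ {K} f = List.foldr ℚ._+_ 0ℚ (List.map f (allFin K))

-- neg i j : e^-_{ij},  pos i j : e^+_{ij}  (only used with j < i),
-- loop i  : e^ℓ_i
data Edge (n : ℕ) : Set where
  neg  : Fin n → Fin n → Edge n
  pos  : Fin n → Fin n → Edge n
  loop : Fin n → Edge n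

_==E_ : {n : ℕ} → Edge n → Edge n → Bool
neg i j ==E neg k l = (i ==F k) ∧ (j ==F l)
pos i j ==E pos k l = (i ==F k) ∧ (j ==F l)
loop i  ==E loop k  = i ==F k
_ ==E _ = false

_∈E_ : {n : ℕ} → Edge n → List (Edge n) → Bool
e ∈E S = any (e ==E_) S

edges : (n : ℕ) → List (Edge n)
edges n =
  concatMap (λ i → concatMap (λ j →
      if toℕ j <ᵇ toℕ i then neg i j ∷ pos i j ∷ [] else []) (allFin n)) (allFin n)
  ++ List.map loop (allFin n)

M : ℕ → ℕ
M n = length (edges n)

unit : {n : ℕ} → Fin n → Vec ℤ n
unit i = tabulate (λ k → if k ==F i then + 1 else + 0)

evec : {n : ℕ} → Edge n → Vec ℤ n
evec (neg i j) = zipWith ℤ._-_ (unit i) (unit j)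
evec (pos i j) = zipWith ℤ._+_ (unit i) (unit j)
evec (loop i)  = zipWith ℤ._+_ (unit i) (unit i)

zeroV : {n : ℕ} → Vec ℤ n
zeroV = replicate _ (+ 0)

sumV : {n : ℕ} → List (Vec ℤ n) → Vec ℤ n
sumV = List.foldr (zipWith ℤ._+_) zeroV

-- Coxeter tournaments on K_{C_n}: an outcome w_e ∈ {0,1} (false/true)
-- for each game, games listed in the order of  edges n.

Tournament : ℕ → Set
Tournament n = Vec Bool (M n)

-- 2 (w - 1/2) ∈ {-1, 1}
sgn : Bool → ℤ
sgn true  = + 1
sgn false = -[1+ 0 ]

-- TWICE the score vector  Σ_e (w_e - 1/2) e  (doubling avoids halves)
score2 : {n : ℕ} → Tournament n → Vec ℤ n
score2 {n} T = sumV (toList (zipWith (λ e b → Vec.map (sgn b ℤ.*_) (evec e)) (fromList (edges n)) T))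

InScore2 : (n : ℕ) → Vec ℤ n → Set
InScore2 n s = Σ (Tournament n) (λ T → score2 T ≡ s)

allVecs : (m : ℕ) → List (Vec Bool m)
allVecs zero    = Vec.[] ∷ []
allVecs (suc m) = concatMap (λ v → (true Vec.∷ v) ∷ (false Vec.∷ v) ∷ []) (allVecs m)

-- Generator copies.  Every copy of a type-C_n generator (as a set of
-- edges) appears exactly once in  genShapes n, with its edge weight
-- (2 for a clover, 1 for a triangle).

tri : {n : ℕ} → Fin n → Fin n → Fin n → List (ℕ × List (Edge n))
tri i j k =
    (1 , neg i j ∷ neg j k ∷ neg i k ∷ [])
  ∷ (1 , neg i j ∷ pos j k ∷ pos i k ∷ [])
  ∷ (1 , pos i j ∷ neg j k ∷ pos i k ∷ [])
  ∷ (1 , pos i j ∷ pos j k ∷ neg i k ∷ [])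
  ∷ []

clov : {n : ℕ} → Fin n → Fin n → List (ℕ × List (Edge n))
clov i j =
    (2 , neg i j ∷ pos i j ∷ loop i ∷ [])
  ∷ (2 , neg i j ∷ pos i j ∷ loop j ∷ [])
  ∷ []

genShapes : (n : ℕ) → List (ℕ × List (Edge n))
genShapes n =
  concatMap (λ i → concatMap (λ j → concatMap (λ k →
      if (toℕ j <ᵇ toℕ i) ∧ (toℕ k <ᵇ toℕ j) then tri i j k else [])
    (allFin n)) (allFin n)) (allFin n)
  ++
  concatMap (λ i → concatMap (λ j →
      if toℕ j <ᵇ toℕ i then clov i j else []) (allFin n)) (allFin n)

neutral : {n : ℕ} → Tournament n → List (Edge n) → Bool
neutral {n} T S =
  does (≡-dec ℤ._≟_
    (sumV (toList (zipWith (λ e b → if e ∈E S then Vec.map (sgn b ℤ.*_) (evec e) else zeroV)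
                           (fromList (edges n)) T)))
    zeroV)

flipT : {n : ℕ} → Tournament n → List (Edge n) → Tournament n
flipT {n} T S = zipWith (λ e b → if e ∈E S then not b else b) (fromList (edges n)) T

multT : {n : ℕ} → Tournament n → Tournament n → ℕ
multT {n} T1 T2 =
  sum (List.map (λ { (w , S) →
    if neutral T1 S ∧ does (≡-dec Data.Bool._≟_ (flipT T1 S) T2) then w else 0 })
    (genShapes n))
  where import Data.Bool

verts : (n : ℕ) → Vec ℤ n → List (Tournament n)
verts n s = List.filter (λ T → ≡-dec ℤ._≟_ (score2 T) s) (allVecs (M n))

K : (n : ℕ) → Vec ℤ n → ℕ
K n s = length (verts n s)

vtx : {n : ℕ} {s : Vec ℤ n} → Fin (K n s) → Tournament n
vtx {n} {s} i = List.lookup (verts n s) i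

IntGr : (n : ℕ) (s : Vec ℤ n) → Fin (K n s) → Fin (K n s) → ℕ
IntGr n s x y = multT {n} (vtx {n} {s} x) (vtx {n} {s} y)

module _ {K : ℕ} (mult : Fin K → Fin K → ℕ) where

  deg : Fin K → ℕ
  deg x = sumℕ (mult x)

  IsRegularOfDegree : ℕ → Set
  IsRegularOfDegree d = (x : Fin K) → deg x ≡ d

  adj : Fin K → Fin K → Bool
  adj x y = not (mult x y ≡ᵇ 0)

  mid : Fin K → Fin K → Fin K → Bool
  mid x y m = adj x m ∧ adj m y

  dist2 : Fin K → Fin K → Bool
  dist2 x y = not (x ==F y) ∧ not (adj x y) ∧ anyF (mid x y)

  inVN : Fin K → Fin K → Fin K → Bool
  inVN x y v = (v ==F x) ∨ (v ==F y) ∨ mid x y v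

  -- {u,v} is an edge (with all its parallel copies) of N(x,y)
  inN : Fin K → Fin K → Fin K → Fin K → Bool
  inN x y u v = (((u ==F x) ∨ (u ==F y)) ∧ mid x y v)
              ∨ (((v ==F x) ∨ (v ==F y)) ∧ mid x y u)

  inNhat : Fin K → Fin K → Fin K → Fin K → Bool
  inNhat x y u v = anyF (λ x' → anyF (λ y' →
    inVN x y x' ∧ inVN x y y' ∧ dist2 x' y' ∧ inN x' y' u v))

  -- a subgraph is given by its (symmetric) edge set; its vertices are
  -- the endpoints of its edges, and edges carry full multiplicity
  SubGraph : Set
  SubGraph = Vec (Vec Bool K) K

  hasEdge : SubGraph → Fin K → Fin K → Bool
  hasEdge H u v = Vec.lookup (Vec.lookup H u) v

  Nhat : Fin K → Fin K → SubGraph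
  Nhat x y = tabulate (λ u → tabulate (λ v → inNhat x y u v))

  isVertex : SubGraph → Fin K → Bool
  isVertex H v = anyF (hasEdge H v)

  multIn : SubGraph → Fin K → Fin K → ℕ
  multIn H u v = if hasEdge H u v then mult u v else 0

  IsCrystalShaped : SubGraph → Set
  IsCrystalShaped H =
    Σ (Fin 6 → Fin K) λ φ →
      ((a b : Fin 6) → φ a ≡ φ b → a ≡ b)
    × ((v : Fin K) → isVertex H v ≡ true → Σ (Fin 6) λ a → φ a ≡ v)
    × ((a b : Fin 6) → multIn H (φ a) (φ b) ≡ crystalMult a b)
    where
    edgeIs : ℕ → ℕ → ℕ → ℕ → Bool
    edgeIs i j a b = ((i ≡ᵇ a) ∧ (j ≡ᵇ b)) ∨ ((i ≡ᵇ b) ∧ (j ≡ᵇ a))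
    -- vertices a b c d y z = 0 1 2 3 4 5
    crystalMult : Fin 6 → Fin 6 → ℕ
    crystalMult a b =
      let i = toℕ a ; j = toℕ b in
      if edgeIs i j 0 1 ∨ edgeIs i j 1 2 ∨ edgeIs i j 2 3 ∨ edgeIs i j 3 0 then 1
      else if edgeIs i j 0 4 ∨ edgeIs i j 2 4 ∨ edgeIs i j 1 5 ∨ edgeIs i j 3 5 then 2
      else 0

  IsCrystal : SubGraph → Set
  IsCrystal H = Σ (Fin K) λ x → Σ (Fin K) λ y →
    (dist2 x y ≡ true) × (H ≡ Nhat x y) × IsCrystalShaped H

  CrystalDegree : Fin K → Fin K → ℕ → Set
  CrystalDegree p q k = Σ (List SubGraph) λ L →
      Unique L
    × ((H : SubGraph) → (H ∈ L → IsCrystal H × (hasEdge H p q ≡ true))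
                      × (IsCrystal H × (hasEdge H p q ≡ true) → H ∈ L))
    × (length L ≡ k)

  -- γ is the maximum crystal degree over all double edges (0 if none)
  IsMaxCrystalDegree : ℕ → Set
  IsMaxCrystalDegree γ =
      ((p q : Fin K) (k : ℕ) → mult p q ≡ 2 → CrystalDegree p q k → k ℕ.≤ γ)
    × ((γ ≡ 0) ⊎ Σ (Fin K) λ p → Σ (Fin K) λ q → (mult p q ≡ 2) × CrystalDegree p q γ)

  δ : Fin K → Fin K → ℚ
  δ x y = if x ==F y then 1ℚ else 0ℚ

  frac : ℕ → ℕ → ℚ
  frac a zero    = 0ℚ
  frac a (suc k) = (+ a) ℚ./ suc k

  P : Fin K → Fin K → ℚ
  P x y with deg x
  ... | zero  = δ x y
  ... | suc k = ½ ℚ.* δ x y ℚ.+ frac (mult x y) (2 ℕ.* suc k)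

  Pt : ℕ → Fin K → Fin K → ℚ
  Pt zero    x y = δ x y
  Pt (suc t) x y = sumℚ (λ z → Pt t x z ℚ.* P z y)

  IsStationary : (Fin K → ℚ) → Set
  IsStationary π =
      ((y : Fin K) → 0ℚ ℚ.≤ π y)
    × (sumℚ π ≡ 1ℚ)
    × ((y : Fin K) → sumℚ (λ z → π z ℚ.* P z y) ≡ π y)

  dTV : (Fin K → ℚ) → ℕ → Fin K → ℚ
  dTV π t x = ½ ℚ.* sumℚ (λ y → ℚ.∣ Pt t x y ℚ.- π y ∣)

  TmixAtMost : (Fin K → ℚ) → ℕ → Set
  TmixAtMost π B = Σ ℕ λ t → (t ℕ.≤ B) × ((x : Fin K) → dTV π t x ℚ.≤ (+ 1 ℚ./ 4))

{-# OPTIONS --safe #-}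
module Submission where

-- Path coupling, in dual form.  A function F on tournaments is Lipschitz with constants c (γ + 1) across single edges
-- and c γ across double edges (c and c if there are no crystals); one step of the walk multiplies c by at most
-- 1 − 1 / (γ d).  As the interchange graph has diameter at most the number of games, sign functions are almost constant
-- after O(γ d log n) steps.
--
-- With signed vertices ±e_i, a generator is a directed triangle u → v → w → u, a clover if two of its vertices are
-- opposite.  To compare the moves from T and from T₂ across an edge given by a generator G, note that each further
-- signed vertex spans with G a tetrahedron, whose four triangles cover every game twice; hence a move of T on one
-- face meets a move of T₂ on a face of the same tetrahedron.  Nothing is lost except at crystals, where single edges
-- are matched with double ones.  A double edge lies in at most γ crystals, and this is what the weights γ + 1 and γ
-- compensate for.

open import Defs
open import Algebra using (CommutativeRing)
open import Data.Bool using (Bool; true; false; not; _∧_; _∨_; _xor_; if_then_else_; T)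
import Data.Bool as 𝔹
import Data.Bool.Properties as 𝔹ₚ
open import Data.Bool.ListAction using (any)
open import Data.Empty using (⊥; ⊥-elim)
open import Data.Fin using (Fin; toℕ; #_) renaming (zero to fzero; suc to fsuc)
import Data.Fin as Fin
import Data.Fin.Properties as Finₚ
open import Data.Integer as ℤ using (ℤ; +_; -[1+_]; 0ℤ; 1ℤ; _+_; _-_; -_; _*_; _≤_; _<_)
import Data.Integer.Properties as ℤₚ
open import Data.Integer.Tactic.RingSolver using (solve-∀)
open import Data.List as List using (List; []; _∷_; _++_; concatMap; length; allFin)
import Data.List.Properties as Listₚ
open import Data.List.Membership.Propositional using (_∈_)
import Data.List.Membership.Propositional.Properties as ∈ₚ
open import Data.List.Relation.Binary.Permutation.Propositional using (_↭_; prep; swap)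
import Data.List.Relation.Binary.Permutation.Propositional as Perm
import Data.List.Relation.Binary.Permutation.Propositional.Properties as Permₚ
import Data.List.Relation.Binary.Permutation.Setoid.Properties as PermSₚ
open import Data.List.Relation.Unary.All as All using (All; []; _∷_)
open import Data.List.Relation.Unary.AllPairs using (AllPairs; []; _∷_)
import Data.List.Relation.Unary.AllPairs.Properties as AllPairsₚ
open import Data.List.Relation.Unary.Any as Any using (Any; here; there)
open import Data.List.Relation.Unary.Unique.Propositional using (Unique)
import Data.List.Relation.Unary.Unique.Propositional.Properties as Uniqueₚ
open import Data.Nat as ℕ using (ℕ; zero; suc; _<ᵇ_)
open import Data.Nat.ListAction using (sum)
import Data.Nat.Properties as ℕₚ
open import Data.Product using (Σ; ∃; _×_; _,_; proj₁; proj₂)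
open import Data.Sum using (_⊎_; inj₁; inj₂; [_,_]′)
open import Data.Unit using (tt)
open import Data.Vec as Vec using (Vec; []; _∷_; zipWith; toList; fromList; lookup)
import Data.Vec.Properties as Vecₚ
open import Function using (_∘_; id; case_of_; flip)
open import Level using (0ℓ)
open import Relation.Binary.PropositionalEquality using (_≡_; _≢_; _≗_; refl; sym; trans; cong; cong₂; subst; subst₂; setoid; module ≡-Reasoning)
open import Relation.Nullary using (Dec; yes; no; does; ¬_; contradiction)
open import Data.Product.Properties using () renaming (≡-dec to ×-≡-dec)
open import Relation.Binary.Definitions using (tri<; tri≈; tri>)
open import Data.List.Membership.Propositional using () renaming (find to ∈-find; lose to ∈-lose)
open import Relation.Nullary.Decidable using (_×-dec_; _⊎-dec_; _→-dec_; ¬?)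
import Data.List.Relation.Unary.Any.Properties as Anyₚ
import Data.List.Relation.Unary.Unique.DecPropositional.Properties as UniqueDecₚ
open import Data.Nat.Induction using (<-rec)
open import Data.Nat.Logarithm using (⌈log₂_⌉; ⌈log₂⌉-mono-≤; ⌈log₂⌈n/2⌉⌉≡⌈log₂n⌉∸1)
open import Data.Rational as ℚ using (ℚ; 0ℚ; 1ℚ; ½)
import Data.Rational.Properties as ℚₚ
open import Data.Rational.Unnormalised as ℚᵘ using (mkℚᵘ; *≡*; *≤*)
import Data.Rational.Unnormalised.Properties as ℚᵘₚ
import Data.Nat.Tactic.RingSolver as ℕSolver

-- Contraction along an edge (T , T₂) normally comes from the moves T → T₂ and T₂ → T, which make
-- the chains meet. A triangle edge on a crystal loses this: a clover counts twice but faces only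
-- one triangle, so its second copy has to be matched with the move along the edge itself. With
-- equal weights nothing would be gained there. With constants c (γ + 1) and c γ, each of the four
-- matches at such an edge ends on a double edge and gains c. A double edge pays 2 c per crystal
-- through it, at most 2 c γ in all, which its own gain can afford. The dual form avoids couplings
-- as objects: comparing the walk at the two ends of an edge is an inequality between integer sums
-- over generators, and rationals enter only after multiplying each step by 2 d γ. A second obstacle
-- is that γ counts crystals defined by paths in the whole graph. The configurations where matches
-- lose must be shown to be such crystals. They live on three indices, so the shape is checked by
-- evaluation in K_{C_3}; paths through other indices are excluded because the relevant corners
-- differ in at least three games.

module ListSum (R : CommutativeRing 0ℓ 0ℓ) where
  open CommutativeRing R using (Carrier; _≈_; 0#; +-cong; +-congˡ; +-identityˡ; +-identityʳ; +-assoc; zeroʳ; distribˡ)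
  open CommutativeRing R using () renaming (_+_ to _⊞_; _*_ to _⊠_; refl to ≈-refl; sym to ≈-sym; trans to ≈-trans)
  open import Algebra.Properties.CommutativeSemigroup (CommutativeRing.+-commutativeSemigroup R) using (interchange)

  ∑ : {A : Set} → List A → (A → Carrier) → Carrier
  ∑ xs f = List.foldr _⊞_ 0# (List.map f xs)

  module _ {A : Set} where

    ∑-cong-∈ : ∀ (xs : List A) {f g : A → Carrier} → (∀ {x} → x ∈ xs → f x ≈ g x) → ∑ xs f ≈ ∑ xs g
    ∑-cong-∈ []       eq = ≈-refl
    ∑-cong-∈ (x ∷ xs) eq = +-cong (eq (here refl)) (∑-cong-∈ xs (eq ∘ there))

    ∑-cong : ∀ (xs : List A) {f g : A → Carrier} → (∀ x → f x ≈ g x) → ∑ xs f ≈ ∑ xs g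
    ∑-cong xs eq = ∑-cong-∈ xs (λ {x} _ → eq x)

    ∑-zero : ∀ (xs : List A) → ∑ xs (λ _ → 0#) ≈ 0#
    ∑-zero []       = ≈-refl
    ∑-zero (x ∷ xs) = ≈-trans (+-identityˡ _) (∑-zero xs)

    ∑-+ : ∀ (xs : List A) (f g : A → Carrier) → ∑ xs (λ x → f x ⊞ g x) ≈ ∑ xs f ⊞ ∑ xs g
    ∑-+ []       f g = ≈-sym (+-identityˡ 0#)
    ∑-+ (x ∷ xs) f g = ≈-trans (+-congˡ (∑-+ xs f g)) (interchange _ _ _ _)

    ∑-*ˡ : ∀ (xs : List A) c (f : A → Carrier) → ∑ xs (λ x → c ⊠ f x) ≈ c ⊠ ∑ xs f
    ∑-*ˡ []       c f = ≈-sym (zeroʳ c)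
    ∑-*ˡ (x ∷ xs) c f = ≈-trans (+-congˡ (∑-*ˡ xs c f)) (≈-sym (distribˡ c _ _))

    ∑-++ : ∀ (xs ys : List A) (f : A → Carrier) → ∑ (xs ++ ys) f ≈ ∑ xs f ⊞ ∑ ys f
    ∑-++ []       ys f = ≈-sym (+-identityˡ _)
    ∑-++ (x ∷ xs) ys f = ≈-trans (+-congˡ (∑-++ xs ys f)) (≈-sym (+-assoc _ _ _))

    ∑-single : ∀ {x : A} (xs : List A) (f : A → Carrier) → Unique xs → x ∈ xs → (∀ {y} → y ≢ x → f y ≈ 0#) → ∑ xs f ≈ f x
    ∑-single (x ∷ xs) f (x∉ ∷ u) (here refl) off =
      ≈-trans (+-congˡ (≈-trans (∑-cong-∈ xs (λ y∈ → off (λ eq → All.lookup x∉ y∈ (sym eq)))) (∑-zero xs))) (+-identityʳ (f x))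
    ∑-single (y ∷ xs) f (y∉ ∷ u) (there x∈)  off =
      ≈-trans (+-cong (off (All.lookup y∉ x∈)) (∑-single xs f u x∈ off)) (+-identityˡ _)

  ∑-concatMap : ∀ {A B : Set} (xs : List A) (h : A → List B) f → ∑ (concatMap h xs) f ≈ ∑ xs (λ x → ∑ (h x) f)
  ∑-concatMap []       h f = ≈-refl
  ∑-concatMap (x ∷ xs) h f = ≈-trans (∑-++ (h x) (concatMap h xs) f) (+-congˡ (∑-concatMap xs h f))

  ∑-swap : ∀ {A B : Set} (xs : List A) (ys : List B) (f : A → B → Carrier) →
           ∑ xs (λ x → ∑ ys (f x)) ≈ ∑ ys (λ y → ∑ xs (λ x → f x y))
  ∑-swap []       ys f = ≈-sym (∑-zero ys)
  ∑-swap (x ∷ xs) ys f = ≈-trans (+-congˡ (∑-swap xs ys f)) (≈-sym (∑-+ ys (f x) _))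

open ListSum ℤₚ.+-*-commutativeRing

-- The shape in which all linear inequalities below are proved: exhibit the slack and let the ring solver check it.
≤-slack : ∀ {x y} z → 0ℤ ≤ z → x + z ≡ y → x ≤ y
≤-slack {x} z 0≤z refl = subst (_≤ x + z) (ℤₚ.+-identityʳ x) (ℤₚ.+-monoʳ-≤ x 0≤z)

0≤+ : ∀ {x y} → 0ℤ ≤ x → 0ℤ ≤ y → 0ℤ ≤ x + y
0≤+ = ℤₚ.+-mono-≤

0≤* : ∀ {x y} → 0ℤ ≤ x → 0ℤ ≤ y → 0ℤ ≤ x * y
0≤* {x} {y} 0≤x 0≤y = subst (_≤ x * y) (ℤₚ.*-zeroʳ x) (ℤₚ.*-monoˡ-≤-nonNeg x {{ℤ.nonNegative 0≤x}} 0≤y)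

-- Doubling is kept apart from ℤ's multiplication, whose unfolding is expensive to compare.
twice : ℤ → ℤ
twice x = x + x

gap : ∀ {x y} → x ≤ y → 0ℤ ≤ y - x
gap = ℤₚ.i≤j⇒0≤j-i

∑-≤0 : ∀ {A : Set} (xs : List A) {f : A → ℤ} → (∀ {x} → x ∈ xs → f x ≤ 0ℤ) → ∑ xs f ≤ 0ℤ
∑-≤0 []       p = ℤₚ.≤-refl
∑-≤0 (x ∷ xs) p = ℤₚ.+-mono-≤ (p (here refl)) (∑-≤0 xs (p ∘ there))

∑-mono : ∀ {A : Set} (xs : List A) {f g : A → ℤ} → (∀ {x} → x ∈ xs → f x ≤ g x) → ∑ xs f ≤ ∑ xs g
∑-mono []       p = ℤₚ.≤-refl
∑-mono (x ∷ xs) p = ℤₚ.+-mono-≤ (p (here refl)) (∑-mono xs (p ∘ there))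

-- Sums over unordered pairs and triples of list entries

module _ {A : Set} where

  pairs : List A → (A → A → ℤ) → ℤ
  pairs []       k = 0ℤ
  pairs (x ∷ xs) k = ∑ xs (k x) + pairs xs k

  triples : List A → (A → A → A → ℤ) → ℤ
  triples []       t = 0ℤ
  triples (x ∷ xs) t = pairs xs (t x) + triples xs t

  ∑-↭ : ∀ {xs ys} (f : A → ℤ) → xs ↭ ys → ∑ xs f ≡ ∑ ys f
  ∑-↭ f Perm.refl           = refl
  ∑-↭ f (prep x p)          = cong (λ z → f x + z) (∑-↭ f p)
  ∑-↭ f (swap {ys = ys} x y p) rewrite ∑-↭ f p = rearrange (f x) (f y) (∑ ys f)
    where rearrange : ∀ a b c → a + (b + c) ≡ b + (a + c)
          rearrange = solve-∀
  ∑-↭ f (Perm.trans p q)    = trans (∑-↭ f p) (∑-↭ f q)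

  pairs-↭ : ∀ {xs ys} (k : A → A → ℤ) → (∀ x y → k x y ≡ k y x) → xs ↭ ys → pairs xs k ≡ pairs ys k
  pairs-↭ k s Perm.refl              = refl
  pairs-↭ k s (prep x p)             = cong₂ _+_ (∑-↭ (k x) p) (pairs-↭ k s p)
  pairs-↭ k s (swap {ys = ys} x y p) rewrite ∑-↭ (k x) p | ∑-↭ (k y) p | pairs-↭ k s p | s x y =
    rearrange (k y x) (∑ ys (k x)) (∑ ys (k y)) (pairs ys k)
    where rearrange : ∀ a b c d → a + b + (c + d) ≡ a + c + (b + d)
          rearrange = solve-∀
  pairs-↭ k s (Perm.trans p q)       = trans (pairs-↭ k s p) (pairs-↭ k s q)

  pairs-cong : ∀ (xs : List A) {k k′ : A → A → ℤ} → (∀ x y → k x y ≡ k′ x y) → pairs xs k ≡ pairs xs k′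
  pairs-cong []       eq = refl
  pairs-cong (x ∷ xs) eq = cong₂ _+_ (∑-cong xs (eq x)) (pairs-cong xs eq)

  triples-cong : ∀ (xs : List A) {t t′ : A → A → A → ℤ} → (∀ x y z → t x y z ≡ t′ x y z) → triples xs t ≡ triples xs t′
  triples-cong []       eq = refl
  triples-cong (x ∷ xs) eq = cong₂ _+_ (pairs-cong xs (eq x)) (triples-cong xs eq)

  -- The two adjacent transpositions generate all permutations of the arguments, so the order of the
  -- list is irrelevant. This is what allows the indices of a given generator to be moved to the
  -- front of `allFin n`.
  triples-↭ : ∀ {xs ys} (t : A → A → A → ℤ) → (∀ x y z → t x y z ≡ t y x z) → (∀ x y z → t x y z ≡ t x z y) →
              xs ↭ ys → triples xs t ≡ triples ys t
  triples-↭ t s s′ Perm.refl              = refl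
  triples-↭ t s s′ (prep x p)             = cong₂ _+_ (pairs-↭ (t x) (s′ x) p) (triples-↭ t s s′ p)
  triples-↭ t s s′ (swap {ys = ys} x y p)
    rewrite ∑-↭ (t x y) p | pairs-↭ (t x) (s′ x) p | pairs-↭ (t y) (s′ y) p | triples-↭ t s s′ p | ∑-cong ys (s x y) =
    rearrange (∑ ys (t y x)) (pairs ys (t x)) (pairs ys (t y)) (triples ys t)
    where rearrange : ∀ a b c d → a + b + (c + d) ≡ a + c + (b + d)
          rearrange = solve-∀
  triples-↭ t s s′ (Perm.trans p q)       = trans (triples-↭ t s s′ p) (triples-↭ t s s′ q)

  pairs-≤0 : ∀ (xs : List A) {k : A → A → ℤ} → Unique xs → (∀ {x y} → x ∈ xs → y ∈ xs → x ≢ y → k x y ≤ 0ℤ) → pairs xs k ≤ 0ℤ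
  pairs-≤0 []       u       p = ℤₚ.≤-refl
  pairs-≤0 (x ∷ xs) (x∉ ∷ u) p = ℤₚ.+-mono-≤
    (∑-≤0 xs (λ y∈ → p (here refl) (there y∈) (All.lookup x∉ y∈)))
    (pairs-≤0 xs u (λ a b → p (there a) (there b)))

  triples-≤0 : ∀ (xs : List A) {t : A → A → A → ℤ} → Unique xs →
               (∀ {x y z} → x ∈ xs → y ∈ xs → z ∈ xs → x ≢ y → x ≢ z → y ≢ z → t x y z ≤ 0ℤ) → triples xs t ≤ 0ℤ
  triples-≤0 []       u        p = ℤₚ.≤-refl
  triples-≤0 (x ∷ xs) (x∉ ∷ u) p = ℤₚ.+-mono-≤
    (pairs-≤0 xs u (λ y∈ z∈ → p (here refl) (there y∈) (there z∈) (All.lookup x∉ y∈) (All.lookup x∉ z∈)))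
    (triples-≤0 xs u (λ a b c → p (there a) (there b) (there c)))

extract : ∀ {A : Set} {x : A} {xs} → x ∈ xs → ∃ λ ys → xs ↭ x ∷ ys
extract {x = x} x∈ with ∈ₚ.∈-∃++ x∈
... | ys , zs , refl = ys ++ zs , Permₚ.shift x ys zs

Unique-↭ : ∀ {A : Set} {xs ys : List A} → xs ↭ ys → Unique xs → Unique ys
Unique-↭ p u = PermSₚ.Unique-resp-↭ (setoid _) (Perm.↭⇒↭ₛ p) u

∈-tail : ∀ {n} {i : Fin n} {L} → allFin n ↭ i ∷ L → ∀ j → j ≢ i → j ∈ L
∈-tail p j ne with Permₚ.∈-resp-↭ p (∈ₚ.∈-allFin j)
... | here eq  = contradiction eq ne
... | there j∈ = j∈

∈-tail₂ : ∀ {n} {i j : Fin n} {L} → allFin n ↭ i ∷ j ∷ L → ∀ k → k ≢ i → k ≢ j → k ∈ L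
∈-tail₂ p k k≢i k≢j with ∈-tail p k k≢i
... | here eq  = contradiction eq k≢j
... | there k∈ = k∈

unique-drop : ∀ {A : Set} {x : A} {xs} → Unique (x ∷ xs) → Unique xs
unique-drop (_ ∷ u) = u

unique-head : ∀ {A : Set} {x : A} {xs} → Unique (x ∷ xs) → ∀ {y} → y ∈ xs → x ≢ y
unique-head (x∉ ∷ _) y∈ = All.lookup x∉ y∈

-- Signed vertices and the games they name

-- Signed vertices: (i , true) stands for e_i and (i , false) for −e_i.  The game ed u v has root ±(e_u − e_v), and
-- orient u v tells whether e_u − e_v is the positive root.

V : ℕ → Set
V n = Fin n × Bool

∧-sound : ∀ {a b} → (a ∧ b) ≡ true → a ≡ true × b ≡ true
∧-sound {true} {true} _ = refl , refl

same : Bool → Bool → Bool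
same a b = not (a xor b)

module _ {n : ℕ} where

  ix : V n → Fin n
  ix = proj₁

  bar : V n → V n
  bar (i , a) = i , not a

  bar-bar : ∀ u → bar (bar u) ≡ u
  bar-bar (i , true)  = refl
  bar-bar (i , false) = refl

  bar-≢ : ∀ u → u ≢ bar u
  bar-≢ (i , true)  ()
  bar-≢ (i , false) ()

  bar-inj : ∀ {u v} → bar u ≡ bar v → u ≡ v
  bar-inj {u} {v} eq = trans (sym (bar-bar u)) (trans (cong bar eq) (bar-bar v))

  _≟V_ : (u v : V n) → Dec (u ≡ v)
  _≟V_ = ×-≡-dec Finₚ._≟_ 𝔹._≟_

  apart : ∀ {u v : V n} → ix u ≢ ix v → u ≢ v
  apart ne refl = ne refl

  pairE : Bool → Fin n → Fin n → Edge n
  pairE true  = neg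
  pairE false = pos

  opaque
    -- A difference of signed unit vectors is a negative edge for equal signs, a positive edge for
    -- opposite signs, and a loop for u and `bar u`. The diagonal also falls into the loop branch,
    -- hence the hypotheses u ≢ v in the lemmas below.
    ed : V n → V n → Edge n
    ed (i , a) (j , b) =
      if toℕ j <ᵇ toℕ i then pairE (same a b) i j else
      if toℕ i <ᵇ toℕ j then pairE (same a b) j i else loop i

    orient : V n → V n → Bool
    orient (i , a) (j , b) =
      if toℕ j <ᵇ toℕ i then a else
      if toℕ i <ᵇ toℕ j then not b else a

  -- Records the outcomes of both Boolean comparisons, in the form in which `rewrite` resolves the
  -- conditionals inside `ed` and `orient`.
  data Compare (i j : Fin n) : Set where
    below : (toℕ i <ᵇ toℕ j) ≡ true  → (toℕ j <ᵇ toℕ i) ≡ false → i ≢ j → Compare i j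
    above : (toℕ i <ᵇ toℕ j) ≡ false → (toℕ j <ᵇ toℕ i) ≡ true → i ≢ j → Compare i j
    equal : (toℕ i <ᵇ toℕ i) ≡ false → i ≡ j → Compare i j

  <ᵇ-true : ∀ {m k} → m ℕ.< k → (m <ᵇ k) ≡ true
  <ᵇ-true {m} {k} lt with m <ᵇ k | ℕₚ.<⇒<ᵇ lt
  ... | true | _ = refl

  <ᵇ-false : ∀ {m k} → k ℕ.≤ m → (m <ᵇ k) ≡ false
  <ᵇ-false {m} {k} le with m <ᵇ k in eq
  ... | false = refl
  ... | true  = ⊥-elim (ℕₚ.<⇒≱ (ℕₚ.<ᵇ⇒< m k (subst T (sym eq) tt)) le)

  compare : ∀ i j → Compare i j
  compare i j with Finₚ.<-cmp i j
  ... | tri< lt ne _ = below (<ᵇ-true lt) (<ᵇ-false (ℕₚ.<⇒≤ lt)) ne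
  ... | tri> _ ne gt = above (<ᵇ-false (ℕₚ.<⇒≤ gt)) (<ᵇ-true gt) ne
  ... | tri≈ _ eq _  = equal (<ᵇ-false {toℕ i} ℕₚ.≤-refl) eq

  opaque
    unfolding ed orient

    ed-sym : ∀ (u v : V n) → ed u v ≡ ed v u
    ed-sym (i , a) (j , b) with compare i j
    ... | below p q _    rewrite p | q | 𝔹ₚ.xor-comm a b = refl
    ... | above p q _    rewrite p | q | 𝔹ₚ.xor-comm a b = refl
    ... | equal p refl rewrite p = refl

  same-not : ∀ a b → same (not a) (not b) ≡ same a b
  same-not true  b = refl
  same-not false b = cong not (𝔹ₚ.not-involutive b)

  opaque
    unfolding ed orient

    ed-bar : ∀ (u v : V n) → ed (bar u) (bar v) ≡ ed u v
    ed-bar (i , a) (j , b) rewrite same-not a b = refl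

    orient-swap : ∀ (u v : V n) → u ≢ v → orient v u ≡ not (orient u v)
    orient-swap (i , a) (j , b) ne with compare i j
    ... | below p q _    rewrite p | q = sym (𝔹ₚ.not-involutive b)
    ... | above p q _    rewrite p | q = refl
    orient-swap (i , true) (j , true) ne | equal p refl = contradiction refl ne
    orient-swap (i , true) (j , false) ne | equal p refl rewrite p = refl
    orient-swap (i , false) (j , true) ne | equal p refl rewrite p = refl
    orient-swap (i , false) (j , false) ne | equal p refl = contradiction refl ne

    orient-bar : ∀ (u v : V n) → orient (bar u) (bar v) ≡ not (orient u v)
    orient-bar (i , a) (j , b) with compare i j
    ... | below p q _    rewrite p | q = refl
    ... | above p q _    rewrite p | q = refl
    ... | equal p refl rewrite p = refl

  ends : Edge n → V n × V n
  ends (neg i j) = (i , true) , (j , true)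
  ends (pos i j) = (i , true) , (j , false)
  ends (loop i)  = (i , true) , (i , false)

  -- the four ordered pairs of signed vertices that name the same game
  data _~_ : V n × V n → V n × V n → Set where
    keep   : ∀ {u v} → (u , v) ~ (u , v)
    swop   : ∀ {u v} → (u , v) ~ (v , u)
    mirror : ∀ {u v} → (u , v) ~ (bar u , bar v)
    both   : ∀ {u v} → (u , v) ~ (bar v , bar u)

  ~-sym : ∀ {p q} → p ~ q → q ~ p
  ~-sym keep = keep
  ~-sym swop = swop
  ~-sym (mirror {u} {v}) = subst₂ (λ x y → (bar u , bar v) ~ (x , y)) (bar-bar u) (bar-bar v) mirror
  ~-sym (both {u} {v})   = subst₂ (λ x y → (bar v , bar u) ~ (x , y)) (bar-bar u) (bar-bar v) both

  ~-trans : ∀ {p q r} → p ~ q → q ~ r → p ~ r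
  ~-trans keep q = q
  ~-trans swop keep = swop
  ~-trans swop swop = keep
  ~-trans swop mirror = both
  ~-trans swop both = mirror
  ~-trans mirror keep = mirror
  ~-trans mirror swop = both
  ~-trans (mirror {u} {v}) mirror rewrite bar-bar u | bar-bar v = keep
  ~-trans (mirror {u} {v}) both rewrite bar-bar u | bar-bar v = swop
  ~-trans both keep = both
  ~-trans both swop = mirror
  ~-trans (both {u} {v}) mirror rewrite bar-bar u | bar-bar v = swop
  ~-trans (both {u} {v}) both rewrite bar-bar u | bar-bar v = keep

  opaque
    unfolding ed orient

    ends-ed : ∀ (u v : V n) → u ≢ v → ends (ed u v) ~ (u , v)
    ends-ed (i , a) (j , b) ne with compare i j
    ends-ed (i , true) (j , true) ne | below p q _ rewrite p | q = swop
    ends-ed (i , true) (j , false) ne | below p q _ rewrite p | q = both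
    ends-ed (i , false) (j , true) ne | below p q _ rewrite p | q = swop
    ends-ed (i , false) (j , false) ne | below p q _ rewrite p | q = both
    ends-ed (i , true) (j , true) ne | above p q _ rewrite p | q = keep
    ends-ed (i , true) (j , false) ne | above p q _ rewrite p | q = keep
    ends-ed (i , false) (j , true) ne | above p q _ rewrite p | q = mirror
    ends-ed (i , false) (j , false) ne | above p q _ rewrite p | q = mirror
    ends-ed (i , true) (j , true) ne | equal p refl = contradiction refl ne
    ends-ed (i , true) (j , false) ne | equal p refl rewrite p = keep
    ends-ed (i , false) (j , true) ne | equal p refl rewrite p = swop
    ends-ed (i , false) (j , false) ne | equal p refl = contradiction refl ne

  ed-~ : ∀ {u v x y : V n} → (u , v) ~ (x , y) → ed u v ≡ ed x y
  ed-~ keep = refl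
  ed-~ (swop {u} {v}) = ed-sym u v
  ed-~ (mirror {u} {v}) = sym (ed-bar u v)
  ed-~ (both {u} {v}) = trans (ed-sym u v) (sym (ed-bar v u))

  -- A game has the canonical pair `ends`, and every pair naming the game is equivalent to it; two
  -- pairs with the same game meet there.
  ed-inj : ∀ {u v x y : V n} → u ≢ v → x ≢ y → ed u v ≡ ed x y → (u , v) ~ (x , y)
  ed-inj {u} {v} {x} {y} u≢v x≢y eq =
    ~-trans (~-sym (ends-ed u v u≢v)) (subst (λ e → ends e ~ (x , y)) (sym eq) (ends-ed x y x≢y))

  ed-bar-swap : ∀ u v → ed u (bar v) ≡ ed v (bar u)
  ed-bar-swap u v = trans (ed-sym u (bar v)) (trans (sym (ed-bar (bar v) u)) (cong (λ x → ed x (bar u)) (bar-bar v)))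

  ==F-refl : ∀ (i : Fin n) → (i ==F i) ≡ true
  ==F-refl i with i Finₚ.≟ i
  ... | yes _ = refl
  ... | no ne = contradiction refl ne

  ==F-≢ : ∀ {i j : Fin n} → i ≢ j → (i ==F j) ≡ false
  ==F-≢ {i} {j} ne with i Finₚ.≟ j
  ... | yes eq = contradiction eq ne
  ... | no _   = refl

  ==F-sound : ∀ {i j : Fin n} → (i ==F j) ≡ true → i ≡ j
  ==F-sound {i} {j} t with i Finₚ.≟ j
  ... | yes eq = eq

  ==E-refl : ∀ (e : Edge n) → (e ==E e) ≡ true
  ==E-refl (neg i j) rewrite ==F-refl i | ==F-refl j = refl
  ==E-refl (pos i j) rewrite ==F-refl i | ==F-refl j = refl
  ==E-refl (loop i) = ==F-refl i

  ==E-sound : ∀ (e f : Edge n) → (e ==E f) ≡ true → e ≡ f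
  ==E-sound (neg i j) (neg k l) t with ∧-sound t
  ... | p , q = cong₂ neg (==F-sound p) (==F-sound q)
  ==E-sound (pos i j) (pos k l) t with ∧-sound t
  ... | p , q = cong₂ pos (==F-sound p) (==F-sound q)
  ==E-sound (loop i) (loop k) t = cong loop (==F-sound t)

  ==E-≢ : ∀ {e f : Edge n} → e ≢ f → (e ==E f) ≡ false
  ==E-≢ {e} {f} ne with e ==E f in eq
  ... | true  = contradiction (==E-sound e f eq) ne
  ... | false = refl

  ==E-≡ : ∀ {e f : Edge n} → e ≡ f → (e ==E f) ≡ true
  ==E-≡ {e} refl = ==E-refl e

  _≟E_ : (e f : Edge n) → Dec (e ≡ f)
  e ≟E f with e ==E f in eq
  ... | true  = yes (==E-sound e f eq)
  ... | false = no (λ { refl → case trans (sym eq) (==E-refl e) of λ () })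

  -- A game whose two vertices are named by an index it does not touch cannot occur among games that touch it.
  touches : Fin n → Edge n → Bool
  touches l e = (l ==F ix (proj₁ (ends e))) ∨ (l ==F ix (proj₂ (ends e)))

  touches-~ : ∀ {u v x y} l → (u , v) ~ (x , y) → (l ==F ix u ∨ l ==F ix v) ≡ (l ==F ix x ∨ l ==F ix y)
  touches-~ l keep = refl
  touches-~ l (swop {u} {v}) = 𝔹ₚ.∨-comm (l ==F ix u) _
  touches-~ l mirror = refl
  touches-~ l (both {u} {v}) = 𝔹ₚ.∨-comm (l ==F ix u) _

  touches-ed : ∀ l u v → u ≢ v → touches l (ed u v) ≡ (l ==F ix u ∨ l ==F ix v)
  touches-ed l u v ne = touches-~ l (ends-ed u v ne)

-- A chart identifies a small set of signed vertices with V m; inside it, equality of games is decided by evaluation.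
record Chart (m n : ℕ) : Set where
  field
    ι     : V m → V n
    ι-bar : ∀ a → ι (bar a) ≡ bar (ι a)
    ι-inj : ∀ {a b} → ι a ≡ ι b → a ≡ b

  ι-≢ : ∀ {a b} → a ≢ b → ι a ≢ ι b
  ι-≢ ne = ne ∘ ι-inj

  ~-push : ∀ {a b c d} → (a , b) ~ (c , d) → (ι a , ι b) ~ (ι c , ι d)
  ~-push keep = keep
  ~-push swop = swop
  ~-push {a} {b} mirror rewrite ι-bar a | ι-bar b = mirror
  ~-push {a} {b} both rewrite ι-bar a | ι-bar b = both

  -- The second pair is a variable with an equation attached, because matching on `~` directly would
  -- have to unify applications of `ι`.
  ~-pull′ : ∀ {a b c d p} → p ≡ (ι c , ι d) → (ι a , ι b) ~ p → (a , b) ~ (c , d)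
  ~-pull′ eq keep with refl ← ι-inj (cong proj₁ eq) | refl ← ι-inj (cong proj₂ eq) = keep
  ~-pull′ eq swop with refl ← ι-inj (cong proj₁ eq) | refl ← ι-inj (cong proj₂ eq) = swop
  ~-pull′ {a} {b} eq mirror
    with refl ← ι-inj (trans (ι-bar a) (cong proj₁ eq)) | refl ← ι-inj (trans (ι-bar b) (cong proj₂ eq)) = mirror
  ~-pull′ {a} {b} eq both
    with refl ← ι-inj (trans (ι-bar b) (cong proj₁ eq)) | refl ← ι-inj (trans (ι-bar a) (cong proj₂ eq)) = both

  ~-pull : ∀ {a b c d} → (ι a , ι b) ~ (ι c , ι d) → (a , b) ~ (c , d)
  ~-pull = ~-pull′ refl

  -- Equality of games is `~`-equivalence of the pairs naming them, and `ι` preserves and reflects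
  -- `~`, being injective and compatible with `bar`.
  chart-== : ∀ {a b c d} → a ≢ b → c ≢ d → (ed (ι a) (ι b) ==E ed (ι c) (ι d)) ≡ (ed a b ==E ed c d)
  chart-== {a} {b} {c} {d} a≢b c≢d with ed a b ≟E ed c d
  ... | yes eq = trans (==E-≡ (ed-~ (~-push (ed-inj a≢b c≢d eq)))) (sym (==E-≡ eq))
  ... | no ne  = trans (==E-≢ (λ eq → ne (ed-~ (~-pull (ed-inj (ι-≢ a≢b) (ι-≢ c≢d) eq))))) (sym (==E-≢ ne))

-- Outcomes, flips and sums over a list of games

module _ {n : ℕ} where

  -- Games outside L get the junk value `false`, hence the membership hypothesis in `at-flip`.
  at : (L : List (Edge n)) → Vec Bool (length L) → Edge n → Bool
  at []       []       e = false
  at (f ∷ L) (b ∷ bs) e = if e ==E f then b else at L bs e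

  flipBy : (L : List (Edge n)) → (Edge n → Bool) → Vec Bool (length L) → Vec Bool (length L)
  flipBy L χ T = zipWith (λ e b → if χ e then not b else b) (fromList L) T

  -- Follows the recursion of the zipped vectors in `score2` and `neutral`, so that each coordinate
  -- of either becomes a sum of this kind.
  ∑at : (L : List (Edge n)) → Vec Bool (length L) → (Edge n → Bool → ℤ) → ℤ
  ∑at []       []       h = 0ℤ
  ∑at (f ∷ L) (b ∷ bs) h = h f b + ∑at L bs h

  at-flip : ∀ L χ T {e} → e ∈ L → at L (flipBy L χ T) e ≡ (χ e) xor (at L T e)
  at-flip (f ∷ L) χ (b ∷ bs) {e} e∈ with e ==E f in eq
  at-flip (f ∷ L) χ (b ∷ bs) {e} e∈ | true rewrite ==E-sound e f eq with χ f
  ... | true  = refl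
  ... | false = refl
  at-flip (f ∷ L) χ (b ∷ bs) {e} (here refl) | false = case trans (sym eq) (==E-refl e) of λ ()
  at-flip (f ∷ L) χ (b ∷ bs) {e} (there e∈)  | false = at-flip L χ bs e∈

  at-ext : ∀ L (T T′ : Vec Bool (length L)) → Unique L → (∀ {e} → e ∈ L → at L T e ≡ at L T′ e) → T ≡ T′
  at-ext []       []       []       u        p = refl
  at-ext (f ∷ L) (b ∷ bs) (c ∷ cs) (f∉ ∷ u) p = cong₂ _∷_ head tail
    where
    head : b ≡ c
    head with f ==E f | ==E-refl f | p (here refl)
    ... | true | _ | eq = eq
    tail : bs ≡ cs
    tail = at-ext L bs cs u λ {e} e∈ → case p (there e∈) of
      subst (λ x → (if x then b else at L bs e) ≡ (if x then c else at L cs e) → at L bs e ≡ at L cs e)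
            (sym (==E-≢ (λ eq → All.lookup f∉ e∈ (sym eq)))) id

  ∑at-cong : ∀ L T {h h′ : Edge n → Bool → ℤ} → (∀ e b → h e b ≡ h′ e b) → ∑at L T h ≡ ∑at L T h′
  ∑at-cong []       []       p = refl
  ∑at-cong (f ∷ L) (b ∷ bs) p = cong₂ _+_ (p f b) (∑at-cong L bs p)

  ∑at-+ : ∀ L T (h k : Edge n → Bool → ℤ) → ∑at L T (λ e b → h e b + k e b) ≡ ∑at L T h + ∑at L T k
  ∑at-+ []       []       h k = refl
  ∑at-+ (f ∷ L) (b ∷ bs) h k rewrite ∑at-+ L bs h k = rearrange (h f b) (k f b) (∑at L bs h) (∑at L bs k)
    where rearrange : ∀ a b c d → a + b + (c + d) ≡ a + c + (b + d)
          rearrange = solve-∀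

  ∑at-zero : ∀ L T → ∑at L T (λ _ _ → 0ℤ) ≡ 0ℤ
  ∑at-zero []       []       = refl
  ∑at-zero (f ∷ L) (b ∷ bs) = trans (ℤₚ.+-identityˡ _) (∑at-zero L bs)

  ∑at-flip : ∀ L χ T (h : Edge n → Bool → ℤ) → ∑at L (flipBy L χ T) h ≡ ∑at L T (λ e b → h e (if χ e then not b else b))
  ∑at-flip []       χ []       h = refl
  ∑at-flip (f ∷ L) χ (b ∷ bs) h = cong (λ z → h f (if χ f then not b else b) + z) (∑at-flip L χ bs h)

  ∑at-pick : ∀ L T (h : Edge n → Bool → ℤ) {e} → Unique L → e ∈ L →
             ∑at L T (λ f b → if f ==E e then h f b else 0ℤ) ≡ h e (at L T e)
  ∑at-pick (f ∷ L) (b ∷ bs) h (f∉ ∷ u) (here refl) rewrite ==E-refl f =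
    trans (cong (λ z → h f b + z) (none L bs f∉)) (ℤₚ.+-identityʳ _)
    where
    none : ∀ L (bs : Vec Bool (length L)) → All (f ≢_) L → ∑at L bs (λ g b → if g ==E f then h g b else 0ℤ) ≡ 0ℤ
    none []      []       []          = refl
    none (g ∷ L) (b ∷ bs) (f≢g ∷ f∉) rewrite ==E-≢ (λ eq → f≢g (sym eq)) = trans (ℤₚ.+-identityˡ _) (none L bs f∉)
  ∑at-pick (f ∷ L) (b ∷ bs) h {e} (f∉ ∷ u) (there e∈)
    rewrite ==E-≢ (All.lookup f∉ e∈) | ==E-≢ (λ eq → All.lookup f∉ e∈ (sym eq)) =
    trans (ℤₚ.+-identityˡ _) (∑at-pick L bs h u e∈)

  lookup-sumV : ∀ L (T : Vec Bool (length L)) (g : Edge n → Bool → Vec ℤ n) c →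
                lookup (sumV (toList (zipWith g (fromList L) T))) c ≡ ∑at L T (λ e b → lookup (g e b) c)
  lookup-sumV []      []       g c = Vecₚ.lookup-replicate c 0ℤ
  lookup-sumV (f ∷ L) (b ∷ bs) g c =
    trans (Vecₚ.lookup-zipWith _+_ c (g f b) _) (cong (λ z → lookup (g f b) c + z) (lookup-sumV L bs g c))

-- Disjointness of the blocks is expressed by letting an entry determine the index of its block; a
-- repetition across blocks would then repeat an index in xs.
Unique-concatMap : ∀ {A B : Set} (xs : List A) {f : A → List B} → Unique xs → (∀ x → Unique (f x)) →
                   (∀ {x x′ y} → y ∈ f x → y ∈ f x′ → x ≡ x′) → Unique (concatMap f xs)
Unique-concatMap []       u        uf key = []
Unique-concatMap (x ∷ xs) {f} (x∉ ∷ u) uf key = Uniqueₚ.++⁺ (uf x) (Unique-concatMap xs u uf key) λ (y∈x , y∈xs) →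
  let x′ , x′∈ , y∈x′ = ∈-find (∈ₚ.∈-concatMap⁻ f {xs = xs} y∈xs) in All.lookup x∉ x′∈ (key y∈x y∈x′)

-- Completeness and uniqueness of the list of games

module _ (n : ℕ) where

  private
    row : Fin n → Fin n → List (Edge n)
    row i j = if toℕ j <ᵇ toℕ i then neg i j ∷ pos i j ∷ [] else []

    ∈-row-above : ∀ {i j e} → e ∈ row i j → (toℕ j <ᵇ toℕ i) ≡ true
    ∈-row-above {i} {j} e∈ with toℕ j <ᵇ toℕ i
    ... | true = refl

    ∈-row : ∀ {i j e} → e ∈ row i j → e ≡ neg i j ⊎ e ≡ pos i j
    ∈-row {i} {j} e∈ with toℕ j <ᵇ toℕ i
    ∈-row (here eq)         | true = inj₁ eq
    ∈-row (there (here eq)) | true = inj₂ eq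

    above⇒≢ : ∀ (i j : Fin n) → (toℕ j <ᵇ toℕ i) ≡ true → i ≢ j
    above⇒≢ i .i lt refl = case trans (sym lt) (<ᵇ-false {n} {toℕ i} ℕₚ.≤-refl) of λ ()

    rows : Fin n → List (Edge n)
    rows i = concatMap (row i) (allFin n)

    ∈-rows : ∀ {i e} → e ∈ rows i → ∃ λ j → e ≡ neg i j ⊎ e ≡ pos i j
    ∈-rows {i} e∈ = let j , _ , e∈′ = ∈-find (∈ₚ.∈-concatMap⁻ (row i) {xs = allFin n} e∈) in j , ∈-row e∈′

    ∈-table : ∀ i j → (toℕ j <ᵇ toℕ i) ≡ true → ∀ s → pairE s i j ∈ concatMap rows (allFin n)
    ∈-table i j lt s =
      ∈ₚ.∈-concatMap⁺ rows (∈-lose (∈ₚ.∈-allFin i) (∈ₚ.∈-concatMap⁺ (row i) (∈-lose (∈ₚ.∈-allFin j) (inRow s))))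
      where inRow : ∀ s → pairE s i j ∈ row i j
            inRow true  rewrite lt = here refl
            inRow false rewrite lt = there (here refl)

    row-Unique : ∀ i j → Unique (row i j)
    row-Unique i j with toℕ j <ᵇ toℕ i
    ... | true  = ((λ ()) ∷ []) ∷ [] ∷ []
    ... | false = []

  edges-Unique : Unique (edges n)
  edges-Unique = Uniqueₚ.++⁺
    (Unique-concatMap (allFin n) (Uniqueₚ.allFin⁺ n)
      (λ i → Unique-concatMap (allFin n) (Uniqueₚ.allFin⁺ n) (row-Unique i) (λ p q → column (∈-row p) (∈-row q)))
      (λ p q → rowIndex (proj₂ (∈-rows p)) (proj₂ (∈-rows q))))
    (Uniqueₚ.map⁺ (λ { refl → refl }) (Uniqueₚ.allFin⁺ n))
    (λ (p , q) → notLoop (∈ₚ.∈-concatMap⁻ rows {xs = allFin n} p) (∈ₚ.∈-map⁻ loop q))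
    where
    column : ∀ {i j j′} {e : Edge n} → e ≡ neg i j ⊎ e ≡ pos i j → e ≡ neg i j′ ⊎ e ≡ pos i j′ → j ≡ j′
    column (inj₁ refl) (inj₁ refl) = refl
    column (inj₂ refl) (inj₂ refl) = refl
    rowIndex : ∀ {i i′ j j′} {e : Edge n} → e ≡ neg i j ⊎ e ≡ pos i j → e ≡ neg i′ j′ ⊎ e ≡ pos i′ j′ → i ≡ i′
    rowIndex (inj₁ refl) (inj₁ refl) = refl
    rowIndex (inj₂ refl) (inj₂ refl) = refl
    notLoop : ∀ {e} → Any ((e ∈_) ∘ rows) (allFin n) → ∃ (λ i → i ∈ allFin n × e ≡ loop i) → ⊥
    notLoop p (i , _ , refl) with ∈-find p
    ... | _ , _ , e∈ with ∈-rows e∈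
    ... | _ , inj₁ ()
    ... | _ , inj₂ ()

  opaque
    unfolding ed

    ed-∈ : ∀ (u v : V n) → u ≢ v → ed u v ∈ edges n
    ed-∈ (i , a) (j , b) ne with compare i j
    ... | below p q _    rewrite p | q = ∈ₚ.∈-++⁺ˡ (∈-table j i p (same a b))
    ... | above p q _    rewrite p | q = ∈ₚ.∈-++⁺ˡ (∈-table i j q (same a b))
    ... | equal p refl rewrite p = ∈ₚ.∈-++⁺ʳ (concatMap rows (allFin n)) (∈ₚ.∈-map⁺ loop (∈ₚ.∈-allFin i))


  opaque
    unfolding ed

    edges-ed : ∀ {e} → e ∈ edges n → ∃ λ (a : V n) → ∃ λ (b : V n) → a ≢ b × e ≡ ed a b
    edges-ed e∈ = [ in-table , in-loops ]′ (∈ₚ.∈-++⁻ (concatMap rows (allFin n)) e∈)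
      where
      in-loops : ∀ {e} → e ∈ List.map loop (allFin n) → ∃ λ (a : V n) → ∃ λ (b : V n) → a ≢ b × e ≡ ed a b
      in-loops p with ∈ₚ.∈-map⁻ loop p
      ... | i , _ , refl = (i , true) , (i , false) , (λ ()) ,
            sym (cong (λ b → if b then pos i i else if b then pos i i else loop i) (<ᵇ-false {n} {toℕ i} ℕₚ.≤-refl))
      in-table : ∀ {e} → e ∈ concatMap rows (allFin n) → ∃ λ (a : V n) → ∃ λ (b : V n) → a ≢ b × e ≡ ed a b
      in-table p with ∈-find (∈ₚ.∈-concatMap⁻ rows {xs = allFin n} p)
      ... | i , _ , pᵢ with ∈-find (∈ₚ.∈-concatMap⁻ (row i) {xs = allFin n} pᵢ)
      ... | j , _ , pᵢⱼ with ∈-row-above {i} {j} pᵢⱼ | ∈-row {i} {j} pᵢⱼ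
      ... | lt | inj₁ refl = (i , true) , (j , true) , apart (above⇒≢ i j lt) ,
            sym (cong (λ b → if b then neg i j else if toℕ i <ᵇ toℕ j then neg j i else loop i) lt)
      ... | lt | inj₂ refl = (i , true) , (j , false) , (λ ()) ,
            sym (cong (λ b → if b then pos i j else if toℕ i <ᵇ toℕ j then pos j i else loop i) lt)

-- Orientations of games and neutrality of triples

half : ∀ x → x + x ≡ 0ℤ → x ≡ 0ℤ
half (+ zero) _ = refl

does-sound : ∀ {P : Set} (d : Dec P) → does d ≡ true → P
does-sound (yes p) _ = p

does-complete : ∀ {P : Set} (d : Dec P) → P → does d ≡ true
does-complete (yes p) _ = refl
does-complete (no ¬p) p = contradiction p ¬p

vec-ext : ∀ {A : Set} {m} (xs ys : Vec A m) → (∀ c → lookup xs c ≡ lookup ys c) → xs ≡ ys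
vec-ext []       []       p = refl
vec-ext (x ∷ xs) (y ∷ ys) p = cong₂ _∷_ (p fzero) (vec-ext xs ys (p ∘ fsuc))

every : ∀ k → (Vec Bool k → Bool) → Bool
every zero    P = P []
every (suc k) P = every k (P ∘ (true ∷_)) ∧ every k (P ∘ (false ∷_))

every-sound : ∀ k (P : Vec Bool k → Bool) → every k P ≡ true → ∀ v → P v ≡ true
every-sound zero    P t []          = t
every-sound (suc k) P t (true  ∷ v) = every-sound k _ (proj₁ (∧-sound t)) v
every-sound (suc k) P t (false ∷ v) = every-sound k _ (proj₂ (∧-sound {every k (P ∘ (true ∷_))} t)) v

-- Turns an identity in k Booleans into a single evaluation over all 2^k cases, to be discharged by
-- `refl`.
by-cases : ∀ k {A : Set} (_≟_ : (x y : A) → Dec (x ≡ y)) (f g : Vec Bool k → A) →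
           every k (λ v → does (f v ≟ g v)) ≡ true → ∀ v → f v ≡ g v
by-cases k _≟_ f g t v = does-sound (f v ≟ g v) (every-sound k _ t v)

turn : Bool → Bool → Bool
turn o b = if o then b else not b

turn-not : ∀ o b → turn (not o) b ≡ not (turn o b)
turn-not true  b = refl
turn-not false b = sym (𝔹ₚ.not-involutive b)

turn-xor : ∀ o x b → turn o (x xor b) ≡ x xor turn o b
turn-xor true  x     b = refl
turn-xor false true  b = refl
turn-xor false false b = refl

ind : Bool → ℤ
ind p = if p then 1ℤ else 0ℤ

infixl 6 _⊕_

_⊕_ : ∀ {n} → Tournament n → (Edge n → Bool) → Tournament n
_⊕_ {n} T χ = flipBy (edges n) χ T

val : ∀ {n} → Tournament n → Edge n → Bool
val {n} = at (edges n)

-- The coordinates of the vector e_i or -e_i.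
pm : ∀ {n} → V n → Fin n → ℤ
pm (i , a) c = if c ==F i then sgn a else 0ℤ

-- the games of the generator on three signed vertices; it is a clover when two of them are opposite
opaque
  tr : ∀ {n} → V n → V n → V n → List (Edge n)
  tr u v w = ed u v ∷ ed v w ∷ ed u w ∷ []

Distinct : ∀ {n} → V n → V n → V n → Set
Distinct u v w = u ≢ v × v ≢ w × u ≢ w

module _ {n : ℕ} where

  flipBy-cong : ∀ (L : List (Edge n)) T {χ ψ : Edge n → Bool} → (∀ e → χ e ≡ ψ e) → flipBy L χ T ≡ flipBy L ψ T
  flipBy-cong []      []       p = refl
  flipBy-cong (e ∷ L) (b ∷ bs) p = cong₂ _∷_ (cong (λ x → if x then not b else b) (p e)) (flipBy-cong L bs p)

  flipBy-flipBy : ∀ (L : List (Edge n)) T (χ ψ : Edge n → Bool) →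
                  flipBy L ψ (flipBy L χ T) ≡ flipBy L (λ e → χ e xor ψ e) T
  flipBy-flipBy []      []       χ ψ = refl
  flipBy-flipBy (e ∷ L) (b ∷ bs) χ ψ = cong₂ _∷_ head (flipBy-flipBy L bs χ ψ)
    where
    head : (if ψ e then not (if χ e then not b else b) else (if χ e then not b else b)) ≡ (if χ e xor ψ e then not b else b)
    head with χ e | ψ e
    ... | true  | true  = 𝔹ₚ.not-involutive b
    ... | true  | false = refl
    ... | false | true  = refl
    ... | false | false = refl

  flipBy-none : ∀ (L : List (Edge n)) T → flipBy L (λ _ → false) T ≡ T
  flipBy-none []      []       = refl
  flipBy-none (e ∷ L) (b ∷ bs) = cong (b ∷_) (flipBy-none L bs)

  ⊕-cong : ∀ (T : Tournament n) {χ ψ : Edge n → Bool} → (∀ e → χ e ≡ ψ e) → T ⊕ χ ≡ T ⊕ ψ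
  ⊕-cong = flipBy-cong (edges n)

  ⊕-⊕ : ∀ (T : Tournament n) χ ψ → T ⊕ χ ⊕ ψ ≡ T ⊕ (λ e → χ e xor ψ e)
  ⊕-⊕ = flipBy-flipBy (edges n)

  ⊕-involutive : ∀ (T : Tournament n) χ → T ⊕ χ ⊕ χ ≡ T
  ⊕-involutive T χ = trans (⊕-⊕ T χ χ) (trans (⊕-cong T (λ e → 𝔹ₚ.xor-same (χ e))) (flipBy-none (edges n) T))

  val-⊕ : ∀ (T : Tournament n) χ u v → u ≢ v → val (T ⊕ χ) (ed u v) ≡ χ (ed u v) xor val T (ed u v)
  val-⊕ T χ u v ne = at-flip (edges n) χ T (ed-∈ n u v ne)

  opaque
    -- True if the game enters the doubled score as +(e_u - e_v), drawn as an arc u → v. Exchanging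
    -- the ends or barring both reverses the arc, so doing both gives the same arc again: u → v and
    -- v̄ → ū are one game.
    τ : Tournament n → V n → V n → Bool
    τ T u v = turn (orient u v) (val T (ed u v))

  opaque
    unfolding τ

    τ-swap : ∀ (T : Tournament n) {u v : V n} → u ≢ v → τ T v u ≡ not (τ T u v)
    τ-swap T {u} {v} ne rewrite orient-swap u v ne | ed-sym v u = turn-not (orient u v) _

    τ-bar : ∀ (T : Tournament n) (u v : V n) → τ T (bar u) (bar v) ≡ not (τ T u v)
    τ-bar T u v rewrite orient-bar u v | ed-bar u v = turn-not (orient u v) _

  τ-mirror : ∀ (T : Tournament n) {u v : V n} → u ≢ v → τ T (bar v) (bar u) ≡ τ T u v
  τ-mirror T {u} {v} ne = trans (τ-bar T v u) (trans (cong not (τ-swap T ne)) (𝔹ₚ.not-involutive _))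

  opaque
    unfolding τ

    τ-⊕ : ∀ (T : Tournament n) (χ : Edge n → Bool) {u v : V n} → u ≢ v → τ (T ⊕ χ) u v ≡ χ (ed u v) xor τ T u v
    τ-⊕ T χ {u} {v} ne = trans (cong (turn (orient u v)) (val-⊕ T χ u v ne)) (turn-xor (orient u v) (χ (ed u v)) (val T (ed u v)))

  lookup-unit : ∀ (i c : Fin n) → lookup (unit i) c ≡ (if c ==F i then 1ℤ else 0ℤ)
  lookup-unit i c = Vecₚ.lookup∘tabulate _ c

  root-below : ∀ x y p q b → sgn b * (if same x y then ind q - ind p else ind q + ind p)
                           ≡ sgn (turn (not y) b) * ((if p then sgn x else 0ℤ) - (if q then sgn y else 0ℤ))
  root-below x y p q b = by-cases 5 ℤ._≟_
    (λ { (x ∷ y ∷ p ∷ q ∷ b ∷ []) → sgn b * (if same x y then ind q - ind p else ind q + ind p) })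
    (λ { (x ∷ y ∷ p ∷ q ∷ b ∷ []) → sgn (turn (not y) b) * ((if p then sgn x else 0ℤ) - (if q then sgn y else 0ℤ)) })
    refl (x ∷ y ∷ p ∷ q ∷ b ∷ [])

  root-above : ∀ x y p q b → sgn b * (if same x y then ind p - ind q else ind p + ind q)
                           ≡ sgn (turn x b) * ((if p then sgn x else 0ℤ) - (if q then sgn y else 0ℤ))
  root-above x y p q b = by-cases 5 ℤ._≟_
    (λ { (x ∷ y ∷ p ∷ q ∷ b ∷ []) → sgn b * (if same x y then ind p - ind q else ind p + ind q) })
    (λ { (x ∷ y ∷ p ∷ q ∷ b ∷ []) → sgn (turn x b) * ((if p then sgn x else 0ℤ) - (if q then sgn y else 0ℤ)) })
    refl (x ∷ y ∷ p ∷ q ∷ b ∷ [])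

  root-loop : ∀ x p b → sgn b * (ind p + ind p) ≡ sgn (turn x b) * ((if p then sgn x else 0ℤ) - (if p then sgn (not x) else 0ℤ))
  root-loop x p b = by-cases 3 ℤ._≟_
    (λ { (x ∷ p ∷ b ∷ []) → sgn b * (ind p + ind p) })
    (λ { (x ∷ p ∷ b ∷ []) → sgn (turn x b) * ((if p then sgn x else 0ℤ) - (if p then sgn (not x) else 0ℤ)) })
    refl (x ∷ p ∷ b ∷ [])

  lookup-pairE : ∀ s (i j c : Fin n) → lookup (evec (pairE s i j)) c ≡
                 (if s then ind (c ==F i) - ind (c ==F j) else ind (c ==F i) + ind (c ==F j))
  lookup-pairE true  i j c = trans (Vecₚ.lookup-zipWith _-_ c (unit i) (unit j)) (cong₂ _-_ (lookup-unit i c) (lookup-unit j c))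
  lookup-pairE false i j c = trans (Vecₚ.lookup-zipWith _+_ c (unit i) (unit j)) (cong₂ _+_ (lookup-unit i c) (lookup-unit j c))

  lookup-loop : ∀ (i c : Fin n) → lookup (evec (loop i)) c ≡ ind (c ==F i) + ind (c ==F i)
  lookup-loop i c = lookup-pairE false i i c

  opaque
    unfolding ed orient

    -- Brings the three kinds of roots to the uniform form ±(e_u - e_v), on which the score
    -- computations for triples and arcs are based.
    root : ∀ (u v : V n) (c : Fin n) b → u ≢ v → sgn b * lookup (evec (ed u v)) c ≡ sgn (turn (orient u v) b) * (pm u c - pm v c)
    root (i , x) (j , y) c b ne with compare i j
    ... | below p q _ rewrite p | q = trans (cong (sgn b *_) (lookup-pairE (same x y) j i c)) (root-below x y (c ==F i) (c ==F j) b)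
    ... | above p q _ rewrite p | q = trans (cong (sgn b *_) (lookup-pairE (same x y) i j c)) (root-above x y (c ==F i) (c ==F j) b)
    ... | equal p refl rewrite p = trans (cong (sgn b *_) (lookup-loop i c)) (go x y ne)
      where
      go : ∀ x y → (i , x) ≢ (i , y) → sgn b * (ind (c ==F i) + ind (c ==F i)) ≡ sgn (turn x b) * (pm (i , x) c - pm (i , y) c)
      go true  true  ne = contradiction refl ne
      go true  false ne = root-loop true (c ==F i) b
      go false true  ne = root-loop false (c ==F i) b
      go false false ne = contradiction refl ne

  pm-≢ : ∀ (u v : V n) → u ≢ v → pm u (ix u) - pm v (ix u) ≢ 0ℤ
  pm-≢ (i , x) (j , y) ne with i Finₚ.≟ j
  pm-≢ (i , x) (j , y) ne | yes refl rewrite ==F-refl i with x | y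
  ... | true  | true  = λ _ → ne refl
  ... | true  | false = λ ()
  ... | false | true  = λ ()
  ... | false | false = λ _ → ne refl
  pm-≢ (i , x) (j , y) ne | no i≢j rewrite ==F-refl i with x
  ... | true  = λ ()
  ... | false = λ ()

  lookup-scale : ∀ b (e : Edge n) c → lookup (Vec.map (sgn b *_) (evec e)) c ≡ sgn b * lookup (evec e) c
  lookup-scale b e c = Vecₚ.lookup-map c (sgn b *_) (evec e)

  score-at : ∀ (T : Tournament n) c → lookup (score2 T) c ≡ ∑at (edges n) T (λ e b → sgn b * lookup (evec e) c)
  score-at T c = trans (lookup-sumV (edges n) T _ c) (∑at-cong (edges n) T (λ e b → lookup-scale b e c))

  balance : Tournament n → List (Edge n) → Fin n → ℤ
  balance T S c = ∑at (edges n) T (λ e b → if e ∈E S then sgn b * lookup (evec e) c else 0ℤ)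

  private
    neutralVec : Tournament n → List (Edge n) → Vec ℤ n
    neutralVec T S = sumV (toList (zipWith (λ e b → if e ∈E S then Vec.map (sgn b *_) (evec e) else zeroV) (fromList (edges n)) T))

    balance-at : ∀ (T : Tournament n) (S : List (Edge n)) (c : Fin n) → lookup (neutralVec T S) c ≡ balance T S c
    balance-at T S c = trans (lookup-sumV (edges n) T _ c) (∑at-cong (edges n) T pointwise)
      where
      pointwise : ∀ e b → lookup (if e ∈E S then Vec.map (sgn b *_) (evec e) else zeroV) c
                        ≡ (if e ∈E S then sgn b * lookup (evec e) c else 0ℤ)
      pointwise e b with e ∈E S
      ... | true  = lookup-scale b e c
      ... | false = Vecₚ.lookup-replicate c 0ℤ

  neutral⇒balance : ∀ (T : Tournament n) (S : List (Edge n)) → neutral T S ≡ true → ∀ c → balance T S c ≡ 0ℤ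
  neutral⇒balance T S eq c =
    trans (sym (balance-at T S c)) (trans (cong (λ v → lookup {n = n} v c) (does-sound (Vecₚ.≡-dec ℤ._≟_ (neutralVec T S) zeroV) eq)) (Vecₚ.lookup-replicate c 0ℤ))

  balance⇒neutral : ∀ (T : Tournament n) (S : List (Edge n)) → (∀ c → balance T S c ≡ 0ℤ) → neutral T S ≡ true
  balance⇒neutral T S eq = does-complete (Vecₚ.≡-dec ℤ._≟_ (neutralVec T S) zeroV)
    (vec-ext (neutralVec T S) zeroV λ c → trans (balance-at T S c) (trans (eq c) (sym (Vecₚ.lookup-replicate c 0ℤ))))

  -- A flipped game reverses its term in the doubled score, so the score drops by twice the balance.
  -- Neutrality thus becomes the same as the flip preserving the score.
  score-flip : ∀ (T : Tournament n) (S : List (Edge n)) (c : Fin n) → lookup (score2 (T ⊕ (_∈E S))) c + (balance T S c + balance T S c) ≡ lookup (score2 T) c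
  score-flip T S c = begin
    lookup (score2 (T ⊕ (_∈E S))) c + (balance T S c + balance T S c)
      ≡⟨ cong₂ _+_ (trans (score-at (T ⊕ (_∈E S)) c) (∑at-flip (edges n) (_∈E S) T _)) (sym (∑at-+ (edges n) T _ _)) ⟩
    ∑at (edges n) T flipped + ∑at (edges n) T doubled ≡⟨ ∑at-+ (edges n) T flipped doubled ⟨
    ∑at (edges n) T (λ e b → flipped e b + doubled e b) ≡⟨ ∑at-cong (edges n) T pointwise ⟩
    ∑at (edges n) T (λ e b → sgn b * lookup (evec e) c) ≡⟨ score-at T c ⟨
    lookup (score2 T) c ∎
    where
    open ≡-Reasoning
    flipped doubled : Edge n → Bool → ℤ
    flipped e b = sgn (if e ∈E S then not b else b) * lookup (evec e) c
    doubled e b = (if e ∈E S then sgn b * lookup (evec e) c else 0ℤ) + (if e ∈E S then sgn b * lookup (evec e) c else 0ℤ)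
    cancel⁺ : ∀ x → -[1+ 0 ] * x + (1ℤ * x + 1ℤ * x) ≡ 1ℤ * x
    cancel⁺ = solve-∀
    cancel⁻ : ∀ x → 1ℤ * x + (-[1+ 0 ] * x + -[1+ 0 ] * x) ≡ -[1+ 0 ] * x
    cancel⁻ = solve-∀
    pointwise : ∀ e b → flipped e b + doubled e b ≡ sgn b * lookup (evec e) c
    pointwise e b with e ∈E S | b
    ... | true  | true  = cancel⁺ (lookup (evec e) c)
    ... | true  | false = cancel⁻ (lookup (evec e) c)
    ... | false | b     = ℤₚ.+-identityʳ _

  neutral⇒score : ∀ (T : Tournament n) (S : List (Edge n)) → neutral T S ≡ true → score2 (T ⊕ (_∈E S)) ≡ score2 T
  neutral⇒score T S eq = vec-ext _ _ λ c → trans (sym (ℤₚ.+-identityʳ _))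
    (trans (cong (λ z → lookup (score2 (T ⊕ (_∈E S))) c + (z + z)) (sym (neutral⇒balance T S eq c))) (score-flip T S c))

  score⇒neutral : ∀ (T : Tournament n) (S : List (Edge n)) → score2 (T ⊕ (_∈E S)) ≡ score2 T → neutral T S ≡ true
  score⇒neutral T S eq = balance⇒neutral T S λ c → half (balance T S c)
    (+-cancelˡ′ (lookup (score2 T) c) (trans (cong (λ v → lookup v c + (balance T S c + balance T S c)) (sym eq)) (score-flip T S c)))
    where
    +-cancelˡ′ : ∀ x {y} → x + y ≡ x → y ≡ 0ℤ
    +-cancelˡ′ x {y} eq = trans (sym (move x y)) (trans (cong (_- x) eq) (ℤₚ.+-inverseʳ x))
      where move : ∀ x y → x + y - x ≡ y
            move = solve-∀

  -- Two games of a triple share a vertex. Each of the four ways in which they could coincide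
  -- identifies two of the three vertices, or the shared vertex with its opposite.
  ed-distinct : ∀ {u v w : V n} → Distinct u v w → ed u v ≢ ed v w × ed u v ≢ ed u w × ed v w ≢ ed u w
  ed-distinct {u} {v} {w} (u≢v , v≢w , u≢w) =
    (λ eq → corner u≢v v≢w u≢w (trans (ed-sym v u) eq)) ,
    (λ eq → corner (u≢v ∘ sym) u≢w v≢w eq) ,
    (λ eq → corner v≢w (u≢w ∘ sym) (u≢v ∘ sym) (trans (ed-sym w v) (trans eq (ed-sym u w))))
    where
    go : ∀ {a b c : V n} {p q} → p ≡ (b , a) → q ≡ (b , c) → a ≢ b → b ≢ c → a ≢ c → p ~ q → ⊥
    go refl eq a≢b b≢c a≢c keep   = a≢c (cong proj₂ eq)
    go refl eq a≢b b≢c a≢c swop   = a≢b (cong proj₁ eq)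
    go {b = b} refl eq a≢b b≢c a≢c mirror = bar-≢ b (sym (cong proj₁ eq))
    go {a} {b} refl eq a≢b b≢c a≢c both   = a≢c (trans (sym (bar-bar a)) (trans (cong bar (cong proj₁ eq)) (cong proj₂ eq)))
    corner : ∀ {a b c : V n} → a ≢ b → b ≢ c → a ≢ c → ed b a ≡ ed b c → ⊥
    corner a≢b b≢c a≢c eq = go refl refl a≢b b≢c a≢c (ed-inj (a≢b ∘ sym) b≢c eq)

  if-∈E : ∀ (e : Edge n) {e₁ e₂ e₃} → e₁ ≢ e₂ → e₁ ≢ e₃ → e₂ ≢ e₃ → ∀ (x : ℤ) →
          (if e ∈E (e₁ ∷ e₂ ∷ e₃ ∷ []) then x else 0ℤ) ≡
          (if e ==E e₁ then x else 0ℤ) + ((if e ==E e₂ then x else 0ℤ) + (if e ==E e₃ then x else 0ℤ))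
  if-∈E e {e₁} {e₂} {e₃} n₁₂ n₁₃ n₂₃ x with e ==E e₁ in p | e ==E e₂ in q | e ==E e₃ in r
  ... | true  | true  | _     = contradiction (trans (sym (==E-sound e e₁ p)) (==E-sound e e₂ q)) n₁₂
  ... | true  | false | true  = contradiction (trans (sym (==E-sound e e₁ p)) (==E-sound e e₃ r)) n₁₃
  ... | true  | false | false = sym (ℤₚ.+-identityʳ x)
  ... | false | true  | true  = contradiction (trans (sym (==E-sound e e₂ q)) (==E-sound e e₃ r)) n₂₃
  ... | false | true  | false = sym (trans (ℤₚ.+-identityˡ _) (ℤₚ.+-identityʳ x))
  ... | false | false | true  = sym (trans (ℤₚ.+-identityˡ _) (ℤₚ.+-identityˡ x))
  ... | false | false | false = refl

  opaque
    unfolding tr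

    ∑at-tr : ∀ (T : Tournament n) {u v w : V n} → Distinct u v w → (h : Edge n → Bool → ℤ) →
             ∑at (edges n) T (λ e b → if e ∈E tr u v w then h e b else 0ℤ) ≡
             h (ed u v) (val T (ed u v)) + (h (ed v w) (val T (ed v w)) + h (ed u w) (val T (ed u w)))
    ∑at-tr T {u} {v} {w} D@(u≢v , v≢w , u≢w) h = begin
      ∑at L T (λ e b → if e ∈E tr u v w then h e b else 0ℤ)
        ≡⟨ ∑at-cong L T (λ e b → let n₁ , n₂ , n₃ = ed-distinct D in if-∈E e n₁ n₂ n₃ (h e b)) ⟩
      ∑at L T (λ e b → pick (ed u v) e b + (pick (ed v w) e b + pick (ed u w) e b))
        ≡⟨ trans (∑at-+ L T _ _) (cong (λ z → ∑at L T (pick (ed u v)) + z) (∑at-+ L T _ _)) ⟩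
      ∑at L T (pick (ed u v)) + (∑at L T (pick (ed v w)) + ∑at L T (pick (ed u w)))
        ≡⟨ cong₂ _+_ (picked u≢v) (cong₂ _+_ (picked v≢w) (picked u≢w)) ⟩
      h (ed u v) (val T (ed u v)) + (h (ed v w) (val T (ed v w)) + h (ed u w) (val T (ed u w))) ∎
      where
      open ≡-Reasoning
      L : List (Edge n)
      L = edges n
      pick : Edge n → Edge n → Bool → ℤ
      pick f e b = if e ==E f then h e b else 0ℤ
      picked : ∀ {a b} → a ≢ b → ∑at L T (pick (ed a b)) ≡ h (ed a b) (val T (ed a b))
      picked {a} {b} ne = ∑at-pick L T h (edges-Unique n) (ed-∈ n a b ne)

  opaque
    unfolding τ

    balance-tr : ∀ (T : Tournament n) {u v w : V n} → Distinct u v w → ∀ (c : Fin n) → balance T (tr u v w) c ≡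
      sgn (τ T u v) * (pm u c - pm v c) + (sgn (τ T v w) * (pm v c - pm w c) + sgn (τ T u w) * (pm u c - pm w c))
    balance-tr T {u} {v} {w} D@(u≢v , v≢w , u≢w) c = trans (∑at-tr T D _)
      (cong₂ _+_ (root u v c _ u≢v) (cong₂ _+_ (root v w c _ v≢w) (root u w c _ u≢w)))

  cyc : Tournament n → V n → V n → V n → Bool
  cyc T u v w = same (τ T u v) (τ T v w) ∧ same (τ T v w) (τ T w u)

  -- A non-cyclic triple has balance ±2 (e_x − e_y) for two of its vertices.
  neutral-tr : ∀ (T : Tournament n) {u v w : V n} → Distinct u v w → neutral T (tr u v w) ≡ cyc T u v w
  neutral-tr T {u} {v} {w} D@(u≢v , v≢w , u≢w) rewrite τ-swap T u≢w =
    go (τ T u v) (τ T v w) (τ T u w) (balance-tr T D)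
    where
    Balance : Bool → Bool → Bool → Set
    Balance a b d = ∀ c → balance T (tr u v w) c ≡
      sgn a * (pm u c - pm v c) + (sgn b * (pm v c - pm w c) + sgn d * (pm u c - pm w c))
    off : ∀ {x y} → x ≢ y → (∀ c → balance T (tr u v w) c ≡ (pm x c - pm y c) + (pm x c - pm y c)) → neutral T (tr u v w) ≡ false
    off {x} {y} x≢y eq with neutral T (tr u v w) in t
    ... | false = refl
    ... | true  = contradiction (half _ (trans (sym (eq (ix x))) (neutral⇒balance T (tr u v w) t (ix x)))) (pm-≢ x y x≢y)
    go : ∀ a b d → Balance a b d → neutral T (tr u v w) ≡ same a b ∧ same b (not d)
    go true  true  false eq = balance⇒neutral T (tr u v w) λ c → trans (eq c) (id₁ (pm u c) (pm v c) (pm w c))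
      where id₁ : ∀ a b d → 1ℤ * (a - b) + (1ℤ * (b - d) + -[1+ 0 ] * (a - d)) ≡ 0ℤ
            id₁ = solve-∀
    go false false true  eq = balance⇒neutral T (tr u v w) λ c → trans (eq c) (id₁ (pm u c) (pm v c) (pm w c))
      where id₁ : ∀ a b d → -[1+ 0 ] * (a - b) + (-[1+ 0 ] * (b - d) + 1ℤ * (a - d)) ≡ 0ℤ
            id₁ = solve-∀
    go true  true  true  eq = off u≢w λ c → trans (eq c) (id₁ (pm u c) (pm v c) (pm w c))
      where id₁ : ∀ a b d → 1ℤ * (a - b) + (1ℤ * (b - d) + 1ℤ * (a - d)) ≡ (a - d) + (a - d)
            id₁ = solve-∀
    go false false false eq = off (u≢w ∘ sym) λ c → trans (eq c) (id₁ (pm u c) (pm v c) (pm w c))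
      where id₁ : ∀ a b d → -[1+ 0 ] * (a - b) + (-[1+ 0 ] * (b - d) + -[1+ 0 ] * (a - d)) ≡ (d - a) + (d - a)
            id₁ = solve-∀
    go true  false true  eq = off u≢v λ c → trans (eq c) (id₁ (pm u c) (pm v c) (pm w c))
      where id₁ : ∀ a b d → 1ℤ * (a - b) + (-[1+ 0 ] * (b - d) + 1ℤ * (a - d)) ≡ (a - b) + (a - b)
            id₁ = solve-∀
    go true  false false eq = off (v≢w ∘ sym) λ c → trans (eq c) (id₁ (pm u c) (pm v c) (pm w c))
      where id₁ : ∀ a b d → 1ℤ * (a - b) + (-[1+ 0 ] * (b - d) + -[1+ 0 ] * (a - d)) ≡ (d - b) + (d - b)
            id₁ = solve-∀
    go false true  true  eq = off v≢w λ c → trans (eq c) (id₁ (pm u c) (pm v c) (pm w c))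
      where id₁ : ∀ a b d → -[1+ 0 ] * (a - b) + (1ℤ * (b - d) + 1ℤ * (a - d)) ≡ (b - d) + (b - d)
            id₁ = solve-∀
    go false true  false eq = off (u≢v ∘ sym) λ c → trans (eq c) (id₁ (pm u c) (pm v c) (pm w c))
      where id₁ : ∀ a b d → -[1+ 0 ] * (a - b) + (1ℤ * (b - d) + -[1+ 0 ] * (a - d)) ≡ (b - a) + (b - a)
            id₁ = solve-∀

-- Sums over all generators as sums over triples and pairs of indices

module _ {n : ℕ} where

  private
    _≺_ : Fin n → Fin n → Bool
    q ≺ p = toℕ q <ᵇ toℕ p

    Sorted : List (Fin n) → Set
    Sorted = AllPairs (λ x y → toℕ x ℕ.< toℕ y)

    ≺-true : ∀ {x y : Fin n} → toℕ x ℕ.< toℕ y → (x ≺ y) ≡ true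
    ≺-true = <ᵇ-true {n}

    ≺-false : ∀ {x y : Fin n} → toℕ y ℕ.≤ toℕ x → (x ≺ y) ≡ false
    ≺-false = <ᵇ-false {n}

    vanish : ∀ (xs : List (Fin n)) {f : Fin n → ℤ} → (∀ {x} → x ∈ xs → f x ≡ 0ℤ) → ∑ xs f ≡ 0ℤ
    vanish xs p = trans (∑-cong-∈ xs p) (∑-zero xs)

  -- Peel off the least entry x: as the larger index of a pair it contributes nothing, as the
  -- smaller one it contributes its whole row.
  ∑-sorted-pairs : ∀ xs → Sorted xs → (k : Fin n → Fin n → ℤ) → (∀ p q → k p q ≡ k q p) →
                   ∑ xs (λ p → ∑ xs (λ q → if q ≺ p then k p q else 0ℤ)) ≡ pairs xs k
  ∑-sorted-pairs []       s        k ksym = refl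
  ∑-sorted-pairs (x ∷ xs) (x< ∷ s) k ksym = begin
    ∑ (x ∷ xs) (g x) + ∑ xs (λ p → ∑ (x ∷ xs) (g p))
      ≡⟨ cong₂ _+_ (vanish (x ∷ xs) {g x} first) (∑-+ xs (λ p → g p x) (λ p → ∑ xs (g p))) ⟩
    0ℤ + (∑ xs (λ p → g p x) + ∑ xs (λ p → ∑ xs (g p)))
      ≡⟨ ℤₚ.+-identityˡ _ ⟩
    ∑ xs (λ p → g p x) + ∑ xs (λ p → ∑ xs (g p))
      ≡⟨ cong₂ _+_ (∑-cong-∈ xs (λ {p} p∈ → trans (cong (λ b → if b then k p x else 0ℤ) (≺-true (All.lookup x< p∈))) (ksym p x)))
                   (∑-sorted-pairs xs s k ksym) ⟩
    ∑ xs (k x) + pairs xs k ∎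
    where
    open ≡-Reasoning
    g : Fin n → Fin n → ℤ
    g p q = if q ≺ p then k p q else 0ℤ
    first : ∀ {q} → q ∈ x ∷ xs → g x q ≡ 0ℤ
    first (here refl) = cong (λ b → if b then k x x else 0ℤ) (≺-false {x} {x} ℕₚ.≤-refl)
    first {q} (there q∈) = cong (λ b → if b then k x q else 0ℤ) (≺-false (ℕₚ.<⇒≤ (All.lookup x< q∈)))

  -- The least entry x can only be the smallest of the three indices, which leaves a sorted pair sum
  -- with x held fixed.
  ∑-sorted-triples : ∀ xs → Sorted xs → (t : Fin n → Fin n → Fin n → ℤ) →
                     (∀ p q r → t p q r ≡ t q p r) → (∀ p q r → t p q r ≡ t p r q) →
                     ∑ xs (λ p → ∑ xs (λ q → ∑ xs (λ r → if (q ≺ p) ∧ (r ≺ q) then t p q r else 0ℤ))) ≡ triples xs t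
  ∑-sorted-triples []       s        t s₁ s₂ = refl
  ∑-sorted-triples (x ∷ xs) (x< ∷ s) t s₁ s₂ = begin
    ∑ (x ∷ xs) (λ q → ∑ (x ∷ xs) (g x q)) + ∑ xs (λ p → ∑ (x ∷ xs) (λ q → ∑ (x ∷ xs) (g p q)))
      ≡⟨ cong₂ _+_ (vanish (x ∷ xs) {λ q → ∑ (x ∷ xs) (g x q)} (λ {q} q∈ → vanish (x ∷ xs) {g x q} (λ {r} _ → noTop {q} {r} q∈))) (∑-cong xs inner) ⟩
    0ℤ + ∑ xs (λ p → ∑ xs (λ q → g p q x) + ∑ xs (λ q → ∑ xs (g p q)))
      ≡⟨ trans (ℤₚ.+-identityˡ _) (∑-+ xs _ _) ⟩
    ∑ xs (λ p → ∑ xs (λ q → g p q x)) + ∑ xs (λ p → ∑ xs (λ q → ∑ xs (g p q)))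
      ≡⟨ cong₂ _+_ (trans (∑-cong xs λ p → ∑-cong-∈ xs λ q∈ → bottom p q∈)
                          (∑-sorted-pairs xs s (t x) (s₂ x)))
                   (∑-sorted-triples xs s t s₁ s₂) ⟩
    pairs xs (t x) + triples xs t ∎
    where
    open ≡-Reasoning
    g : Fin n → Fin n → Fin n → ℤ
    g p q r = if (q ≺ p) ∧ (r ≺ q) then t p q r else 0ℤ
    least : ∀ {q} → q ∈ x ∷ xs → (q ≺ x) ≡ false
    least (here refl) = ≺-false {x} {x} ℕₚ.≤-refl
    least (there q∈)  = ≺-false (ℕₚ.<⇒≤ (All.lookup x< q∈))
    noTop : ∀ {q r} → q ∈ x ∷ xs → g x q r ≡ 0ℤ
    noTop {q} {r} q∈ = cong (λ b → if b ∧ (r ≺ q) then t x q r else 0ℤ) (least q∈)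
    noMid : ∀ p {r} → r ∈ x ∷ xs → g p x r ≡ 0ℤ
    noMid p {r} r∈ = cong (λ b → if b then t p x r else 0ℤ) (trans (cong ((x ≺ p) ∧_) (least r∈)) (𝔹ₚ.∧-zeroʳ _))
    inner : ∀ p → ∑ (x ∷ xs) (λ q → ∑ (x ∷ xs) (g p q)) ≡ ∑ xs (λ q → g p q x) + ∑ xs (λ q → ∑ xs (g p q))
    inner p = trans (cong (λ z → z + ∑ xs (λ q → ∑ (x ∷ xs) (g p q))) (vanish (x ∷ xs) {g p x} (noMid p)))
                    (trans (ℤₚ.+-identityˡ _) (∑-+ xs _ _))
    bottom : ∀ p {q} → q ∈ xs → g p q x ≡ (if q ≺ p then t x p q else 0ℤ)
    bottom p {q} q∈ rewrite ≺-true (All.lookup x< q∈) | 𝔹ₚ.∧-identityʳ (q ≺ p) | s₂ p q x | s₁ p x q = refl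

  allFin-sorted : Sorted (allFin n)
  allFin-sorted = AllPairsₚ.tabulate⁺-< id

  -- A generator is a set of games, but `tr` lists them in an order that depends on the order of its
  -- vertices; only functions blind to this order can be summed symmetrically.
  Respects : (List (Edge n) → ℤ) → Set
  Respects θ = ∀ {S S′} → (∀ e → (e ∈E S) ≡ (e ∈E S′)) → θ S ≡ θ S′

  opaque
    unfolding tr

    tr-swap₁₂ : ∀ (u v w : V n) e → (e ∈E tr u v w) ≡ (e ∈E tr v u w)
    tr-swap₁₂ u v w e rewrite ed-sym v u = by-cases 3 𝔹._≟_
      (λ { (a ∷ b ∷ c ∷ []) → a ∨ (b ∨ (c ∨ false)) }) (λ { (a ∷ b ∷ c ∷ []) → a ∨ (c ∨ (b ∨ false)) }) refl
      ((e ==E ed u v) ∷ (e ==E ed v w) ∷ (e ==E ed u w) ∷ [])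

    tr-swap₂₃ : ∀ (u v w : V n) e → (e ∈E tr u v w) ≡ (e ∈E tr u w v)
    tr-swap₂₃ u v w e rewrite ed-sym w v = by-cases 3 𝔹._≟_
      (λ { (a ∷ b ∷ c ∷ []) → a ∨ (b ∨ (c ∨ false)) }) (λ { (a ∷ b ∷ c ∷ []) → c ∨ (b ∨ (a ∨ false)) }) refl
      ((e ==E ed u v) ∷ (e ==E ed v w) ∷ (e ==E ed u w) ∷ [])

    tr-bar : ∀ (u v w : V n) → tr (bar u) (bar v) (bar w) ≡ tr u v w
    tr-bar u v w rewrite ed-bar u v | ed-bar v w | ed-bar u w = refl

  module Shapes (θ : List (Edge n) → ℤ) (resp : Respects θ) where

    θ′ : V n → V n → V n → ℤ
    θ′ u v w = θ (tr u v w)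

    θ-swap₁₂ : ∀ u v w → θ′ u v w ≡ θ′ v u w
    θ-swap₁₂ u v w = resp (tr-swap₁₂ u v w)

    θ-swap₂₃ : ∀ u v w → θ′ u v w ≡ θ′ u w v
    θ-swap₂₃ u v w = resp (tr-swap₂₃ u v w)

    θ-rot : ∀ u v w → θ′ u v w ≡ θ′ v w u
    θ-rot u v w = trans (θ-swap₁₂ u v w) (θ-swap₂₃ v u w)

    θ-swap₁₃ : ∀ u v w → θ′ u v w ≡ θ′ w v u
    θ-swap₁₃ u v w = trans (θ-rot u v w) (θ-swap₁₂ v w u)

    θ-bar : ∀ u v w → θ′ (bar u) (bar v) (bar w) ≡ θ′ u v w
    θ-bar u v w = cong θ (tr-bar u v w)

    -- The eight sign choices on three indices form four classes under changing all signs, one for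
    -- each triangle generator; the representatives give p the positive sign.
    triangles : Fin n → Fin n → Fin n → ℤ
    triangles p q r =
      θ′ (p , true) (q , true) (r , true) + θ′ (p , true) (q , true) (r , false) +
      θ′ (p , true) (q , false) (r , false) + θ′ (p , true) (q , false) (r , true)

    -- One clover has its loop at p, the other at q; the doubling is the multiplicity of clover
    -- edges.
    clovers : Fin n → Fin n → ℤ
    clovers p q = twice (θ′ (p , true) (q , true) (p , false)) + twice (θ′ (q , true) (p , true) (q , false))

    triangles-swap₁₂ : ∀ p q r → triangles p q r ≡ triangles q p r
    triangles-swap₁₂ p q r
      rewrite θ-swap₁₂ (p , true) (q , true) (r , true) | θ-swap₁₂ (p , true) (q , true) (r , false)
            | θ-swap₁₂ (p , true) (q , false) (r , false) | θ-swap₁₂ (p , true) (q , false) (r , true)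
            | sym (θ-bar (q , false) (p , true) (r , false)) | sym (θ-bar (q , false) (p , true) (r , true)) =
      rearrange (θ′ (q , true) (p , true) (r , true)) (θ′ (q , true) (p , true) (r , false))
                (θ′ (q , true) (p , false) (r , true)) (θ′ (q , true) (p , false) (r , false))
      where rearrange : ∀ a b c d → a + b + c + d ≡ a + b + d + c
            rearrange = solve-∀

    triangles-swap₂₃ : ∀ p q r → triangles p q r ≡ triangles p r q
    triangles-swap₂₃ p q r
      rewrite θ-swap₂₃ (p , true) (q , true) (r , true) | θ-swap₂₃ (p , true) (q , true) (r , false)
            | θ-swap₂₃ (p , true) (q , false) (r , false) | θ-swap₂₃ (p , true) (q , false) (r , true) =
      rearrange (θ′ (p , true) (r , true) (q , true)) (θ′ (p , true) (r , false) (q , true))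
                (θ′ (p , true) (r , false) (q , false)) (θ′ (p , true) (r , true) (q , false))
      where rearrange : ∀ a b c d → a + b + c + d ≡ a + d + c + b
            rearrange = solve-∀

    clovers-sym : ∀ p q → clovers p q ≡ clovers q p
    clovers-sym p q = ℤₚ.+-comm (twice (θ′ (p , true) (q , true) (p , false))) (twice (θ′ (q , true) (p , true) (q , false)))

    -- From any choice of signs, changing none or exactly one of them runs through the four classes.
    -- The sum over three indices can therefore be based at the signed vertices of a given directed
    -- triangle.
    triangles-signed : ∀ u v w → triangles (ix u) (ix v) (ix w) ≡ θ′ u v w + θ′ (bar u) v w + θ′ u (bar v) w + θ′ u v (bar w)
    triangles-signed (p , a) (q , b) (r , c) = go a b c
      where
      g : Bool → Bool → Bool → ℤ
      g a b c = θ′ (p , a) (q , b) (r , c)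
      flip′ : ∀ b c → g false b c ≡ g true (not b) (not c)
      flip′ b c = sym (θ-bar (p , false) (q , b) (r , c))
      sum₁ : ∀ a b c d → a + b + c + d ≡ a + c + d + b
      sum₁ = solve-∀
      sum₂ : ∀ a b c d → a + b + c + d ≡ b + d + c + a
      sum₂ = solve-∀
      sum₃ : ∀ a b c d → a + b + c + d ≡ d + b + a + c
      sum₃ = solve-∀
      sum₄ : ∀ a b c d → a + b + c + d ≡ c + a + b + d
      sum₄ = solve-∀
      go : ∀ a b c → g true true true + g true true false + g true false false + g true false true
                   ≡ g a b c + g (not a) b c + g a (not b) c + g a b (not c)
      go true true true rewrite flip′ true true = sum₁ (g true true true) (g true true false) (g true false false) (g true false true)
      go true true false rewrite flip′ true false = sum₂ (g true true true) (g true true false) (g true false false) (g true false true)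
      go true false true rewrite flip′ false true = sum₃ (g true true true) (g true true false) (g true false false) (g true false true)
      go true false false rewrite flip′ false false = sum₄ (g true true true) (g true true false) (g true false false) (g true false true)
      go false true true rewrite flip′ true true | flip′ false true | flip′ true false = sum₅ (g true true true) (g true true false) (g true false false) (g true false true)
        where sum₅ : ∀ a b c d → a + b + c + d ≡ c + a + b + d
              sum₅ = solve-∀
      go false true false rewrite flip′ true false | flip′ true true | flip′ false false = sum₅ (g true true true) (g true true false) (g true false false) (g true false true)
        where sum₅ : ∀ a b c d → a + b + c + d ≡ d + b + a + c
              sum₅ = solve-∀
      go false false true rewrite flip′ false true | flip′ true true | flip′ false false = sum₅ (g true true true) (g true true false) (g true false false) (g true false true)
        where sum₅ : ∀ a b c d → a + b + c + d ≡ b + d + c + a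
              sum₅ = solve-∀
      go false false false rewrite flip′ false false | flip′ true false | flip′ false true = sum₅ (g true true true) (g true true false) (g true false false) (g true false true)
        where sum₅ : ∀ a b c d → a + b + c + d ≡ a + c + d + b
              sum₅ = solve-∀

    clovers-signed : ∀ u v → clovers (ix u) (ix v) ≡ twice (θ′ u v (bar u)) + twice (θ′ v u (bar v))
    clovers-signed (p , a) (q , b) = cong₂ (λ x y → twice x + twice y) (go p q a b) (go q p b a)
      where
      go : ∀ p q a b → θ′ (p , true) (q , true) (p , false) ≡ θ′ (p , a) (q , b) (p , not a)
      go p q true true   = refl
      go p q false true  = θ-swap₁₃ (p , true) (q , true) (p , false)
      go p q true false  = trans (θ-swap₁₃ (p , true) (q , true) (p , false)) (θ-bar (p , true) (q , false) (p , false))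
      go p q false false = θ-bar (p , false) (q , false) (p , true)

    weighted : ℕ × List (Edge n) → ℤ
    weighted (w , S) = + w * θ S

    opaque
      unfolding tr ed

      tr-above : ∀ {p q r : Fin n} → (q ≺ p) ≡ true → (r ≺ q) ≡ true → (r ≺ p) ≡ true →
                 ∑ (tri p q r) weighted ≡ triangles p q r
      tr-above {p} {q} {r} qp rq rp rewrite qp | rq | rp =
        rearrange (θ (neg p q ∷ neg q r ∷ neg p r ∷ [])) (θ (neg p q ∷ pos q r ∷ pos p r ∷ []))
                  (θ (pos p q ∷ neg q r ∷ pos p r ∷ [])) (θ (pos p q ∷ pos q r ∷ neg p r ∷ []))
        where rearrange : ∀ a b c d → 1ℤ * a + (1ℤ * b + (1ℤ * c + (1ℤ * d + 0ℤ))) ≡ a + b + c + d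
              rearrange = solve-∀

      clov-above : ∀ {p q : Fin n} → (q ≺ p) ≡ true → (p ≺ q) ≡ false → (p ≺ p) ≡ false → (q ≺ q) ≡ false →
                   ∑ (clov p q) weighted ≡ clovers p q
      clov-above {p} {q} qp pq pp qq rewrite qp | pq | pp | qq =
        rearrange (θ (neg p q ∷ pos p q ∷ loop p ∷ [])) (θ (neg p q ∷ pos p q ∷ loop q ∷ []))
        where rearrange : ∀ a b → + 2 * a + (+ 2 * b + 0ℤ) ≡ a + a + (b + b)
              rearrange = solve-∀

    -- Replaces the list `genShapes`, whose entries depend on the order of the indices, by symmetric
    -- sums in which any indices can be singled out.
    ∑-shapes : ∑ (genShapes n) weighted ≡ triples (allFin n) triangles + pairs (allFin n) clovers
    ∑-shapes = begin
      ∑ (genShapes n) weighted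
        ≡⟨ ∑-++ (concatMap tris₃ (allFin n)) (concatMap clovs₂ (allFin n)) weighted ⟩
      ∑ (concatMap tris₃ (allFin n)) weighted + ∑ (concatMap clovs₂ (allFin n)) weighted
        ≡⟨ cong₂ _+_ left right ⟩
      triples (allFin n) triangles + pairs (allFin n) clovers ∎
      where
      open ≡-Reasoning
      tris₁ : Fin n → Fin n → Fin n → List (ℕ × List (Edge n))
      tris₁ p q r = if (q ≺ p) ∧ (r ≺ q) then tri p q r else []
      tris₂ : Fin n → Fin n → List (ℕ × List (Edge n))
      tris₂ p q = concatMap (tris₁ p q) (allFin n)
      tris₃ : Fin n → List (ℕ × List (Edge n))
      tris₃ p = concatMap (tris₂ p) (allFin n)
      clovs₁ : Fin n → Fin n → List (ℕ × List (Edge n))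
      clovs₁ p q = if q ≺ p then clov p q else []
      clovs₂ : Fin n → List (ℕ × List (Edge n))
      clovs₂ p = concatMap (clovs₁ p) (allFin n)
      <ᵇ-< : ∀ {x y : Fin n} → (x ≺ y) ≡ true → toℕ x ℕ.< toℕ y
      <ᵇ-< {x} {y} t = ℕₚ.<ᵇ⇒< (toℕ x) (toℕ y) (subst T (sym t) tt)
      tri-term : ∀ p q r → ∑ (tris₁ p q r) weighted ≡ (if (q ≺ p) ∧ (r ≺ q) then triangles p q r else 0ℤ)
      tri-term p q r = go (q ≺ p) (r ≺ q) refl refl
        where
        go : ∀ a b → (q ≺ p) ≡ a → (r ≺ q) ≡ b →
             ∑ (if a ∧ b then tri p q r else []) weighted ≡ (if a ∧ b then triangles p q r else 0ℤ)
        go true  true  qp rq = tr-above qp rq (≺-true (ℕₚ.<-trans (<ᵇ-< {r} {q} rq) (<ᵇ-< {q} {p} qp)))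
        go true  false qp rq = refl
        go false b     qp rq = refl
      clov-term : ∀ p q → ∑ (clovs₁ p q) weighted ≡ (if q ≺ p then clovers p q else 0ℤ)
      clov-term p q = go (q ≺ p) refl
        where
        go : ∀ a → (q ≺ p) ≡ a → ∑ (if a then clov p q else []) weighted ≡ (if a then clovers p q else 0ℤ)
        go true  qp = clov-above qp (≺-false (ℕₚ.<⇒≤ (<ᵇ-< {q} {p} qp))) (≺-false {p} {p} ℕₚ.≤-refl) (≺-false {q} {q} ℕₚ.≤-refl)
        go false qp = refl
      left : ∑ (concatMap tris₃ (allFin n)) weighted ≡ triples (allFin n) triangles
      left = trans (∑-concatMap (allFin n) tris₃ weighted)
        (trans (∑-cong (allFin n) λ p → trans (∑-concatMap (allFin n) (tris₂ p) weighted)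
          (∑-cong (allFin n) λ q → trans (∑-concatMap (allFin n) (tris₁ p q) weighted)
            (∑-cong (allFin n) (tri-term p q))))
        (∑-sorted-triples (allFin n) allFin-sorted triangles triangles-swap₁₂ triangles-swap₂₃))
      right : ∑ (concatMap clovs₂ (allFin n)) weighted ≡ pairs (allFin n) clovers
      right = trans (∑-concatMap (allFin n) clovs₂ weighted)
        (trans (∑-cong (allFin n) λ p → trans (∑-concatMap (allFin n) (clovs₁ p) weighted) (∑-cong (allFin n) (clov-term p)))
        (∑-sorted-pairs (allFin n) allFin-sorted clovers clovers-sym))

-- Flipping generators, and the tetrahedron identity

infixl 6 _⟲_

opaque
  _⟲_ : ∀ {n} → Tournament n → List (Edge n) → Tournament n
  T ⟲ S = T ⊕ (_∈E S)

  neut : ∀ {n} → Tournament n → List (Edge n) → Bool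
  neut = neutral

-- The clover with its loop at u: both games between the indices of u and v, and the game between u
-- and its opposite.
κ : ∀ {n} → V n → V n → List (Edge n)
κ u v = tr v u (bar u)

module _ {n : ℕ} where

  opaque
    unfolding _⟲_

    ⟲-cong : ∀ (T : Tournament n) {S S′ : List (Edge n)} → (∀ e → (e ∈E S) ≡ (e ∈E S′)) → T ⟲ S ≡ T ⟲ S′
    ⟲-cong T = ⊕-cong T

    ⟲-involutive : ∀ (T : Tournament n) (S : List (Edge n)) → T ⟲ S ⟲ S ≡ T
    ⟲-involutive T S = ⊕-involutive T (_∈E S)

    ⟲-exchange : ∀ (T : Tournament n) (S₁ S₂ S₃ S₄ : List (Edge n)) →
                 (∀ e → (e ∈E S₁) xor (e ∈E S₂) ≡ (e ∈E S₃) xor (e ∈E S₄)) → T ⟲ S₁ ⟲ S₂ ≡ T ⟲ S₃ ⟲ S₄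
    ⟲-exchange T S₁ S₂ S₃ S₄ eq = trans (⊕-⊕ T (_∈E S₁) (_∈E S₂)) (trans (⊕-cong T eq) (sym (⊕-⊕ T (_∈E S₃) (_∈E S₄))))

  ⟲-comm : ∀ (T : Tournament n) (S S′ : List (Edge n)) → T ⟲ S ⟲ S′ ≡ T ⟲ S′ ⟲ S
  ⟲-comm T S S′ = ⟲-exchange T S S′ S′ S (λ e → 𝔹ₚ.xor-comm (e ∈E S) (e ∈E S′))

  opaque
    unfolding _⟲_ neut

    ⟲-score : ∀ {s : Vec ℤ n} (T : Tournament n) (S : List (Edge n)) → score2 {n} T ≡ s → neut T S ≡ true → score2 {n} (T ⟲ S) ≡ s
    ⟲-score T S sc ne = trans (neutral⇒score T S ne) sc

    score⇒neut : ∀ (T : Tournament n) (S : List (Edge n)) → score2 {n} (T ⟲ S) ≡ score2 {n} T → neut T S ≡ true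
    score⇒neut = score⇒neutral

    -- Neutrality is equivalent to the flip preserving the score, and the flipped tournament depends
    -- only on the set of games.
    neutral-cong : ∀ (T : Tournament n) {S S′ : List (Edge n)} → (∀ e → (e ∈E S) ≡ (e ∈E S′)) → neut T S ≡ neut T S′
    neutral-cong T {S} {S′} eq with neut T S in p | neut T S′ in q
    ... | true  | true  = refl
    ... | false | false = refl
    ... | true  | false = trans (sym (score⇒neut T S′ (trans (cong (score2 {n}) (sym (⟲-cong T {S} {S′} eq))) (neutral⇒score T S p)))) q
    ... | false | true  = trans (sym p) (score⇒neut T S (trans (cong (score2 {n}) (⟲-cong T {S} {S′} eq)) (neutral⇒score T S′ q)))

  opaque
    unfolding tr

    tr-xor : ∀ {u v w : V n} → Distinct u v w → ∀ e →
             (e ∈E tr u v w) ≡ (e ==E ed u v) xor ((e ==E ed v w) xor (e ==E ed u w))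
    tr-xor {u} {v} {w} D e with ed-distinct D
    ... | n₁₂ , n₁₃ , n₂₃ with e ==E ed u v in p | e ==E ed v w in q | e ==E ed u w in r
    ... | true  | true  | _     = contradiction (trans (sym (==E-sound e _ p)) (==E-sound e _ q)) n₁₂
    ... | true  | false | true  = contradiction (trans (sym (==E-sound e _ p)) (==E-sound e _ r)) n₁₃
    ... | true  | false | false = refl
    ... | false | true  | true  = contradiction (trans (sym (==E-sound e _ q)) (==E-sound e _ r)) n₂₃
    ... | false | true  | false = refl
    ... | false | false | true  = refl
    ... | false | false | false = refl

-- Modulo 2, the boundary of a tetrahedron has no boundary: each game lies on two of the four faces.
module Tetrahedron {n : ℕ} {a b c d : V n} (a≢b : a ≢ b) (a≢c : a ≢ c) (a≢d : a ≢ d) (b≢c : b ≢ c) (b≢d : b ≢ d) (c≢d : c ≢ d) where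

  face : Fin 4 → List (Edge n)
  face fzero                      = tr a b c
  face (fsuc fzero)               = tr a b d
  face (fsuc (fsuc fzero))        = tr a c d
  face (fsuc (fsuc (fsuc fzero))) = tr b c d

  -- Membership in a face as the parity of three of the six games. An identity between double flips
  -- then becomes an identity in six Booleans; the parity form stays right if some of the six games
  -- coincide.
  pattern₄ : Fin 4 → Vec Bool 6 → Bool
  pattern₄ fzero                      (ab ∷ ac ∷ ad ∷ bc ∷ bd ∷ cd ∷ []) = ab xor (bc xor ac)
  pattern₄ (fsuc fzero)               (ab ∷ ac ∷ ad ∷ bc ∷ bd ∷ cd ∷ []) = ab xor (bd xor ad)
  pattern₄ (fsuc (fsuc fzero))        (ab ∷ ac ∷ ad ∷ bc ∷ bd ∷ cd ∷ []) = ac xor (cd xor ad)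
  pattern₄ (fsuc (fsuc (fsuc fzero))) (ab ∷ ac ∷ ad ∷ bc ∷ bd ∷ cd ∷ []) = bc xor (cd xor bd)

  atoms : Edge n → Vec Bool 6
  atoms e = (e ==E ed a b) ∷ (e ==E ed a c) ∷ (e ==E ed a d) ∷ (e ==E ed b c) ∷ (e ==E ed b d) ∷ (e ==E ed c d) ∷ []

  face-pattern : ∀ i e → (e ∈E face i) ≡ pattern₄ i (atoms e)
  face-pattern fzero                      = tr-xor (a≢b , b≢c , a≢c)
  face-pattern (fsuc fzero)               = tr-xor (a≢b , b≢d , a≢d)
  face-pattern (fsuc (fsuc fzero))        = tr-xor (a≢c , c≢d , a≢d)
  face-pattern (fsuc (fsuc (fsuc fzero))) = tr-xor (b≢c , c≢d , b≢d)

  tetra : ∀ (T : Tournament n) i j k l → every 6 (λ v → does (pattern₄ i v xor pattern₄ j v 𝔹.≟ pattern₄ k v xor pattern₄ l v)) ≡ true →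
          T ⟲ face i ⟲ face j ≡ T ⟲ face k ⟲ face l
  tetra T i j k l ok = ⟲-exchange T (face i) (face j) (face k) (face l) λ e →
    trans (cong₂ _xor_ (face-pattern i e) (face-pattern j e))
    (trans (by-cases 6 𝔹._≟_ (λ v → pattern₄ i v xor pattern₄ j v) (λ v → pattern₄ k v xor pattern₄ l v) ok (atoms e))
    (sym (cong₂ _xor_ (face-pattern k e) (face-pattern l e))))

-- Neutrality from three orientations, and games told apart

module _ {n : ℕ} where

  opaque
    unfolding neut

    neutral-bits : ∀ (T : Tournament n) {u v w : V n} → Distinct u v w → ∀ {a b c} → τ T u v ≡ a → τ T v w ≡ b → τ T w u ≡ c →
                   neut T (tr u v w) ≡ same a b ∧ same b c
    neutral-bits T D refl refl refl = neutral-tr T D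

  opaque
    unfolding tr

    ∈tr₁ : ∀ (u v w : V n) → (ed u v ∈E tr u v w) ≡ true
    ∈tr₁ u v w rewrite ==E-refl (ed u v) = refl

    ∈tr₂ : ∀ (u v w : V n) → (ed v w ∈E tr u v w) ≡ true
    ∈tr₂ u v w rewrite ==E-refl (ed v w) = 𝔹ₚ.∨-zeroʳ (ed v w ==E ed u v)

    ∈tr₃ : ∀ (u v w : V n) → (ed u w ∈E tr u v w) ≡ true
    ∈tr₃ u v w rewrite ==E-refl (ed u w) | 𝔹ₚ.∨-zeroʳ (ed u w ==E ed v w) = 𝔹ₚ.∨-zeroʳ (ed u w ==E ed u v)

    ∉tr : ∀ {e} {u v w : V n} → e ≢ ed u v → e ≢ ed v w → e ≢ ed u w → (e ∈E tr u v w) ≡ false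
    ∉tr p q r rewrite ==E-≢ p | ==E-≢ q | ==E-≢ r = refl

  -- Games are told apart by an index that only one of them touches.
  apart-by : ∀ {a b c d : V n} → a ≢ b → c ≢ d → ix a ≢ ix c → ix a ≢ ix d → ed a b ≢ ed c d
  apart-by {a} {b} {c} {d} a≢b c≢d p q eq =
    case trans (sym touched) (trans (cong (touches (ix a)) eq) untouched) of λ ()
    where
    touched : touches (ix a) (ed a b) ≡ true
    touched rewrite touches-ed (ix a) a b a≢b | ==F-refl (ix a) = refl
    untouched : touches (ix a) (ed c d) ≡ false
    untouched rewrite touches-ed (ix a) c d c≢d | ==F-≢ p | ==F-≢ q = refl

  apart-byʳ : ∀ {a b c d : V n} → a ≢ b → c ≢ d → ix b ≢ ix c → ix b ≢ ix d → ed a b ≢ ed c d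
  apart-byʳ {a} {b} a≢b c≢d p q eq = apart-by (a≢b ∘ sym) c≢d p q (trans (ed-sym b a) eq)

  apart-by-sign : ∀ {u v : V n} → ix u ≢ ix v → ed u (bar v) ≢ ed u v
  apart-by-sign {u} {v} ne eq = go refl refl (ed-inj (apart ne) (apart ne) eq)
    where
    go : ∀ {p q} → p ≡ (u , bar v) → q ≡ (u , v) → p ~ q → ⊥
    go refl eq keep   = bar-≢ v (sym (cong proj₂ eq))
    go refl eq swop   = ne (cong (ix ∘ proj₂) eq)
    go refl eq mirror = bar-≢ u (sym (cong proj₁ eq))
    go refl eq both   = ne (cong (ix ∘ proj₂) eq)

  opaque
    unfolding _⟲_

    τ-in : ∀ (T : Tournament n) (S : List (Edge n)) {u v : V n} → u ≢ v → (ed u v ∈E S) ≡ true → τ (T ⟲ S) u v ≡ not (τ T u v)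
    τ-in T S ne eq = trans (τ-⊕ T (_∈E S) ne) (cong (_xor τ T _ _) eq)

    τ-out : ∀ (T : Tournament n) (S : List (Edge n)) {u v : V n} → u ≢ v → (ed u v ∈E S) ≡ false → τ (T ⟲ S) u v ≡ τ T u v
    τ-out T S ne eq = trans (τ-⊕ T (_∈E S) ne) (cong (_xor τ T _ _) eq)

  opaque
    unfolding neut

    neutral-disjoint : ∀ (T : Tournament n) (S : List (Edge n)) {a b c : V n} → Distinct a b c →
      (ed a b ∈E S) ≡ false → (ed b c ∈E S) ≡ false → (ed a c ∈E S) ≡ false → neut (T ⟲ S) (tr a b c) ≡ neut T (tr a b c)
    neutral-disjoint T S {a} {b} {c} D@(a≢b , b≢c , a≢c) p q r =
      trans (neutral-bits (T ⟲ S) D (τ-out T S a≢b p) (τ-out T S b≢c q) (τ-out T S (a≢c ∘ sym) (trans (cong (_∈E S) (ed-sym c a)) r)))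
            (sym (neutral-tr T D))

-- Matching the moves from the two ends of an edge

gate : Bool → ℤ → ℤ
gate b x = if b then x else 0ℤ

-- Upper bounds alone control absolute values, since every edge can also be traversed backwards.
record Lipschitz {n : ℕ} (s : Vec ℤ n) (F : Tournament n → ℤ) (A B : ℤ) : Set where
  field
    triangle : ∀ (T : Tournament n) (u v w : V n) → ix u ≢ ix v → ix v ≢ ix w → ix u ≢ ix w →
               score2 {n} T ≡ s → score2 {n} (T ⟲ tr u v w) ≡ s → F T - F (T ⟲ tr u v w) ≤ A
    clover : ∀ (T : Tournament n) (u v : V n) → ix u ≢ ix v →
             score2 {n} T ≡ s → score2 {n} (T ⟲ κ u v) ≡ s → F T - F (T ⟲ κ u v) ≤ B

-- α S and β S are the contributions of flipping S in T and in T₂; all sums are normalised by the constant W − (F T − F T₂).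
module Coupling {n : ℕ} {s : Vec ℤ n} {F : Tournament n → ℤ} {A B : ℤ} (lip : Lipschitz s F A B)
                (T T₂ : Tournament n) (W : ℤ) (scT : score2 {n} T ≡ s) (scT₂ : score2 {n} T₂ ≡ s) where

  α β θ : List (Edge n) → ℤ
  α S = F (T ⟲ S) - F T - (W - (F T - F T₂))
  β S = F (T₂ ⟲ S) - F T₂
  θ S = gate (neut T S) (α S) - gate (neut T₂ S) (β S)

  θ-respects : Respects θ
  θ-respects {S} {S′} eq = cong₂ _-_
    (cong₂ (λ b x → gate b (F x - F T - (W - (F T - F T₂)))) (neutral-cong T {S} {S′} eq) (⟲-cong T {S} {S′} eq))
    (cong₂ (λ b x → gate b (F x - F T₂)) (neutral-cong T₂ {S} {S′} eq) (⟲-cong T₂ {S} {S′} eq))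

  -- A move H of T matched with a move H′ of T₂ ends with the chains one flip J apart. Thanks to the
  -- normalisation in `α`, the match contributes the bound X for the new distance minus the bound W
  -- for the old one, hence nothing when both edges are of the same kind.
  pair : ∀ X (H H′ J : List (Edge n)) → T ⟲ H ⟲ J ≡ T₂ ⟲ H′ → F (T ⟲ H) - F (T ⟲ H ⟲ J) ≤ X → α H ≤ β H′ + (X - W)
  pair X H H′ J eq le = ≤-slack (X - (F (T ⟲ H) - F (T ⟲ H ⟲ J))) (gap le)
    (trans (cong (λ z → α H + (X - (F (T ⟲ H) - F z))) eq) (identity X W (F (T ⟲ H)) (F (T₂ ⟲ H′)) (F T) (F T₂)))
    where
    identity : ∀ X W h h′ t t₂ → (h - t - (W - (t - t₂))) + (X - (h - h′)) ≡ (h′ - t₂) + (X - W)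
    identity = solve-∀

  pair-triangle : ∀ (H H′ : List (Edge n)) {a b c : V n} → ix a ≢ ix b → ix b ≢ ix c → ix a ≢ ix c → T ⟲ H ⟲ tr a b c ≡ T₂ ⟲ H′ →
                  neut T H ≡ true → neut T₂ H′ ≡ true → α H ≤ β H′ + (A - W)
  pair-triangle H H′ {a} {b} {c} p q r eq nH nH′ = pair A H H′ (tr a b c) eq
    (Lipschitz.triangle lip (T ⟲ H) a b c p q r (⟲-score T H scT nH) (trans (cong (score2 {n}) eq) (⟲-score T₂ H′ scT₂ nH′)))

  pair-clover : ∀ (H H′ : List (Edge n)) {a b : V n} → ix a ≢ ix b → T ⟲ H ⟲ κ a b ≡ T₂ ⟲ H′ →
                neut T H ≡ true → neut T₂ H′ ≡ true → α H ≤ β H′ + (B - W)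
  pair-clover H H′ {a} {b} p eq nH nH′ = pair B H H′ (κ a b) eq
    (Lipschitz.clover lip (T ⟲ H) a b p (⟲-score T H scT nH) (trans (cong (score2 {n}) eq) (⟲-score T₂ H′ scT₂ nH′)))

  -- A generator sharing no game with S₀ is neutral in both tournaments or in neither, and it
  -- commutes with S₀: the same move at both ends translates the edge.
  θ-disjoint : ∀ (S₀ : List (Edge n)) → T₂ ≡ T ⟲ S₀ → (∀ (T′ : Tournament n) → score2 {n} T′ ≡ s → score2 {n} (T′ ⟲ S₀) ≡ s → F T′ - F (T′ ⟲ S₀) ≤ W) →
    ∀ {a b c : V n} → Distinct a b c →
    (ed a b ∈E S₀) ≡ false → (ed b c ∈E S₀) ≡ false → (ed a c ∈E S₀) ≡ false → θ (tr a b c) ≤ 0ℤ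
  θ-disjoint S₀ refl lip₀ {a} {b} {c} D p q r = go (neut T S) refl
    where
    S = tr a b c
    same-neutral : neut T₂ S ≡ neut T S
    same-neutral = neutral-disjoint T S₀ D p q r
    go : ∀ x → neut T S ≡ x → θ S ≤ 0ℤ
    go false eq rewrite same-neutral | eq = ℤₚ.≤-refl
    go true  eq rewrite same-neutral | eq = ≤-slack (β S + (W - W) - α S)
      (gap (pair W S S S₀ (⟲-comm T S S₀) (lip₀ (T ⟲ S) (⟲-score T S scT eq)
        (trans (cong (score2 {n}) (⟲-comm T S S₀)) (⟲-score T₂ S scT₂ (trans same-neutral eq))))))
      (identity (α S) (β S) W)
      where identity : ∀ x y W → x - y + (y + (W - W) - x) ≡ 0ℤ
            identity = solve-∀

  -- One chain jumps to the position of the other while that one moves along a clover. Afterwards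
  -- they are one clover apart, whatever kind of edge S₀ was.
  flip-then-clover : ∀ S₀ {a b : V n} → T₂ ≡ T ⟲ S₀ → ix a ≢ ix b → neut T S₀ ≡ true → neut T₂ (κ a b) ≡ true →
                     α S₀ ≤ β (κ a b) + (B - W)
  flip-then-clover S₀ {a} {b} eq ne n₀ nκ = pair-clover S₀ (κ a b) ne (cong (_⟲ κ a b) (sym eq)) n₀ nκ

  clover-then-flip : ∀ S₀ {a b : V n} → T₂ ≡ T ⟲ S₀ → ix a ≢ ix b → neut T (κ a b) ≡ true → neut T₂ S₀ ≡ true →
                     α (κ a b) ≤ β S₀ + (B - W)
  clover-then-flip S₀ {a} {b} eq ne nκ n₀ = pair-clover (κ a b) S₀ ne
    (trans (⟲-involutive T (κ a b)) (trans (sym (⟲-involutive T S₀)) (cong (_⟲ S₀) (sym eq)))) nκ n₀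

  back : ∀ (S₀ : List (Edge n)) → T₂ ≡ T ⟲ S₀ → T₂ ⟲ S₀ ≡ T
  back S₀ eq = trans (cong (_⟲ S₀) eq) (⟲-involutive T S₀)

  neutral-back : ∀ (S₀ : List (Edge n)) → T₂ ≡ T ⟲ S₀ → neut T₂ S₀ ≡ true
  neutral-back S₀ eq = score⇒neut T₂ S₀ (trans (cong (score2 {n}) (back S₀ eq)) (trans scT (sym scT₂)))

  -- The source of contraction. The moves T → T₂ and T₂ → T contribute -W and -(F T - F T₂); in a
  -- coupling each would be paired with a lazy step of the other chain, so that the chains meet.
  θ-self : ∀ (S₀ : List (Edge n)) → T₂ ≡ T ⟲ S₀ → neut T S₀ ≡ true → θ S₀ ≡ - (F T - F T₂ + W)
  θ-self S₀ eq n₀ = trans (cong₂ (λ b c → gate b (α S₀) - gate c (β S₀)) n₀ (neutral-back S₀ eq))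
    (trans (cong₂ (λ x y → (F x - F T - (W - (F T - F T₂))) - (F y - F T₂)) (sym eq) (back S₀ eq)) (identity (F T) (F T₂) W))
    where
    identity : ∀ t t₂ W → (t₂ - t - (W - (t - t₂))) - (t - t₂) ≡ - (t - t₂ + W)
    identity = solve-∀

  θ-eval : ∀ {S b c} → neut T S ≡ b → neut T₂ S ≡ c → θ S ≡ gate b (α S) - gate c (β S)
  θ-eval {S} = cong₂ (λ b c → gate b (α S) - gate c (β S))

  θ-left : ∀ {S} → neut T S ≡ true → neut T₂ S ≡ false → θ S ≡ α S
  θ-left {S} p q = trans (θ-eval {S} p q) (ℤₚ.+-identityʳ (α S))

  θ-right : ∀ {S} → neut T S ≡ false → neut T₂ S ≡ true → θ S ≡ - β S
  θ-right {S} p q = trans (θ-eval {S} p q) (ℤₚ.+-identityˡ (- β S))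

  θ-none : ∀ {S} → neut T S ≡ false → neut T₂ S ≡ false → θ S ≡ 0ℤ
  θ-none {S} = θ-eval {S}

-- Here a orients the loop and x is the common value of the bits `x` and `z` of `Vertex`. If a = x,
-- no clover is neutral on either side; otherwise one clover is neutral in T, the other in T₂, and
-- these two are matched.
loops-arithmetic : ∀ (a x : Bool) (αv βv αw βw A : ℤ) →
  (a ≡ false → x ≡ true → αv ≤ βw + (A - A)) → (a ≡ true → x ≡ false → αw ≤ βv + (A - A)) →
  twice (gate (same false a ∧ same a (not x)) αv - gate (same true a ∧ same a (not x)) βv)
  + twice (gate (same true a ∧ same a (not x)) αw - gate (same false a ∧ same a (not x)) βw) ≤ 0ℤ
loops-arithmetic true  true  αv βv αw βw A h h′ = ℤₚ.≤-refl
loops-arithmetic true  false αv βv αw βw A h h′ = ≤-slack (twice (βv + (A - A) - αw)) (0≤+ (gap (h′ refl refl)) (gap (h′ refl refl))) (identity αw βv A)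
  where identity : ∀ p q A → (0ℤ - q) + (0ℤ - q) + ((p - 0ℤ) + (p - 0ℤ)) + ((q + (A - A) - p) + (q + (A - A) - p)) ≡ 0ℤ
        identity = solve-∀
loops-arithmetic false true  αv βv αw βw A h h′ = ≤-slack (twice (βw + (A - A) - αv)) (0≤+ (gap (h refl refl)) (gap (h refl refl))) (identity αv βw A)
  where identity : ∀ p q A → (p - 0ℤ) + (p - 0ℤ) + ((0ℤ - q) + (0ℤ - q)) + ((q + (A - A) - p) + (q + (A - A) - p)) ≡ 0ℤ
        identity = solve-∀
loops-arithmetic false false αv βv αw βw A h h′ = ℤₚ.≤-refl

-- The tetrahedron on u, v, w and the opposite of u, where u → v → w → u is the flipped triangle.
-- Its other faces are the two clovers `κ u v`, `κ u w` and the triangle on v, w and `bar u`; which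
-- of them are neutral depends only on the bits `x`, `z`, `a`.
module Vertex {n : ℕ} {s : Vec ℤ n} {F : Tournament n → ℤ} {A B : ℤ} (lip : Lipschitz s F A B)
              (T T₂ : Tournament n) (scT : score2 {n} T ≡ s) (scT₂ : score2 {n} T₂ ≡ s)
              (u v w : V n) (u≢v : ix u ≢ ix v) (v≢w : ix v ≢ ix w) (u≢w : ix u ≢ ix w)
              (T₂≡ : T₂ ≡ T ⟲ tr v w u) (vw : τ T v w ≡ true) (wu : τ T w u ≡ true) (uv : τ T u v ≡ true) where

  open Coupling lip T T₂ A scT scT₂

  x z a : Bool
  x = τ T u (bar v)
  z = τ T w (bar u)
  a = τ T u (bar u)

  private
    module Tet = Tetrahedron {a = v} {w} {u} {bar u} (apart v≢w) (apart (u≢v ∘ sym)) (apart (u≢v ∘ sym))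
                             (apart (u≢w ∘ sym)) (apart (u≢w ∘ sym)) (bar-≢ u)
    G : List (Edge n)
    G = tr v w u

    chain : ∀ {S S₁ S₂ : List (Edge n)} → T ⟲ S ⟲ S₁ ≡ T ⟲ G ⟲ S₂ → T ⟲ S ⟲ S₁ ≡ T₂ ⟲ S₂
    chain {S₂ = S₂} eq = trans eq (cong (_⟲ S₂) (sym T₂≡))

    Dκv : Distinct v u (bar u)
    Dκv = apart (u≢v ∘ sym) , bar-≢ u , apart (u≢v ∘ sym)
    Dκw : Distinct w u (bar u)
    Dκw = apart (u≢w ∘ sym) , bar-≢ u , apart (u≢w ∘ sym)
    DŪ : Distinct v w (bar u)
    DŪ = apart v≢w , apart (u≢w ∘ sym) , apart (u≢v ∘ sym)

    out-uū : (ed u (bar u) ∈E G) ≡ false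
    out-uū = ∉tr (apart-by (bar-≢ u) (apart v≢w) u≢v u≢w)
                (λ eq → apart-by (apart (u≢w ∘ sym)) (bar-≢ u) (u≢w ∘ sym) (u≢w ∘ sym) (sym eq))
                (λ eq → apart-by (apart (u≢v ∘ sym)) (bar-≢ u) (u≢v ∘ sym) (u≢v ∘ sym) (sym eq))

    out-ūv : (ed (bar u) v ∈E G) ≡ false
    out-ūv = ∉tr (apart-by (apart u≢v) (apart v≢w) u≢v u≢w)
                (apart-byʳ (apart u≢v) (apart (u≢w ∘ sym)) v≢w (u≢v ∘ sym))
                (λ eq → apart-by-sign (u≢v ∘ sym) (trans (ed-sym v (bar u)) eq))

    out-wū : (ed w (bar u) ∈E G) ≡ false
    out-wū = ∉tr (apart-byʳ (apart (u≢w ∘ sym)) (apart v≢w) u≢v u≢w)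
                (apart-by-sign (u≢w ∘ sym))
                (apart-by (apart (u≢w ∘ sym)) (apart (u≢v ∘ sym)) (v≢w ∘ sym) (u≢w ∘ sym))

    ūv : τ T (bar u) v ≡ not x
    ūv = trans (τ-swap T (apart (u≢v ∘ sym))) (cong not (trans (sym (τ-mirror T (apart (u≢v ∘ sym)))) (cong (λ y → τ T y (bar v)) (bar-bar u))))

    ūw : τ T (bar u) w ≡ not z
    ūw = τ-swap T (apart (u≢w ∘ sym))

    vu : τ T v u ≡ false
    vu = trans (τ-swap T (apart u≢v)) (cong not uv)

    T₂-in : ∀ {b c : V n} {p} → b ≢ c → (ed b c ∈E G) ≡ true → τ T b c ≡ p → τ T₂ b c ≡ not p
    T₂-in ne i eq rewrite T₂≡ = trans (τ-in T G ne i) (cong not eq)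

    T₂-out : ∀ {b c : V n} {p} → b ≢ c → (ed b c ∈E G) ≡ false → τ T b c ≡ p → τ T₂ b c ≡ p
    T₂-out ne o eq rewrite T₂≡ = trans (τ-out T G ne o) eq

    vu₂ : τ T₂ v u ≡ true
    vu₂ = T₂-in (apart (u≢v ∘ sym)) (∈tr₃ v w u) vu
    wu₂ : τ T₂ w u ≡ false
    wu₂ = T₂-in (apart (u≢w ∘ sym)) (∈tr₂ v w u) wu
    vw₂ : τ T₂ v w ≡ false
    vw₂ = T₂-in (apart v≢w) (∈tr₁ v w u) vw
    uū₂ : τ T₂ u (bar u) ≡ a
    uū₂ = T₂-out (bar-≢ u) out-uū refl
    ūv₂ : τ T₂ (bar u) v ≡ not x
    ūv₂ = T₂-out (apart u≢v) out-ūv ūv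
    wū₂ : τ T₂ w (bar u) ≡ z
    wū₂ = T₂-out (apart (u≢w ∘ sym)) out-wū refl
    ūw₂ : τ T₂ (bar u) w ≡ not z
    ūw₂ = trans (τ-swap T₂ (apart (u≢w ∘ sym))) (cong not wū₂)

  κv : neut T (κ u v) ≡ same false a ∧ same a (not x)
  κv = neutral-bits T Dκv vu refl ūv
  κw : neut T (κ u w) ≡ same true a ∧ same a (not z)
  κw = neutral-bits T Dκw wu refl ūw
  κv₂ : neut T₂ (κ u v) ≡ same true a ∧ same a (not x)
  κv₂ = neutral-bits T₂ Dκv vu₂ uū₂ ūv₂
  κw₂ : neut T₂ (κ u w) ≡ same false a ∧ same a (not z)
  κw₂ = neutral-bits T₂ Dκw wu₂ uū₂ ūw₂
  Ū₁ : neut T (tr v w (bar u)) ≡ same true z ∧ same z (not x)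
  Ū₁ = neutral-bits T DŪ vw refl ūv
  Ū₂ : neut T₂ (tr v w (bar u)) ≡ same false z ∧ same z (not x)
  Ū₂ = neutral-bits T₂ DŪ vw₂ wū₂ ūv₂

  κv≤κw : neut T (κ u v) ≡ true → neut T₂ (κ u w) ≡ true → α (κ u v) ≤ β (κ u w) + (A - A)
  κv≤κw = pair-triangle (κ u v) (κ u w) v≢w (u≢w ∘ sym) (u≢v ∘ sym) (chain (Tet.tetra T (# 2) (# 1) (# 0) (# 3) refl))

  κw≤κv : neut T (κ u w) ≡ true → neut T₂ (κ u v) ≡ true → α (κ u w) ≤ β (κ u v) + (A - A)
  κw≤κv = pair-triangle (κ u w) (κ u v) v≢w (u≢w ∘ sym) (u≢v ∘ sym) (chain (Tet.tetra T (# 3) (# 1) (# 0) (# 2) refl))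

  loops : ℤ
  loops = twice (θ (κ u v)) + twice (θ (κ u w))

  loops-balanced : x ≡ z → loops ≤ 0ℤ
  loops-balanced eq rewrite κv | κw | κv₂ | κw₂ | sym eq =
    loops-arithmetic a x (α (κ u v)) (β (κ u v)) (α (κ u w)) (β (κ u w)) A
      (λ pa px → κv≤κw (trans κv (cong₂ (λ a x → same false a ∧ same a (not x)) pa px))
                       (trans κw₂ (cong₂ (λ a z → same false a ∧ same a (not z)) pa (trans (sym eq) px))))
      (λ pa px → κw≤κv (trans κw (cong₂ (λ a z → same true a ∧ same a (not z)) pa (trans (sym eq) px)))
                       (trans κv₂ (cong₂ (λ a x → same true a ∧ same a (not x)) pa px)))

  -- When x and z differ, exactly one of the two clovers at u is neutral, in T or in T₂.
  inner outer : List (Edge n)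
  inner = if a then κ u w else κ u v
  outer = if a then κ u v else κ u w

  -- A double move on one side faces a single one on the other: T has a neutral clover at u and T₂
  -- has none, while the triangle on v, w and `bar u` is neutral in T₂ only. In `loops-lose` the two
  -- tournaments exchange roles.
  loops-win : x ≡ true → z ≡ false → loops ≡ twice (α inner) × neut T inner ≡ true
  loops-win px pz rewrite κv | κw | κv₂ | κw₂ | px | pz with a in pa
  ... | true  = id₁ (α (κ u w)) , trans κw (cong₂ (λ a z → same true a ∧ same a (not z)) pa pz)
    where id₁ : ∀ p → (0ℤ - 0ℤ) + (0ℤ - 0ℤ) + ((p - 0ℤ) + (p - 0ℤ)) ≡ p + p
          id₁ = solve-∀
  ... | false = id₁ (α (κ u v)) , trans κv (cong₂ (λ a x → same false a ∧ same a (not x)) pa px)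
    where id₁ : ∀ p → (p - 0ℤ) + (p - 0ℤ) + ((0ℤ - 0ℤ) + (0ℤ - 0ℤ)) ≡ p + p
          id₁ = solve-∀

  loops-lose : x ≡ false → z ≡ true → loops ≡ - twice (β outer) × neut T₂ outer ≡ true
  loops-lose px pz rewrite κv | κw | κv₂ | κw₂ | px | pz with a in pa
  ... | true  = id₁ (β (κ u v)) , trans κv₂ (cong₂ (λ a x → same true a ∧ same a (not x)) pa px)
    where id₁ : ∀ p → (0ℤ - p) + (0ℤ - p) + ((0ℤ - 0ℤ) + (0ℤ - 0ℤ)) ≡ - (p + p)
          id₁ = solve-∀
  ... | false = id₁ (β (κ u w)) , trans κw₂ (cong₂ (λ a z → same false a ∧ same a (not z)) pa pz)
    where id₁ : ∀ p → (0ℤ - 0ℤ) + (0ℤ - 0ℤ) + ((0ℤ - p) + (0ℤ - p)) ≡ - (p + p)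
          id₁ = solve-∀

  Ū≤outer : neut T (tr v w (bar u)) ≡ true → neut T₂ outer ≡ true → α (tr v w (bar u)) ≤ β outer + (B - A)
  Ū≤outer with a
  ... | true  = pair-clover (tr v w (bar u)) (κ u v) u≢w (chain (Tet.tetra T (# 1) (# 3) (# 0) (# 2) refl))
  ... | false = pair-clover (tr v w (bar u)) (κ u w) u≢v (chain (Tet.tetra T (# 1) (# 2) (# 0) (# 3) refl))

  inner≤Ū : neut T inner ≡ true → neut T₂ (tr v w (bar u)) ≡ true → α inner ≤ β (tr v w (bar u)) + (B - A)
  inner≤Ū with a
  ... | true  = pair-clover (κ u w) (tr v w (bar u)) u≢v (chain (Tet.tetra T (# 3) (# 2) (# 0) (# 1) refl))
  ... | false = pair-clover (κ u v) (tr v w (bar u)) u≢w (chain (Tet.tetra T (# 2) (# 3) (# 0) (# 1) refl))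

  -- Of the two copies of the clover, one is matched with the triangle on v, w and `bar u`, and the
  -- other with the move back along the edge itself.
  inner≤G : ∀ (S₀ : List (Edge n)) → T₂ ≡ T ⟲ S₀ → neut T inner ≡ true → α inner ≤ β S₀ + (B - A)
  inner≤G S₀ eq with a
  ... | true  = λ nκ → clover-then-flip S₀ eq u≢w nκ (neutral-back S₀ eq)
  ... | false = λ nκ → clover-then-flip S₀ eq u≢v nκ (neutral-back S₀ eq)

  G≤outer : ∀ (S₀ : List (Edge n)) → T₂ ≡ T ⟲ S₀ → neut T S₀ ≡ true → neut T₂ outer ≡ true → α S₀ ≤ β outer + (B - A)
  G≤outer S₀ eq n₀ with a
  ... | true  = λ nκ → flip-then-clover S₀ eq u≢v n₀ nκ
  ... | false = λ nκ → flip-then-clover S₀ eq u≢w n₀ nκ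

-- The tetrahedron on the flipped triangle and a vertex x with a new index. If x points to all of u,
-- v, w or to none, no face through x is neutral. Otherwise exactly one such face is neutral in T
-- and another one in T₂; they are matched across the third, which is again a triangle.
module Outside {n : ℕ} {s : Vec ℤ n} {F : Tournament n → ℤ} {A B : ℤ} (lip : Lipschitz s F A B)
               (T T₂ : Tournament n) (scT : score2 {n} T ≡ s) (scT₂ : score2 {n} T₂ ≡ s)
               (u v w : V n) (u≢v : ix u ≢ ix v) (v≢w : ix v ≢ ix w) (u≢w : ix u ≢ ix w)
               (T₂≡ : T₂ ≡ T ⟲ tr u v w) (uv : τ T u v ≡ true) (vw : τ T v w ≡ true) (wu : τ T w u ≡ true)
               (x : V n) (x≢u : ix x ≢ ix u) (x≢v : ix x ≢ ix v) (x≢w : ix x ≢ ix w) where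

  open Coupling lip T T₂ A scT scT₂

  private
    module Tet = Tetrahedron {a = u} {v} {w} {x} (apart u≢v) (apart u≢w) (apart (x≢u ∘ sym))
                             (apart v≢w) (apart (x≢v ∘ sym)) (apart (x≢w ∘ sym))
    G : List (Edge n)
    G = tr u v w

    chain : ∀ {S S₁ S₂ : List (Edge n)} → T ⟲ S ⟲ S₁ ≡ T ⟲ G ⟲ S₂ → T ⟲ S ⟲ S₁ ≡ T₂ ⟲ S₂
    chain {S₂ = S₂} eq = trans eq (cong (_⟲ S₂) (sym T₂≡))

    out : ∀ (y : V n) → x ≢ y → (ed x y ∈E G) ≡ false
    out y ne = ∉tr (apart-by ne (apart u≢v) x≢u x≢v) (apart-by ne (apart v≢w) x≢v x≢w) (apart-by ne (apart u≢w) x≢u x≢w)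

    T₂-in : ∀ {b c : V n} {p} → b ≢ c → (ed b c ∈E G) ≡ true → τ T b c ≡ p → τ T₂ b c ≡ not p
    T₂-in ne i eq rewrite T₂≡ = trans (τ-in T G ne i) (cong not eq)

    T₂-out : ∀ (c : V n) {p} → x ≢ c → τ T x c ≡ p → τ T₂ x c ≡ p
    T₂-out c ne eq rewrite T₂≡ = trans (τ-out T G ne (out c ne)) eq

    opposite : ∀ (T : Tournament n) (c : V n) {p} → ix x ≢ ix c → τ T x c ≡ p → τ T c x ≡ not p
    opposite T c ne eq = trans (τ-swap T (apart ne)) (cong not eq)

    uw : τ T u w ≡ false
    uw = trans (τ-swap T (apart (u≢w ∘ sym))) (cong not wu)

    uv₂ : τ T₂ u v ≡ false
    uv₂ = T₂-in (apart u≢v) (∈tr₁ u v w) uv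
    vw₂ : τ T₂ v w ≡ false
    vw₂ = T₂-in (apart v≢w) (∈tr₂ u v w) vw
    uw₂ : τ T₂ u w ≡ true
    uw₂ = T₂-in (apart u≢w) (∈tr₃ u v w) uw

    H₁ H₂ H₃ : List (Edge n)
    H₁ = tr u v x
    H₂ = tr u w x
    H₃ = tr v w x

    D₁ : Distinct u v x
    D₁ = apart u≢v , apart (x≢v ∘ sym) , apart (x≢u ∘ sym)
    D₂ : Distinct u w x
    D₂ = apart u≢w , apart (x≢w ∘ sym) , apart (x≢u ∘ sym)
    D₃ : Distinct v w x
    D₃ = apart v≢w , apart (x≢w ∘ sym) , apart (x≢v ∘ sym)

    cancel : ∀ y → y + (A - A) ≡ y
    cancel y = trans (cong (λ q → y + q) (ℤₚ.+-inverseʳ A)) (ℤₚ.+-identityʳ y)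

    le : ∀ {H H′ : List (Edge n)} → α H ≤ β H′ + (A - A) → α H ≤ β H′
    le {H} {H′} p = subst (α H ≤_) (cancel (β H′)) p

    sum₃ : ∀ {x₁ x₂ x₃ y₁ y₂ y₃} → x₁ ≡ y₁ → x₂ ≡ y₂ → x₃ ≡ y₃ → y₁ + y₂ + y₃ ≤ 0ℤ → x₁ + x₂ + x₃ ≤ 0ℤ
    sum₃ refl refl refl p = p

    sum₁₂ : ∀ {p q} → p ≤ q → p + - q + 0ℤ ≤ 0ℤ
    sum₁₂ {p} {q} le = ≤-slack (q - p) (gap le) (identity p q)
      where identity : ∀ p q → p + - q + 0ℤ + (q - p) ≡ 0ℤ
            identity = solve-∀
    sum₁₃ : ∀ {p q} → p ≤ q → p + 0ℤ + - q ≤ 0ℤ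
    sum₁₃ {p} {q} le = ≤-slack (q - p) (gap le) (identity p q)
      where identity : ∀ p q → p + 0ℤ + - q + (q - p) ≡ 0ℤ
            identity = solve-∀
    sum₂₁ : ∀ {p q} → p ≤ q → - q + p + 0ℤ ≤ 0ℤ
    sum₂₁ {p} {q} le = ≤-slack (q - p) (gap le) (identity p q)
      where identity : ∀ p q → - q + p + 0ℤ + (q - p) ≡ 0ℤ
            identity = solve-∀
    sum₂₃ : ∀ {p q} → p ≤ q → 0ℤ + p + - q ≤ 0ℤ
    sum₂₃ {p} {q} le = ≤-slack (q - p) (gap le) (identity p q)
      where identity : ∀ p q → 0ℤ + p + - q + (q - p) ≡ 0ℤ
            identity = solve-∀
    sum₃₁ : ∀ {p q} → p ≤ q → - q + 0ℤ + p ≤ 0ℤ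
    sum₃₁ {p} {q} le = ≤-slack (q - p) (gap le) (identity p q)
      where identity : ∀ p q → - q + 0ℤ + p + (q - p) ≡ 0ℤ
            identity = solve-∀
    sum₃₂ : ∀ {p q} → p ≤ q → 0ℤ + - q + p ≤ 0ℤ
    sum₃₂ {p} {q} le = ≤-slack (q - p) (gap le) (identity p q)
      where identity : ∀ p q → 0ℤ + - q + p + (q - p) ≡ 0ℤ
            identity = solve-∀

  outside≤0 : θ (tr u v x) + θ (tr u w x) + θ (tr v w x) ≤ 0ℤ
  outside≤0 = go (τ T x u) (τ T x v) (τ T x w) refl refl refl
    where
    go : ∀ p q r → τ T x u ≡ p → τ T x v ≡ q → τ T x w ≡ r → θ H₁ + θ H₂ + θ H₃ ≤ 0ℤ
    go p q r xu xv xw = cases p q r n₁ n₁₂ n₂ n₂₂ n₃ n₃₂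
      where
      vx : τ T v x ≡ not q
      vx = opposite T v x≢v xv
      wx : τ T w x ≡ not r
      wx = opposite T w x≢w xw
      xu₂ : τ T₂ x u ≡ p
      xu₂ = T₂-out u (apart x≢u) xu
      xv₂ : τ T₂ x v ≡ q
      xv₂ = T₂-out v (apart x≢v) xv
      xw₂ : τ T₂ x w ≡ r
      xw₂ = T₂-out w (apart x≢w) xw
      n₁ : neut T H₁ ≡ same true (not q) ∧ same (not q) p
      n₁ = neutral-bits T D₁ uv vx xu
      n₁₂ : neut T₂ H₁ ≡ same false (not q) ∧ same (not q) p
      n₁₂ = neutral-bits T₂ D₁ uv₂ (opposite T₂ v x≢v xv₂) xu₂
      n₂ : neut T H₂ ≡ same false (not r) ∧ same (not r) p
      n₂ = neutral-bits T D₂ uw wx xu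
      n₂₂ : neut T₂ H₂ ≡ same true (not r) ∧ same (not r) p
      n₂₂ = neutral-bits T₂ D₂ uw₂ (opposite T₂ w x≢w xw₂) xu₂
      n₃ : neut T H₃ ≡ same true (not r) ∧ same (not r) q
      n₃ = neutral-bits T D₃ vw wx xv
      n₃₂ : neut T₂ H₃ ≡ same false (not r) ∧ same (not r) q
      n₃₂ = neutral-bits T₂ D₃ vw₂ (opposite T₂ w x≢w xw₂) xv₂
      xv≢ : ix v ≢ ix x
      xv≢ = x≢v ∘ sym
      xw≢ : ix w ≢ ix x
      xw≢ = x≢w ∘ sym
      xu≢ : ix u ≢ ix x
      xu≢ = x≢u ∘ sym
      cases : ∀ p q r →
        neut T H₁ ≡ same true (not q) ∧ same (not q) p → neut T₂ H₁ ≡ same false (not q) ∧ same (not q) p →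
        neut T H₂ ≡ same false (not r) ∧ same (not r) p → neut T₂ H₂ ≡ same true (not r) ∧ same (not r) p →
        neut T H₃ ≡ same true (not r) ∧ same (not r) q → neut T₂ H₃ ≡ same false (not r) ∧ same (not r) q →
        θ H₁ + θ H₂ + θ H₃ ≤ 0ℤ
      cases true true true n₁ n₁′ n₂ n₂′ n₃ n₃′ = sum₃ (θ-none {H₁} n₁ n₁′) (θ-none {H₂} n₂ n₂′) (θ-none {H₃} n₃ n₃′) ℤₚ.≤-refl
      cases false false false n₁ n₁′ n₂ n₂′ n₃ n₃′ = sum₃ (θ-none {H₁} n₁ n₁′) (θ-none {H₂} n₂ n₂′) (θ-none {H₃} n₃ n₃′) ℤₚ.≤-refl
      cases true false false n₁ n₁′ n₂ n₂′ n₃ n₃′ = sum₃ (θ-left {H₁} n₁ n₁′) (θ-right {H₂} n₂ n₂′) (θ-none {H₃} n₃ n₃′)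
        (sum₁₂ (le {H₁} {H₂} (pair-triangle H₁ H₂ v≢w xw≢ xv≢ (chain (Tet.tetra T (# 1) (# 3) (# 0) (# 2) refl)) n₁ n₂′)))
      cases true false true n₁ n₁′ n₂ n₂′ n₃ n₃′ = sum₃ (θ-left {H₁} n₁ n₁′) (θ-none {H₂} n₂ n₂′) (θ-right {H₃} n₃ n₃′)
        (sum₁₃ (le {H₁} {H₃} (pair-triangle H₁ H₃ u≢w xw≢ xu≢ (chain (Tet.tetra T (# 1) (# 2) (# 0) (# 3) refl)) n₁ n₃′)))
      cases true true false n₁ n₁′ n₂ n₂′ n₃ n₃′ = sum₃ (θ-none {H₁} n₁ n₁′) (θ-right {H₂} n₂ n₂′) (θ-left {H₃} n₃ n₃′)
        (sum₃₂ (le {H₃} {H₂} (pair-triangle H₃ H₂ u≢v xv≢ xu≢ (chain (Tet.tetra T (# 3) (# 1) (# 0) (# 2) refl)) n₃ n₂′)))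
      cases false true false n₁ n₁′ n₂ n₂′ n₃ n₃′ = sum₃ (θ-right {H₁} n₁ n₁′) (θ-none {H₂} n₂ n₂′) (θ-left {H₃} n₃ n₃′)
        (sum₃₁ (le {H₃} {H₁} (pair-triangle H₃ H₁ u≢w xw≢ xu≢ (chain (Tet.tetra T (# 3) (# 2) (# 0) (# 1) refl)) n₃ n₁′)))
      cases false false true n₁ n₁′ n₂ n₂′ n₃ n₃′ = sum₃ (θ-none {H₁} n₁ n₁′) (θ-left {H₂} n₂ n₂′) (θ-right {H₃} n₃ n₃′)
        (sum₂₃ (le {H₂} {H₃} (pair-triangle H₂ H₃ u≢v xv≢ xu≢ (chain (Tet.tetra T (# 2) (# 1) (# 0) (# 3) refl)) n₂ n₃′)))
      cases false true true n₁ n₁′ n₂ n₂′ n₃ n₃′ = sum₃ (θ-right {H₁} n₁ n₁′) (θ-left {H₂} n₂ n₂′) (θ-none {H₃} n₃ n₃′)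
        (sum₂₁ (le {H₂} {H₁} (pair-triangle H₂ H₁ v≢w xw≢ xv≢ (chain (Tet.tetra T (# 2) (# 3) (# 0) (# 1) refl)) n₂ n₁′)))

module Inside {n : ℕ} {s : Vec ℤ n} {F : Tournament n → ℤ} {A B : ℤ} (lip : Lipschitz s F A B)
              (T T₂ : Tournament n) (scT : score2 {n} T ≡ s) (scT₂ : score2 {n} T₂ ≡ s) where

  open Coupling lip T T₂ A scT scT₂

  rot : ∀ (u v w : V n) → T ⟲ tr u v w ≡ T ⟲ tr v w u
  rot u v w = ⟲-cong T {tr u v w} {tr v w u} (λ e → trans (tr-swap₁₂ u v w e) (tr-swap₂₃ v u w e))

  loopsAt : V n → V n → V n → ℤ
  loopsAt u v w = twice (θ (κ u v)) + twice (θ (κ u w))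

  -- All generators on the three indices: the flipped triangle itself, the three triangles with one
  -- vertex replaced by its opposite, and the six clovers with their multiplicity.
  total : V n → V n → V n → ℤ
  total u v w = θ (tr u v w) + (θ (tr v w (bar u)) + θ (tr w u (bar v)) + θ (tr u v (bar w)))
              + (loopsAt u v w + loopsAt v w u + loopsAt w u v)

  total-rot : ∀ u v w → total u v w ≡ total v w u
  total-rot u v w = cong₂ _+_ (cong₂ _+_ (θ-respects {tr u v w} {tr v w u} (λ e → trans (tr-swap₁₂ u v w e) (tr-swap₂₃ v u w e)))
    (identity (θ (tr v w (bar u))) (θ (tr w u (bar v))) (θ (tr u v (bar w)))))
    (identity (loopsAt u v w) (loopsAt v w u) (loopsAt w u v))
    where identity : ∀ a b c → a + b + c ≡ b + c + a
          identity = solve-∀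

  module At (u v w : V n) (u≢v : ix u ≢ ix v) (v≢w : ix v ≢ ix w) (u≢w : ix u ≢ ix w)
            (T₂≡ : T₂ ≡ T ⟲ tr u v w) (uv : τ T u v ≡ true) (vw : τ T v w ≡ true) (wu : τ T w u ≡ true) where

    module U′ = Vertex lip T T₂ scT scT₂ u v w u≢v v≢w u≢w (trans T₂≡ (rot u v w)) vw wu uv
    module V′ = Vertex lip T T₂ scT scT₂ v w u v≢w (u≢w ∘ sym) (u≢v ∘ sym) (trans T₂≡ (trans (rot u v w) (rot v w u))) wu uv vw
    module W′ = Vertex lip T T₂ scT scT₂ w u v (u≢w ∘ sym) u≢v (v≢w ∘ sym) T₂≡ uv vw wu

    x y z : Bool
    x = τ T u (bar v)
    y = τ T v (bar w)
    z = τ T w (bar u)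

    neutral₀ : neut T (tr u v w) ≡ true
    neutral₀ = neutral-bits T (apart u≢v , apart v≢w , apart u≢w) uv vw wu

    private
      G : List (Edge n)
      G = tr u v w

      flat : ∀ g {x z : Bool} → x ≡ z → same g z ∧ same z (not x) ≡ false
      flat true  {true}  refl = refl
      flat true  {false} refl = refl
      flat false {true}  refl = refl
      flat false {false} refl = refl

      bits : ∀ g {x z x′ z′ : Bool} → x ≡ x′ → z ≡ z′ → same g z ∧ same z (not x) ≡ same g z′ ∧ same z′ (not x′)
      bits g refl refl = refl

    -- With equal bits, none of the sign-changed triangles is neutral in either tournament and the
    -- clovers balance at each vertex, so the move along the edge keeps its full gain.
    calm : x ≡ y → y ≡ z → total u v w ≤ - (F T - F T₂ + A)
    calm xy yz = ℤₚ.≤-trans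
      (ℤₚ.+-mono-≤ (ℤₚ.≤-reflexive (cong₂ _+_ (θ-self G T₂≡ neutral₀) (cong₂ _+_ (cong₂ _+_
          (θ-none {tr v w (bar u)} (trans U′.Ū₁ (flat true (trans xy yz))) (trans U′.Ū₂ (flat false (trans xy yz))))
          (θ-none {tr w u (bar v)} (trans V′.Ū₁ (flat true (sym xy))) (trans V′.Ū₂ (flat false (sym xy)))))
          (θ-none {tr u v (bar w)} (trans W′.Ū₁ (flat true (sym yz))) (trans W′.Ū₂ (flat false (sym yz)))))))
        (ℤₚ.+-mono-≤ (ℤₚ.+-mono-≤ (U′.loops-balanced (trans xy yz)) (V′.loops-balanced (sym xy))) (W′.loops-balanced (sym yz))))
      (ℤₚ.≤-reflexive (identity (- (F T - F T₂ + A))))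
      where identity : ∀ p → p + (0ℤ + 0ℤ + 0ℤ) + (0ℤ + 0ℤ + 0ℤ) ≡ p
            identity = solve-∀

    -- The four moves of a crystal around the edge (T , T₂) are matched across its double edges.
    crystal : x ≡ false → z ≡ true → total u v w ≤ twice (twice (B - A))
    crystal px pz = go y refl
      where
      θG : θ G ≡ α G - β G
      θG = θ-eval {G} neutral₀ (neutral-back G T₂≡)
      Ū₁ : neut T (tr v w (bar u)) ≡ true
      Ū₁ = trans U′.Ū₁ (bits true px pz)
      θŪ : θ (tr v w (bar u)) ≡ α (tr v w (bar u))
      θŪ = θ-left {tr v w (bar u)} Ū₁ (trans U′.Ū₂ (bits false px pz))
      outer₂ : neut T₂ U′.outer ≡ true
      outer₂ = proj₂ (U′.loops-lose px pz)
      -- The two copies of the neutral clover of T (value aK) are matched with bG and bV, those of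
      -- T₂ (value bK) with aU and aG. Every match ends on a double edge, whence four times D = B -
      -- A.
      arithmetic : ∀ {aG bG aU bV aK bK l D : ℤ} → aK ≤ bG + D → aK ≤ bV + D → aU ≤ bK + D → aG ≤ bK + D → l ≤ 0ℤ →
                   (aG - bG) + (aU + - bV + 0ℤ) + (- twice bK + twice aK + l) ≤ twice (twice D)
      arithmetic {aG} {bG} {aU} {bV} {aK} {bK} {l} {D} p q r t e =
        ≤-slack ((bG + D - aK) + (bV + D - aK) + (bK + D - aU) + (bK + D - aG) + (0ℤ - l))
          (0≤+ (0≤+ (0≤+ (0≤+ (gap p) (gap q)) (gap r)) (gap t)) (gap e)) (identity aG bG aU bV aK bK l D)
        where identity : ∀ aG bG aU bV aK bK l D → (aG - bG) + (aU + - bV + 0ℤ) + (- (bK + bK) + (aK + aK) + l)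
                           + ((bG + D - aK) + (bV + D - aK) + (bK + D - aU) + (bK + D - aG) + (0ℤ - l)) ≡ (D + D) + (D + D)
              identity = solve-∀
      -- Since u loses, exactly one other vertex wins: v if y is true, w if y is false. The
      -- remaining vertex sees equal bits and is balanced.
      go : ∀ b → y ≡ b → total u v w ≤ twice (twice (B - A))
      go true py = ℤₚ.≤-trans
        (ℤₚ.≤-reflexive (cong₂ _+_ (cong₂ _+_ θG (cong₂ _+_ (cong₂ _+_ θŪ θV̄) θW̄))
          (cong₂ _+_ (cong₂ _+_ (proj₁ (U′.loops-lose px pz)) (proj₁ win)) refl)))
        (arithmetic {bK = β U′.outer} (V′.inner≤G G T₂≡ (proj₂ win)) (V′.inner≤Ū (proj₂ win) V̄₂) (U′.Ū≤outer Ū₁ outer₂)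
                    (U′.G≤outer G T₂≡ neutral₀ outer₂) (W′.loops-balanced (trans pz (sym py))))
        where
        V̄₂ : neut T₂ (tr w u (bar v)) ≡ true
        V̄₂ = trans V′.Ū₂ (bits false py px)
        θV̄ : θ (tr w u (bar v)) ≡ - β (tr w u (bar v))
        θV̄ = θ-right {tr w u (bar v)} (trans V′.Ū₁ (bits true py px)) V̄₂
        θW̄ : θ (tr u v (bar w)) ≡ 0ℤ
        θW̄ = θ-none {tr u v (bar w)} (trans W′.Ū₁ (bits true pz py)) (trans W′.Ū₂ (bits false pz py))
        win = V′.loops-win py px
      go false py = ℤₚ.≤-trans
        (ℤₚ.≤-reflexive (trans (cong₂ _+_ (cong₂ _+_ θG (cong₂ _+_ (cong₂ _+_ θŪ θV̄) θW̄))
          (cong₂ _+_ (cong₂ _+_ (proj₁ (U′.loops-lose px pz)) refl) (proj₁ win)))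
          (reorder (α G - β G) (α (tr v w (bar u))) (- β (tr u v (bar w))) (- twice (β U′.outer)) V′.loops (twice (α W′.inner)))))
        (arithmetic {bK = β U′.outer} (W′.inner≤G G T₂≡ (proj₂ win)) (W′.inner≤Ū (proj₂ win) W̄₂) (U′.Ū≤outer Ū₁ outer₂)
                    (U′.G≤outer G T₂≡ neutral₀ outer₂) (V′.loops-balanced (trans py (sym px))))
        where
        W̄₂ : neut T₂ (tr u v (bar w)) ≡ true
        W̄₂ = trans W′.Ū₂ (bits false pz py)
        θV̄ : θ (tr w u (bar v)) ≡ 0ℤ
        θV̄ = θ-none {tr w u (bar v)} (trans V′.Ū₁ (bits true py px)) (trans V′.Ū₂ (bits false py px))
        θW̄ : θ (tr u v (bar w)) ≡ - β (tr u v (bar w))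
        θW̄ = θ-right {tr u v (bar w)} (trans W′.Ū₁ (bits true pz py)) W̄₂
        win = W′.loops-win pz py
        reorder : ∀ a b c d e f → a + (b + 0ℤ + c) + (d + e + f) ≡ a + (b + c + 0ℤ) + (d + f + e)
        reorder = solve-∀

module _ {n : ℕ} where

  loop-≢ : ∀ {a b c : V n} → ix b ≢ ix c → ed a (bar a) ≢ ed b c
  loop-≢ {a} {b} {c} ne eq with ix b Finₚ.≟ ix a
  ... | no b≢a   = apart-by (apart ne) (bar-≢ a) b≢a b≢a (sym eq)
  ... | yes refl = apart-byʳ (apart ne) (bar-≢ a) (ne ∘ sym) (ne ∘ sym) (sym eq)

  ed-bar₁ : ∀ (u v : V n) → ed (bar u) v ≡ ed u (bar v)
  ed-bar₁ u v = trans (sym (ed-bar (bar u) v)) (cong (λ x → ed x (bar v)) (bar-bar u))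

  bar-distinct : ∀ {a b : V n} → ix a ≢ ix b → Distinct a b (bar a)
  bar-distinct {a} ne = apart ne , apart (ne ∘ sym) , bar-≢ a

-- Adding up the matches over all generators

module Far {n : ℕ} {s : Vec ℤ n} {F : Tournament n → ℤ} {A B : ℤ} (lip : Lipschitz s F A B)
           (T T₂ : Tournament n) (W : ℤ) (scT : score2 {n} T ≡ s) (scT₂ : score2 {n} T₂ ≡ s)
           (g₁ g₂ g₃ : V n) (g : Distinct g₁ g₂ g₃) (T₂≡ : T₂ ≡ T ⟲ tr g₁ g₂ g₃)
           (lip₀ : ∀ (T′ : Tournament n) → score2 {n} T′ ≡ s → score2 {n} (T′ ⟲ tr g₁ g₂ g₃) ≡ s → F T′ - F (T′ ⟲ tr g₁ g₂ g₃) ≤ W) where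

  open Coupling lip T T₂ W scT scT₂ public
  open Shapes θ θ-respects public

  Out : Fin n → Set
  Out l = l ≢ ix g₁ × l ≢ ix g₂ × l ≢ ix g₃

  outˡ : ∀ {x y : V n} → x ≢ y → Out (ix x) → (ed x y ∈E tr g₁ g₂ g₃) ≡ false
  outˡ ne (o₁ , o₂ , o₃) = let g₁₂ , g₂₃ , g₁₃ = g in
    ∉tr (apart-by ne g₁₂ o₁ o₂) (apart-by ne g₂₃ o₂ o₃) (apart-by ne g₁₃ o₁ o₃)

  outʳ : ∀ {x y : V n} → x ≢ y → Out (ix y) → (ed x y ∈E tr g₁ g₂ g₃) ≡ false
  outʳ {x} {y} ne o = trans (cong (_∈E tr g₁ g₂ g₃) (ed-sym x y)) (outˡ (ne ∘ sym) o)

  disjoint : ∀ {a b c : V n} → Distinct a b c → (ed a b ∈E tr g₁ g₂ g₃) ≡ false →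
             (ed b c ∈E tr g₁ g₂ g₃) ≡ false → (ed a c ∈E tr g₁ g₂ g₃) ≡ false → θ (tr a b c) ≤ 0ℤ
  disjoint = θ-disjoint (tr g₁ g₂ g₃) T₂≡ lip₀

  -- The games at x involve an index foreign to the edge's generator, so only the game between a and
  -- b could be shared with it.
  hanging : ∀ {a b x : V n} → Distinct a b x → (ed a b ∈E tr g₁ g₂ g₃) ≡ false → Out (ix x) → θ (tr a b x) ≤ 0ℤ
  hanging D@(_ , b≢x , a≢x) ab o = disjoint D ab (outʳ b≢x o) (outʳ a≢x o)

  far : ∀ {a x y : V n} → Distinct a x y → Out (ix x) → Out (ix y) → θ (tr a x y) ≤ 0ℤ
  far D@(a≢x , x≢y , a≢y) ox oy = hanging D (outʳ a≢x ox) oy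

  four≤0 : ∀ {a b c d} → a ≤ 0ℤ → b ≤ 0ℤ → c ≤ 0ℤ → d ≤ 0ℤ → a + b + c + d ≤ 0ℤ
  four≤0 p q r t = ℤₚ.+-mono-≤ (ℤₚ.+-mono-≤ (ℤₚ.+-mono-≤ p q) r) t

  twice≤0 : ∀ {a} → a ≤ 0ℤ → twice a ≤ 0ℤ
  twice≤0 p = ℤₚ.+-mono-≤ p p

  far-triangles : ∀ {p l m : Fin n} → p ≢ l → l ≢ m → p ≢ m → Out l → Out m → triangles p l m ≤ 0ℤ
  far-triangles {p} {l} {m} p≢l l≢m p≢m ol om = four≤0
    (far (apart p≢l , apart l≢m , apart p≢m) ol om) (far (apart p≢l , apart l≢m , apart p≢m) ol om)
    (far (apart p≢l , apart l≢m , apart p≢m) ol om) (far (apart p≢l , apart l≢m , apart p≢m) ol om)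

  far-loop : ∀ (x u : V n) → ix x ≢ ix u → Out (ix x) → θ (tr x u (bar x)) ≤ 0ℤ
  far-loop x u ne ox = subst (_≤ 0ℤ) (θ-swap₁₂ u x (bar x)) (far (apart (ne ∘ sym) , bar-≢ x , apart (ne ∘ sym)) ox ox)

  far-clovers : ∀ {l m : Fin n} → l ≢ m → Out l → Out m → clovers l m ≤ 0ℤ
  far-clovers {l} {m} ne ol om = ℤₚ.+-mono-≤ (twice≤0 (far-loop (l , true) (m , true) ne ol))
                                             (twice≤0 (far-loop (m , true) (l , true) (ne ∘ sym) om))

module TriangleStep {n : ℕ} {s : Vec ℤ n} {F : Tournament n → ℤ} {A B : ℤ} (lip : Lipschitz s F A B)
                    (T : Tournament n) (u v w : V n) (u≢v : ix u ≢ ix v) (v≢w : ix v ≢ ix w) (u≢w : ix u ≢ ix w)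
                    (scT : score2 {n} T ≡ s) (scT₂ : score2 {n} (T ⟲ tr u v w) ≡ s)
                    (uv : τ T u v ≡ true) (vw : τ T v w ≡ true) (wu : τ T w u ≡ true) where

  T₂ : Tournament n
  T₂ = T ⟲ tr u v w

  open Far lip T T₂ A scT scT₂ u v w (apart u≢v , apart v≢w , apart u≢w) refl
           (λ T′ → Lipschitz.triangle lip T′ u v w u≢v v≢w u≢w) public
  open Inside lip T T₂ scT scT₂ using (total; module At) public

  private
    sign-uv : (ed u (bar v) ∈E tr u v w) ≡ false
    sign-uv = ∉tr (apart-by-sign u≢v) (apart-by (apart u≢v) (apart v≢w) u≢v u≢w)
                  (apart-byʳ (apart u≢v) (apart u≢w) (u≢v ∘ sym) v≢w)
    sign-vw : (ed v (bar w) ∈E tr u v w) ≡ false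
    sign-vw = ∉tr (apart-byʳ (apart v≢w) (apart u≢v) (u≢w ∘ sym) (v≢w ∘ sym)) (apart-by-sign v≢w)
                  (apart-by (apart v≢w) (apart u≢w) (u≢v ∘ sym) v≢w)
    sign-uw : (ed u (bar w) ∈E tr u v w) ≡ false
    sign-uw = ∉tr (apart-byʳ (apart u≢w) (apart u≢v) (u≢w ∘ sym) (v≢w ∘ sym))
                  (apart-by (apart u≢w) (apart v≢w) u≢v u≢w) (apart-by-sign u≢w)
    barˡ : ∀ (a b : V n) → (ed a (bar b) ∈E tr u v w) ≡ false → (ed (bar a) b ∈E tr u v w) ≡ false
    barˡ a b p = trans (cong (_∈E tr u v w) (ed-bar₁ a b)) p

  -- Of the twelve triangles with one new index, six are the faces of the two tetrahedra over the
  -- signed vertices of l. In each of the other six, one vertex of the flipped triangle is replaced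
  -- by its opposite, which removes the common game.
  triangles-out : ∀ l → Out l → triangles (ix u) (ix v) l + triangles (ix u) (ix w) l + triangles (ix v) (ix w) l ≤ 0ℤ
  triangles-out l o@(l≢u , l≢v , l≢w) = ℤₚ.≤-trans
    (ℤₚ.≤-reflexive (trans
      (cong₂ _+_ (cong₂ _+_ (triangles-signed u v x) (triangles-signed u w x)) (triangles-signed v w x))
      (identity (θ′ u v x) (θ′ (bar u) v x) (θ′ u (bar v) x) (θ′ u v (bar x))
                (θ′ u w x) (θ′ (bar u) w x) (θ′ u (bar w) x) (θ′ u w (bar x))
                (θ′ v w x) (θ′ (bar v) w x) (θ′ v (bar w) x) (θ′ v w (bar x)))))
    (ℤₚ.+-mono-≤ (ℤₚ.+-mono-≤ (outside true) (outside false)) (ℤₚ.+-mono-≤ (ℤₚ.+-mono-≤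
      (ℤₚ.+-mono-≤ (hang u≢v l≢u l≢v (barˡ u v sign-uv)) (hang u≢v l≢u l≢v sign-uv))
      (ℤₚ.+-mono-≤ (hang u≢w l≢u l≢w (barˡ u w sign-uw)) (hang u≢w l≢u l≢w sign-uw)))
      (ℤₚ.+-mono-≤ (hang v≢w l≢v l≢w (barˡ v w sign-vw)) (hang v≢w l≢v l≢w sign-vw))))
    where
    x : V n
    x = l , true
    outside : ∀ b → θ (tr u v (l , b)) + θ (tr u w (l , b)) + θ (tr v w (l , b)) ≤ 0ℤ
    outside b = Outside.outside≤0 lip T T₂ scT scT₂ u v w u≢v v≢w u≢w refl uv vw wu (l , b) l≢u l≢v l≢w
    hang : ∀ {a b : V n} → ix a ≢ ix b → l ≢ ix a → l ≢ ix b → (ed a b ∈E tr u v w) ≡ false → θ (tr a b x) ≤ 0ℤ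
    hang ne la lb ab = hanging (apart ne , apart (lb ∘ sym) , apart (la ∘ sym)) ab o
    identity : ∀ a₁ a₂ a₃ a₄ b₁ b₂ b₃ b₄ c₁ c₂ c₃ c₄ →
      (a₁ + a₂ + a₃ + a₄) + (b₁ + b₂ + b₃ + b₄) + (c₁ + c₂ + c₃ + c₄) ≡
      ((a₁ + b₁ + c₁) + (a₄ + b₄ + c₄)) + (((a₂ + a₃) + (b₂ + b₃)) + (c₂ + c₃))
    identity = solve-∀

  clovers-out : ∀ (a : V n) l → ix a ≢ l → Out l → clovers (ix a) l ≤ 0ℤ
  clovers-out a l ne o = subst (_≤ 0ℤ) (sym (clovers-signed a x)) (ℤₚ.+-mono-≤
    (twice≤0 (disjoint (bar-distinct ne) (outʳ (apart ne) o) (outˡ (apart (ne ∘ sym)) o)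
                       (∉tr (loop-≢ u≢v) (loop-≢ v≢w) (loop-≢ u≢w))))
    (twice≤0 (far-loop x a (ne ∘ sym) o)))
    where
    x : V n
    x = l , true

  total-shapes : triangles (ix u) (ix v) (ix w) + (clovers (ix u) (ix v) + clovers (ix u) (ix w) + clovers (ix v) (ix w)) ≡ total u v w
  total-shapes = trans
    (cong₂ _+_ (triangles-signed u v w) (cong₂ _+_ (cong₂ _+_ (clovers-signed u v) (clovers-signed u w)) (clovers-signed v w)))
    (trans (cong₂ _+_
      (cong₂ (λ a b → θ′ u v w + a + b + θ′ u v (bar w)) (θ-rot (bar u) v w) (θ-swap₂₁₃ u (bar v) w))
      (cong₂ _+_ (cong₂ _+_ (cong₂ _+_ (clover u v) (clover v u)) (cong₂ _+_ (clover u w) (clover w u))) (cong₂ _+_ (clover v w) (clover w v))))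
    (identity (θ (tr u v w)) (θ (tr v w (bar u))) (θ (tr w u (bar v))) (θ (tr u v (bar w)))
              (twice (θ (κ u v))) (twice (θ (κ v u))) (twice (θ (κ u w))) (twice (θ (κ w u))) (twice (θ (κ v w))) (twice (θ (κ w v)))))
    where
    θ-swap₂₁₃ : ∀ a b c → θ′ a b c ≡ θ′ c a b
    θ-swap₂₁₃ a b c = trans (θ-rot a b c) (θ-rot b c a)
    clover : ∀ a b → twice (θ′ a b (bar a)) ≡ twice (θ (κ a b))
    clover a b = cong twice (θ-swap₁₂ a b (bar a))
    identity : ∀ t a b c uv vu uw wu vw wv → (t + a + b + c) + ((uv + vu) + (uw + wu) + (vw + wv)) ≡
               t + (a + b + c) + ((uv + uw) + (vw + vu) + (wu + wv))
    identity = solve-∀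

  -- With the three indices at the front, the terms with one new index are nonpositive by
  -- `triangles-out` and `clovers-out`; those with at least two new indices share no game with the
  -- edge.
  shapes≤total : ∑ (genShapes n) weighted ≤ total u v w
  shapes≤total with extract (∈ₚ.∈-allFin (ix u))
  ... | L₁ , p₁ with ∈-tail p₁ (ix v) (u≢v ∘ sym)
  ... | v∈ with extract v∈
  ... | L₂ , p₂ with ∈-tail (Perm.trans p₁ (prep _ p₂)) (ix w) (u≢w ∘ sym)
  ... | here eq = contradiction (sym eq) v≢w
  ... | there w∈ with extract w∈
  ... | R , p₃ = begin
    ∑ (genShapes n) weighted
      ≡⟨ ∑-shapes ⟩
    triples (allFin n) triangles + pairs (allFin n) clovers
      ≡⟨ cong₂ _+_ (triples-↭ triangles triangles-swap₁₂ triangles-swap₂₃ perm) (pairs-↭ clovers clovers-sym perm) ⟩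
    triples (i ∷ j ∷ k ∷ R) triangles + pairs (i ∷ j ∷ k ∷ R) clovers
      ≡⟨ identity (t i j k) (∑ R (t i j)) (∑ R (t i k)) (pairs R (t i)) (∑ R (t j k)) (pairs R (t j)) (pairs R (t k)) (triples R t)
                  (c i j) (c i k) (∑ R (c i)) (c j k) (∑ R (c j)) (∑ R (c k)) (pairs R c) ⟩
    (t i j k + (c i j + c i k + c j k)) + ((∑ R (t i j) + ∑ R (t i k) + ∑ R (t j k)) +
      (pairs R (t i) + pairs R (t j) + pairs R (t k) + triples R t) + (∑ R (c i) + ∑ R (c j) + ∑ R (c k) + pairs R c))
      ≤⟨ ℤₚ.+-mono-≤ (ℤₚ.≤-reflexive total-shapes) (ℤₚ.+-mono-≤ (ℤₚ.+-mono-≤ middle (four≤0 (spread i i∉) (spread j j∉) (spread k k∉) apartAll))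
           (four≤0 (∑-≤0 R (λ l∈ → clovers-out u _ (i∉ l∈) (out l∈))) (∑-≤0 R (λ l∈ → clovers-out v _ (j∉ l∈) (out l∈)))
                   (∑-≤0 R (λ l∈ → clovers-out w _ (k∉ l∈) (out l∈))) (pairs-≤0 R uniqueR (λ l∈ m∈ ne → far-clovers ne (out l∈) (out m∈))))) ⟩
    total u v w + 0ℤ ≡⟨ ℤₚ.+-identityʳ _ ⟩
    total u v w ∎
    where
    open ℤₚ.≤-Reasoning
    i j k : Fin n
    i = ix u
    j = ix v
    k = ix w
    t : Fin n → Fin n → Fin n → ℤ
    t = triangles
    c : Fin n → Fin n → ℤ
    c = clovers
    perm : allFin n ↭ i ∷ j ∷ k ∷ R
    perm = Perm.trans p₁ (prep _ (Perm.trans p₂ (prep _ p₃)))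
    unique : Unique (i ∷ j ∷ k ∷ R)
    unique = Unique-↭ perm (Uniqueₚ.allFin⁺ n)
    uniqueR : Unique R
    uniqueR = unique-drop (unique-drop (unique-drop unique))
    i∉ : ∀ {l} → l ∈ R → i ≢ l
    i∉ l∈ = unique-head unique (there (there l∈))
    j∉ : ∀ {l} → l ∈ R → j ≢ l
    j∉ l∈ = unique-head (unique-drop unique) (there l∈)
    k∉ : ∀ {l} → l ∈ R → k ≢ l
    k∉ l∈ = unique-head (unique-drop (unique-drop unique)) l∈
    out : ∀ {l} → l ∈ R → Out l
    out l∈ = i∉ l∈ ∘ sym , j∉ l∈ ∘ sym , k∉ l∈ ∘ sym
    middle : ∑ R (t i j) + ∑ R (t i k) + ∑ R (t j k) ≤ 0ℤ
    middle = subst (_≤ 0ℤ)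
      (trans (∑-+ R (λ l → t i j l + t i k l) (t j k)) (cong (λ q → q + ∑ R (t j k)) (∑-+ R (t i j) (t i k))))
      (∑-≤0 R (λ {l} l∈ → triangles-out l (out l∈)))
    spread : ∀ p → (∀ {l} → l ∈ R → p ≢ l) → pairs R (t p) ≤ 0ℤ
    spread p p∉ = pairs-≤0 R uniqueR (λ l∈ m∈ ne → far-triangles (p∉ l∈) ne (p∉ m∈) (out l∈) (out m∈))
    apartAll : triples R t ≤ 0ℤ
    apartAll = triples-≤0 R uniqueR (λ _ l∈ m∈ a b c → far-triangles a c b (out l∈) (out m∈))
    identity : ∀ tijk tij tik ti tjk tj tk t₀ cij cik ci cjk cj ck c₀ →
      ((tijk + tij) + (tik + ti)) + ((tjk + tj) + (tk + t₀)) + ((cij + (cik + ci)) + ((cjk + cj) + (ck + c₀))) ≡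
      (tijk + (cij + cik + cjk)) + ((tij + tik + tjk) + (ti + tj + tk + t₀) + (ci + cj + ck + c₀))
    identity = solve-∀

-- One half of the games between {u , ū} and {ν , x}, with one of the two copies of the clover κ u x; ν runs over v and v̄.
module HalfClover {n : ℕ} {s : Vec ℤ n} {F : Tournament n → ℤ} {A B : ℤ} (lip : Lipschitz s F A B)
                  (T T₂ : Tournament n) (scT : score2 {n} T ≡ s) (scT₂ : score2 {n} T₂ ≡ s)
                  (u ν x : V n) (u≢ν : ix u ≢ ix ν) (x≢u : ix x ≢ ix u) (x≢ν : ix x ≢ ix ν)
                  (T₂≡ : T₂ ≡ T ⟲ κ u ν) (uν : τ T u ν ≡ true) (νū : τ T ν (bar u) ≡ true) (ūu : τ T (bar u) u ≡ true) where

  open Coupling lip T T₂ B scT scT₂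

  p q : Bool
  p = τ T u x
  q = τ T u (bar x)

  private
    module Tet = Tetrahedron {a = ν} {x} {u} {bar u} (apart (x≢ν ∘ sym)) (apart (u≢ν ∘ sym)) (apart (u≢ν ∘ sym))
                             (apart x≢u) (apart x≢u) (bar-≢ u)
    G : List (Edge n)
    G = κ u ν

    chain : ∀ {S S₁ S₂ : List (Edge n)} → T ⟲ S ⟲ S₁ ≡ T ⟲ G ⟲ S₂ → T ⟲ S ⟲ S₁ ≡ T₂ ⟲ S₂
    chain {S₂ = S₂} eq = trans eq (cong (_⟲ S₂) (sym T₂≡))

    out : ∀ (y : V n) → x ≢ y → (ed x y ∈E G) ≡ false
    out y ne = ∉tr (apart-by ne (apart (u≢ν ∘ sym)) x≢ν x≢u) (apart-by ne (bar-≢ u) x≢u x≢u)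
                   (apart-by ne (apart (u≢ν ∘ sym)) x≢ν x≢u)

    T₂-in : ∀ {b c : V n} {y} → b ≢ c → (ed b c ∈E G) ≡ true → τ T b c ≡ y → τ T₂ b c ≡ not y
    T₂-in ne i eq rewrite T₂≡ = trans (τ-in T G ne i) (cong not eq)

    T₂-out : ∀ (c : V n) {y} → x ≢ c → τ T x c ≡ y → τ T₂ x c ≡ y
    T₂-out c ne eq rewrite T₂≡ = trans (τ-out T G ne (out c ne)) eq

    opposite : ∀ (T : Tournament n) {a c : V n} {y} → a ≢ c → τ T a c ≡ y → τ T c a ≡ not y
    opposite T ne eq = trans (τ-swap T ne) (cong not eq)

    H₁ H₂ H₃ : List (Edge n)
    H₁ = tr ν x u
    H₂ = tr ν x (bar u)
    H₃ = κ u x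

    D₁ : Distinct ν x u
    D₁ = apart (x≢ν ∘ sym) , apart x≢u , apart (u≢ν ∘ sym)
    D₂ : Distinct ν x (bar u)
    D₂ = apart (x≢ν ∘ sym) , apart x≢u , apart (u≢ν ∘ sym)
    D₃ : Distinct x u (bar u)
    D₃ = apart x≢u , bar-≢ u , apart x≢u

    r : Bool
    r = τ T ν x

    xu : τ T x u ≡ not p
    xu = τ-swap T (apart (x≢u ∘ sym))
    xū : τ T x (bar u) ≡ q
    xū = trans (sym (τ-mirror T (apart x≢u))) (cong (λ y → τ T y (bar x)) (bar-bar u))
    ūν : τ T (bar u) ν ≡ false
    ūν = opposite T (apart (u≢ν ∘ sym)) νū
    uū : τ T u (bar u) ≡ false
    uū = opposite T (bar-≢ u ∘ sym) ūu
    ūx : τ T (bar u) x ≡ not q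
    ūx = opposite T (apart x≢u) xū
    νx₂ : τ T₂ ν x ≡ r
    νx₂ = trans (opposite T₂ (apart x≢ν) (T₂-out ν (apart x≢ν) (opposite T (apart (x≢ν ∘ sym)) refl))) (𝔹ₚ.not-involutive r)
    xu₂ : τ T₂ x u ≡ not p
    xu₂ = T₂-out u (apart x≢u) xu
    xū₂ : τ T₂ x (bar u) ≡ q
    xū₂ = T₂-out (bar u) (apart x≢u) xū
    ūx₂ : τ T₂ (bar u) x ≡ not q
    ūx₂ = opposite T₂ (apart x≢u) xū₂
    uν₂ : τ T₂ u ν ≡ false
    uν₂ = opposite T₂ (apart (u≢ν ∘ sym)) (T₂-in (apart (u≢ν ∘ sym)) (∈tr₁ ν u (bar u)) (opposite T (apart u≢ν) uν))
    ūν₂ : τ T₂ (bar u) ν ≡ true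
    ūν₂ = opposite T₂ (apart (u≢ν ∘ sym)) (T₂-in (apart (u≢ν ∘ sym)) (∈tr₃ ν u (bar u)) νū)
    uū₂ : τ T₂ u (bar u) ≡ true
    uū₂ = T₂-in (bar-≢ u) (∈tr₂ ν u (bar u)) uū

    cancel : ∀ y → y + (B - B) ≡ y + 0ℤ
    cancel y = cong (λ z → y + z) (ℤₚ.+-inverseʳ B)

    sum₃ : ∀ {x₁ x₂ x₃ y₁ y₂ y₃ g g′} → x₁ ≡ y₁ → x₂ ≡ y₂ → x₃ ≡ y₃ → g ≡ g′ → y₁ + y₂ + y₃ ≤ g′ → x₁ + x₂ + x₃ ≤ g
    sum₃ refl refl refl refl p = p

    sum₁₂ : ∀ {a b D} → a ≤ b + D → a + - b + 0ℤ ≤ D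
    sum₁₂ {a} {b} {D} le = ≤-slack (b + D - a) (gap le) (identity a b D)
      where identity : ∀ p q D → p + - q + 0ℤ + (q + D - p) ≡ D
            identity = solve-∀
    sum₂₁ : ∀ {a b D} → a ≤ b + D → - b + a + 0ℤ ≤ D
    sum₂₁ {a} {b} {D} le = ≤-slack (b + D - a) (gap le) (identity a b D)
      where identity : ∀ p q D → - q + p + 0ℤ + (q + D - p) ≡ D
            identity = solve-∀
    sum₁₃ : ∀ {a b D} → a ≤ b + D → a + 0ℤ + - b ≤ D
    sum₁₃ {a} {b} {D} le = ≤-slack (b + D - a) (gap le) (identity a b D)
      where identity : ∀ p q D → p + 0ℤ + - q + (q + D - p) ≡ D
            identity = solve-∀
    sum₂₃ : ∀ {a b D} → a ≤ b + D → 0ℤ + a + - b ≤ D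
    sum₂₃ {a} {b} {D} le = ≤-slack (b + D - a) (gap le) (identity a b D)
      where identity : ∀ p q D → 0ℤ + p + - q + (q + D - p) ≡ D
            identity = solve-∀
    sum₃₁ : ∀ {a b D} → a ≤ b + D → - b + 0ℤ + a ≤ D
    sum₃₁ {a} {b} {D} le = ≤-slack (b + D - a) (gap le) (identity a b D)
      where identity : ∀ p q D → - q + 0ℤ + p + (q + D - p) ≡ D
            identity = solve-∀
    sum₃₂ : ∀ {a b D} → a ≤ b + D → 0ℤ + - b + a ≤ D
    sum₃₂ {a} {b} {D} le = ≤-slack (b + D - a) (gap le) (identity a b D)
      where identity : ∀ p q D → 0ℤ + - q + p + (q + D - p) ≡ D
            identity = solve-∀

    level : ∀ {H H′ : List (Edge n)} → α H ≤ β H′ + (B - B) → α H ≤ β H′ + 0ℤ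
    level {H} {H′} = subst (α H ≤_) (cancel (β H′))

  -- If p = q, the clover `κ u x` is neutral on one side and one of the two triangles on the other.
  -- They are matched across the other triangle, an edge with the larger constant A, at the price A
  -- - B. If p ≠ q, either nothing is neutral or the two triangles are matched across the clover for
  -- free.
  half≤ : θ (tr ν x u) + θ (tr ν x (bar u)) + θ (κ u x) ≤ gate (same p q) (A - B)
  half≤ = cases p q r refl refl n₁ n₁₂ n₂ n₂₂ n₃ n₃₂
    where
    n₁ : neut T H₁ ≡ same r (not p) ∧ same (not p) true
    n₁ = neutral-bits T D₁ refl xu uν
    n₁₂ : neut T₂ H₁ ≡ same r (not p) ∧ same (not p) false
    n₁₂ = neutral-bits T₂ D₁ νx₂ xu₂ uν₂
    n₂ : neut T H₂ ≡ same r q ∧ same q false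
    n₂ = neutral-bits T D₂ refl xū ūν
    n₂₂ : neut T₂ H₂ ≡ same r q ∧ same q true
    n₂₂ = neutral-bits T₂ D₂ νx₂ xū₂ ūν₂
    n₃ : neut T H₃ ≡ same (not p) false ∧ same false (not q)
    n₃ = neutral-bits T D₃ xu uū ūx
    n₃₂ : neut T₂ H₃ ≡ same (not p) true ∧ same true (not q)
    n₃₂ = neutral-bits T₂ D₃ xu₂ uū₂ ūx₂
    grade : ∀ {p′ q′} → p ≡ p′ → q ≡ q′ → gate (same p q) (A - B) ≡ gate (same p′ q′) (A - B)
    grade = cong₂ (λ a b → gate (same a b) (A - B))
    cases : ∀ p′ q′ r → p ≡ p′ → q ≡ q′ →
      neut T H₁ ≡ same r (not p′) ∧ same (not p′) true → neut T₂ H₁ ≡ same r (not p′) ∧ same (not p′) false →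
      neut T H₂ ≡ same r q′ ∧ same q′ false → neut T₂ H₂ ≡ same r q′ ∧ same q′ true →
      neut T H₃ ≡ same (not p′) false ∧ same false (not q′) → neut T₂ H₃ ≡ same (not p′) true ∧ same true (not q′) →
      θ H₁ + θ H₂ + θ H₃ ≤ gate (same p q) (A - B)
    cases true true true pp pq n₁ n₁′ n₂ n₂′ n₃ n₃′ =
      sum₃ (θ-none {H₁} n₁ n₁′) (θ-right {H₂} n₂ n₂′) (θ-left {H₃} n₃ n₃′) (grade pp pq)
        (sum₃₂ {b = β H₂} (pair-triangle H₃ H₂ (x≢ν ∘ sym) x≢u (u≢ν ∘ sym) (chain (Tet.tetra T (# 3) (# 0) (# 2) (# 1) refl)) n₃ n₂′))
    cases true true false pp pq n₁ n₁′ n₂ n₂′ n₃ n₃′ =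
      sum₃ (θ-right {H₁} n₁ n₁′) (θ-none {H₂} n₂ n₂′) (θ-left {H₃} n₃ n₃′) (grade pp pq)
        (sum₃₁ {b = β H₁} (pair-triangle H₃ H₁ (x≢ν ∘ sym) x≢u (u≢ν ∘ sym) (chain (Tet.tetra T (# 3) (# 1) (# 2) (# 0) refl)) n₃ n₁′))
    cases false false true pp pq n₁ n₁′ n₂ n₂′ n₃ n₃′ =
      sum₃ (θ-left {H₁} n₁ n₁′) (θ-none {H₂} n₂ n₂′) (θ-right {H₃} n₃ n₃′) (grade pp pq)
        (sum₁₃ (pair-triangle H₁ H₃ (x≢ν ∘ sym) x≢u (u≢ν ∘ sym) (chain (Tet.tetra T (# 0) (# 1) (# 2) (# 3) refl)) n₁ n₃′))
    cases false false false pp pq n₁ n₁′ n₂ n₂′ n₃ n₃′ =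
      sum₃ (θ-none {H₁} n₁ n₁′) (θ-left {H₂} n₂ n₂′) (θ-right {H₃} n₃ n₃′) (grade pp pq)
        (sum₂₃ (pair-triangle H₂ H₃ (x≢ν ∘ sym) x≢u (u≢ν ∘ sym) (chain (Tet.tetra T (# 1) (# 0) (# 2) (# 3) refl)) n₂ n₃′))
    cases false true true pp pq n₁ n₁′ n₂ n₂′ n₃ n₃′ =
      sum₃ (θ-left {H₁} n₁ n₁′) (θ-right {H₂} n₂ n₂′) (θ-none {H₃} n₃ n₃′) (grade pp pq)
        (sum₁₂ (level {H₁} {H₂} (pair-clover H₁ H₂ (x≢u ∘ sym) (chain (Tet.tetra T (# 0) (# 3) (# 2) (# 1) refl)) n₁ n₂′)))
    cases false true false pp pq n₁ n₁′ n₂ n₂′ n₃ n₃′ =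
      sum₃ (θ-none {H₁} n₁ n₁′) (θ-none {H₂} n₂ n₂′) (θ-none {H₃} n₃ n₃′) (grade pp pq) ℤₚ.≤-refl
    cases true false false pp pq n₁ n₁′ n₂ n₂′ n₃ n₃′ =
      sum₃ (θ-right {H₁} n₁ n₁′) (θ-left {H₂} n₂ n₂′) (θ-none {H₃} n₃ n₃′) (grade pp pq)
        (sum₂₁ {b = β H₁} (level {H₂} {H₁} (pair-clover H₂ H₁ (x≢u ∘ sym) (chain (Tet.tetra T (# 1) (# 3) (# 2) (# 0) refl)) n₂ n₁′)))
    cases true false true pp pq n₁ n₁′ n₂ n₂′ n₃ n₃′ =
      sum₃ (θ-none {H₁} n₁ n₁′) (θ-none {H₂} n₂ n₂′) (θ-none {H₃} n₃ n₃′) (grade pp pq) ℤₚ.≤-refl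

module CloverStep {n : ℕ} {s : Vec ℤ n} {F : Tournament n → ℤ} {A B : ℤ} (lip : Lipschitz s F A B)
                  (T : Tournament n) (u v : V n) (u≢v : ix u ≢ ix v)
                  (scT : score2 {n} T ≡ s) (scT₂ : score2 {n} (T ⟲ κ u v) ≡ s)
                  (uv : τ T u v ≡ true) (vū : τ T v (bar u) ≡ true) (ūu : τ T (bar u) u ≡ true) where

  T₂ : Tournament n
  T₂ = T ⟲ κ u v

  private
    D₀ : Distinct v u (bar u)
    D₀ = apart (u≢v ∘ sym) , bar-≢ u , apart (u≢v ∘ sym)

  open Far lip T T₂ B scT scT₂ v u (bar u) D₀ refl (λ T′ → Lipschitz.clover lip T′ u v u≢v) public

  -- True if u points to both signed vertices of l or to neither. These are the indices for which
  -- `CrystalCount` produces a crystal through the double edge.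
  crystalline : Fin n → Bool
  crystalline l = same (τ T u (l , true)) (τ T u (l , false))

  private
    uv̄ : τ T u (bar v) ≡ true
    uv̄ = trans (sym (τ-mirror T (apart u≢v))) (trans (cong (λ y → τ T y (bar u)) (bar-bar v)) vū)

    v̄ū : τ T (bar v) (bar u) ≡ true
    v̄ū = trans (τ-mirror T (apart u≢v)) uv

    κ-bar : ∀ e → (e ∈E κ u v) ≡ (e ∈E κ u (bar v))
    κ-bar e = begin
      e ∈E tr v u (bar u)                         ≡⟨ cong (e ∈E_) (sym (tr-bar v u (bar u))) ⟩
      e ∈E tr (bar v) (bar u) (bar (bar u))       ≡⟨ cong (λ y → e ∈E tr (bar v) (bar u) y) (bar-bar u) ⟩
      e ∈E tr (bar v) (bar u) u                   ≡⟨ tr-swap₂₃ (bar v) (bar u) u e ⟩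
      e ∈E tr (bar v) u (bar u)                   ∎
      where open ≡-Reasoning

    opposite : ∀ (T : Tournament n) {a c : V n} {y} → a ≢ c → τ T a c ≡ y → τ T c a ≡ not y
    opposite T ne eq = trans (τ-swap T ne) (cong not eq)

    Out₂ : ∀ {l} → l ≢ ix u → l ≢ ix v → Out l
    Out₂ l≢u l≢v = l≢v , l≢u , l≢u

  local : ∀ l → l ≢ ix u → l ≢ ix v →
          triangles (ix u) (ix v) l + clovers (ix u) l + clovers (ix v) l ≤ twice (gate (crystalline l) (A - B))
  local l l≢u l≢v = ℤₚ.≤-trans
    (ℤₚ.≤-reflexive (trans (cong₂ _+_ (cong₂ _+_ (triangles-signed u v x) (clovers-signed u x)) (clovers-signed v x))
      (trans (cong₂ _+_ (cong₂ _+_ (cong₂ _+_ (cong₂ _+_ (cong₂ _+_ (θ-rot u v x) (θ-rot (bar u) v x)) (θ-rot u (bar v) x)) tail)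
               (cong₂ _+_ (cong twice swap-κ) (refl {x = twice (θ′ x u (bar x))})))
               (refl {x = twice (θ′ v x (bar v)) + twice (θ′ x v (bar x))}))
        (identity (θ′ v x u) (θ′ v x (bar u)) (θ′ (bar v) x u) (θ′ (bar v) x (bar u)) (θ (κ u x)) (θ′ x u (bar x)) (θ′ v x (bar v)) (θ′ x v (bar x))))))
    (ℤₚ.≤-trans
      (ℤₚ.+-mono-≤ (ℤₚ.+-mono-≤ half-v half-v̄) (ℤₚ.+-mono-≤ (ℤₚ.+-mono-≤ (twice≤0 (far-loop x u l≢u o)) (twice≤0 loop-v)) (twice≤0 (far-loop x v l≢v o))))
      (ℤₚ.≤-reflexive (ℤₚ.+-identityʳ _)))
    where
    x : V n
    x = l , true
    o : Out l
    o = Out₂ l≢u l≢v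
    half-v : θ (tr v x u) + θ (tr v x (bar u)) + θ (κ u x) ≤ gate (crystalline l) (A - B)
    half-v = HalfClover.half≤ lip T T₂ scT scT₂ u v x u≢v l≢u l≢v refl uv vū ūu
    half-v̄ : θ (tr (bar v) x u) + θ (tr (bar v) x (bar u)) + θ (κ u x) ≤ gate (crystalline l) (A - B)
    half-v̄ = HalfClover.half≤ lip T T₂ scT scT₂ u (bar v) x u≢v l≢u l≢v (⟲-cong T {κ u v} {κ u (bar v)} κ-bar) uv̄ v̄ū ūu
    tail : θ′ u v (bar x) ≡ θ′ (bar v) x (bar u)
    tail = trans (sym (θ-bar u v (bar x))) (trans (cong (θ′ (bar u) (bar v)) (bar-bar x)) (θ-rot (bar u) (bar v) x))
    swap-κ : θ′ u x (bar u) ≡ θ (κ u x)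
    swap-κ = θ-swap₁₂ u x (bar u)
    loop-v : θ′ v x (bar v) ≤ 0ℤ
    loop-v = disjoint (bar-distinct (l≢v ∘ sym)) (outʳ (apart (l≢v ∘ sym)) o) (outˡ (apart l≢v) o)
      (∉tr (loop-≢ (u≢v ∘ sym)) (apart-by (bar-≢ v) (bar-≢ u) (u≢v ∘ sym) (u≢v ∘ sym)) (loop-≢ (u≢v ∘ sym)))
    identity : ∀ a b c d k e f g → (a + b + c + d) + ((k + k) + (e + e)) + ((f + f) + (g + g)) ≡
               ((a + b + k) + (c + d + k)) + (((e + e) + (f + f)) + (g + g))
    identity = solve-∀

  -- The clover with its loop at v is neutral on neither side, so only the flipped clover remains,
  -- with its multiplicity two.
  own : clovers (ix u) (ix v) ≡ - twice (F T - F T₂ + B)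
  own = trans (clovers-signed u v) (trans (cong₂ (λ a b → twice a + twice b)
      (trans (θ-swap₁₂ u v (bar u)) (θ-self (κ u v) refl neutral₀)) other)
    (identity (F T - F T₂ + B)))
    where
    neutral₀ : neut T (κ u v) ≡ true
    neutral₀ = neutral-bits T D₀ (opposite T (apart u≢v) uv) (opposite T (bar-≢ u ∘ sym) ūu) (opposite T (apart (u≢v ∘ sym)) vū)
    D₁ : Distinct v u (bar v)
    D₁ = bar-distinct (u≢v ∘ sym)
    vu₂ : τ T₂ v u ≡ true
    vu₂ = trans (τ-in T (κ u v) (apart (u≢v ∘ sym)) (∈tr₁ v u (bar u))) (cong not (opposite T (apart u≢v) uv))
    uv̄₂ : τ T₂ u (bar v) ≡ false
    uv̄₂ = trans (τ-in T (κ u v) (apart u≢v) (trans (cong (_∈E κ u v) (ed-bar-swap u v)) (∈tr₃ v u (bar u)))) (cong not uv̄)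
    other : θ′ v u (bar v) ≡ 0ℤ
    other = θ-none {tr v u (bar v)} (neutral-bits T D₁ (opposite T (apart u≢v) uv) uv̄ refl) (neutral-bits T₂ D₁ vu₂ uv̄₂ refl)
    identity : ∀ y → (- y + - y) + (0ℤ + 0ℤ) ≡ - (y + y)
    identity = solve-∀

  shapes≤ : ∀ {R} → allFin n ↭ ix u ∷ ix v ∷ R →
            ∑ (genShapes n) weighted ≤ - twice (F T - F T₂ + B) + ∑ R (λ l → twice (gate (crystalline l) (A - B)))
  shapes≤ {R} perm = begin
    ∑ (genShapes n) weighted
      ≡⟨ ∑-shapes ⟩
    triples (allFin n) triangles + pairs (allFin n) clovers
      ≡⟨ cong₂ _+_ (triples-↭ triangles triangles-swap₁₂ triangles-swap₂₃ perm) (pairs-↭ clovers clovers-sym perm) ⟩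
    triples (i ∷ j ∷ R) triangles + pairs (i ∷ j ∷ R) clovers
      ≡⟨ identity (∑ R (t i j)) (pairs R (t i)) (pairs R (t j)) (triples R t) (c i j) (∑ R (c i)) (∑ R (c j)) (pairs R c) ⟩
    (c i j + (∑ R (t i j) + ∑ R (c i) + ∑ R (c j))) + (pairs R (t i) + pairs R (t j) + triples R t + pairs R c)
      ≤⟨ ℤₚ.+-mono-≤ (ℤₚ.+-mono-≤ (ℤₚ.≤-reflexive own) middle)
           (four≤0 (spread i i∉) (spread j j∉) apartAll (pairs-≤0 R uniqueR (λ l∈ m∈ ne → far-clovers ne (out l∈) (out m∈)))) ⟩
    (- twice (F T - F T₂ + B) + ∑ R bound) + 0ℤ ≡⟨ ℤₚ.+-identityʳ _ ⟩
    - twice (F T - F T₂ + B) + ∑ R bound ∎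
    where
    open ℤₚ.≤-Reasoning
    i j : Fin n
    i = ix u
    j = ix v
    t : Fin n → Fin n → Fin n → ℤ
    t = triangles
    c : Fin n → Fin n → ℤ
    c = clovers
    bound : Fin n → ℤ
    bound l = twice (gate (crystalline l) (A - B))
    unique : Unique (i ∷ j ∷ R)
    unique = Unique-↭ perm (Uniqueₚ.allFin⁺ n)
    uniqueR : Unique R
    uniqueR = unique-drop (unique-drop unique)
    i∉ : ∀ {l} → l ∈ R → i ≢ l
    i∉ l∈ = unique-head unique (there l∈)
    j∉ : ∀ {l} → l ∈ R → j ≢ l
    j∉ l∈ = unique-head (unique-drop unique) l∈
    out : ∀ {l} → l ∈ R → Out l
    out l∈ = Out₂ (i∉ l∈ ∘ sym) (j∉ l∈ ∘ sym)
    middle : ∑ R (t i j) + ∑ R (c i) + ∑ R (c j) ≤ ∑ R bound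
    middle = subst (_≤ ∑ R bound)
      (trans (∑-+ R (λ l → t i j l + c i l) (c j)) (cong (λ q → q + ∑ R (c j)) (∑-+ R (t i j) (c i))))
      (∑-mono R (λ {l} l∈ → local l (i∉ l∈ ∘ sym) (j∉ l∈ ∘ sym)))
    spread : ∀ p → (∀ {l} → l ∈ R → p ≢ l) → pairs R (t p) ≤ 0ℤ
    spread p p∉ = pairs-≤0 R uniqueR (λ l∈ m∈ ne → far-triangles (p∉ l∈) ne (p∉ m∈) (out l∈) (out m∈))
    apartAll : triples R t ≤ 0ℤ
    apartAll = triples-≤0 R uniqueR (λ _ l∈ m∈ a b c → far-triangles a c b (out l∈) (out m∈))
    identity : ∀ tij ti tj t₀ cij ci cj c₀ → (tij + ti) + (tj + t₀) + ((cij + ci) + (cj + c₀)) ≡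
               (cij + (tij + ci + cj)) + (ti + tj + t₀ + c₀)
    identity = solve-∀

-- The unnormalised generator of the walk, and the degree

increment : ∀ {n} → (Tournament n → ℤ) → Tournament n → ℕ × List (Edge n) → ℤ
increment F T (k , S) = + k * gate (neut T S) (F (T ⟲ S) - F T)

multiplicity : ∀ {n} → Tournament n → ℕ × List (Edge n) → ℤ
multiplicity T (k , S) = + k * ind (neut T S)

-- The generator of the walk, without normalisation.
𝓛 : ∀ {n} → (Tournament n → ℤ) → Tournament n → ℤ
𝓛 {n} F T = ∑ (genShapes n) (increment {n} F T)

degree : ∀ {n} → Tournament n → ℤ
degree {n} T = ∑ (genShapes n) (multiplicity {n} T)

module _ {n : ℕ} {s : Vec ℤ n} {F : Tournament n → ℤ} {A B : ℤ} (lip : Lipschitz s F A B)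
         (T T₂ : Tournament n) (W : ℤ) (scT : score2 {n} T ≡ s) (scT₂ : score2 {n} T₂ ≡ s) where

  open Coupling lip T T₂ W scT scT₂
  open Shapes θ θ-respects

  -- `α` subtracts W - (F T - F T₂) from every neutral move of T; this is restored as that constant
  -- times the number of moves.
  𝓛-difference : 𝓛 {n} F T - 𝓛 {n} F T₂ ≡ ∑ (genShapes n) weighted + (W - (F T - F T₂)) * degree {n} T
  𝓛-difference = trans (cong (λ z → 𝓛 {n} F T + z) (sym (trans (∑-*ˡ (genShapes n) -[1+ 0 ] (increment {n} F T₂)) (ℤₚ.-1*i≡-i (𝓛 {n} F T₂)))))
    (trans (sym (∑-+ (genShapes n) (increment {n} F T) (λ p → -[1+ 0 ] * increment {n} F T₂ p)))
    (trans (∑-cong (genShapes n) {g = λ p → weighted p + (W - (F T - F T₂)) * multiplicity {n} T p}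
             λ { (k , S) → pointwise (+ k) (neut T S) (neut T₂ S) (F (T ⟲ S) - F T) (W - (F T - F T₂)) (β S) })
    (trans (∑-+ (genShapes n) weighted (λ p → (W - (F T - F T₂)) * multiplicity {n} T p))
           (cong (λ z → ∑ (genShapes n) weighted + z) (∑-*ˡ (genShapes n) (W - (F T - F T₂)) (multiplicity {n} T))))))
    where
    pointwise : ∀ k b b′ a c β → k * gate b a + -[1+ 0 ] * (k * gate b′ β) ≡ k * (gate b (a - c) - gate b′ β) + c * (k * ind b)
    pointwise k true  b′ a c β = identity k a c (gate b′ β)
      where identity : ∀ k a c β → k * a + -[1+ 0 ] * (k * β) ≡ k * (a - c - β) + c * (k * 1ℤ)
            identity = solve-∀
    pointwise k false b′ a c β = identity k c (gate b′ β)
      where identity : ∀ k c β → k * 0ℤ + -[1+ 0 ] * (k * β) ≡ k * (0ℤ - β) + c * (k * 0ℤ)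
            identity = solve-∀

module _ {n : ℕ} (T : Tournament n) where

  private
    -- The degree is bounded from below through its negative, so that the lemmas on sums of
    -- nonpositive terms apply.
    θ⁻ : List (Edge n) → ℤ
    θ⁻ S = - ind (neut T S)

    θ⁻-respects : Respects θ⁻
    θ⁻-respects {S} {S′} eq = cong (λ b → - ind b) (neutral-cong T {S} {S′} eq)

    θ⁻≤0 : ∀ S → θ⁻ S ≤ 0ℤ
    θ⁻≤0 S with neut T S
    ... | true  = ℤ.-≤+
    ... | false = ℤₚ.≤-refl

  private
    open Shapes θ⁻ θ⁻-respects

    -degree : - degree {n} T ≡ triples (allFin n) triangles + pairs (allFin n) clovers
    -degree = trans (sym (trans (∑-cong (genShapes n) {g = λ p → -[1+ 0 ] * multiplicity {n} T p} (λ { (k , S) → pointwise (+ k) (ind (neut T S)) }))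
                                (trans (∑-*ˡ (genShapes n) -[1+ 0 ] (multiplicity {n} T)) (ℤₚ.-1*i≡-i (degree {n} T))))) ∑-shapes
      where pointwise : ∀ k x → k * - x ≡ -[1+ 0 ] * (k * x)
            pointwise = solve-∀

    triangles≤0 : ∀ p q r → triangles p q r ≤ 0ℤ
    triangles≤0 p q r = ℤₚ.+-mono-≤ (ℤₚ.+-mono-≤ (ℤₚ.+-mono-≤
      (θ⁻≤0 (tr (p , true) (q , true) (r , true))) (θ⁻≤0 (tr (p , true) (q , true) (r , false))))
      (θ⁻≤0 (tr (p , true) (q , false) (r , false)))) (θ⁻≤0 (tr (p , true) (q , false) (r , true)))

    clovers≤0 : ∀ p q → clovers p q ≤ 0ℤ
    clovers≤0 p q = ℤₚ.+-mono-≤ (ℤₚ.+-mono-≤ (θ⁻≤0 K₁) (θ⁻≤0 K₁)) (ℤₚ.+-mono-≤ (θ⁻≤0 K₂) (θ⁻≤0 K₂))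
      where K₁ K₂ : List (Edge n)
            K₁ = tr (p , true) (q , true) (p , false)
            K₂ = tr (q , true) (p , true) (q , false)

  degree≥2 : ∀ (u v : V n) → ix u ≢ ix v → neut T (κ u v) ≡ true → + 2 ≤ degree {n} T
  degree≥2 u v u≢v nκ with extract (∈ₚ.∈-allFin (ix u))
  ... | L₁ , p₁ with extract (∈-tail p₁ (ix v) (u≢v ∘ sym))
  ... | R , p₂ = ℤₚ.neg-cancel-≤ (begin
    - degree {n} T
      ≡⟨ -degree ⟩
    triples (allFin n) triangles + pairs (allFin n) clovers
      ≡⟨ cong (λ z → triples (allFin n) triangles + z) (pairs-↭ clovers clovers-sym perm) ⟩
    triples (allFin n) triangles + ((clovers i j + ∑ R (clovers i)) + pairs (j ∷ R) clovers)
      ≤⟨ ℤₚ.+-mono-≤ (triples-≤0 (allFin n) (Uniqueₚ.allFin⁺ n) (λ {p} {q} {r} _ _ _ _ _ _ → triangles≤0 p q r))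
           (ℤₚ.+-mono-≤ (ℤₚ.+-mono-≤ own (∑-≤0 R (λ {l} _ → clovers≤0 i l))) (pairs-≤0 (j ∷ R) unique (λ {l} {m} _ _ _ → clovers≤0 l m))) ⟩
    -[1+ 1 ] ∎)
    where
    open ℤₚ.≤-Reasoning
    i j : Fin n
    i = ix u
    j = ix v
    perm : allFin n ↭ i ∷ j ∷ R
    perm = Perm.trans p₁ (prep _ p₂)
    unique : Unique (j ∷ R)
    unique = unique-drop (Unique-↭ perm (Uniqueₚ.allFin⁺ n))
    own : clovers i j ≤ -[1+ 1 ]
    own = ℤₚ.≤-trans (ℤₚ.≤-reflexive (clovers-signed u v)) (ℤₚ.+-mono-≤
      (ℤₚ.≤-reflexive (cong twice (trans (θ-swap₁₂ u v (bar u)) (cong (λ b → - ind b) nκ))))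
      (ℤₚ.+-mono-≤ (θ⁻≤0 (tr v u (bar v))) (θ⁻≤0 (tr v u (bar v)))))

  degree≥1 : ∀ (u v w : V n) → ix u ≢ ix v → ix v ≢ ix w → ix u ≢ ix w → neut T (tr u v w) ≡ true → 1ℤ ≤ degree {n} T
  degree≥1 u v w u≢v v≢w u≢w nΔ with extract (∈ₚ.∈-allFin (ix u))
  ... | L₁ , p₁ with extract (∈-tail p₁ (ix v) (u≢v ∘ sym))
  ... | L₂ , p₂ with ∈-tail (Perm.trans p₁ (prep _ p₂)) (ix w) (u≢w ∘ sym)
  ... | here eq = contradiction (sym eq) v≢w
  ... | there w∈ with extract w∈
  ... | R , p₃ = ℤₚ.neg-cancel-≤ (begin
    - degree {n} T
      ≡⟨ -degree ⟩
    triples (allFin n) triangles + pairs (allFin n) clovers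
      ≡⟨ cong (λ z → z + pairs (allFin n) clovers) (triples-↭ triangles triangles-swap₁₂ triangles-swap₂₃ perm) ⟩
    ((triangles i j k + ∑ R (triangles i j)) + pairs (k ∷ R) (triangles i)) + triples (j ∷ k ∷ R) triangles + pairs (allFin n) clovers
      ≤⟨ ℤₚ.+-mono-≤ (ℤₚ.+-mono-≤ (ℤₚ.+-mono-≤ (ℤₚ.+-mono-≤ own (∑-≤0 R (λ {l} _ → triangles≤0 i j l)))
             (pairs-≤0 (k ∷ R) (unique-drop unique) (λ {l} {m} _ _ _ → triangles≤0 i l m)))
             (triples-≤0 (j ∷ k ∷ R) unique (λ {p} {q} {r} _ _ _ _ _ _ → triangles≤0 p q r)))
           (pairs-≤0 (allFin n) (Uniqueₚ.allFin⁺ n) (λ {l} {m} _ _ _ → clovers≤0 l m)) ⟩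
    -[1+ 0 ] ∎)
    where
    open ℤₚ.≤-Reasoning
    i j k : Fin n
    i = ix u
    j = ix v
    k = ix w
    perm : allFin n ↭ i ∷ j ∷ k ∷ R
    perm = Perm.trans p₁ (prep _ (Perm.trans p₂ (prep _ p₃)))
    unique : Unique (j ∷ k ∷ R)
    unique = unique-drop (Unique-↭ perm (Uniqueₚ.allFin⁺ n))
    own : triangles i j k ≤ -[1+ 0 ]
    own = ℤₚ.≤-trans (ℤₚ.≤-reflexive (triangles-signed u v w)) (ℤₚ.+-mono-≤ (ℤₚ.+-mono-≤ (ℤₚ.+-mono-≤
      (ℤₚ.≤-reflexive (cong (λ b → - ind b) nΔ)) (θ⁻≤0 (tr (bar u) v w))) (θ⁻≤0 (tr u (bar v) w))) (θ⁻≤0 (tr u v (bar w))))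

-- Contraction of the Lipschitz constants

record TriangleBits {n} (T : Tournament n) (u v w : V n) : Set where
  field
    u≢v : ix u ≢ ix v
    v≢w : ix v ≢ ix w
    u≢w : ix u ≢ ix w
    uv : τ T u v ≡ true
    vw : τ T v w ≡ true
    wu : τ T w u ≡ true

record CloverBits {n} (T : Tournament n) (u v : V n) : Set where
  field
    u≢v : ix u ≢ ix v
    uv : τ T u v ≡ true
    vū : τ T v (bar u) ≡ true
    ūu : τ T (bar u) u ≡ true

crystals : ∀ {n} → Tournament n → V n → List (Fin n) → ℤ
crystals T u R = ∑ R (λ l → ind (same (τ T u (l , true)) (τ T u (l , false))))

-- What the contraction needs to know about crystals, for weights proportional to g + η (triangles) and g (clovers).
record CrystalBound {n} (s : Vec ℤ n) (g η : ℤ) : Set where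
  field
    double : ∀ (T : Tournament n) (u v : V n) → score2 {n} T ≡ s → CloverBits T u v →
             ∀ R → allFin n ↭ ix u ∷ ix v ∷ R → η * crystals T u R ≤ g
    single : ∀ (T : Tournament n) (u v w : V n) → score2 {n} T ≡ s → TriangleBits T u v w →
             τ T u (bar v) ≡ false → τ T w (bar u) ≡ true → 1ℤ ≤ η

module _ {n : ℕ} (T : Tournament n) where

  opposite : ∀ {a c : V n} {y} → a ≢ c → τ T a c ≡ y → τ T c a ≡ not y
  opposite ne eq = trans (τ-swap T ne) (cong not eq)

  same-sound : ∀ {a b c} → same a b ∧ same b c ≡ true → (a ≡ true × b ≡ true × c ≡ true) ⊎ (a ≡ false × b ≡ false × c ≡ false)
  same-sound {true}  {true}  {true}  _ = inj₁ (refl , refl , refl)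
  same-sound {false} {false} {false} _ = inj₂ (refl , refl , refl)

  orient-triangle : ∀ (u v w : V n) → ix u ≢ ix v → ix v ≢ ix w → ix u ≢ ix w → neut T (tr u v w) ≡ true →
                    TriangleBits T u v w ⊎ TriangleBits T w v u
  orient-triangle u v w u≢v v≢w u≢w eq
    with same-sound (trans (sym (neutral-bits T (apart u≢v , apart v≢w , apart u≢w) refl refl refl)) eq)
  ... | inj₁ (uv , vw , wu) = inj₁ record { u≢v = u≢v ; v≢w = v≢w ; u≢w = u≢w ; uv = uv ; vw = vw ; wu = wu }
  ... | inj₂ (uv , vw , wu) = inj₂ record
    { u≢v = v≢w ∘ sym ; v≢w = u≢v ∘ sym ; u≢w = u≢w ∘ sym
    ; uv = opposite (apart v≢w) vw ; vw = opposite (apart u≢v) uv ; wu = opposite (apart (u≢w ∘ sym)) wu }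

  -- A neutral triple is a directed cycle in one of two directions. For a clover the wrong direction
  -- is repaired by replacing u with its opposite, which gives the same set of games.
  orient-clover : ∀ (u v : V n) → ix u ≢ ix v → neut T (κ u v) ≡ true → CloverBits T u v ⊎ CloverBits T (bar u) v
  orient-clover u v u≢v eq
    with same-sound (trans (sym (neutral-bits T (apart (u≢v ∘ sym) , bar-≢ u , apart (u≢v ∘ sym)) refl refl refl)) eq)
  ... | inj₁ (vu , uū , ūv) = inj₂ record
    { u≢v = u≢v ; uv = ūv ; vū = trans (cong (τ T v) (bar-bar u)) vu ; ūu = trans (cong (λ y → τ T y (bar u)) (bar-bar u)) uū }
  ... | inj₂ (vu , uū , ūv) = inj₁ record
    { u≢v = u≢v ; uv = opposite (apart (u≢v ∘ sym)) vu ; vū = opposite (apart u≢v) ūv ; ūu = opposite (bar-≢ u) uū }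

  tr-reverse : ∀ (u v w : V n) → T ⟲ tr u v w ≡ T ⟲ tr w v u
  tr-reverse u v w = ⟲-cong T {tr u v w} {tr w v u}
    (λ e → trans (tr-swap₁₂ u v w e) (trans (tr-swap₂₃ v u w e) (tr-swap₁₂ v w u e)))

  κ-reverse : ∀ (u v : V n) → T ⟲ κ u v ≡ T ⟲ κ (bar u) v
  κ-reverse u v = trans (⟲-cong T {tr v u (bar u)} {tr v (bar u) u} (tr-swap₂₃ v u (bar u)))
                        (cong (λ y → T ⟲ tr v (bar u) y) (sym (bar-bar u)))

-- E is what a step gains over the trivial bound 2 d W. A gain of 2 W / g is exactly what lowers the
-- factor 2 d g to 2 d g - 2.
scale : ∀ {g d W D E : ℤ} → 0ℤ ≤ g → D ≤ twice (d * W) - E → twice W ≤ g * E → g * D ≤ (twice (d * g) - + 2) * W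
scale {g} {d} {W} {D} {E} 0≤g le gain = ℤₚ.≤-trans (ℤₚ.*-monoˡ-≤-nonNeg g {{ℤ.nonNegative 0≤g}} le)
  (≤-slack (g * E - twice W) (gap gain) (identity g d W E))
  where identity : ∀ g d W E → g * (d * W + d * W - E) + (g * E - (W + W)) ≡ (d * g + d * g - + 2) * W
        identity = solve-∀

≤-multiple : ∀ {g W : ℤ} → 1ℤ ≤ g → 0ℤ ≤ W → W ≤ g * W
≤-multiple {g} {W} 1≤g 0≤W = ≤-slack ((g - 1ℤ) * W) (0≤* (gap 1≤g) 0≤W) (identity g W)
  where identity : ∀ g W → W + (g - 1ℤ) * W ≡ g * W
        identity = solve-∀

-- The gain is Δ + A, but Δ may fall short of A. The deficit is compensated by the d - 1 copies of Δ
-- that remain, which the trivial bound counts as A.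
calm-bound : ∀ {d Δ A S : ℤ} → 1ℤ ≤ d → Δ ≤ A → S ≤ - (Δ + A) → d * Δ + d * A + S ≤ twice (d * A) - twice A
calm-bound {d} {Δ} {A} {S} 1≤d Δ≤A le = ≤-slack ((- (Δ + A) - S) + (d - 1ℤ) * (A - Δ)) (0≤+ (gap le) (0≤* (gap 1≤d) (gap Δ≤A)))
  (identity d Δ A S)
  where identity : ∀ d Δ A S → d * Δ + d * A + S + ((- (Δ + A) - S) + (d - 1ℤ) * (A - Δ)) ≡ d * A + d * A - (A + A)
        identity = solve-∀

crystal-bound : ∀ {d Δ A B S : ℤ} → 1ℤ ≤ d → Δ ≤ A → S ≤ twice (twice (B - A)) → d * Δ + d * A + S ≤ twice (d * A) - twice (twice (A - B))
crystal-bound {d} {Δ} {A} {B} {S} 1≤d Δ≤A le = ≤-slack ((twice (twice (B - A)) - S) + d * (A - Δ))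
  (0≤+ (gap le) (0≤* (ℤₚ.≤-trans (ℤ.+≤+ ℕ.z≤n) 1≤d) (gap Δ≤A))) (identity d Δ A B S)
  where identity : ∀ d Δ A B S → d * Δ + d * A + S + ((((B - A) + (B - A)) + ((B - A) + (B - A)) - S) + d * (A - Δ))
                               ≡ d * A + d * A - (((A - B) + (A - B)) + ((A - B) + (A - B)))
        identity = solve-∀

-- The constants differ by c, so the four gains amount to 4 c, and 4 c g ≥ 2 c (g + 1) because g ≥
-- 1.
crystal-gain : ∀ {c g : ℤ} → 0ℤ ≤ c → 1ℤ ≤ g → twice (c * (g + 1ℤ)) ≤ g * twice (twice (c * (g + 1ℤ) - c * g))
crystal-gain {c} {g} 0≤c 1≤g = ≤-slack (twice (c * (g - 1ℤ))) (0≤+ (0≤* 0≤c (gap 1≤g)) (0≤* 0≤c (gap 1≤g))) (identity c g)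
  where identity : ∀ c g → c * (g + 1ℤ) + c * (g + 1ℤ) + (c * (g - 1ℤ) + c * (g - 1ℤ)) ≡
                   g * (((c * (g + 1ℤ) - c * g) + (c * (g + 1ℤ) - c * g)) + ((c * (g + 1ℤ) - c * g) + (c * (g + 1ℤ) - c * g)))
        identity = solve-∀

-- M is half of the loss at crystals. The two copies of the edge gain 2 (Δ + B); after giving up 2 M
-- ≤ 2 B, the remaining (d - 2)(Δ + B) + 2 M is at most 2 d B - 2 B, where d ≥ 2 allows Δ to be
-- replaced by B.
clover-bound : ∀ {d Δ B S M : ℤ} → + 2 ≤ d → Δ ≤ B → M ≤ B → S ≤ - twice (Δ + B) + twice M → d * Δ + d * B + S ≤ twice (d * B) - twice B
clover-bound {d} {Δ} {B} {S} {M} 2≤d Δ≤B M≤B le =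
  ≤-slack ((- twice (Δ + B) + twice M - S) + ((d - + 2) * (B - Δ) + twice (B - M)))
    (0≤+ (gap le) (0≤+ (0≤* (gap 2≤d) (gap Δ≤B)) (0≤+ (gap M≤B) (gap M≤B)))) (identity d Δ B S M)
  where identity : ∀ d Δ B S M → d * Δ + d * B + S + ((- ((Δ + B) + (Δ + B)) + (M + M) - S) + ((d - + 2) * (B - Δ) + ((B - M) + (B - M))))
                               ≡ d * B + d * B - (B + B)
        identity = solve-∀

*-left-comm : ∀ (c k w : ℤ) → k * (c * w) ≡ c * k * w
*-left-comm = solve-∀

-- One step of path coupling in dual form: 𝓠 is 2 d g times the transition operator, and it shrinks the
-- Lipschitz constant c by the factor (2 d g − 2) / (2 d g).
module Contraction {n : ℕ} {s : Vec ℤ n} (d : ℤ) (1≤d : 1ℤ ≤ d) (regular : ∀ (T : Tournament n) → score2 {n} T ≡ s → degree {n} T ≡ d)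
                   (g η : ℤ) (1≤g : 1ℤ ≤ g) (0≤η : 0ℤ ≤ η) (η≤1 : η ≤ 1ℤ) (cry : CrystalBound s g η) where

  𝓠 : (Tournament n → ℤ) → Tournament n → ℤ
  𝓠 F T = g * (twice (d * F T) + 𝓛 {n} F T)

  module Step {F : Tournament n → ℤ} {c : ℤ} (0≤c : 0ℤ ≤ c) (lip : Lipschitz s F (c * (g + η)) (c * g)) where

    A B : ℤ
    A = c * (g + η)
    B = c * g

    0≤g : 0ℤ ≤ g
    0≤g = ℤₚ.≤-trans (ℤ.+≤+ ℕ.z≤n) 1≤g

    drift : ∀ (T T₂ : Tournament n) W → (scT : score2 {n} T ≡ s) (scT₂ : score2 {n} T₂ ≡ s) →
            𝓠 F T - 𝓠 F T₂ ≡ g * (d * (F T - F T₂) + d * W + ∑ (genShapes n)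
              (Shapes.weighted (Coupling.θ lip T T₂ W scT scT₂) (Coupling.θ-respects lip T T₂ W scT scT₂)))
    drift T T₂ W scT scT₂ = trans (expand g d (F T) (F T₂) (𝓛 {n} F T) (𝓛 {n} F T₂))
      (trans (cong (λ z → g * (twice (d * (F T - F T₂)) + z))
        (trans (𝓛-difference lip T T₂ W scT scT₂) (cong (λ z → S + (W - (F T - F T₂)) * z) (regular T scT))))
      (collect g d (F T - F T₂) W S))
      where
      open Coupling lip T T₂ W scT scT₂
      open Shapes θ θ-respects
      S : ℤ
      S = ∑ (genShapes n) weighted
      expand : ∀ g d a b l m → g * (d * a + d * a + l) - g * (d * b + d * b + m) ≡ g * (d * (a - b) + d * (a - b) + (l - m))
      expand = solve-∀
      collect : ∀ g d Δ W S → g * (d * Δ + d * Δ + (S + (W - Δ) * d)) ≡ g * (d * Δ + d * W + S)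
      collect = solve-∀

    step-triangle : ∀ (T : Tournament n) (u v w : V n) → TriangleBits T u v w →
                    score2 {n} T ≡ s → score2 {n} (T ⟲ tr u v w) ≡ s →
                    𝓠 F T - 𝓠 F (T ⟲ tr u v w) ≤ c * (twice (d * g) - + 2) * (g + η)
    step-triangle T u v w bits scT scT₂ = subst (_≤ c * (twice (d * g) - + 2) * (g + η)) (sym (drift T T₂ A scT scT₂))
      (go (At.x u v w u≢v v≢w u≢w refl uv vw wu) (At.y u v w u≢v v≢w u≢w refl uv vw wu) (At.z u v w u≢v v≢w u≢w refl uv vw wu) refl refl refl)
      where
      open TriangleBits bits
      open TriangleStep lip T u v w u≢v v≢w u≢w scT scT₂ uv vw wu
      Δ S : ℤ
      Δ = F T - F T₂
      S = ∑ (genShapes n) weighted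
      Δ≤A : Δ ≤ A
      Δ≤A = Lipschitz.triangle lip T u v w u≢v v≢w u≢w scT scT₂
      0≤A : 0ℤ ≤ A
      0≤A = 0≤* 0≤c (0≤+ 0≤g 0≤η)
      Goal : Set
      Goal = g * (d * Δ + d * A + S) ≤ c * (twice (d * g) - + 2) * (g + η)
      assemble : g * (d * Δ + d * A + S) ≤ (twice (d * g) - + 2) * A → Goal
      assemble = subst (g * (d * Δ + d * A + S) ≤_) (*-left-comm c (twice (d * g) - + 2) (g + η))
      finish-calm : S ≤ - (Δ + A) → Goal
      finish-calm le = assemble (scale {g} {d} {A} {_} {twice A} 0≤g (calm-bound {d} {Δ} {A} {S} 1≤d Δ≤A le)
        (≤-multiple {g} {twice A} 1≤g (0≤+ 0≤A 0≤A)))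
      finish-crystal : 1ℤ ≤ η → S ≤ twice (twice (B - A)) → Goal
      finish-crystal 1≤η le = assemble (scale {g} {d} {A} {_} {twice (twice (A - B))} 0≤g (crystal-bound {d} {Δ} {A} {B} {S} 1≤d Δ≤A le)
        (subst (λ e → twice (c * (g + e)) ≤ g * twice (twice (c * (g + e) - c * g))) (ℤₚ.≤-antisym 1≤η η≤1) (crystal-gain {c} {g} 0≤c 1≤g)))
      crystal-at : ∀ (a b e : V n) (bits′ : TriangleBits T a b e) → (eq : T₂ ≡ T ⟲ tr a b e) → total u v w ≡ total a b e →
                   τ T a (bar b) ≡ false → τ T e (bar a) ≡ true → Goal
      crystal-at a b e bits′ eq teq px pz = finish-crystal (CrystalBound.single cry T a b e scT bits′ px pz)
        (ℤₚ.≤-trans shapes≤total (ℤₚ.≤-trans (ℤₚ.≤-reflexive teq)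
          (At.crystal a b e (Bits.u≢v bits′) (Bits.v≢w bits′) (Bits.u≢w bits′) eq (Bits.uv bits′) (Bits.vw bits′) (Bits.wu bits′) px pz)))
        where module Bits = TriangleBits
      open Inside lip T T₂ scT scT₂ using (rot; total-rot)
      bits₂ : TriangleBits T v w u
      bits₂ = record { u≢v = v≢w ; v≢w = u≢w ∘ sym ; u≢w = u≢v ∘ sym ; uv = vw ; vw = wu ; wu = uv }
      bits₃ : TriangleBits T w u v
      bits₃ = record { u≢v = u≢w ∘ sym ; v≢w = u≢v ; u≢w = v≢w ∘ sym ; uv = wu ; vw = uv ; wu = vw }
      -- Unless the three bits agree, some rotation of the triangle has its first bit false and its
      -- last bit true, the position required by `At.crystal`.
      go : ∀ x y z → τ T u (bar v) ≡ x → τ T v (bar w) ≡ y → τ T w (bar u) ≡ z → Goal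
      go true  true  true  px py pz = finish-calm (ℤₚ.≤-trans shapes≤total (At.calm u v w u≢v v≢w u≢w refl uv vw wu (trans px (sym py)) (trans py (sym pz))))
      go false false false px py pz = finish-calm (ℤₚ.≤-trans shapes≤total (At.calm u v w u≢v v≢w u≢w refl uv vw wu (trans px (sym py)) (trans py (sym pz))))
      go false _     true  px py pz = crystal-at u v w bits refl refl px pz
      go true  false _     px py pz = crystal-at v w u bits₂ (rot u v w) (total-rot u v w) py px
      go _     true  false px py pz = crystal-at w u v bits₃ (trans (rot u v w) (rot v w u)) (trans (total-rot u v w) (total-rot v w u)) pz py

    step-clover : ∀ (T : Tournament n) (u v : V n) → CloverBits T u v →
                  score2 {n} T ≡ s → score2 {n} (T ⟲ κ u v) ≡ s →
                  𝓠 F T - 𝓠 F (T ⟲ κ u v) ≤ c * (twice (d * g) - + 2) * g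
    step-clover T u v bits scT scT₂ = subst (_≤ c * (twice (d * g) - + 2) * g) (sym (drift T T₂ B scT scT₂))
      (subst (g * (d * Δ + d * B + S) ≤_) (*-left-comm c (twice (d * g) - + 2) g)
        (scale {g} {d} {B} {_} {twice B} 0≤g (clover-bound {d} {Δ} {B} {S} {c * (η * m)} 2≤d Δ≤B few bound)
          (≤-multiple {g} {twice B} 1≤g (0≤+ 0≤B 0≤B))))
      where
      open CloverBits bits
      open CloverStep lip T u v u≢v scT scT₂ uv vū ūu
      Δ S : ℤ
      Δ = F T - F T₂
      S = ∑ (genShapes n) weighted
      Δ≤B : Δ ≤ B
      Δ≤B = Lipschitz.clover lip T u v u≢v scT scT₂
      0≤B : 0ℤ ≤ B
      0≤B = 0≤* 0≤c 0≤g
      2≤d : + 2 ≤ d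
      2≤d = subst (+ 2 ≤_) (regular T scT) (degree≥2 T u v u≢v (score⇒neut T (κ u v) (trans scT₂ (sym scT))))
      split = extract (∈ₚ.∈-allFin (ix u))
      split₂ = extract (∈-tail (proj₂ split) (ix v) (u≢v ∘ sym))
      R : List (Fin n)
      R = proj₁ split₂
      perm : allFin n ↭ ix u ∷ ix v ∷ R
      perm = Perm.trans (proj₂ split) (prep _ (proj₂ split₂))
      m : ℤ
      m = crystals T u R
      few : c * (η * m) ≤ B
      few = ℤₚ.*-monoˡ-≤-nonNeg c {{ℤ.nonNegative 0≤c}} (CrystalBound.double cry T u v scT bits R perm)
      gate-* : ∀ b → twice (gate b (A - B)) ≡ twice (c * η) * ind b
      gate-* true  = identity c g η
        where identity : ∀ c g η → (c * (g + η) - c * g) + (c * (g + η) - c * g) ≡ (c * η + c * η) * 1ℤ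
              identity = solve-∀
      gate-* false = sym (ℤₚ.*-zeroʳ (twice (c * η)))
      distrib : ∀ c η m → (c * η + c * η) * m ≡ c * (η * m) + c * (η * m)
      distrib = solve-∀
      bound : S ≤ - twice (Δ + B) + twice (c * (η * m))
      bound = ℤₚ.≤-trans (shapes≤ perm) (ℤₚ.≤-reflexive (cong (λ z → - twice (Δ + B) + z)
        (trans (∑-cong R (λ l → gate-* (crystalline l)))
        (trans (∑-*ˡ R (twice (c * η)) (λ l → ind (crystalline l))) (distrib c η m)))))

    contract : Lipschitz s (𝓠 F) (c * (twice (d * g) - + 2) * (g + η)) (c * (twice (d * g) - + 2) * g)
    Lipschitz.triangle contract T u v w u≢v v≢w u≢w scT scT₂
      with orient-triangle T u v w u≢v v≢w u≢w (score⇒neut T (tr u v w) (trans scT₂ (sym scT)))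
    ... | inj₁ bits = step-triangle T u v w bits scT scT₂
    ... | inj₂ bits = subst (λ T′ → 𝓠 F T - 𝓠 F T′ ≤ c * (twice (d * g) - + 2) * (g + η)) (sym (tr-reverse T u v w))
      (step-triangle T w v u bits scT (trans (cong (score2 {n}) (sym (tr-reverse T u v w))) scT₂))
    Lipschitz.clover contract T u v u≢v scT scT₂
      with orient-clover T u v u≢v (score⇒neut T (κ u v) (trans scT₂ (sym scT)))
    ... | inj₁ bits = step-clover T u v bits scT scT₂
    ... | inj₂ bits = subst (λ T′ → 𝓠 F T - 𝓠 F T′ ≤ c * (twice (d * g) - + 2) * g) (sym (κ-reverse T u v))
      (step-clover T (bar u) v bits scT (trans (cong (score2 {n}) (sym (κ-reverse T u v))) scT₂))

-- The diameter of the interchange graph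

-- the change of the Hamming distance when a game is flipped
cost : Bool → ℤ
cost b = if b then -[1+ 0 ] else 1ℤ

module _ {n : ℕ} where

  ∑at-∑ : ∀ (L : List (Edge n)) (T : Vec Bool (length L)) (h : Edge n → Bool → ℤ) → Unique L →
          ∑at L T h ≡ ∑ L (λ e → h e (at L T e))
  ∑at-∑ []      []       h u        = refl
  ∑at-∑ (f ∷ L) (b ∷ bs) h (f∉ ∷ u) = cong₂ _+_
    (cong (λ x → h f (if x then b else at L bs f)) (sym (==E-refl f)))
    (trans (∑at-∑ L bs h u) (∑-cong-∈ L λ {e} e∈ →
      cong (λ x → h e (if x then b else at L bs e)) (sym (==E-≢ (λ eq → All.lookup f∉ e∈ (sym eq))))))

  score-∑ : ∀ (T : Tournament n) c → lookup (score2 {n} T) c ≡ ∑ (edges n) (λ e → sgn (val T e) * lookup (evec e) c)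
  score-∑ T c = trans (score-at T c) (∑at-∑ (edges n) T _ (edges-Unique n))

  ∑-tr : ∀ {u v w : V n} → Distinct u v w → (h : Edge n → ℤ) →
         ∑ (edges n) (λ e → if e ∈E tr u v w then h e else 0ℤ) ≡ h (ed u v) + (h (ed v w) + h (ed u w))
  ∑-tr {u} {v} {w} D h = trans (sym (∑at-∑ (edges n) T₀ (λ e _ → if e ∈E tr u v w then h e else 0ℤ) (edges-Unique n)))
                               (∑at-tr T₀ D (λ e _ → h e))
    where T₀ : Tournament n
          T₀ = Vec.replicate _ true

  differ : Tournament n → Tournament n → Edge n → Bool
  differ T T′ e = val T e xor val T′ e

  hamming : Tournament n → Tournament n → ℤ
  hamming T T′ = ∑ (edges n) (λ e → ind (differ T T′ e))

  hamming≥0 : ∀ T T′ → 0ℤ ≤ hamming T T′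
  hamming≥0 T T′ = go (edges n)
    where
    ind≥0 : ∀ b → 0ℤ ≤ ind b
    ind≥0 true  = ℤ.+≤+ ℕ.z≤n
    ind≥0 false = ℤₚ.≤-refl
    go : ∀ L → 0ℤ ≤ ∑ L (λ e → ind (differ T T′ e))
    go []      = ℤₚ.≤-refl
    go (e ∷ L) = 0≤+ (ind≥0 (differ T T′ e)) (go L)

  hamming-sym : ∀ T T′ → hamming T T′ ≡ hamming T′ T
  hamming-sym T T′ = ∑-cong (edges n) (λ e → cong ind (𝔹ₚ.xor-comm (val T e) (val T′ e)))

  turn-inj : ∀ o a b → turn o a xor turn o b ≡ a xor b
  turn-inj true  a     b = refl
  turn-inj false true  b = refl
  turn-inj false false b = 𝔹ₚ.not-involutive b

  opaque
    unfolding τ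

    differ-τ : ∀ (T T′ : Tournament n) (u v : V n) → differ T T′ (ed u v) ≡ τ T u v xor τ T′ u v
    differ-τ T T′ u v = sym (turn-inj (orient u v) (val T (ed u v)) (val T′ (ed u v)))

    score-term : ∀ (T : Tournament n) (u v : V n) c → u ≢ v →
                 sgn (val T (ed u v)) * lookup (evec (ed u v)) c ≡ sgn (τ T u v) * (pm u c - pm v c)
    score-term T u v c ne = root u v c (val T (ed u v)) ne

  opaque
    unfolding _⟲_

    hamming-flip : ∀ (T T′ : Tournament n) {u v w : V n} → Distinct u v w → hamming (T ⟲ tr u v w) T′ ≡
      hamming T T′ + (cost (differ T T′ (ed u v)) + (cost (differ T T′ (ed v w)) + cost (differ T T′ (ed u w))))
    hamming-flip T T′ {u} {v} {w} D = trans (∑-cong-∈ (edges n) pointwise)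
      (trans (∑-+ (edges n) (λ e → ind (differ T T′ e)) (λ e → if e ∈E tr u v w then cost (differ T T′ e) else 0ℤ))
        (cong (λ z → hamming T T′ + z) (∑-tr D (λ e → cost (differ T T′ e)))))
      where
      flipped : ∀ c a b → ind ((c xor a) xor b) ≡ ind (a xor b) + (if c then cost (a xor b) else 0ℤ)
      flipped c a b = by-cases 3 ℤ._≟_ (λ { (c ∷ a ∷ b ∷ []) → ind ((c xor a) xor b) })
        (λ { (c ∷ a ∷ b ∷ []) → ind (a xor b) + (if c then cost (a xor b) else 0ℤ) }) refl (c ∷ a ∷ b ∷ [])
      pointwise : ∀ {e} → e ∈ edges n → ind (differ (T ⟲ tr u v w) T′ e) ≡
                  ind (differ T T′ e) + (if e ∈E tr u v w then cost (differ T T′ e) else 0ℤ)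
      pointwise {e} e∈ = trans (cong (λ x → ind (x xor val T′ e)) (at-flip (edges n) (_∈E tr u v w) T e∈))
                               (flipped (e ∈E tr u v w) (val T e) (val T′ e))

  two-signs : ∀ {a b c : V n} → a ≢ b → b ≢ c → a ≢ c → ix a ≡ ix b → ix b ≡ ix c → ⊥
  two-signs {i , true}  {j , true}  ab bc ac refl refl = ab refl
  two-signs {i , true}  {j , false} {k , true}  ab bc ac refl refl = ac refl
  two-signs {i , true}  {j , false} {k , false} ab bc ac refl refl = bc refl
  two-signs {i , false} {j , false} ab bc ac refl refl = ab refl
  two-signs {i , false} {j , true}  {k , false} ab bc ac refl refl = ac refl
  two-signs {i , false} {j , true}  {k , true}  ab bc ac refl refl = bc refl

  opposite-sign : ∀ {a b : V n} → a ≢ b → ix a ≡ ix b → b ≡ bar a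
  opposite-sign {i , true}  {j , true}  ne refl = contradiction refl ne
  opposite-sign {i , true}  {j , false} ne refl = refl
  opposite-sign {i , false} {j , true}  ne refl = refl
  opposite-sign {i , false} {j , false} ne refl = contradiction refl ne

  -- Distinct signed vertices share an index only if they are opposite, so a degenerate triple is a
  -- clover, and its constant B is absorbed by A.
  lip-any : ∀ {s : Vec ℤ n} {F A B} → Lipschitz s F A B → B ≤ A → ∀ (T : Tournament n) {u v w : V n} → Distinct u v w →
            score2 {n} T ≡ s → score2 {n} (T ⟲ tr u v w) ≡ s → F T - F (T ⟲ tr u v w) ≤ A
  lip-any {s} {F} {A} {B} lip B≤A T {u} {v} {w} (u≢v , v≢w , u≢w) scT scT₂ = go (ix u Finₚ.≟ ix v) (ix v Finₚ.≟ ix w) (ix u Finₚ.≟ ix w)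
    where
    clover : ∀ (a b c : V n) → ix a ≢ ix b → c ≡ bar a → (∀ e → (e ∈E tr u v w) ≡ (e ∈E tr b a c)) → F T - F (T ⟲ tr u v w) ≤ A
    clover a b c ne refl eq = subst (λ T′ → F T - F T′ ≤ A) (sym same-flip)
      (ℤₚ.≤-trans (Lipschitz.clover lip T a b ne scT (trans (cong (score2 {n}) (sym same-flip)) scT₂)) B≤A)
      where same-flip : T ⟲ tr u v w ≡ T ⟲ tr b a (bar a)
            same-flip = ⟲-cong T {tr u v w} {tr b a (bar a)} eq
    go : Dec (ix u ≡ ix v) → Dec (ix v ≡ ix w) → Dec (ix u ≡ ix w) → F T - F (T ⟲ tr u v w) ≤ A
    go (no p)  (no q)  (no r)  = Lipschitz.triangle lip T u v w p q r scT scT₂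
    go (yes p) (yes q) _       = ⊥-elim (two-signs u≢v v≢w u≢w p q)
    go (yes p) (no q)  _       = clover u w v (λ r → q (trans (sym p) r)) (opposite-sign u≢v p)
      (λ e → trans (tr-swap₂₃ u v w e) (tr-swap₁₂ u w v e))
    go (no p)  (yes q) _       = clover v u w (p ∘ sym) (opposite-sign v≢w q) (λ e → refl)
    go (no p)  (no q)  (yes r) = clover u v w p (opposite-sign u≢w r) (tr-swap₁₂ u v w)

  any-V? : {P : V n → Set} → (∀ v → Dec (P v)) → Dec (∃ P)
  any-V? {P} P? with Finₚ.any? (λ i → P? (i , true) ⊎-dec P? (i , false))
  ... | yes (i , inj₁ p) = yes ((i , true) , p)
  ... | yes (i , inj₂ p) = yes ((i , false) , p)
  ... | no ¬p = no λ { ((i , true) , p) → ¬p (i , inj₁ p) ; ((i , false) , p) → ¬p (i , inj₂ p) }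

module Connect {n : ℕ} (T T′ : Tournament n) (same-score : score2 {n} T ≡ score2 {n} T′) where

  -- The games on which the tournaments differ, directed as in T. Each such game shows up as an arc
  -- together with its mirror image.
  Arc : V n → V n → Set
  Arc u v = u ≢ v × τ T u v ≡ true × τ T′ u v ≡ false

  Arc? : ∀ u v → Dec (Arc u v)
  Arc? u v = ¬? (u ≟V v) ×-dec (τ T u v 𝔹.≟ true) ×-dec (τ T′ u v 𝔹.≟ false)

  Arc-mirror : ∀ {u v} → Arc u v → Arc (bar v) (bar u)
  Arc-mirror (ne , p , q) = (λ eq → ne (sym (bar-inj eq))) , trans (τ-mirror T ne) p , trans (τ-mirror T′ ne) q

  arc-of : ∀ {a b} → a ≢ b → τ T a b ≢ τ T′ a b → Arc a b ⊎ Arc b a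
  arc-of {a} {b} ne d = go (τ T a b) (τ T′ a b) refl refl
    where
    go : ∀ x y → τ T a b ≡ x → τ T′ a b ≡ y → Arc a b ⊎ Arc b a
    go true  true  p q = contradiction (trans p (sym q)) d
    go true  false p q = inj₁ (ne , p , q)
    go false true  p q = inj₂ (ne ∘ sym , trans (τ-swap T ne) (cong not p) , trans (τ-swap T′ ne) (cong not q))
    go false false p q = contradiction (trans p (sym q)) d

  -- The score at v forbids v from being only the head of arcs.
  flow : V n → Edge n → ℤ
  flow v e = pm v (ix v) * (sgn (val T e) * lookup (evec e) (ix v) - sgn (val T′ e) * lookup (evec e) (ix v))

  flow-sum : ∀ v → ∑ (edges n) (flow v) ≡ 0ℤ
  flow-sum v = begin
    ∑ (edges n) (flow v) ≡⟨ ∑-*ˡ (edges n) (pm v c) (λ e → f T e - f T′ e) ⟩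
    pm v c * ∑ (edges n) (λ e → f T e - f T′ e)
      ≡⟨ cong (λ z → pm v c * z) (trans (∑-+ (edges n) (f T) (λ e → - f T′ e)) (cong (λ z → ∑ (edges n) (f T) + z)
           (trans (∑-cong (edges n) (λ e → sym (ℤₚ.-1*i≡-i (f T′ e)))) (trans (∑-*ˡ (edges n) -[1+ 0 ] (f T′)) (ℤₚ.-1*i≡-i (∑ (edges n) (f T′))))))) ⟩
    pm v c * (∑ (edges n) (f T) - ∑ (edges n) (f T′))
      ≡⟨ cong (λ z → pm v c * z) (ℤₚ.i≡j⇒i-j≡0 {∑ (edges n) (f T)} {∑ (edges n) (f T′)} (trans (sym (score-∑ T c)) (trans (cong (λ s → lookup s c) same-score) (score-∑ T′ c)))) ⟩
    pm v c * 0ℤ ≡⟨ ℤₚ.*-zeroʳ (pm v c) ⟩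
    0ℤ ∎
    where
    open ≡-Reasoning
    c : Fin n
    c = ix v
    f : Tournament n → Edge n → ℤ
    f T e = sgn (val T e) * lookup (evec e) c

  flow-ed : ∀ v a b → a ≢ b → flow v (ed a b) ≡
            pm v (ix v) * (sgn (τ T a b) * (pm a (ix v) - pm b (ix v)) - sgn (τ T′ a b) * (pm a (ix v) - pm b (ix v)))
  flow-ed v a b ne = cong₂ (λ x y → pm v (ix v) * (x - y)) (score-term T a b (ix v) ne) (score-term T′ a b (ix v) ne)

  flow-arc : ∀ v a b → Arc a b → flow v (ed a b) ≡ twice (pm v (ix v) * (pm a (ix v) - pm b (ix v)))
  flow-arc v a b (ne , p , q) = trans (flow-ed v a b ne)
    (trans (cong₂ (λ x y → pm v (ix v) * (sgn x * (pm a (ix v) - pm b (ix v)) - sgn y * (pm a (ix v) - pm b (ix v)))) p q)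
           (identity (pm v (ix v)) (pm a (ix v) - pm b (ix v))))
    where identity : ∀ e d → e * (1ℤ * d - -[1+ 0 ] * d) ≡ e * d + e * d
          identity = solve-∀

  enters : ∀ {u v : V n} → u ≢ v → twice (pm v (ix v) * (pm u (ix v) - pm v (ix v))) < 0ℤ
  enters {i , a} {j , b} ne rewrite ==F-refl j = go (j Finₚ.≟ i) a b ne
    where
    go : (d : Dec (j ≡ i)) → ∀ a b → (i , a) ≢ (j , b) → twice (sgn b * ((if does d then sgn a else 0ℤ) - sgn b)) < 0ℤ
    go (yes refl) true  true  ne = contradiction refl ne
    go (yes refl) true  false ne = ℤ.-<+
    go (yes refl) false true  ne = ℤ.-<+
    go (yes refl) false false ne = contradiction refl ne
    go (no _)     a     true  ne = ℤ.-<+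
    go (no _)     a     false ne = ℤ.-<+

  -- A positive contribution at v means that the arc starts at v or ends at the opposite of v; in
  -- the latter case its mirror image starts at v.
  leaves : ∀ {v a b : V n} → 0ℤ < twice (pm v (ix v) * (pm a (ix v) - pm b (ix v))) → a ≡ v ⊎ b ≡ bar v
  leaves {k , c} {i , x} {j , y} plus rewrite ==F-refl k = go (k Finₚ.≟ i) (k Finₚ.≟ j) c x y plus
    where
    go : (d : Dec (k ≡ i)) (e : Dec (k ≡ j)) → ∀ c x y →
         0ℤ < twice (sgn c * ((if does d then sgn x else 0ℤ) - (if does e then sgn y else 0ℤ))) →
         (i , x) ≡ (k , c) ⊎ (j , y) ≡ (k , not c)
    go (yes refl) e true  true  y p = inj₁ refl
    go (yes refl) e false false y p = inj₁ refl
    go d (yes refl) true  x false p = inj₂ refl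
    go d (yes refl) false x true  p = inj₂ refl
    go (yes refl) (yes refl) true  false true p = ⊥-elim (ℤₚ.<-asym p ℤ.-<+)
    go (yes refl) (no _) true  false y p = ⊥-elim (ℤₚ.<-asym p ℤ.-<+)
    go (yes refl) (yes refl) false true false p = ⊥-elim (ℤₚ.<-asym p ℤ.-<+)
    go (yes refl) (no _) false true y p = ⊥-elim (ℤₚ.<-asym p ℤ.-<+)
    go (no _) (yes refl) true  x true  p = ⊥-elim (ℤₚ.<-asym p ℤ.-<+)
    go (no _) (yes refl) false x false p = ⊥-elim (ℤₚ.<-asym p ℤ.-<+)
    go (no _) (no _) true  x y p = ⊥-elim (ℤₚ.<-irrefl refl p)
    go (no _) (no _) false x y p = ⊥-elim (ℤₚ.<-irrefl refl p)

  ∑-positive : ∀ (L : List (Edge n)) (f : Edge n → ℤ) {e₀} → ∑ L f ≡ 0ℤ → e₀ ∈ L → f e₀ < 0ℤ → ∃ λ e → e ∈ L × 0ℤ < f e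
  ∑-positive L f {e₀} sum₀ e₀∈ minus with Any.any? (λ e → 0ℤ ℤₚ.<? f e) L
  ... | yes p = let e , e∈ , plus = ∈-find p in e , e∈ , plus
  ... | no ¬p = ⊥-elim (ℤₚ.<-irrefl refl (ℤₚ.≤-<-trans (subst (_≤ f e₀) sum₀ (dominated L e₀∈ (λ e∈ → ℤₚ.≮⇒≥ (λ plus → ¬p (∈-lose e∈ plus))))) minus))
    where
    dominated : ∀ L → e₀ ∈ L → (∀ {e} → e ∈ L → f e ≤ 0ℤ) → ∑ L f ≤ f e₀
    dominated (e ∷ L) (here refl) nonpos = subst (f e + ∑ L f ≤_) (ℤₚ.+-identityʳ (f e)) (ℤₚ.+-monoʳ-≤ (f e) (∑-≤0 L (nonpos ∘ there)))
    dominated (e ∷ L) (there e₀∈) nonpos = subst (f e + ∑ L f ≤_) (ℤₚ.+-identityˡ (f e₀)) (ℤₚ.+-mono-≤ (nonpos (here refl)) (dominated L e₀∈ (nonpos ∘ there)))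

  -- The contributions at v add up to zero, and that of an arc into v is negative. Some differing
  -- game must therefore contribute positively, and it leaves v by `leaves`.
  next : ∀ {u v} → Arc u v → ∃ λ w → Arc v w
  next {u} {v} arc@(u≢v , _) with ∑-positive (edges n) (flow v) (flow-sum v) (ed-∈ n u v u≢v)
      (subst (_< 0ℤ) (sym (flow-arc v u v arc)) (enters u≢v))
  ... | e , e∈ , plus with edges-ed n e∈
  ... | a , b , a≢b , refl with τ T a b 𝔹.≟ τ T′ a b
  ... | yes eq = ⊥-elim (ℤₚ.<-irrefl (sym (trans (flow-ed v a b a≢b)
        (trans (cong (λ t → pm v (ix v) * (sgn t * (pm a (ix v) - pm b (ix v)) - sgn (τ T′ a b) * (pm a (ix v) - pm b (ix v)))) eq)
               (identity (pm v (ix v)) (sgn (τ T′ a b) * (pm a (ix v) - pm b (ix v))))))) plus)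
    where identity : ∀ e x → e * (x - x) ≡ 0ℤ
          identity = solve-∀
  ... | no ne = [ found , (λ arc′ → found′ arc′) ]′ (arc-of a≢b ne)
    where
    exit : ∀ {a b} → Arc a b → a ≡ v ⊎ b ≡ bar v → ∃ λ w → Arc v w
    exit arc (inj₁ refl) = _ , arc
    exit {a} arc (inj₂ refl) = bar a , subst (λ y → Arc y (bar a)) (bar-bar v) (Arc-mirror arc)
    found : Arc a b → ∃ λ w → Arc v w
    found arc′ = exit arc′ (leaves {v} {a} {b} (subst (0ℤ <_) (flow-arc v a b arc′) plus))
    found′ : Arc b a → ∃ λ w → Arc v w
    found′ arc′ = exit arc′ (leaves {v} {b} {a} (subst (0ℤ <_) (trans (cong (flow v) (ed-sym a b)) (flow-arc v b a arc′)) plus))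

  encode : V n → Fin (n ℕ.* 2)
  encode (i , a) = Fin.combine i (if a then fzero else fsuc fzero)

  encode-inj : ∀ u v → encode u ≡ encode v → u ≡ v
  encode-inj (i , a) (j , b) eq with Finₚ.combine-injective i _ j _ eq
  encode-inj (i , true)  (j , true)  eq | refl , _  = refl
  encode-inj (i , true)  (j , false) eq | refl , ()
  encode-inj (i , false) (j , true)  eq | refl , ()
  encode-inj (i , false) (j , false) eq | refl , _  = refl

  -- Following arcs forever would revisit a vertex, so the arcs cannot be transitive.
  shortcut : ∀ {u v} → Arc u v → ∃ λ u → ∃ λ v → ∃ λ w → Arc u v × Arc v w × ¬ Arc u w
  shortcut {u₀} {v₀} arc₀ with any-V? (λ u → any-V? (λ v → any-V? (λ w → Arc? u v ×-dec (Arc? v w ×-dec ¬? (Arc? u w)))))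
  ... | yes (u , v , w , p , q , r) = u , v , w , p , q , r
  ... | no none = ⊥-elim (revisit (Finₚ.pigeonhole (ℕₚ.n<1+n (n ℕ.* 2)) (λ i → encode (visit (toℕ i)))))
    where
    transitive : ∀ {u v w} → Arc u v → Arc v w → Arc u w
    transitive {u} {v} {w} p q with Arc? u w
    ... | yes r = r
    ... | no ¬r = contradiction (u , v , w , p , q , ¬r) none
    walk : ℕ → ∃ λ u → ∃ λ v → Arc u v
    walk zero    = u₀ , v₀ , arc₀
    walk (suc k) = let _ , v , arc = walk k ; w , arc′ = next arc in v , w , arc′
    visit : ℕ → V n
    visit k = proj₁ (walk k)
    forward : ∀ i k → Arc (visit i) (visit (suc k ℕ.+ i))
    forward i zero    = proj₂ (proj₂ (walk i))
    forward i (suc k) = transitive (forward i k) (proj₂ (proj₂ (walk (suc k ℕ.+ i))))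
    revisit : (∃ λ (i : Fin (suc (n ℕ.* 2))) → ∃ λ j → i Fin.< j × encode (visit (toℕ i)) ≡ encode (visit (toℕ j))) → ⊥
    revisit (i , j , i<j , eq) with ℕₚ.m≤n⇒∃[o]m+o≡n i<j
    ... | k , k+i with encode-inj (visit (toℕ i)) (visit (toℕ j)) eq
    ... | same-vertex = proj₁ (subst (Arc (visit (toℕ i))) (trans (cong visit (trans (cong suc (ℕₚ.+-comm k (toℕ i))) k+i)) (sym same-vertex)) (forward (toℕ i) k)) refl

  agree-or-arc : T ≡ T′ ⊎ ∃ λ u → ∃ λ v → Arc u v
  agree-or-arc with any-V? (λ u → any-V? (λ v → Arc? u v))
  ... | yes arc = inj₂ arc
  ... | no none = inj₁ (at-ext (edges n) T T′ (edges-Unique n) λ {e} e∈ → equal-at e∈)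
    where
    xor-false : ∀ {a b} → (a xor b) ≡ false → a ≡ b
    xor-false {true}  {true}  _ = refl
    xor-false {false} {false} _ = refl
    equal-at : ∀ {e} → e ∈ edges n → val T e ≡ val T′ e
    equal-at e∈ with edges-ed n e∈
    ... | a , b , a≢b , refl with τ T a b 𝔹.≟ τ T′ a b
    ... | yes eq = xor-false (trans (differ-τ T T′ a b) (trans (cong (_xor τ T′ a b) eq) (𝔹ₚ.xor-same (τ T′ a b))))
    ... | no ne  = ⊥-elim ([ (λ arc → none (a , b , arc)) , (λ arc → none (b , a , arc)) ]′ (arc-of a≢b ne))

-- The Hamming distance drops by at least one whenever a two-step path of arcs is not closed by an arc.
module Distance {n : ℕ} {s : Vec ℤ n} {F : Tournament n → ℤ} {A B : ℤ} (lip : Lipschitz s F A B) (0≤A : 0ℤ ≤ A) (B≤A : B ≤ A) where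

  closer : ∀ (T T′ : Tournament n) {u v w : V n} → Distinct u v w → differ {n} T T′ (ed u v) ≡ true → differ {n} T T′ (ed v w) ≡ true →
           hamming {n} (T ⟲ tr u v w) T′ ≤ hamming {n} T T′ - 1ℤ
  closer T T′ {u} {v} {w} D p q = ≤-slack (1ℤ - cost x) (gap (cost≤1 x))
    (trans (cong (λ z → z + (1ℤ - cost x)) (trans (hamming-flip T T′ D)
      (cong₂ (λ a b → hamming {n} T T′ + (cost a + (cost b + cost x))) p q)))
      (identity (hamming {n} T T′) (cost x)))
    where
    x : Bool
    x = differ {n} T T′ (ed u w)
    cost≤1 : ∀ b → cost b ≤ 1ℤ
    cost≤1 true  = ℤ.-≤+
    cost≤1 false = ℤₚ.≤-refl
    identity : ∀ h c → h + (-[1+ 0 ] + (-[1+ 0 ] + c)) + (1ℤ - c) ≡ h - 1ℤ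
    identity = solve-∀

  Closer : Tournament n → Tournament n → Set
  Closer T T′ = ∃ λ (T₁ : Tournament n) → ∃ λ (T₁′ : Tournament n) → score2 {n} T₁ ≡ s × score2 {n} T₁′ ≡ s ×
                hamming {n} T₁ T₁′ ≤ hamming {n} T T′ - 1ℤ × F T - F T′ ≤ F T₁ - F T₁′ + A

  -- As u → w is not an arc, either w → u in T or u → w in T′. In the first case the triple is a
  -- directed cycle of T, in the second one of T′; flipping it there corrects the two arcs and
  -- spoils at most the third game. So it may be either end of the path that moves.
  advance : ∀ (T T′ : Tournament n) → score2 {n} T ≡ s → score2 {n} T′ ≡ s → T ≡ T′ ⊎ Closer T T′
  advance T T′ sc sc′ with Connect.agree-or-arc {n} T T′ (trans sc (sym sc′))
  ... | inj₁ eq = inj₁ eq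
  ... | inj₂ (_ , _ , arc) with Connect.shortcut {n} T T′ (trans sc (sym sc′)) arc
  ... | u , v , w , (u≢v , uv , uv′) , (v≢w , vw , vw′) , ¬uw = inj₂ (go (τ T u w) (τ T′ u w) refl refl)
    where
    u≢w : u ≢ w
    u≢w refl = case trans (sym vw) (trans (τ-swap T u≢v) (cong not uv)) of λ ()
    D : Distinct u v w
    D = u≢v , v≢w , u≢w
    d₁ : differ {n} T T′ (ed u v) ≡ true
    d₁ = trans (differ-τ T T′ u v) (cong₂ _xor_ uv uv′)
    d₂ : differ {n} T T′ (ed v w) ≡ true
    d₂ = trans (differ-τ T T′ v w) (cong₂ _xor_ vw vw′)
    go : ∀ x y → τ T u w ≡ x → τ T′ u w ≡ y → Closer T T′
    go true false p q = contradiction (u≢w , p , q) ¬uw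
    go false _ p q = T ⟲ tr u v w , T′ , sc₁ , sc′ , closer T T′ D d₁ d₂ ,
      ≤-slack (A - (F T - F (T ⟲ tr u v w))) (gap (lip-any lip B≤A T D sc sc₁)) (identity (F T) (F T′) (F (T ⟲ tr u v w)) A)
      where
      sc₁ : score2 {n} (T ⟲ tr u v w) ≡ s
      sc₁ = ⟲-score T (tr u v w) sc (neutral-bits T D uv vw (trans (τ-swap T u≢w) (cong not p)))
      identity : ∀ a b c A → a - b + (A - (a - c)) ≡ c - b + A
      identity = solve-∀
    go true true p q = T , T′₁ , sc , sc₁ ,
      subst₂ _≤_ (hamming-sym {n} T′₁ T) (cong (λ z → z - 1ℤ) (hamming-sym {n} T′ T))
        (closer T′ T D (trans (𝔹ₚ.xor-comm (val T′ (ed u v)) (val T (ed u v))) d₁) (trans (𝔹ₚ.xor-comm (val T′ (ed v w)) (val T (ed v w))) d₂)) ,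
      ≤-slack (A - (F T′₁ - F (T′₁ ⟲ tr u v w))) (gap (lip-any lip B≤A T′₁ D sc₁ (trans (cong (score2 {n}) back) sc′)))
        (trans (cong (λ t → F T - F T′ + (A - (F T′₁ - F t))) back) (identity (F T) (F T′) (F T′₁) A))
      where
      T′₁ : Tournament n
      T′₁ = T′ ⟲ tr u v w
      back : T′₁ ⟲ tr u v w ≡ T′
      back = ⟲-involutive T′ (tr u v w)
      sc₁ : score2 {n} T′₁ ≡ s
      sc₁ = ⟲-score T′ (tr u v w) sc′ (neutral-bits T′ D uv′ vw′ (trans (τ-swap T′ u≢w) (cong not q)))
      identity : ∀ a b c A → a - b + (A - (c - b)) ≡ a - c + A
      identity = solve-∀

  distance : ∀ k (T T′ : Tournament n) → score2 {n} T ≡ s → score2 {n} T′ ≡ s → hamming {n} T T′ ≤ + k → F T - F T′ ≤ A * + k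
  distance k T T′ sc sc′ le with advance T T′ sc sc′
  ... | inj₁ refl = subst (_≤ A * + k) (sym (ℤₚ.+-inverseʳ (F T))) (0≤* 0≤A (ℤ.+≤+ ℕ.z≤n))
  distance zero    T T′ sc sc′ le | inj₂ (T₁ , T₁′ , sc₁ , sc₁′ , drop , bound) =
    ⊥-elim (ℤₚ.<-irrefl refl (ℤₚ.≤-<-trans (hamming≥0 {n} T₁ T₁′) (ℤₚ.≤-<-trans drop (ℤₚ.≤-<-trans (ℤₚ.+-monoˡ-≤ -[1+ 0 ] {hamming {n} T T′} le) ℤ.-<+))))
  distance (suc k) T T′ sc sc′ le | inj₂ (T₁ , T₁′ , sc₁ , sc₁′ , drop , bound) =
    ℤₚ.≤-trans bound (ℤₚ.≤-trans (ℤₚ.+-monoˡ-≤ A (distance k T₁ T₁′ sc₁ sc₁′ (ℤₚ.≤-trans drop (ℤₚ.+-monoˡ-≤ -[1+ 0 ] {hamming {n} T T′} le))))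
      (ℤₚ.≤-reflexive (identity A (+ k))))
    where identity : ∀ A k → A * k + A ≡ A * (1ℤ + k)
          identity = solve-∀

-- Vertices and multiplicities of the interchange graph

allVecs-complete : ∀ {m} (v : Vec Bool m) → v ∈ allVecs m
allVecs-complete []          = here refl
allVecs-complete {suc m} (b ∷ v) = ∈ₚ.∈-concatMap⁺ _ {xs = allVecs m} (∈-lose (allVecs-complete v) (choose b))
  where choose : ∀ b → (b Vec.∷ v) ∈ ((true Vec.∷ v) ∷ (false Vec.∷ v) ∷ [])
        choose true  = here refl
        choose false = there (here refl)

allVecs-Unique : ∀ m → Unique (allVecs m)
allVecs-Unique zero    = [] ∷ []
allVecs-Unique (suc m) = Unique-concatMap (allVecs m) (allVecs-Unique m) (λ v → ((λ ()) ∷ []) ∷ [] ∷ [])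
  (λ { (here refl) (here refl) → refl ; (here refl) (there (here ())) ; (here refl) (there (there ()))
     ; (there (here refl)) (there (here refl)) → refl ; (there (there ())) _ })

sum-∑ : ∀ {A : Set} (xs : List A) (f : A → ℕ) → + sum (List.map f xs) ≡ ∑ xs (λ x → + f x)
sum-∑ []       f = refl
sum-∑ (x ∷ xs) f = trans (ℤₚ.pos-+ (f x) (sum (List.map f xs))) (cong (λ z → + f x + z) (sum-∑ xs f))

lookup-injective : ∀ {A : Set} (xs : List A) → Unique xs → ∀ {i j} → List.lookup xs i ≡ List.lookup xs j → i ≡ j
lookup-injective (x ∷ xs) (x∉ ∷ u) {fzero}  {fzero}  eq = refl
lookup-injective (x ∷ xs) (x∉ ∷ u) {fzero}  {fsuc j} eq = contradiction eq (All.lookup x∉ (∈ₚ.∈-lookup j))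
lookup-injective (x ∷ xs) (x∉ ∷ u) {fsuc i} {fzero}  eq = contradiction (sym eq) (All.lookup x∉ (∈ₚ.∈-lookup i))
lookup-injective (x ∷ xs) (x∉ ∷ u) {fsuc i} {fsuc j} eq = cong fsuc (lookup-injective xs u eq)

module _ {n : ℕ} where

  _==T_ : Tournament n → Tournament n → Bool
  T ==T T′ = does (Vecₚ.≡-dec 𝔹._≟_ T T′)

  ==T-sound : ∀ {T T′ : Tournament n} → (T ==T T′) ≡ true → T ≡ T′
  ==T-sound {T} {T′} = does-sound (Vecₚ.≡-dec 𝔹._≟_ T T′)

  ==T-complete : ∀ {T T′ : Tournament n} → T ≡ T′ → (T ==T T′) ≡ true
  ==T-complete {T} {T′} = does-complete (Vecₚ.≡-dec 𝔹._≟_ T T′)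

  hit : Tournament n → Tournament n → List (Edge n) → Bool
  hit T T′ S = neut T S ∧ ((T ⟲ S) ==T T′)

  hits : Tournament n → Tournament n → ℕ × List (Edge n) → ℤ
  hits T T′ (k , S) = + k * ind (hit T T′ S)

  opaque
    unfolding _⟲_ neut

    multT-∑ : ∀ (T T′ : Tournament n) → + multT {n} T T′ ≡ ∑ (genShapes n) (hits T T′)
    multT-∑ T T′ = trans (sum-∑ (genShapes n) _) (∑-cong (genShapes n) λ { (k , S) → pointwise k (hit T T′ S) })
      where pointwise : ∀ k b → + (if b then k else 0) ≡ + k * ind b
            pointwise k true  = sym (ℤₚ.*-identityʳ (+ k))
            pointwise k false = sym (ℤₚ.*-zeroʳ (+ k))

  hit-respects : ∀ (T T′ : Tournament n) → Respects (λ S → ind (hit T T′ S))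
  hit-respects T T′ {S} {S′} eq = cong₂ (λ b t → ind (b ∧ (t ==T T′))) (neutral-cong T {S} {S′} eq) (⟲-cong T {S} {S′} eq)

  hit-sound : ∀ (T T′ : Tournament n) S → hit T T′ S ≡ true → T ⟲ S ≡ T′
  hit-sound T T′ S eq = ==T-sound (proj₂ (∧-sound {neut T S} eq))

  IsGenerator : List (Edge n) → Set
  IsGenerator S = ∃ λ (u : V n) → ∃ λ (v : V n) → ∃ λ (w : V n) → Distinct u v w × S ≡ tr u v w

  private
    <ᵇ⇒ : ∀ {i j : Fin n} → (toℕ j <ᵇ toℕ i) ≡ true → toℕ j ℕ.< toℕ i
    <ᵇ⇒ {i} {j} t = ℕₚ.<ᵇ⇒< (toℕ j) (toℕ i) (subst T (sym t) tt)

    ≢-of : ∀ {i j : Fin n} → toℕ j ℕ.< toℕ i → i ≢ j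
    ≢-of lt refl = ℕₚ.<-irrefl refl lt

    tris : Fin n → Fin n → Fin n → List (ℕ × List (Edge n))
    tris i j k = if (toℕ j <ᵇ toℕ i) ∧ (toℕ k <ᵇ toℕ j) then tri i j k else []

    clovs : Fin n → Fin n → List (ℕ × List (Edge n))
    clovs i j = if toℕ j <ᵇ toℕ i then clov i j else []

    if-∈ : ∀ {A : Set} {x : A} b {xs} → x ∈ (if b then xs else []) → b ≡ true × x ∈ xs
    if-∈ true p = refl , p

  opaque
    unfolding tr ed

    tri-generator : ∀ {i j k : Fin n} {w S} → toℕ j ℕ.< toℕ i → toℕ k ℕ.< toℕ j → (w , S) ∈ tri i j k → IsGenerator S
    tri-generator {i} {j} {k} j<i k<j p = go p
      where
      D : ∀ {a b c} → Distinct (i , a) (j , b) (k , c)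
      D = apart (≢-of j<i) , apart (≢-of k<j) , apart (≢-of (ℕₚ.<-trans k<j j<i))
      shape : ∀ a b c → pairE (same a b) i j ∷ pairE (same b c) j k ∷ pairE (same a c) i k ∷ [] ≡ tr (i , a) (j , b) (k , c)
      shape a b c rewrite <ᵇ-true {n} j<i | <ᵇ-true {n} k<j | <ᵇ-true {n} (ℕₚ.<-trans k<j j<i) = refl
      go : ∀ {w S} → (w , S) ∈ tri i j k → IsGenerator S
      go (here refl)                         = (i , true) , (j , true) , (k , true) , D , shape true true true
      go (there (here refl))                 = (i , true) , (j , true) , (k , false) , D , shape true true false
      go (there (there (here refl)))         = (i , true) , (j , false) , (k , false) , D , shape true false false
      go (there (there (there (here refl)))) = (i , true) , (j , false) , (k , true) , D , shape true false true

    clov-generator : ∀ {i j : Fin n} {w S} → toℕ j ℕ.< toℕ i → (w , S) ∈ clov i j → IsGenerator S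
    clov-generator {i} {j} j<i p = go p
      where
      first : neg i j ∷ pos i j ∷ loop i ∷ [] ≡ tr (i , true) (j , true) (i , false)
      first rewrite <ᵇ-true {n} j<i | <ᵇ-false {n} (ℕₚ.<⇒≤ j<i) | <ᵇ-false {n} {toℕ i} ℕₚ.≤-refl = refl
      second : neg i j ∷ pos i j ∷ loop j ∷ [] ≡ tr (j , true) (i , true) (j , false)
      second rewrite <ᵇ-true {n} j<i | <ᵇ-false {n} (ℕₚ.<⇒≤ j<i) | <ᵇ-false {n} {toℕ j} ℕₚ.≤-refl = refl
      go : ∀ {w S} → (w , S) ∈ clov i j → IsGenerator S
      go (here refl)         = (i , true) , (j , true) , (i , false) , (apart (≢-of j<i) , apart (≢-of j<i ∘ sym) , λ ()) , first
      go (there (here refl)) = (j , true) , (i , true) , (j , false) , (apart (≢-of j<i ∘ sym) , apart (≢-of j<i) , λ ()) , second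

  genShapes-generator : ∀ {w S} → (w , S) ∈ genShapes n → IsGenerator S
  genShapes-generator p = [ triangle-case , clover-case ]′ (∈ₚ.∈-++⁻ (concatMap tris₁ (allFin n)) p)
    where
    tris₂ : Fin n → Fin n → List (ℕ × List (Edge n))
    tris₂ i j = concatMap (tris i j) (allFin n)
    tris₁ : Fin n → List (ℕ × List (Edge n))
    tris₁ i = concatMap (tris₂ i) (allFin n)
    clovs₁ : Fin n → List (ℕ × List (Edge n))
    clovs₁ i = concatMap (clovs i) (allFin n)
    triangle-case : ∀ {w S} → (w , S) ∈ concatMap tris₁ (allFin n) → IsGenerator S
    triangle-case q with ∈-find (∈ₚ.∈-concatMap⁻ tris₁ {xs = allFin n} q)
    ... | i , _ , qᵢ with ∈-find (∈ₚ.∈-concatMap⁻ (tris₂ i) {xs = allFin n} qᵢ)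
    ... | j , _ , qⱼ with ∈-find (∈ₚ.∈-concatMap⁻ (tris i j) {xs = allFin n} qⱼ)
    ... | k , _ , qₖ with if-∈ ((toℕ j <ᵇ toℕ i) ∧ (toℕ k <ᵇ toℕ j)) qₖ
    ... | cond , r with ∧-sound {toℕ j <ᵇ toℕ i} cond
    ... | ji , kj = tri-generator {i} {j} {k} (<ᵇ⇒ {i} {j} ji) (<ᵇ⇒ {j} {k} kj) r
    clover-case : ∀ {w S} → (w , S) ∈ concatMap clovs₁ (allFin n) → IsGenerator S
    clover-case q with ∈-find (∈ₚ.∈-concatMap⁻ clovs₁ {xs = allFin n} q)
    ... | i , _ , qᵢ with ∈-find (∈ₚ.∈-concatMap⁻ (clovs i) {xs = allFin n} qᵢ)
    ... | j , _ , qⱼ with if-∈ (toℕ j <ᵇ toℕ i) qⱼ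
    ... | ji , r = clov-generator {i} {j} (<ᵇ⇒ {i} {j} ji) r

∑≢0 : ∀ {A : Set} (xs : List A) (f : A → ℤ) → ∑ xs f ≢ 0ℤ → ∃ λ x → x ∈ xs × f x ≢ 0ℤ
∑≢0 []       f ne = contradiction refl ne
∑≢0 (x ∷ xs) f ne with f x ℤ.≟ 0ℤ
... | no fx≢0 = x , here refl , fx≢0
... | yes eq  = let y , y∈ , fy = ∑≢0 xs f (λ rest → ne (cong₂ _+_ eq rest)) in y , there y∈ , fy

module _ {n : ℕ} where

  multT≢0 : ∀ (T T′ : Tournament n) → multT {n} T T′ ≢ 0 → ∃ λ (S : List (Edge n)) → IsGenerator S × neut T S ≡ true × T ⟲ S ≡ T′
  multT≢0 T T′ ne with ∑≢0 (genShapes n) (hits T T′) (λ eq → ne (ℤₚ.+-injective (trans (multT-∑ {n} T T′) eq)))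
  ... | (k , S) , S∈ , term = S , genShapes-generator S∈ , proj₁ (∧-sound (on (hit T T′ S) term)) , hit-sound T T′ S (on (hit T T′ S) term)
    where on : ∀ b → + k * ind b ≢ 0ℤ → b ≡ true
          on true  _  = refl
          on false ne = contradiction (ℤₚ.*-zeroʳ (+ k)) ne

module Graph {n : ℕ} (s : Vec ℤ n) where

  vertex : Fin (K n s) → Tournament n
  vertex = vtx {n} {s}

  verts-Unique : Unique (verts n s)
  verts-Unique = Uniqueₚ.filter⁺ (λ T → Vecₚ.≡-dec ℤ._≟_ (score2 {n} T) s) (allVecs-Unique (M n))

  vertex-score : ∀ x → score2 {n} (vertex x) ≡ s
  vertex-score x = proj₂ (∈ₚ.∈-filter⁻ (λ T → Vecₚ.≡-dec ℤ._≟_ (score2 {n} T) s) {xs = allVecs (M n)} (∈ₚ.∈-lookup x))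

  vertex-injective : ∀ {x y} → vertex x ≡ vertex y → x ≡ y
  vertex-injective = lookup-injective (verts n s) verts-Unique

  index : ∀ (T : Tournament n) → score2 {n} T ≡ s → ∃ λ x → vertex x ≡ T
  index T sc = Any.index T∈ , sym (Anyₚ.lookup-index T∈)
    where T∈ : T ∈ verts n s
          T∈ = ∈ₚ.∈-filter⁺ (λ T → Vecₚ.≡-dec ℤ._≟_ (score2 {n} T) s) (allVecs-complete T) sc

-- Restriction of tournaments to three indices

module _ {A : Set} where

  ∑-≡0 : ∀ (xs : List A) {f : A → ℤ} → (∀ {x} → x ∈ xs → f x ≡ 0ℤ) → ∑ xs f ≡ 0ℤ
  ∑-≡0 xs p = trans (∑-cong-∈ xs p) (∑-zero xs)

  pairs-≡0 : ∀ (xs : List A) {k : A → A → ℤ} → Unique xs → (∀ {x y} → x ∈ xs → y ∈ xs → x ≢ y → k x y ≡ 0ℤ) → pairs xs k ≡ 0ℤ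
  pairs-≡0 []       u        p = refl
  pairs-≡0 (x ∷ xs) (x∉ ∷ u) p = cong₂ _+_
    (∑-≡0 xs (λ y∈ → p (here refl) (there y∈) (All.lookup x∉ y∈))) (pairs-≡0 xs u (λ a b → p (there a) (there b)))

  triples-≡0 : ∀ (xs : List A) {t : A → A → A → ℤ} → Unique xs →
               (∀ {x y z} → x ∈ xs → y ∈ xs → z ∈ xs → x ≢ y → x ≢ z → y ≢ z → t x y z ≡ 0ℤ) → triples xs t ≡ 0ℤ
  triples-≡0 []       u        p = refl
  triples-≡0 (x ∷ xs) (x∉ ∷ u) p = cong₂ _+_
    (pairs-≡0 xs u (λ y∈ z∈ → p (here refl) (there y∈) (there z∈) (All.lookup x∉ y∈) (All.lookup x∉ z∈)))
    (triples-≡0 xs u (λ a b c → p (there a) (there b) (there c)))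

  three-terms : ∀ (x y z : A) R (t : A → A → A → ℤ) (c : A → A → ℤ) →
    ∑ R (t x y) ≡ 0ℤ → ∑ R (t x z) ≡ 0ℤ → pairs R (t x) ≡ 0ℤ → ∑ R (t y z) ≡ 0ℤ → pairs R (t y) ≡ 0ℤ → pairs R (t z) ≡ 0ℤ →
    triples R t ≡ 0ℤ → ∑ R (c x) ≡ 0ℤ → ∑ R (c y) ≡ 0ℤ → ∑ R (c z) ≡ 0ℤ → pairs R c ≡ 0ℤ →
    triples (x ∷ y ∷ z ∷ R) t + pairs (x ∷ y ∷ z ∷ R) c ≡ t x y z + (c x y + c x z + c y z)
  three-terms x y z R t c e₁ e₂ e₃ e₄ e₅ e₆ e₇ e₈ e₉ e₁₀ e₁₁
    rewrite e₁ | e₂ | e₃ | e₄ | e₅ | e₆ | e₇ | e₈ | e₉ | e₁₀ | e₁₁ = identity (t x y z) (c x y) (c x z) (c y z)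
    where identity : ∀ t a b c → t + 0ℤ + (0ℤ + 0ℤ) + (0ℤ + 0ℤ + (0ℤ + 0ℤ)) + (a + (b + 0ℤ) + (c + 0ℤ + (0ℤ + 0ℤ))) ≡ t + (a + b + c)
          identity = solve-∀

module _ {n : ℕ} where

  τ-ext : ∀ (T T′ : Tournament n) → (∀ (u v : V n) → u ≢ v → τ T u v ≡ τ T′ u v) → T ≡ T′
  τ-ext T T′ eq = at-ext (edges n) T T′ (edges-Unique n) pointwise
    where
    xor-false : ∀ {a b} → (a xor b) ≡ false → a ≡ b
    xor-false {true}  {true}  _ = refl
    xor-false {false} {false} _ = refl
    pointwise : ∀ {e} → e ∈ edges n → val T e ≡ val T′ e
    pointwise e∈ with edges-ed n e∈
    ... | a , b , a≢b , refl = xor-false (trans (differ-τ T T′ a b) (trans (cong (_xor τ T′ a b) (eq a b a≢b)) (𝔹ₚ.xor-same (τ T′ a b))))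

  opaque
    unfolding τ

    val-τ : ∀ (T T′ : Tournament n) (u v : V n) → val T (ed u v) ≡ val T′ (ed u v) → τ T u v ≡ τ T′ u v
    val-τ T T′ u v = cong (turn (orient u v))

  at-map : ∀ (L : List (Edge n)) (g : Edge n → Bool) {e} → e ∈ L → at L (Vec.map g (fromList L)) e ≡ g e
  at-map (f ∷ L) g {e} e∈ with e ==E f in eq
  ... | true  = cong g (sym (==E-sound e f eq))
  at-map (f ∷ L) g (here refl) | false = case trans (sym eq) (==E-refl f) of λ ()
  at-map (f ∷ L) g (there e∈)  | false = at-map L g e∈

  opaque
    unfolding tr

    ∈E-tr : ∀ {e} {u v w : V n} → (e ∈E tr u v w) ≡ true → e ≡ ed u v ⊎ e ≡ ed v w ⊎ e ≡ ed u w
    ∈E-tr {e} {u} {v} {w} p with e ==E ed u v in q | e ==E ed v w in r | e ==E ed u w in t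
    ... | true  | _     | _    = inj₁ (==E-sound e _ q)
    ... | false | true  | _    = inj₂ (inj₁ (==E-sound e _ r))
    ... | false | false | true = inj₂ (inj₂ (==E-sound e _ t))

all-sound : ∀ {A : Set} (P : A → Bool) (xs : List A) → List.foldr (λ x b → P x ∧ b) true xs ≡ true → ∀ {x} → x ∈ xs → P x ≡ true
all-sound P (x ∷ xs) ok (here refl) = proj₁ (∧-sound ok)
all-sound P (x ∷ xs) ok (there x∈)  = all-sound P xs (proj₂ (∧-sound {P x} ok)) x∈

-- A crystal moves only games between three indices. Restricting along a chart reduces questions
-- about it to K_{C_3}, where finite evaluation decides them.
module Restrict {n : ℕ} (ch : Chart 3 n) where

  open Chart ch

  head₃ tail₃ : Edge 3 → V 3
  head₃ f = proj₁ (ends f)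
  tail₃ f = proj₂ (ends f)

  ρ : Tournament n → Tournament 3
  ρ T = Vec.map (λ f → τ T (ι (head₃ f)) (ι (tail₃ f))) (fromList (edges 3))

  opaque
    unfolding ed orient τ

    ρ-ends : ∀ (T : Tournament n) {f} → f ∈ edges 3 → τ (ρ T) (head₃ f) (tail₃ f) ≡ τ T (ι (head₃ f)) (ι (tail₃ f))
    ρ-ends T {f} f∈ with ∧-sound {ed (head₃ f) (tail₃ f) ==E f} (all-sound (λ f → (ed (head₃ f) (tail₃ f) ==E f) ∧ orient (head₃ f) (tail₃ f)) (edges 3) refl f∈)
    ... | same-edge , positive = trans (cong₂ (λ o e → turn o (val (ρ T) e)) positive (==E-sound (ed (head₃ f) (tail₃ f)) f same-edge))
      (at-map (edges 3) (λ f → τ T (ι (head₃ f)) (ι (tail₃ f))) f∈)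

  ρ-~ : ∀ (T : Tournament n) {x y a b} → x ≢ y → (x , y) ~ (a , b) → τ (ρ T) x y ≡ τ T (ι x) (ι y) → τ (ρ T) a b ≡ τ T (ι a) (ι b)
  ρ-~ T ne keep eq = eq
  ρ-~ T ne swop eq = trans (τ-swap (ρ T) ne) (trans (cong not eq) (sym (τ-swap T (ι-≢ ne))))
  ρ-~ T {x} {y} ne mirror eq = trans (τ-bar (ρ T) x y) (trans (cong not eq) (sym (trans (cong₂ (τ T) (ι-bar x) (ι-bar y)) (τ-bar T (ι x) (ι y)))))
  ρ-~ T {x} {y} ne both eq = trans (τ-mirror (ρ T) ne) (trans eq (sym (trans (cong₂ (τ T) (ι-bar y) (ι-bar x)) (τ-mirror T (ι-≢ ne)))))

  ρ-τ : ∀ (T : Tournament n) a b → a ≢ b → τ (ρ T) a b ≡ τ T (ι a) (ι b)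
  ρ-τ T a b ne = ρ-~ T ends-≢ (ends-ed a b ne) (ρ-ends T (ed-∈ 3 a b ne))
    where
    ends-≢ : head₃ (ed a b) ≢ tail₃ (ed a b)
    ends-≢ eq = go (ends (ed a b)) eq (ends-ed a b ne)
      where
      go : ∀ p → proj₁ p ≡ proj₂ p → p ~ (a , b) → ⊥
      go _ refl keep   = ne refl
      go _ refl swop   = ne refl
      go _ refl mirror = ne refl
      go _ refl both   = ne refl

  Distinct-ι : ∀ {a b c} → Distinct a b c → Distinct (ι a) (ι b) (ι c)
  Distinct-ι (p , q , r) = ι-≢ p , ι-≢ q , ι-≢ r

  neut-ρ : ∀ (T : Tournament n) {a b c} → Distinct a b c → neut (ρ T) (tr a b c) ≡ neut T (tr (ι a) (ι b) (ι c))
  neut-ρ T {a} {b} {c} D@(p , q , r) = trans (neutral-bits (ρ T) D (ρ-τ T a b p) (ρ-τ T b c q) (ρ-τ T c a (r ∘ sym)))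
                                            (sym (neutral-bits T (Distinct-ι D) refl refl refl))

  opaque
    unfolding tr

    ∈E-ι : ∀ {x y a b c} → x ≢ y → Distinct a b c → (ed (ι x) (ι y) ∈E tr (ι a) (ι b) (ι c)) ≡ (ed x y ∈E tr a b c)
    ∈E-ι ne (p , q , r) = cong₂ _∨_ (chart-== ne p) (cong₂ _∨_ (chart-== ne q) (cong₂ _∨_ (chart-== ne r) refl))

  opaque
    unfolding _⟲_

    τ-⟲ : ∀ {m} (T : Tournament m) (S : List (Edge m)) {u v : V m} → u ≢ v → τ (T ⟲ S) u v ≡ (ed u v ∈E S) xor τ T u v
    τ-⟲ T S ne = τ-⊕ T (_∈E S) ne

    val-⟲ : ∀ {m} (T : Tournament m) (S : List (Edge m)) {e} → e ∈ edges m → val (T ⟲ S) e ≡ (e ∈E S) xor val T e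
    val-⟲ {m} T S e∈ = at-flip (edges m) (_∈E S) T e∈

  ρ-⟲ : ∀ (T : Tournament n) {a b c} → Distinct a b c → ρ (T ⟲ tr (ι a) (ι b) (ι c)) ≡ ρ T ⟲ tr a b c
  ρ-⟲ T {a} {b} {c} D = τ-ext _ _ λ x y ne → begin
    τ (ρ (T ⟲ tr (ι a) (ι b) (ι c))) x y                          ≡⟨ ρ-τ (T ⟲ tr (ι a) (ι b) (ι c)) x y ne ⟩
    τ (T ⟲ tr (ι a) (ι b) (ι c)) (ι x) (ι y)                      ≡⟨ τ-⟲ T (tr (ι a) (ι b) (ι c)) (ι-≢ ne) ⟩
    (ed (ι x) (ι y) ∈E tr (ι a) (ι b) (ι c)) xor τ T (ι x) (ι y)  ≡⟨ cong₂ _xor_ (∈E-ι ne D) (sym (ρ-τ T x y ne)) ⟩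
    (ed x y ∈E tr a b c) xor τ (ρ T) x y                          ≡⟨ τ-⟲ (ρ T) (tr a b c) ne ⟨
    τ (ρ T ⟲ tr a b c) x y                                        ∎
    where open ≡-Reasoning

  i₀ i₁ i₂ : Fin n
  i₀ = ix (ι (# 0 , true))
  i₁ = ix (ι (# 1 , true))
  i₂ = ix (ι (# 2 , true))

  inside : Fin n → Bool
  inside l = (l ==F i₀) ∨ ((l ==F i₁) ∨ (l ==F i₂))

  at-index : ∀ (u : V n) j → ix u ≡ ix (ι (j , true)) → ∃ λ a → ι a ≡ u
  at-index u j eq with u ≟V ι (j , true)
  ... | yes same-sign = (j , true) , sym same-sign
  ... | no ne = (j , false) , trans (ι-bar (j , true)) (sym (opposite-sign (ne ∘ sym) (sym eq)))

  lift : ∀ (u : V n) → inside (ix u) ≡ true → ∃ λ a → ι a ≡ u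
  lift u p with ix u ==F i₀ in q | ix u ==F i₁ in r | ix u ==F i₂ in t
  ... | true  | _     | _    = at-index u (# 0) (==F-sound q)
  ... | false | true  | _    = at-index u (# 1) (==F-sound r)
  ... | false | false | true = at-index u (# 2) (==F-sound t)

  inside-ι⁺ : ∀ j → inside (ix (ι (j , true))) ≡ true
  inside-ι⁺ fzero               rewrite ==F-refl i₀ = refl
  inside-ι⁺ (fsuc fzero)        rewrite ==F-refl i₁ = 𝔹ₚ.∨-zeroʳ (i₁ ==F i₀)
  inside-ι⁺ (fsuc (fsuc fzero)) rewrite ==F-refl i₂ | 𝔹ₚ.∨-zeroʳ (i₂ ==F i₁) = 𝔹ₚ.∨-zeroʳ (i₂ ==F i₀)

  inside-ι : ∀ a → inside (ix (ι a)) ≡ true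
  inside-ι (j , true)  = inside-ι⁺ j
  inside-ι (j , false) = trans (cong (inside ∘ ix) (ι-bar (j , true))) (inside-ι⁺ j)

  local : Edge n → Bool
  local e = inside (ix (proj₁ (ends e))) ∧ inside (ix (proj₂ (ends e)))

  local-ed : ∀ u v → u ≢ v → local (ed u v) ≡ inside (ix u) ∧ inside (ix v)
  local-ed u v ne = go (ends-ed u v ne)
    where
    go : ∀ {p q : V n × V n} → p ~ q → inside (ix (proj₁ p)) ∧ inside (ix (proj₂ p)) ≡ inside (ix (proj₁ q)) ∧ inside (ix (proj₂ q))
    go keep = refl
    go (swop {a} {b}) = 𝔹ₚ.∧-comm (inside (ix a)) (inside (ix b))
    go mirror = refl
    go (both {a} {b}) = 𝔹ₚ.∧-comm (inside (ix a)) (inside (ix b))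

  Agree : Tournament n → Tournament n → Set
  Agree T T′ = ∀ {e} → e ∈ edges n → local e ≡ false → val T e ≡ val T′ e

  Agree-trans : ∀ {T T′ T″} → Agree T T′ → Agree T′ T″ → Agree T T″
  Agree-trans p q e∈ l = trans (p e∈ l) (q e∈ l)

  Agree-sym : ∀ {T T′} → Agree T T′ → Agree T′ T
  Agree-sym p e∈ l = sym (p e∈ l)

  Agree-ext : ∀ {T T′} → Agree T T′ → ρ T ≡ ρ T′ → T ≡ T′
  Agree-ext {T} {T′} ag eq = τ-ext T T′ λ u v ne → go u v ne (inside (ix u)) (inside (ix v)) refl refl
    where
    go : ∀ u v → u ≢ v → ∀ x y → inside (ix u) ≡ x → inside (ix v) ≡ y → τ T u v ≡ τ T′ u v
    go u v ne true true p q with lift u p | lift v q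
    ... | a , refl | b , refl = trans (sym (ρ-τ T a b (ne ∘ cong ι))) (trans (cong (λ t → τ t a b) eq) (ρ-τ T′ a b (ne ∘ cong ι)))
    go u v ne false y p q = val-τ T T′ u v (ag (ed-∈ n u v ne) (trans (local-ed u v ne) (cong (_∧ inside (ix v)) p)))
    go u v ne true false p q = val-τ T T′ u v (ag (ed-∈ n u v ne) (trans (local-ed u v ne) (cong₂ _∧_ p q)))

  ∉-local : ∀ {e a b c} → Distinct a b c → local e ≡ false → (e ∈E tr (ι a) (ι b) (ι c)) ≡ false
  ∉-local {e} {a} {b} {c} (p , q , r) out with e ∈E tr (ι a) (ι b) (ι c) in eq
  ... | false = refl
  ... | true  = ⊥-elim ([ clash p , [ clash q , clash r ]′ ]′ (∈E-tr eq))
    where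
    clash : ∀ {x y} → x ≢ y → e ≡ ed (ι x) (ι y) → ⊥
    clash {x} {y} ne refl = case trans (sym out) (trans (local-ed (ι x) (ι y) (ι-≢ ne)) (cong₂ _∧_ (inside-ι x) (inside-ι y))) of λ ()

  Agree-⟲ : ∀ (T : Tournament n) {a b c} → Distinct a b c → Agree T (T ⟲ tr (ι a) (ι b) (ι c))
  Agree-⟲ T {a} {b} {c} D {e} e∈ out = sym (trans (val-⟲ T (tr (ι a) (ι b) (ι c)) e∈) (cong (_xor val T e) (∉-local {e} {a} {b} {c} D out)))

  module _ (T T′ : Tournament n) (ag : Agree T T′) where

    -- A generator with a game outside the chart changes that game, on which T and T′ agree.
    miss : ∀ S (x y : V n) → x ≢ y → (ed x y ∈E S) ≡ true → local (ed x y) ≡ false → ind (hit T T′ S) ≡ 0ℤ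
    miss S x y ne on out = go (hit T T′ S) refl
      where
      go : ∀ b → hit T T′ S ≡ b → ind b ≡ 0ℤ
      go false _  = refl
      go true  eq = ⊥-elim (𝔹ₚ.not-¬ {val T (ed x y)} {val T (ed x y)} refl (sym (begin
        not (val T (ed x y))                     ≡⟨ cong (_xor val T (ed x y)) on ⟨
        (ed x y ∈E S) xor val T (ed x y)         ≡⟨ val-⟲ T S (ed-∈ n x y ne) ⟨
        val (T ⟲ S) (ed x y)                     ≡⟨ cong (λ t → val t (ed x y)) (hit-sound T T′ S eq) ⟩
        val T′ (ed x y)                          ≡⟨ ag (ed-∈ n x y ne) out ⟨
        val T (ed x y)                           ∎)))
        where open ≡-Reasoning

    miss₃ : ∀ u v w → Distinct u v w → inside (ix w) ≡ false → ind (hit T T′ (tr u v w)) ≡ 0ℤ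
    miss₃ u v w (_ , v≢w , _) out = miss (tr u v w) v w v≢w (∈tr₂ u v w)
      (trans (local-ed v w v≢w) (trans (cong (inside (ix v) ∧_) out) (𝔹ₚ.∧-zeroʳ (inside (ix v)))))

    miss₂ : ∀ u v w → Distinct u v w → inside (ix v) ≡ false → ind (hit T T′ (tr u v w)) ≡ 0ℤ
    miss₂ u v w (u≢v , _) out = miss (tr u v w) u v u≢v (∈tr₁ u v w)
      (trans (local-ed u v u≢v) (trans (cong (inside (ix u) ∧_) out) (𝔹ₚ.∧-zeroʳ (inside (ix u)))))

    hit-ρ : ∀ {a b c} → Distinct a b c → hit T T′ (tr (ι a) (ι b) (ι c)) ≡ hit (ρ T) (ρ T′) (tr a b c)
    hit-ρ {a} {b} {c} D = cong₂ _∧_ (sym (neut-ρ T D)) (iff forward backward)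
      where
      S : List (Edge n)
      S = tr (ι a) (ι b) (ι c)
      iff : ∀ {x y} → (x ≡ true → y ≡ true) → (y ≡ true → x ≡ true) → x ≡ y
      iff {true}  {true}  _ _ = refl
      iff {true}  {false} f _ = sym (f refl)
      iff {false} {true}  _ g = g refl
      iff {false} {false} _ _ = refl
      forward : _==T_ {n} (T ⟲ S) T′ ≡ true → _==T_ {3} (ρ T ⟲ tr a b c) (ρ T′) ≡ true
      forward p = ==T-complete {3} {ρ T ⟲ tr a b c} {ρ T′} (trans (sym (ρ-⟲ T D)) (cong ρ (==T-sound {n} {T ⟲ S} {T′} p)))
      backward : _==T_ {3} (ρ T ⟲ tr a b c) (ρ T′) ≡ true → _==T_ {n} (T ⟲ S) T′ ≡ true
      backward p = ==T-complete {n} {T ⟲ S} {T′}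
        (Agree-ext (Agree-trans {T ⟲ S} {T} {T′} (Agree-sym {T} {T ⟲ S} (Agree-⟲ T D)) ag) (trans (ρ-⟲ T D) (==T-sound {3} {ρ T ⟲ tr a b c} {ρ T′} p)))

    private
      distinct₃ : ∀ {x y z : Fin 3} {a b c} → x ≢ y → y ≢ z → x ≢ z → Distinct (x , a) (y , b) (z , c)
      distinct₃ p q r = apart p , apart q , apart r

      index-≢ : ∀ {x y} → x ≢ y → ix (ι (x , true)) ≢ ix (ι (y , true))
      index-≢ {x} {y} ne eq with ι (x , true) ≟V ι (y , true)
      ... | yes same-vertex = ne (cong proj₁ (ι-inj same-vertex))
      ... | no differ₀ = ne (sym (cong proj₁ (ι-inj (trans (opposite-sign differ₀ eq) (sym (ι-bar (x , true)))))))

      n₀₁ : i₀ ≢ i₁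
      n₀₁ = index-≢ (λ ())
      n₁₂ : i₁ ≢ i₂
      n₁₂ = index-≢ (λ ())
      n₀₂ : i₀ ≢ i₂
      n₀₂ = index-≢ (λ ())

    module Big = Shapes {n} (λ S → ind (hit {n} T T′ S)) (hit-respects {n} T T′)
    module Small = Shapes {3} (λ S → ind (hit {3} (ρ T) (ρ T′) S)) (hit-respects {3} (ρ T) (ρ T′))

    private
      θ-ρ : ∀ {a b c u v w} → Distinct a b c → ι a ≡ u → ι b ≡ v → ι c ≡ w → Big.θ′ u v w ≡ Small.θ′ a b c
      θ-ρ D refl refl refl = cong ind (hit-ρ D)

      big-small₃ : Big.triangles i₀ i₁ i₂ ≡ Small.triangles (# 0) (# 1) (# 2)
      big-small₃ = trans (Big.triangles-signed (ι (# 0 , true)) (ι (# 1 , true)) (ι (# 2 , true)))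
        (trans (cong₂ _+_ (cong₂ _+_ (cong₂ _+_ (θ-ρ D refl refl refl) (θ-ρ D (ι-bar (# 0 , true)) refl refl))
          (θ-ρ D refl (ι-bar (# 1 , true)) refl)) (θ-ρ D refl refl (ι-bar (# 2 , true))))
        (sym (Small.triangles-signed (# 0 , true) (# 1 , true) (# 2 , true))))
        where D : ∀ {a b c} → Distinct (# 0 , a) (# 1 , b) (# 2 , c)
              D = distinct₃ (λ ()) (λ ()) (λ ())

      big-small₂ : ∀ x y → x ≢ y → Big.clovers (ix (ι (x , true))) (ix (ι (y , true))) ≡ Small.clovers x y
      big-small₂ x y ne = trans (Big.clovers-signed (ι (x , true)) (ι (y , true)))
        (cong₂ (λ p q → twice p + twice q) (θ-ρ (bar-distinct ne) refl refl (ι-bar (x , true)))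
          (θ-ρ (bar-distinct (ne ∘ sym)) refl refl (ι-bar (y , true))))

    -- Generators that use an index outside the chart cannot lead from T to T′; the others
    -- correspond to generators of K_{C_3}, with the same neutrality and the same multiplicity.
    multT-ρ : multT {n} T T′ ≡ multT {3} (ρ T) (ρ T′)
    multT-ρ with extract (∈ₚ.∈-allFin i₀)
    ... | L₁ , p₁ with extract (∈-tail p₁ i₁ (n₀₁ ∘ sym))
    ... | L₂ , p₂ with ∈-tail (Perm.trans p₁ (prep _ p₂)) i₂ (n₀₂ ∘ sym)
    ... | here eq = contradiction (sym eq) n₁₂
    ... | there w∈ with extract w∈
    ... | R , p₃ = ℤₚ.+-injective (begin
      + multT {n} T T′
        ≡⟨ multT-∑ {n} T T′ ⟩
      ∑ (genShapes n) (hits {n} T T′)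
        ≡⟨ ∑-cong (genShapes n) {hits {n} T T′} {Big.weighted} (λ { (k , S) → refl }) ⟩
      ∑ (genShapes n) Big.weighted
        ≡⟨ Big.∑-shapes ⟩
      triples (allFin n) Big.triangles + pairs (allFin n) Big.clovers
        ≡⟨ cong₂ _+_ (triples-↭ Big.triangles Big.triangles-swap₁₂ Big.triangles-swap₂₃ perm) (pairs-↭ Big.clovers Big.clovers-sym perm) ⟩
      triples (i₀ ∷ i₁ ∷ i₂ ∷ R) Big.triangles + pairs (i₀ ∷ i₁ ∷ i₂ ∷ R) Big.clovers
        ≡⟨ three-terms i₀ i₁ i₂ R Big.triangles Big.clovers
             (∑-≡0 R (λ l∈ → far₃ n₀₁ (i₁∉ l∈) (i₀∉ l∈) (out l∈))) (∑-≡0 R (λ l∈ → far₃ n₀₂ (i₂∉ l∈) (i₀∉ l∈) (out l∈)))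
             (spread i₀ i₀∉) (∑-≡0 R (λ l∈ → far₃ n₁₂ (i₂∉ l∈) (i₁∉ l∈) (out l∈)))
             (spread i₁ i₁∉) (spread i₂ i₂∉)
             (triples-≡0 R uniqueR (λ _ _ z∈ a b c → far₃ a c b (out z∈)))
             (∑-≡0 R (λ l∈ → far₂ (i₀∉ l∈) (out l∈))) (∑-≡0 R (λ l∈ → far₂ (i₁∉ l∈) (out l∈))) (∑-≡0 R (λ l∈ → far₂ (i₂∉ l∈) (out l∈)))
             (pairs-≡0 R uniqueR (λ _ m∈ ne → far₂ ne (out m∈))) ⟩
      Big.triangles i₀ i₁ i₂ + (Big.clovers i₀ i₁ + Big.clovers i₀ i₂ + Big.clovers i₁ i₂)
        ≡⟨ cong₂ _+_ big-small₃ (cong₂ _+_ (cong₂ _+_ (big-small₂ (# 0) (# 1) (λ ())) (big-small₂ (# 0) (# 2) (λ ()))) (big-small₂ (# 1) (# 2) (λ ()))) ⟩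
      Small.triangles (# 0) (# 1) (# 2) + (Small.clovers (# 0) (# 1) + Small.clovers (# 0) (# 2) + Small.clovers (# 1) (# 2))
        ≡⟨ three-terms (# 0) (# 1) (# 2) [] Small.triangles Small.clovers refl refl refl refl refl refl refl refl refl refl refl ⟨
      triples (allFin 3) Small.triangles + pairs (allFin 3) Small.clovers
        ≡⟨ Small.∑-shapes ⟨
      ∑ (genShapes 3) Small.weighted
        ≡⟨ ∑-cong (genShapes 3) {Small.weighted} {hits {3} (ρ T) (ρ T′)} (λ { (k , S) → refl }) ⟩
      ∑ (genShapes 3) (hits {3} (ρ T) (ρ T′))
        ≡⟨ multT-∑ {3} (ρ T) (ρ T′) ⟨
      + multT {3} (ρ T) (ρ T′) ∎)
      where
      open ≡-Reasoning
      perm : allFin n ↭ i₀ ∷ i₁ ∷ i₂ ∷ R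
      perm = Perm.trans p₁ (prep _ (Perm.trans p₂ (prep _ p₃)))
      unique : Unique (i₀ ∷ i₁ ∷ i₂ ∷ R)
      unique = Unique-↭ perm (Uniqueₚ.allFin⁺ n)
      uniqueR : Unique R
      uniqueR = unique-drop (unique-drop (unique-drop unique))
      i₀∉ : ∀ {l} → l ∈ R → i₀ ≢ l
      i₀∉ l∈ = unique-head unique (there (there l∈))
      i₁∉ : ∀ {l} → l ∈ R → i₁ ≢ l
      i₁∉ l∈ = unique-head (unique-drop unique) (there l∈)
      i₂∉ : ∀ {l} → l ∈ R → i₂ ≢ l
      i₂∉ l∈ = unique-head (unique-drop (unique-drop unique)) l∈
      out : ∀ {l} → l ∈ R → inside l ≡ false
      out l∈ rewrite ==F-≢ (i₀∉ l∈ ∘ sym) | ==F-≢ (i₁∉ l∈ ∘ sym) | ==F-≢ (i₂∉ l∈ ∘ sym) = refl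
      far₃ : ∀ {p q l} → p ≢ q → q ≢ l → p ≢ l → inside l ≡ false → Big.triangles p q l ≡ 0ℤ
      far₃ {p} {q} {l} pq ql pl o = cong₂ _+_ (cong₂ _+_ (cong₂ _+_ (z true true) (z true false)) (z false false)) (z false true)
        where z : ∀ b c → Big.θ′ (p , true) (q , b) (l , c) ≡ 0ℤ
              z b c = miss₃ (p , true) (q , b) (l , c) (apart pq , apart ql , apart pl) o
      far₂ : ∀ {p l} → p ≢ l → inside l ≡ false → Big.clovers p l ≡ 0ℤ
      far₂ {p} {l} ne o = cong₂ (λ a b → twice a + twice b)
        (miss₂ (p , true) (l , true) (p , false) (bar-distinct ne) o)
        (miss₃ (l , true) (p , true) (l , false) (bar-distinct (ne ∘ sym)) o)
      spread : ∀ p → (∀ {l} → l ∈ R → p ≢ l) → pairs R (Big.triangles p) ≡ 0ℤ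
      spread p p∉ = pairs-≡0 R uniqueR (λ l∈ m∈ ne → far₃ (p∉ l∈) ne (p∉ m∈) (out m∈))

  -- A generator that leaves the chart has at most one game inside it.
  local-once : ∀ {u v w : V n} → Distinct u v w → inside (ix u) ∧ (inside (ix v) ∧ inside (ix w)) ≡ false → ∀ {e f} →
               (e ∈E tr u v w) ≡ true → (f ∈E tr u v w) ≡ true → local e ≡ true → local f ≡ true → e ≡ f
  local-once {u} {v} {w} (u≢v , v≢w , u≢w) out e∈ f∈ le lf = go (∈E-tr e∈) (∈E-tr f∈) le lf
    where
    both-in : ∀ {a b} → a ≢ b → local (ed a b) ≡ true → inside (ix a) ≡ true × inside (ix b) ≡ true
    both-in {a} {b} ne l = ∧-sound (trans (sym (local-ed a b ne)) l)
    absurd : inside (ix u) ≡ true → inside (ix v) ≡ true → inside (ix w) ≡ true → ∀ {A : Set} → A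
    absurd p q r = case trans (sym out) (cong₂ _∧_ p (cong₂ _∧_ q r)) of λ ()
    go : ∀ {e f} → e ≡ ed u v ⊎ e ≡ ed v w ⊎ e ≡ ed u w → f ≡ ed u v ⊎ f ≡ ed v w ⊎ f ≡ ed u w → local e ≡ true → local f ≡ true → e ≡ f
    go (inj₁ refl) (inj₁ refl) _ _ = refl
    go (inj₁ refl) (inj₂ (inj₁ refl)) p q = absurd (proj₁ (both-in u≢v p)) (proj₂ (both-in u≢v p)) (proj₂ (both-in v≢w q))
    go (inj₁ refl) (inj₂ (inj₂ refl)) p q = absurd (proj₁ (both-in u≢v p)) (proj₂ (both-in u≢v p)) (proj₂ (both-in u≢w q))
    go (inj₂ (inj₁ refl)) (inj₁ refl) p q = absurd (proj₁ (both-in u≢v q)) (proj₂ (both-in u≢v q)) (proj₂ (both-in v≢w p))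
    go (inj₂ (inj₁ refl)) (inj₂ (inj₁ refl)) _ _ = refl
    go (inj₂ (inj₁ refl)) (inj₂ (inj₂ refl)) p q = absurd (proj₁ (both-in u≢w q)) (proj₁ (both-in v≢w p)) (proj₂ (both-in u≢w q))
    go (inj₂ (inj₂ refl)) (inj₁ refl) p q = absurd (proj₁ (both-in u≢v q)) (proj₂ (both-in u≢v q)) (proj₂ (both-in u≢w p))
    go (inj₂ (inj₂ refl)) (inj₂ (inj₁ refl)) p q = absurd (proj₁ (both-in u≢w p)) (proj₁ (both-in v≢w q)) (proj₂ (both-in u≢w p))
    go (inj₂ (inj₂ refl)) (inj₂ (inj₂ refl)) _ _ = refl

  ιE : Edge 3 → Edge n
  ιE f = ed (ι (head₃ f)) (ι (tail₃ f))

  opaque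
    unfolding ed

    ends-edge₃ : ∀ {f} → f ∈ edges 3 → ed (head₃ f) (tail₃ f) ≡ f
    ends-edge₃ {f} f∈ = ==E-sound (ed (head₃ f) (tail₃ f)) f (all-sound (λ f → ed (head₃ f) (tail₃ f) ==E f) (edges 3) refl f∈)

  ends-≢₃ : ∀ (f : Edge 3) → f ∈ edges 3 → head₃ f ≢ tail₃ f
  ends-≢₃ f f∈ eq = does-no (head₃ f ≟V tail₃ f) (all-sound (λ f → not (does (head₃ f ≟V tail₃ f))) (edges 3) refl f∈) eq
    where does-no : ∀ {P : Set} (d : Dec P) → not (does d) ≡ true → ¬ P
          does-no (no ¬p) _ = ¬p

  ιE-injective : ∀ {f g} → f ∈ edges 3 → g ∈ edges 3 → ιE f ≡ ιE g → f ≡ g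
  ιE-injective {f} {g} f∈ g∈ eq = trans (sym (ends-edge₃ f∈)) (trans
    (==E-sound _ _ (trans (sym (chart-== (ends-≢₃ f f∈) (ends-≢₃ g g∈))) (==E-≡ eq))) (ends-edge₃ g∈))

  val-ρ : ∀ (T : Tournament n) {f} → f ∈ edges 3 → val (ρ T) f ≡ τ T (ι (head₃ f)) (ι (tail₃ f))
  val-ρ T f∈ = at-map (edges 3) (λ f → τ T (ι (head₃ f)) (ι (tail₃ f))) f∈

  differ-ρ : ∀ (T T′ : Tournament n) {f} → f ∈ edges 3 → differ {n} T T′ (ιE f) ≡ differ {3} (ρ T) (ρ T′) f
  differ-ρ T T′ {f} f∈ = trans (differ-τ T T′ (ι (head₃ f)) (ι (tail₃ f))) (sym (cong₂ _xor_ (val-ρ T f∈) (val-ρ T′ f∈)))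

  ιE-local : ∀ {f} → f ∈ edges 3 → local (ιE f) ≡ true
  ιE-local {f} f∈ = trans (local-ed _ _ (ι-≢ (ends-≢₃ f f∈))) (cong₂ _∧_ (inside-ι (head₃ f)) (inside-ι (tail₃ f)))

  -- If S leaves the chart, the outer game it flips must be flipped back by S′, so S′ leaves the
  -- chart as well. Each of them then has at most one game inside, too few to produce the three
  -- inner games on which p and q differ.
  midpoint-local : ∀ (p m q : Tournament n) {S S′ : List (Edge n)} → Agree p q → IsGenerator S → IsGenerator S′ → p ⟲ S ≡ m → m ⟲ S′ ≡ q →
    ∀ {f₁ f₂ f₃} → f₁ ∈ edges 3 → f₂ ∈ edges 3 → f₃ ∈ edges 3 → f₁ ≢ f₂ → f₁ ≢ f₃ → f₂ ≢ f₃ →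
    differ {3} (ρ p) (ρ q) f₁ ≡ true → differ {3} (ρ p) (ρ q) f₂ ≡ true → differ {3} (ρ p) (ρ q) f₃ ≡ true →
    ∃ λ a → ∃ λ b → ∃ λ c → Distinct a b c × S ≡ tr (ι a) (ι b) (ι c)
  midpoint-local p m q ag (u , v , w , D@(u≢v , v≢w , u≢w) , refl) (u′ , v′ , w′ , D′@(u′≢v′ , v′≢w′ , u′≢w′) , refl) refl refl
                 {f₁} {f₂} {f₃} m₁ m₂ m₃ n₁₂ n₁₃ n₂₃ d₁ d₂ d₃ = go (inside (ix u)) (inside (ix v)) (inside (ix w)) refl refl refl
    where
    S S′ : List (Edge n)
    S = tr u v w
    S′ = tr u′ v′ w′
    Conclusion : Set
    Conclusion = ∃ λ a → ∃ λ b → ∃ λ c → Distinct a b c × S ≡ tr (ι a) (ι b) (ι c)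
    value : ∀ {e} → e ∈ edges n → differ {n} p (p ⟲ S ⟲ S′) e ≡ (e ∈E S′) xor (e ∈E S)
    value {e} e∈ = trans (cong (val p e xor_) (trans (val-⟲ (p ⟲ S) S′ e∈) (cong ((e ∈E S′) xor_) (val-⟲ p S e∈))))
      (cancel (val p e) (e ∈E S′) (e ∈E S))
      where cancel : ∀ x a b → x xor (a xor (b xor x)) ≡ a xor b
            cancel x a b = by-cases 3 𝔹._≟_ (λ { (x ∷ a ∷ b ∷ []) → x xor (a xor (b xor x)) }) (λ { (x ∷ a ∷ b ∷ []) → a xor b }) refl (x ∷ a ∷ b ∷ [])
    split : ∀ {f} → f ∈ edges 3 → differ {3} (ρ p) (ρ (p ⟲ S ⟲ S′)) f ≡ true → (ιE f ∈E S) ≡ true ⊎ (ιE f ∈E S′) ≡ true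
    split {f} f∈ d = either (ιE f ∈E S′) (ιE f ∈E S) (trans (sym (value (ed-∈ n _ _ (ι-≢ (ends-≢₃ f f∈))))) (trans (differ-ρ p (p ⟲ S ⟲ S′) f∈) d))
      where either : ∀ a b → (a xor b) ≡ true → b ≡ true ⊎ a ≡ true
            either true  b     _ = inj₂ refl
            either false true  _ = inj₁ refl
    -- a game of S outside the chart must be flipped back by S′
    returns : ∀ {x y} → x ≢ y → (ed x y ∈E S) ≡ true → local (ed x y) ≡ false → (ed x y ∈E S′) ≡ true
    returns {x} {y} ne on out = forced (ed x y ∈E S′) (trans (trans (cong ((ed x y ∈E S′) xor_) (sym on)) (sym (value (ed-∈ n x y ne))))
      (trans (cong (val p (ed x y) xor_) (sym (ag (ed-∈ n x y ne) out))) (𝔹ₚ.xor-same (val p (ed x y)))))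
      where forced : ∀ a → (a xor true) ≡ false → a ≡ true
            forced true _ = refl
    leaves′ : ∀ {x y} → (ed x y ∈E S′) ≡ true → local (ed x y) ≡ false → inside (ix u′) ∧ (inside (ix v′) ∧ inside (ix w′)) ≡ false
    leaves′ {x} {y} on out = outside (inside (ix u′)) (inside (ix v′)) (inside (ix w′)) refl refl refl
      where
      clash : ∀ {a b} → a ≢ b → ed x y ≡ ed a b → inside (ix a) ≡ true → inside (ix b) ≡ true → ⊥
      clash {a} {b} ne eq ia ib = case trans (sym out) (trans (cong local eq) (trans (local-ed a b ne) (cong₂ _∧_ ia ib))) of λ ()
      outside : ∀ a b c → inside (ix u′) ≡ a → inside (ix v′) ≡ b → inside (ix w′) ≡ c → a ∧ (b ∧ c) ≡ false
      outside true true true iu iv iw = ⊥-elim ([ (λ eq → clash u′≢v′ eq iu iv) , [ (λ eq → clash v′≢w′ eq iv iw) , (λ eq → clash u′≢w′ eq iu iw) ]′ ]′ (∈E-tr on))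
      outside true true false _ _ _ = refl
      outside true false _ _ _ _ = refl
      outside false _ _ _ _ _ = refl
    crowded : inside (ix u) ∧ (inside (ix v) ∧ inside (ix w)) ≡ false → inside (ix u′) ∧ (inside (ix v′) ∧ inside (ix w′)) ≡ false → ⊥
    crowded out out′ with split m₁ d₁ | split m₂ d₂ | split m₃ d₃
    ... | inj₁ a | inj₁ b | _      = n₁₂ (ιE-injective m₁ m₂ (local-once D out a b (ιE-local m₁) (ιE-local m₂)))
    ... | inj₁ a | inj₂ b | inj₁ c = n₁₃ (ιE-injective m₁ m₃ (local-once D out a c (ιE-local m₁) (ιE-local m₃)))
    ... | inj₁ a | inj₂ b | inj₂ c = n₂₃ (ιE-injective m₂ m₃ (local-once D′ out′ b c (ιE-local m₂) (ιE-local m₃)))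
    ... | inj₂ a | inj₂ b | _      = n₁₂ (ιE-injective m₁ m₂ (local-once D′ out′ a b (ιE-local m₁) (ιE-local m₂)))
    ... | inj₂ a | inj₁ b | inj₁ c = n₂₃ (ιE-injective m₂ m₃ (local-once D out b c (ιE-local m₂) (ιE-local m₃)))
    ... | inj₂ a | inj₁ b | inj₂ c = n₁₃ (ιE-injective m₁ m₃ (local-once D′ out′ a c (ιE-local m₁) (ιE-local m₃)))
    escape : ∀ {x y} → x ≢ y → (ed x y ∈E S) ≡ true → inside (ix x) ∧ inside (ix y) ≡ false → inside (ix u) ∧ (inside (ix v) ∧ inside (ix w)) ≡ false → Conclusion
    escape {x} {y} ne on out outS = ⊥-elim (crowded outS (leaves′ {x} {y} (returns ne on (trans (local-ed x y ne) out)) (trans (local-ed x y ne) out)))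
    go : ∀ a b c → inside (ix u) ≡ a → inside (ix v) ≡ b → inside (ix w) ≡ c → Conclusion
    go true true true iu iv iw with lift u iu | lift v iv | lift w iw
    ... | a , refl | b , refl | c , refl = a , b , c , (u≢v ∘ cong ι , v≢w ∘ cong ι , u≢w ∘ cong ι) , refl
    go false b c iu iv iw = escape u≢v (∈tr₁ u v w) (cong (_∧ inside (ix v)) iu) (cong (_∧ (inside (ix v) ∧ inside (ix w))) iu)
    go true false c iu iv iw = escape u≢v (∈tr₁ u v w) (cong₂ _∧_ iu iv) (cong₂ (λ a b → a ∧ (b ∧ inside (ix w))) iu iv)
    go true true false iu iv iw = escape v≢w (∈tr₂ u v w) (cong₂ _∧_ iv iw) (cong₂ _∧_ iu (cong₂ _∧_ iv iw))

-- The model crystal in K_{C_3} and its copies in larger graphs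

opaque
  unfolding _⟲_ neut

  multT≢0-shape : ∀ {n} (T T′ : Tournament n) → multT {n} T T′ ≢ 0 →
    ∃ λ k → ∃ λ S → (k , S) ∈ genShapes n × neutral {n} T S ≡ true × flipT {n} T S ≡ T′
  multT≢0-shape {n} T T′ ne with ∑≢0 (genShapes n) (hits {n} T T′) (λ eq → ne (ℤₚ.+-injective (trans (multT-∑ {n} T T′) eq)))
  ... | (k , S) , S∈ , term = k , S , S∈ , proj₁ (∧-sound {neutral {n} T S} (on (hit {n} T T′ S) term)) , hit-sound {n} T T′ S (on (hit {n} T T′ S) term)
    where on : ∀ b → + k * ind b ≢ 0ℤ → b ≡ true
          on true  _  = refl
          on false ne = contradiction (ℤₚ.*-zeroʳ (+ k)) ne

-- The crystal on three vertices α = 0, β = 1, δ = 2.  Games are listed as in edges 3: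
-- βα, βᾱ, δα, δᾱ, δβ, δβ̄, αᾱ, ββ̄, δδ̄; the last one plays no role.
corner : Bool → Fin 6 → Tournament 3
corner z fzero                                    = false ∷ true  ∷ true  ∷ false ∷ false ∷ false ∷ false ∷ false ∷ z ∷ []
corner z (fsuc fzero)                             = true  ∷ true  ∷ false ∷ false ∷ true  ∷ false ∷ false ∷ false ∷ z ∷ []
corner z (fsuc (fsuc fzero))                      = true  ∷ false ∷ false ∷ true  ∷ false ∷ false ∷ false ∷ false ∷ z ∷ []
corner z (fsuc (fsuc (fsuc fzero)))               = false ∷ false ∷ false ∷ false ∷ false ∷ true  ∷ false ∷ false ∷ z ∷ []
corner z (fsuc (fsuc (fsuc (fsuc fzero))))        = true  ∷ false ∷ true  ∷ false ∷ false ∷ false ∷ true  ∷ false ∷ z ∷ []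
corner z (fsuc (fsuc (fsuc (fsuc (fsuc fzero))))) = false ∷ false ∷ false ∷ false ∷ true  ∷ false ∷ false ∷ true  ∷ z ∷ []

crystalEdge : ℕ → ℕ → ℕ → ℕ → Bool
crystalEdge i j a b = ((i ℕ.≡ᵇ a) ∧ (j ℕ.≡ᵇ b)) ∨ ((i ℕ.≡ᵇ b) ∧ (j ℕ.≡ᵇ a))

-- a copy of the local definition inside IsCrystalShaped, to which it is definitionally equal
crystalMult : Fin 6 → Fin 6 → ℕ
crystalMult a b =
  let i = toℕ a ; j = toℕ b in
  if crystalEdge i j 0 1 ∨ crystalEdge i j 1 2 ∨ crystalEdge i j 2 3 ∨ crystalEdge i j 3 0 then 1
  else if crystalEdge i j 0 4 ∨ crystalEdge i j 2 4 ∨ crystalEdge i j 1 5 ∨ crystalEdge i j 3 5 then 2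
  else 0

joined : Fin 6 → Fin 6 → Bool
joined i j = not (crystalMult i j ℕ.≡ᵇ 0)

all₂ : (Fin 6 → Fin 6 → Bool) → Bool
all₂ P = List.foldr (λ i b → List.foldr (λ j c → P i j ∧ c) true (allFin 6) ∧ b) true (allFin 6)

all₂-sound : ∀ P → all₂ P ≡ true → ∀ i j → P i j ≡ true
all₂-sound P ok i j = all-sound (P i) (allFin 6) (all-sound (λ i → List.foldr (λ j c → P i j ∧ c) true (allFin 6)) (allFin 6) ok (∈ₚ.∈-allFin i)) (∈ₚ.∈-allFin j)

corner-mult : ∀ z i j → multT {3} (corner z i) (corner z j) ≡ crystalMult i j
corner-mult z i j = ℕₚ.≡ᵇ⇒≡ _ _ (subst T (sym (all₂-sound (λ i j → multT {3} (corner z i) (corner z j) ℕ.≡ᵇ crystalMult i j) (ok z) i j)) tt)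
  where ok : ∀ z → all₂ (λ i j → multT {3} (corner z i) (corner z j) ℕ.≡ᵇ crystalMult i j) ≡ true
        ok true  = refl
        ok false = refl

remote : Fin 6 → Fin 6 → Bool
remote i j = not (i ==F j) ∧ not (joined i j)

is-corner : Bool → Tournament 3 → Bool
is-corner z t = any (λ k → _==T_ {3} t (corner z k)) (allFin 6)

-- Checked by evaluation over all generators of K_{C_3}. It makes the six corners closed under paths
-- of length two, so that the extended network contains nothing else.
corner-midpoint : ∀ z i j → remote i j ≡ true → ∀ {k S} → (k , S) ∈ genShapes 3 → neutral {3} (corner z i) S ≡ true →
                  multT {3} (flipT {3} (corner z i) S) (corner z j) ≢ 0 → is-corner z (flipT {3} (corner z i) S) ≡ true
corner-midpoint z i j far {k} {S} S∈ ne mult≢0 = conclude {k} {S} far (all-sound (check z i j) (genShapes 3) (all₂-sound (λ i j → List.foldr (λ x b → check z i j x ∧ b) true (genShapes 3)) (ok z) i j) S∈) ne mult≢0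
  where
  check : Bool → Fin 6 → Fin 6 → ℕ × List (Edge 3) → Bool
  check z i j (k , S) = if remote i j then (if neutral {3} (corner z i) S then
    (multT {3} (flipT {3} (corner z i) S) (corner z j) ℕ.≡ᵇ 0) ∨ is-corner z (flipT {3} (corner z i) S) else true) else true
  ok : ∀ z → all₂ (λ i j → List.foldr (λ x b → check z i j x ∧ b) true (genShapes 3)) ≡ true
  ok true  = refl
  ok false = refl
  conclude : ∀ {k S} → remote i j ≡ true → check z i j (k , S) ≡ true → neutral {3} (corner z i) S ≡ true →
             multT {3} (flipT {3} (corner z i) S) (corner z j) ≢ 0 → is-corner z (flipT {3} (corner z i) S) ≡ true
  conclude {k} {S} far c ne mult≢0 rewrite far | ne with multT {3} (flipT {3} (corner z i) S) (corner z j)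
  ... | zero  = contradiction refl mult≢0
  ... | suc _ = c

record ThreeApart (t t′ : Tournament 3) : Set where
  field
    f₁ f₂ f₃ : Edge 3
    m₁ : f₁ ∈ edges 3
    m₂ : f₂ ∈ edges 3
    m₃ : f₃ ∈ edges 3
    n₁₂ : f₁ ≢ f₂
    n₁₃ : f₁ ≢ f₃
    n₂₃ : f₂ ≢ f₃
    d₁ : differ {3} t t′ f₁ ≡ true
    d₂ : differ {3} t t′ f₂ ≡ true
    d₃ : differ {3} t t′ f₃ ≡ true

long⇒three : ∀ {t t′ : Tournament 3} fs → Unique fs → (∀ {f} → f ∈ fs → f ∈ edges 3 × differ {3} t t′ f ≡ true) →
             (3 ℕ.≤ᵇ length fs) ≡ true → ThreeApart t t′
long⇒three (f₁ ∷ f₂ ∷ f₃ ∷ fs) ((n₁₂ ∷ n₁₃ ∷ _) ∷ (n₂₃ ∷ _) ∷ _) mem _ = record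
  { f₁ = f₁ ; f₂ = f₂ ; f₃ = f₃ ; n₁₂ = n₁₂ ; n₁₃ = n₁₃ ; n₂₃ = n₂₃
  ; m₁ = proj₁ (mem (here refl)) ; m₂ = proj₁ (mem (there (here refl))) ; m₃ = proj₁ (mem (there (there (here refl))))
  ; d₁ = proj₂ (mem (here refl)) ; d₂ = proj₂ (mem (there (here refl))) ; d₃ = proj₂ (mem (there (there (here refl)))) }

-- Supplies the three differing games with which `midpoint-local` excludes paths through further
-- indices.
three-apart : ∀ z i j → remote i j ≡ true → ThreeApart (corner z i) (corner z j)
three-apart z i j far = long⇒three (moved z i j) (Uniqueₚ.filter⁺ (test z i j) (edges-Unique 3))
  (λ f∈ → ∈ₚ.∈-filter⁻ (test z i j) {xs = edges 3} f∈)
  (conclude far (all₂-sound (λ i j → if remote i j then 3 ℕ.≤ᵇ length (moved z i j) else true) (ok z) i j))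
  where
  test : ∀ z i j (f : Edge 3) → Dec (differ {3} (corner z i) (corner z j) f ≡ true)
  test z i j f = differ {3} (corner z i) (corner z j) f 𝔹.≟ true
  moved : Bool → Fin 6 → Fin 6 → List (Edge 3)
  moved z i j = List.filter (test z i j) (edges 3)
  ok : ∀ z → all₂ (λ i j → if remote i j then 3 ℕ.≤ᵇ length (moved z i j) else true) ≡ true
  ok true  = refl
  ok false = refl
  conclude : ∀ {b c} → b ≡ true → (if b then c else true) ≡ true → c ≡ true
  conclude refl p = p

corner-injective : ∀ z i j → corner z i ≡ corner z j → i ≡ j
corner-injective z i j eq = conclude (all₂-sound (λ i j → (i ==F j) ∨ not (_==T_ {3} (corner z i) (corner z j))) (ok z) i j)
  where
  ok : ∀ z → all₂ (λ i j → (i ==F j) ∨ not (_==T_ {3} (corner z i) (corner z j))) ≡ true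
  ok true  = refl
  ok false = refl
  conclude : ((i ==F j) ∨ not (_==T_ {3} (corner z i) (corner z j))) ≡ true → i ≡ j
  conclude p with i ==F j in q
  ... | true  = ==F-sound q
  ... | false = case trans (sym p) (cong not (==T-complete {3} eq)) of λ ()

∨-sound : ∀ {a b} → (a ∨ b) ≡ true → a ≡ true ⊎ b ≡ true
∨-sound {true}  _ = inj₁ refl
∨-sound {false} p = inj₂ p

∨-left : ∀ {a b} → a ≡ true → (a ∨ b) ≡ true
∨-left refl = refl

∨-right : ∀ {a b} → b ≡ true → (a ∨ b) ≡ true
∨-right {a} refl = 𝔹ₚ.∨-zeroʳ a

any-sound : ∀ {A : Set} (f : A → Bool) xs → any f xs ≡ true → ∃ λ x → x ∈ xs × f x ≡ true
any-sound f (x ∷ xs) p with ∨-sound {f x} p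
... | inj₁ q = x , here refl , q
... | inj₂ q = let y , y∈ , r = any-sound f xs q in y , there y∈ , r

any-complete : ∀ {A : Set} (f : A → Bool) {xs x} → x ∈ xs → f x ≡ true → any f xs ≡ true
any-complete f (here refl) p = ∨-left p
any-complete f {y ∷ xs} (there x∈) p = ∨-right {f y} (any-complete f x∈ p)

anyF-sound : ∀ {m} (f : Fin m → Bool) → anyF f ≡ true → ∃ λ i → f i ≡ true
anyF-sound {m} f p = let i , _ , q = any-sound f (allFin m) p in i , q

anyF-complete : ∀ {m} (f : Fin m → Bool) i → f i ≡ true → anyF f ≡ true
anyF-complete f i p = any-complete f (∈ₚ.∈-allFin i) p

local-inN : Fin 6 → Fin 6 → Fin 6 → Fin 6 → Bool
local-inN p q i j = (((i ==F p) ∨ (i ==F q)) ∧ (joined p j ∧ joined j q)) ∨ (((j ==F p) ∨ (j ==F q)) ∧ (joined p i ∧ joined i q))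

-- Two networks cover the crystal: paths between a and c pass through b, d and y, and paths between
-- b and d bring in the double edges at z.
joined-witness : ∀ i j → joined i j ≡ true → (local-inN (# 0) (# 2) i j ∨ local-inN (# 1) (# 3) i j) ≡ true
joined-witness i j e = conclude e (all₂-sound (λ i j → if joined i j then local-inN (# 0) (# 2) i j ∨ local-inN (# 1) (# 3) i j else true) refl i j)
  where
  conclude : ∀ {b c} → b ≡ true → (if b then c else true) ≡ true → c ≡ true
  conclude refl p = p

-- A vertex whose signed vertices u satisfy u → v, v̄, w, w̄ lies on a crystal; in a suitable chart it is corner 4.
module Crystal {n : ℕ} (s : Vec ℤ n) (Y : Tournament n) (scY : score2 {n} Y ≡ s) (ch : Chart 3 n) (z : Bool)
               (ρY : Restrict.ρ ch Y ≡ corner z (# 4)) where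

  open Chart ch
  open Restrict ch
  open Graph s

  G : Fin (K n s) → Fin (K n s) → ℕ
  G = IntGr n s

  Good : Tournament n → Tournament 3 → Set
  Good T t = score2 {n} T ≡ s × Agree Y T × ρ T ≡ t

  move : Tournament n → V 3 → V 3 → V 3 → Tournament n
  move T a b c = T ⟲ tr (ι a) (ι b) (ι c)

  move-good : ∀ {T t t′} a b c → Good T t → Distinct a b c → neut t (tr a b c) ≡ true → t ⟲ tr a b c ≡ t′ → Good (move T a b c) t′
  move-good {T} {t} a b c (sc , ag , eq) D ne eq′ =
    ⟲-score T (tr (ι a) (ι b) (ι c)) sc (trans (sym (neut-ρ T D)) (trans (cong (λ t → neut t (tr a b c)) eq) ne)) ,
    Agree-trans {Y} {T} {move T a b c} ag (Agree-⟲ T D) ,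
    trans (ρ-⟲ T D) (trans (cong (_⟲ tr a b c) eq) eq′)

  α⁺ α⁻ β⁺ β⁻ δ⁺ : V 3
  α⁺ = # 0 , true
  α⁻ = # 0 , false
  β⁺ = # 1 , true
  β⁻ = # 1 , false
  δ⁺ = # 2 , true

  -- Every corner is reached along edges of the crystal: a and c from y by clovers, b and d from a
  -- by triangles, and z from b by a clover.
  point : Fin 6 → Tournament n
  point fzero                                    = move Y β⁺ α⁺ α⁻
  point (fsuc fzero)                             = move (move Y β⁺ α⁺ α⁻) α⁺ β⁺ δ⁺
  point (fsuc (fsuc fzero))                      = move Y δ⁺ α⁺ α⁻
  point (fsuc (fsuc (fsuc fzero)))               = move (move Y β⁺ α⁺ α⁻) α⁺ β⁻ δ⁺
  point (fsuc (fsuc (fsuc (fsuc fzero))))        = Y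
  point (fsuc (fsuc (fsuc (fsuc (fsuc fzero))))) = move (move (move Y β⁺ α⁺ α⁻) α⁺ β⁺ δ⁺) α⁺ β⁺ β⁻

  opaque
    unfolding _⟲_ neut tr ed

    good₄ : Good Y (corner z (# 4))
    good₄ = scY , (λ _ _ → refl) , ρY

    good₀ : Good (point (# 0)) (corner z (# 0))
    good₀ = move-good {Y} {corner z (# 4)} β⁺ α⁺ α⁻ good₄ ((λ ()) , (λ ()) , (λ ())) refl refl

    good₁ : Good (point (# 1)) (corner z (# 1))
    good₁ = move-good {point (# 0)} {corner z (# 0)} α⁺ β⁺ δ⁺ good₀ ((λ ()) , (λ ()) , (λ ())) refl refl

    good₂ : Good (point (# 2)) (corner z (# 2))
    good₂ = move-good {Y} {corner z (# 4)} δ⁺ α⁺ α⁻ good₄ ((λ ()) , (λ ()) , (λ ())) refl refl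

    good₃ : Good (point (# 3)) (corner z (# 3))
    good₃ = move-good {point (# 0)} {corner z (# 0)} α⁺ β⁻ δ⁺ good₀ ((λ ()) , (λ ()) , (λ ())) refl refl

    good₅ : Good (point (# 5)) (corner z (# 5))
    good₅ = move-good {point (# 1)} {corner z (# 1)} α⁺ β⁺ β⁻ good₁ ((λ ()) , (λ ()) , (λ ())) refl refl

  good : ∀ i → Good (point i) (corner z i)
  good fzero                                    = good₀
  good (fsuc fzero)                             = good₁
  good (fsuc (fsuc fzero))                      = good₂
  good (fsuc (fsuc (fsuc fzero)))               = good₃
  good (fsuc (fsuc (fsuc (fsuc fzero))))        = good₄
  good (fsuc (fsuc (fsuc (fsuc (fsuc fzero))))) = good₅

  name : Fin 6 → Fin (K n s)
  name i = proj₁ (index (point i) (proj₁ (good i)))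

  vertex-name : ∀ i → vertex (name i) ≡ point i
  vertex-name i = proj₂ (index (point i) (proj₁ (good i)))

  agree : ∀ i j → Agree (point i) (point j)
  agree i j = Agree-trans {point i} {Y} {point j} (Agree-sym {Y} {point i} (proj₁ (proj₂ (good i)))) (proj₁ (proj₂ (good j)))

  ρ-point : ∀ i → ρ (point i) ≡ corner z i
  ρ-point i = proj₂ (proj₂ (good i))

  mult-name : ∀ i j → G (name i) (name j) ≡ crystalMult i j
  mult-name i j = trans (cong₂ (multT {n}) (vertex-name i) (vertex-name j))
    (trans (multT-ρ (point i) (point j) (agree i j)) (trans (cong₂ (multT {3}) (ρ-point i) (ρ-point j)) (corner-mult z i j)))

  name-injective : ∀ i j → name i ≡ name j → i ≡ j
  name-injective i j eq = corner-injective z i j (trans (sym (ρ-point i)) (trans (cong ρ (trans (sym (vertex-name i)) (trans (cong vertex eq) (vertex-name j)))) (ρ-point j)))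

  adj≢0 : ∀ x y → adj G x y ≡ true → multT {n} (vertex x) (vertex y) ≢ 0
  adj≢0 x y p eq = case trans (sym p) (cong (λ k → not (k ℕ.≡ᵇ 0)) eq) of λ ()

  -- By `midpoint-local` the first generator of the path lies in the chart, so m agrees with Y
  -- outside it. Its restriction is a midpoint of two remote model corners, hence itself a corner.
  closure : ∀ i j m → remote i j ≡ true → mid G (name i) (name j) m ≡ true → ∃ λ k → name k ≡ m
  closure i j m far p = enter (multT≢0 {n} (point i) (vertex m) ne₁) (multT≢0 {n} (vertex m) (point j) ne₂)
    where
    ne₁ : multT {n} (point i) (vertex m) ≢ 0
    ne₁ = subst (λ t → multT {n} t (vertex m) ≢ 0) (vertex-name i) (adj≢0 (name i) m (proj₁ (∧-sound {adj G (name i) m} p)))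
    ne₂ : multT {n} (vertex m) (point j) ≢ 0
    ne₂ = subst (λ t → multT {n} (vertex m) t ≢ 0) (vertex-name j) (adj≢0 m (name j) (proj₂ (∧-sound {adj G (name i) m} p)))
    land : Agree (point i) (vertex m) → (∃ λ k → ∃ λ S → (k , S) ∈ genShapes 3 × neutral {3} (corner z i) S ≡ true × flipT {3} (corner z i) S ≡ ρ (vertex m)) →
           ∃ λ k → name k ≡ m
    land ag (k , S₃ , S₃∈ , neutral₃ , eq₃) = l , vertex-injective (trans (vertex-name l)
        (Agree-ext {point l} {vertex m} (Agree-trans {point l} {point i} {vertex m} (agree l i) ag)
          (trans (ρ-point l) (trans (sym (==T-sound {3} (proj₂ (proj₂ found)))) eq₃))))
      where
      ne₃ : multT {3} (flipT {3} (corner z i) S₃) (corner z j) ≢ 0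
      ne₃ eq = ne₂ (trans (multT-ρ (vertex m) (point j) (Agree-trans {vertex m} {point i} {point j} (Agree-sym {point i} {vertex m} ag) (agree i j)))
                          (trans (cong₂ (multT {3}) (sym eq₃) (ρ-point j)) eq))
      found : ∃ λ k → k ∈ allFin 6 × _==T_ {3} (flipT {3} (corner z i) S₃) (corner z k) ≡ true
      found = any-sound (λ k → _==T_ {3} (flipT {3} (corner z i) S₃) (corner z k)) (allFin 6) (corner-midpoint z i j far S₃∈ neutral₃ ne₃)
      l : Fin 6
      l = proj₁ found
    inner : ∀ {S} → point i ⟲ S ≡ vertex m → (∃ λ a → ∃ λ b → ∃ λ c → Distinct a b c × S ≡ tr (ι a) (ι b) (ι c)) → ∃ λ k → name k ≡ m
    inner eq₁ (a , b , c , D , refl) = land ag (multT≢0-shape {3} (corner z i) (ρ (vertex m))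
        (λ eq → ne₁ (trans (multT-ρ (point i) (vertex m) ag) (trans (cong (λ t → multT {3} t (ρ (vertex m))) (ρ-point i)) eq))))
      where ag : Agree (point i) (vertex m)
            ag = subst (Agree (point i)) eq₁ (Agree-⟲ (point i) D)
    enter : (∃ λ (S : List (Edge n)) → IsGenerator S × neut (point i) S ≡ true × point i ⟲ S ≡ vertex m) →
            (∃ λ (S : List (Edge n)) → IsGenerator S × neut (vertex m) S ≡ true × vertex m ⟲ S ≡ point j) → ∃ λ k → name k ≡ m
    enter (S , gS , _ , eq₁) (S′ , gS′ , _ , eq₂) = inner eq₁ (midpoint-local (point i) (vertex m) (point j) (agree i j) gS gS′ eq₁ eq₂
        m₁ m₂ m₃ n₁₂ n₁₃ n₂₃ (differs d₁) (differs d₂) (differs d₃))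
      where
      open ThreeApart (three-apart z i j far)
      differs : ∀ {f} → differ {3} (corner z i) (corner z j) f ≡ true → differ {3} (ρ (point i)) (ρ (point j)) f ≡ true
      differs {f} t = trans (cong₂ (λ a b → differ {3} a b f) (ρ-point i) (ρ-point j)) t

  adj-name : ∀ i j → adj G (name i) (name j) ≡ joined i j
  adj-name i j = cong (λ k → not (k ℕ.≡ᵇ 0)) (mult-name i j)

  eq-name : ∀ i j → (name i ==F name j) ≡ (i ==F j)
  eq-name i j with i Finₚ.≟ j
  ... | yes refl = ==F-refl (name i)
  ... | no ne    = ==F-≢ (ne ∘ name-injective i j)

  mid-name : ∀ i j k → mid G (name i) (name j) (name k) ≡ joined i k ∧ joined k j
  mid-name i j k = cong₂ _∧_ (adj-name i k) (adj-name k j)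

  inN-name : ∀ p q i j → inN G (name p) (name q) (name i) (name j) ≡ local-inN p q i j
  inN-name p q i j = cong₂ _∨_
    (cong₂ _∧_ (cong₂ _∨_ (eq-name i p) (eq-name i q)) (mid-name p q j))
    (cong₂ _∧_ (cong₂ _∨_ (eq-name j p) (eq-name j q)) (mid-name p q i))

  inVN-name : ∀ p → inVN G (name (# 0)) (name (# 2)) (name p) ≡ (p ==F (# 0)) ∨ (p ==F (# 2)) ∨ (joined (# 0) p ∧ joined p (# 2))
  inVN-name p = cong₂ _∨_ (eq-name p (# 0)) (cong₂ _∨_ (eq-name p (# 2)) (mid-name (# 0) (# 2) p))

  dist2-name : ∀ i j k → remote i j ≡ true → joined i k ∧ joined k j ≡ true → dist2 G (name i) (name j) ≡ true
  dist2-name i j k far via with ∧-sound {not (i ==F j)} far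
  ... | ne , na = cong₂ _∧_ (trans (cong not (eq-name i j)) ne) (cong₂ _∧_ (trans (cong not (adj-name i j)) na)
        (anyF-complete (mid G (name i) (name j)) (name k) (trans (mid-name i j k) via)))

  H : SubGraph G
  H = Nhat G (name (# 0)) (name (# 2))

  hasEdge-H : ∀ u v → hasEdge G H u v ≡ inNhat G (name (# 0)) (name (# 2)) u v
  hasEdge-H u v = trans (cong (λ row → lookup row v) (Vecₚ.lookup∘tabulate _ u)) (Vecₚ.lookup∘tabulate _ v)

  edge-in : ∀ i j → joined i j ≡ true → hasEdge G H (name i) (name j) ≡ true
  edge-in i j e = trans (hasEdge-H (name i) (name j)) ([ witness (# 0) (# 2) (# 1) refl refl refl refl , witness (# 1) (# 3) (# 0) refl refl refl refl ]′ (∨-sound (joined-witness i j e)))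
    where
    witness : ∀ p q k → ((p ==F (# 0)) ∨ (p ==F (# 2)) ∨ (joined (# 0) p ∧ joined p (# 2))) ≡ true →
              ((q ==F (# 0)) ∨ (q ==F (# 2)) ∨ (joined (# 0) q ∧ joined q (# 2))) ≡ true → remote p q ≡ true → joined p k ∧ joined k q ≡ true →
              local-inN p q i j ≡ true → inNhat G (name (# 0)) (name (# 2)) (name i) (name j) ≡ true
    witness p q k vp vq far via l = anyF-complete _ (name p) (anyF-complete _ (name q)
      (cong₂ _∧_ (trans (inVN-name p) vp) (cong₂ _∧_ (trans (inVN-name q) vq) (cong₂ _∧_ (dist2-name p q k far via) (trans (inN-name p q i j) l)))))

  inVN-closed : ∀ v → inVN G (name (# 0)) (name (# 2)) v ≡ true → ∃ λ k → name k ≡ v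
  inVN-closed v p = [ (λ q → # 0 , sym (==F-sound q)) , (λ r → [ (λ q → # 2 , sym (==F-sound q)) , closure (# 0) (# 2) v refl ]′ (∨-sound {v ==F name (# 2)} r)) ]′
                    (∨-sound {v ==F name (# 0)} p)

  -- An edge of the extended network lies on a path of length two between vertices of N(a,c). Those
  -- vertices are corners, and by `closure` so is the middle of the path.
  vertices : ∀ v → isVertex G H v ≡ true → ∃ λ k → name k ≡ v
  vertices v p = start (anyF-sound (hasEdge G H v) p)
    where
    ends-in : ∀ i j u → remote i j ≡ true → inN G (name i) (name j) v u ≡ true → ∃ λ k → name k ≡ v
    ends-in i j u far q = [ (λ r → endpoint (proj₁ (∧-sound {(v ==F name i) ∨ (v ==F name j)} r)))
                          , (λ r → closure i j v far (proj₂ (∧-sound {(u ==F name i) ∨ (u ==F name j)} r))) ]′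
                          (∨-sound {((v ==F name i) ∨ (v ==F name j)) ∧ mid G (name i) (name j) u} q)
      where endpoint : ((v ==F name i) ∨ (v ==F name j)) ≡ true → ∃ λ k → name k ≡ v
            endpoint r = [ (λ e → i , sym (==F-sound e)) , (λ e → j , sym (==F-sound e)) ]′ (∨-sound {v ==F name i} r)
    close : ∀ u x′ y′ → (∃ λ i → name i ≡ x′) → (∃ λ j → name j ≡ y′) → dist2 G x′ y′ ≡ true → inN G x′ y′ v u ≡ true → ∃ λ k → name k ≡ v
    close u _ _ (i , refl) (j , refl) d q = ends-in i j u (cong₂ _∧_ (trans (cong not (sym (eq-name i j))) ne) (trans (cong not (sym (adj-name i j))) na)) q
      where
      ne : not (name i ==F name j) ≡ true
      ne = proj₁ (∧-sound {not (name i ==F name j)} d)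
      na : not (adj G (name i) (name j)) ≡ true
      na = proj₁ (∧-sound {not (adj G (name i) (name j))} (proj₂ (∧-sound {not (name i ==F name j)} d)))
    start : (∃ λ u → hasEdge G H v u ≡ true) → ∃ λ k → name k ≡ v
    start (u , e) =
      let x′ , ex = anyF-sound _ (trans (sym (hasEdge-H v u)) e)
          y′ , ey = anyF-sound (λ y′ → inVN G (name (# 0)) (name (# 2)) x′ ∧ inVN G (name (# 0)) (name (# 2)) y′ ∧ dist2 G x′ y′ ∧ inN G x′ y′ v u) ex
          vx , rest = ∧-sound {inVN G (name (# 0)) (name (# 2)) x′} ey
          vy , rest₂ = ∧-sound {inVN G (name (# 0)) (name (# 2)) y′} rest
          d , q = ∧-sound {dist2 G x′ y′} rest₂
      in close u x′ y′ (inVN-closed x′ vx) (inVN-closed y′ vy) d q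

  shaped : IsCrystalShaped G H
  shaped = name , name-injective , vertices , multiplicities
    where
    choose : ∀ (b e : Bool) {k} → not (k ℕ.≡ᵇ 0) ≡ e → (e ≡ true → b ≡ true) → (if b then k else 0) ≡ k
    choose true  _     _ _ = refl
    choose false true  _ f = case f refl of λ ()
    choose false false {zero} _ _ = refl
    multiplicities : ∀ i j → multIn G H (name i) (name j) ≡ crystalMult i j
    multiplicities i j = trans (cong (λ k → if hasEdge G H (name i) (name j) then k else 0) (mult-name i j))
      (choose (hasEdge G H (name i) (name j)) (joined i j) {crystalMult i j} refl (edge-in i j))

  isCrystal : IsCrystal G H
  isCrystal = name (# 0) , name (# 2) , dist2-name (# 0) (# 2) (# 1) refl refl , refl , shaped

-- Deciding and enumerating crystals

any-fun? : ∀ m {k} {P : (Fin m → Fin k) → Set} → (∀ φ → Dec (P φ)) → (∀ {φ ψ} → φ ≗ ψ → P φ → P ψ) → Dec (∃ P)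
any-fun? zero P? resp with P? (λ ())
... | yes p = yes ((λ ()) , p)
... | no ¬p = no λ (φ , p) → ¬p (resp (λ ()) p)
any-fun? (suc m) {k} {P} P? resp with Finₚ.any? (λ x → any-fun? m {k} {λ φ → P (cons x φ)} (λ φ → P? (cons x φ)) (λ eq → resp (cons-cong x eq)))
  where
  cons : Fin k → (Fin m → Fin k) → Fin (suc m) → Fin k
  cons x φ fzero    = x
  cons x φ (fsuc i) = φ i
  cons-cong : ∀ x {φ ψ} → φ ≗ ψ → cons x φ ≗ cons x ψ
  cons-cong x eq fzero    = refl
  cons-cong x eq (fsuc i) = eq i
... | yes (x , φ , p) = yes (_ , p)
... | no ¬p = no λ (φ , p) → ¬p (φ fzero , φ ∘ fsuc , resp (λ { fzero → refl ; (fsuc i) → refl }) p)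

module _ {k : ℕ} (mult : Fin k → Fin k → ℕ) where

  _≟S_ : (H H′ : SubGraph mult) → Dec (H ≡ H′)
  _≟S_ = Vecₚ.≡-dec (Vecₚ.≡-dec 𝔹._≟_)

  -- A search through all maps from the six vertices. Without function extensionality it covers maps
  -- only up to pointwise equality, so the invariance of the property is supplied along with it.
  IsCrystalShaped? : ∀ H → Dec (IsCrystalShaped mult H)
  IsCrystalShaped? H = any-fun? 6
    (λ φ → Finₚ.all? (λ a → Finₚ.all? (λ b → (φ a Finₚ.≟ φ b) →-dec (a Finₚ.≟ b)))
       ×-dec Finₚ.all? (λ v → (isVertex mult H v 𝔹.≟ true) →-dec Finₚ.any? (λ a → φ a Finₚ.≟ v))
       ×-dec Finₚ.all? (λ a → Finₚ.all? (λ b → multIn mult H (φ a) (φ b) ℕₚ.≟ crystalMult a b)))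
    (λ {φ} {ψ} eq (inj , cover , mults) →
       (λ a b e → inj a b (trans (eq a) (trans e (sym (eq b))))) ,
       (λ v p → let a , e = cover v p in a , trans (sym (eq a)) e) ,
       (λ a b → trans (cong₂ (multIn mult H) (sym (eq a)) (sym (eq b))) (mults a b)))

  IsCrystal? : ∀ H → Dec (IsCrystal mult H)
  IsCrystal? H = Finₚ.any? λ x → Finₚ.any? λ y → (dist2 mult x y 𝔹.≟ true) ×-dec (H ≟S Nhat mult x y) ×-dec IsCrystalShaped? H

  private
    networks : List (SubGraph mult)
    networks = concatMap (λ x → List.map (Nhat mult x) (allFin k)) (allFin k)

    Through : Fin k → Fin k → SubGraph mult → Set
    Through p q H = IsCrystal mult H × hasEdge mult H p q ≡ true

    Through? : ∀ p q H → Dec (Through p q H)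
    Through? p q H = IsCrystal? H ×-dec (hasEdge mult H p q 𝔹.≟ true)

  crystalsThrough : Fin k → Fin k → List (SubGraph mult)
  crystalsThrough p q = List.filter (Through? p q) (List.deduplicate _≟S_ networks)

  ∈-crystalsThrough : ∀ p q {H} → IsCrystal mult H → hasEdge mult H p q ≡ true → H ∈ crystalsThrough p q
  ∈-crystalsThrough p q c@(x , y , _ , refl , _) e = ∈ₚ.∈-filter⁺ (Through? p q)
    (∈ₚ.∈-deduplicate⁺ _≟S_ (∈ₚ.∈-concatMap⁺ (λ x → List.map (Nhat mult x) (allFin k)) (∈-lose (∈ₚ.∈-allFin x) (∈ₚ.∈-map⁺ (Nhat mult x) (∈ₚ.∈-allFin y)))))
    (c , e)

  -- `IsMaxCrystalDegree` bounds only those degrees that are certified by a list of crystals; this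
  -- exhibits such a list for every pair.
  crystalDegree : ∀ p q → CrystalDegree mult p q (length (crystalsThrough p q))
  crystalDegree p q = crystalsThrough p q , Uniqueₚ.filter⁺ (Through? p q) (UniqueDecₚ.deduplicate-! _≟S_ networks) ,
    (λ H → (λ H∈ → proj₂ (∈ₚ.∈-filter⁻ (Through? p q) {xs = List.deduplicate _≟S_ networks} H∈)) , (λ (c , e) → ∈-crystalsThrough p q c e)) , refl

-- Counting the crystals through a double edge

Unique-length : ∀ {A : Set} (xs ys : List A) → Unique xs → (∀ {x} → x ∈ xs → x ∈ ys) → length xs ℕ.≤ length ys
Unique-length []       ys u        sub = ℕ.z≤n
Unique-length (x ∷ xs) ys (x∉ ∷ u) sub with extract (sub (here refl))
... | zs , p = subst (suc (length xs) ℕ.≤_) (sym (Permₚ.↭-length p)) (ℕ.s≤s (Unique-length xs zs u λ {y} y∈ → remove y∈ (Permₚ.∈-resp-↭ p (sub (there y∈)))))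
  where
  remove : ∀ {y} → y ∈ xs → y ∈ x ∷ zs → y ∈ zs
  remove y∈ (here refl) = contradiction refl (All.lookup x∉ y∈)
  remove y∈ (there q)   = q

-- The chart with α = pick 0, β = pick 1, δ = pick 2.
chart₃ : ∀ {n} (pick : Fin 3 → V n) → (∀ i j → ix (pick i) ≡ ix (pick j) → i ≡ j) → Chart 3 n
chart₃ {n} pick inj = record { ι = ι ; ι-bar = ι-bar ; ι-inj = ι-inj }
  where
  ι : V 3 → V n
  ι (j , true)  = pick j
  ι (j , false) = bar (pick j)
  ι-bar : ∀ a → ι (bar a) ≡ bar (ι a)
  ι-bar (j , true)  = refl
  ι-bar (j , false) = sym (bar-bar (pick j))
  ix-ι : ∀ j b → ix (ι (j , b)) ≡ ix (pick j)
  ix-ι j true  = refl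
  ix-ι j false = refl
  ι-inj : ∀ {a b} → ι a ≡ ι b → a ≡ b
  ι-inj {i , a} {j , b} eq with inj i j (trans (sym (ix-ι i a)) (trans (cong ix eq) (ix-ι j b)))
  ι-inj {i , true}  {i , true}  eq | refl = refl
  ι-inj {i , true}  {i , false} eq | refl = contradiction eq (bar-≢ (pick i))
  ι-inj {i , false} {i , true}  eq | refl = contradiction (sym eq) (bar-≢ (pick i))
  ι-inj {i , false} {i , false} eq | refl = refl

κ-bar : ∀ {n} (T : Tournament n) (u v : V n) → T ⟲ κ u v ≡ T ⟲ κ u (bar v)
κ-bar T u v = ⟲-cong T {κ u v} {κ u (bar v)} λ e → begin
  e ∈E tr v u (bar u)                         ≡⟨ cong (e ∈E_) (sym (tr-bar v u (bar u))) ⟩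
  e ∈E tr (bar v) (bar u) (bar (bar u))       ≡⟨ cong (λ y → e ∈E tr (bar v) (bar u) y) (bar-bar u) ⟩
  e ∈E tr (bar v) (bar u) u                   ≡⟨ tr-swap₂₃ (bar v) (bar u) u e ⟩
  e ∈E tr (bar v) u (bar u)                   ∎
  where open ≡-Reasoning

-- Both clovers `κ u v` and `κ u w` are then neutral, which makes T a candidate for the corner y,
-- with a and c at the other ends of these two double edges.
record Peak {n : ℕ} (T : Tournament n) (u v w : V n) : Set where
  field
    u≢v : ix u ≢ ix v
    u≢w : ix u ≢ ix w
    v≢w : ix v ≢ ix w
    uv : τ T u v ≡ true
    uv̄ : τ T u (bar v) ≡ true
    uw : τ T u w ≡ true
    uw̄ : τ T u (bar w) ≡ true
    ūu : τ T (bar u) u ≡ true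

record CrystalOn {n : ℕ} (s : Vec ℤ n) (T : Tournament n) (u v w : V n) : Set where
  open Graph s
  field
    H : SubGraph (IntGr n s)
    crystal : IsCrystal (IntGr n s) H
    y a c : Fin (K n s)
    is-y : vertex y ≡ T
    is-a : vertex a ≡ T ⟲ κ u v
    is-c : vertex c ≡ T ⟲ κ u w
    ya : hasEdge (IntGr n s) H y a ≡ true
    ay : hasEdge (IntGr n s) H a y ≡ true
    double : IntGr n s y a ≡ 2
    double′ : IntGr n s a y ≡ 2
    c-vertex : isVertex (IntGr n s) H c ≡ true
    near : ∀ m → isVertex (IntGr n s) H m ≡ true → ∀ (p q : V n) → p ≢ q → ix q ≢ ix u → ix q ≢ ix v → ix q ≢ ix w →
           val (vertex m) (ed p q) ≡ val T (ed p q)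

module _ {n : ℕ} {s : Vec ℤ n} (T : Tournament n) (scT : score2 {n} T ≡ s) where

  open Graph s

  private
    opp : ∀ {a c : V n} {y} → a ≢ c → τ T a c ≡ y → τ T c a ≡ not y
    opp = opposite T

    mir : ∀ {a b : V n} {y} → a ≢ b → τ T a b ≡ y → τ T (bar b) (bar a) ≡ y
    mir ne eq = trans (τ-mirror T ne) eq

  peak-crystal : ∀ (u β δ : V n) → Peak T u β δ → τ T β δ ≡ true → τ T (bar β) δ ≡ true → τ T (bar β) β ≡ true →
                 CrystalOn s T u β δ × CrystalOn s T u δ β
  peak-crystal u β δ peak βδ β̄δ β̄β = result (# 0) (# 2) refl refl refl refl (κ-reverse T u β) (κ-reverse T u δ) (λ p q r → p , q , r) ,
                                       result (# 2) (# 0) refl refl refl refl (κ-reverse T u δ) (κ-reverse T u β) (λ p q r → p , r , q)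
    where
    open Peak peak
    pick : Fin 3 → V n
    -- In corner 4 all of β, β̄, δ, δ̄ point to α and α points to its opposite, so α has to be the
    -- opposite of the peak u.
    pick fzero               = bar u
    pick (fsuc fzero)        = β
    pick (fsuc (fsuc fzero)) = δ
    pick-inj : ∀ i j → ix (pick i) ≡ ix (pick j) → i ≡ j
    pick-inj fzero fzero _ = refl
    pick-inj fzero (fsuc fzero) eq = contradiction eq u≢v
    pick-inj fzero (fsuc (fsuc fzero)) eq = contradiction eq u≢w
    pick-inj (fsuc fzero) fzero eq = contradiction (sym eq) u≢v
    pick-inj (fsuc fzero) (fsuc fzero) _ = refl
    pick-inj (fsuc fzero) (fsuc (fsuc fzero)) eq = contradiction eq v≢w
    pick-inj (fsuc (fsuc fzero)) fzero eq = contradiction (sym eq) u≢w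
    pick-inj (fsuc (fsuc fzero)) (fsuc fzero) eq = contradiction (sym eq) v≢w
    pick-inj (fsuc (fsuc fzero)) (fsuc (fsuc fzero)) _ = refl
    ch : Chart 3 n
    ch = chart₃ pick pick-inj
    unbar : ∀ {x : V n} {b} → τ T x u ≡ b → τ T x (bar (bar u)) ≡ b
    unbar {x} eq = trans (cong (τ T x) (bar-bar u)) eq
    up : ∀ {x : V n} → ix u ≢ ix x → τ T u (bar x) ≡ true → τ T x (bar u) ≡ true
    up {x} ne eq = trans (cong (λ y → τ T y (bar u)) (sym (bar-bar x))) (mir (apart ne) eq)
    ρT : Restrict.ρ ch T ≡ corner (τ T δ (bar δ)) (# 4)
    ρT = cong₂ _∷_ (up u≢v uv̄) (cong₂ _∷_ (unbar (opp (apart u≢v) uv)) (cong₂ _∷_ (up u≢w uw̄) (cong₂ _∷_ (unbar (opp (apart u≢w) uw))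
      (cong₂ _∷_ (opp (apart v≢w) βδ) (cong₂ _∷_ (opp (apart v≢w) β̄δ) (cong₂ _∷_ (unbar ūu) (cong₂ _∷_ (opp (bar-≢ β ∘ sym) β̄β) refl)))))))
    module C = Crystal s T scT ch (τ T δ (bar δ)) ρT
    result : ∀ i j {x y : V n} → joined (# 4) i ≡ true → joined i (# 4) ≡ true → crystalMult (# 4) i ≡ 2 → joined j (# 4) ≡ true →
             T ⟲ κ u x ≡ C.point i → T ⟲ κ u y ≡ C.point j →
             (∀ {q : V n} → ix q ≢ ix u → ix q ≢ ix x → ix q ≢ ix y → ix q ≢ ix u × ix q ≢ ix β × ix q ≢ ix δ) → CrystalOn s T u x y
    result i j {x} {y} e₁ e₂ two e₃ eqᵢ eqⱼ out = record
      { H = C.H ; crystal = C.isCrystal ; y = C.name (# 4) ; a = C.name i ; c = C.name j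
      ; is-y = C.vertex-name (# 4) ; is-a = trans (C.vertex-name i) (sym eqᵢ) ; is-c = trans (C.vertex-name j) (sym eqⱼ)
      ; ya = C.edge-in (# 4) i e₁ ; ay = C.edge-in i (# 4) e₂
      ; double = trans (C.mult-name (# 4) i) two ; double′ = trans (C.mult-name i (# 4)) (trans (mult-sym i) two)
      ; c-vertex = anyF-complete _ (C.name (# 4)) (C.edge-in j (# 4) e₃)
      ; near = λ m m∈ p q p≢q a b c → near m (C.vertices m m∈) p q p≢q (out {q} a b c) }
      where
      mult-sym : ∀ i → crystalMult i (# 4) ≡ crystalMult (# 4) i
      mult-sym i = ℕₚ.≡ᵇ⇒≡ _ _ (subst 𝔹.T (sym (all-sound (λ i → crystalMult i (# 4) ℕ.≡ᵇ crystalMult (# 4) i) (allFin 6) refl (∈ₚ.∈-allFin i))) tt)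
      near : ∀ m → (∃ λ k → C.name k ≡ m) → ∀ (p q : V n) → p ≢ q → ix q ≢ ix u × ix q ≢ ix β × ix q ≢ ix δ → val (vertex m) (ed p q) ≡ val T (ed p q)
      near _ (k , refl) p q p≢q (a , b , c) = trans (cong (λ t → val t (ed p q)) (C.vertex-name k))
        (C.agree k (# 4) (ed-∈ n p q p≢q) (trans (Restrict.local-ed ch p q p≢q) (trans (cong (Restrict.inside ch (ix p) ∧_) outside) (𝔹ₚ.∧-zeroʳ (Restrict.inside ch (ix p))))))
        where outside : Restrict.inside ch (ix q) ≡ false
              outside rewrite ==F-≢ a | ==F-≢ b | ==F-≢ c = refl

module _ {n : ℕ} {s : Vec ℤ n} (T : Tournament n) (scT : score2 {n} T ≡ s) where

  open Graph s

  private
    opp : ∀ {a c : V n} {y} → a ≢ c → τ T a c ≡ y → τ T c a ≡ not y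
    opp = opposite T

    mir : ∀ {a b : V n} {y} → a ≢ b → τ T a b ≡ y → τ T (bar b) (bar a) ≡ y
    mir ne eq = trans (τ-mirror T ne) eq

    unbarˡ : ∀ {x y : V n} {b} → τ T (bar (bar x)) y ≡ b → τ T x y ≡ b
    unbarˡ {x} {y} = trans (cong (λ z → τ T z y) (sym (bar-bar x)))

    rebar : ∀ {x y : V n} {b} → τ T x y ≡ b → τ T x (bar (bar y)) ≡ b
    rebar {x} {y} = trans (cong (τ T x) (bar-bar y))

    peak-bar : ∀ {u v w : V n} → Peak T u v w → Peak T u (bar v) w
    peak-bar p = record { u≢v = u≢v ; u≢w = u≢w ; v≢w = v≢w ; uv = uv̄ ; uv̄ = rebar uv ; uw = uw ; uw̄ = uw̄ ; ūu = ūu }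
      where open Peak p

    peak-swap : ∀ {u v w : V n} → Peak T u v w → Peak T u w v
    peak-swap p = record { u≢v = u≢w ; u≢w = u≢v ; v≢w = v≢w ∘ sym ; uv = uw ; uv̄ = uw̄ ; uw = uv ; uw̄ = uv̄ ; ūu = ūu }
      where open Peak p

    on-bar₁ : ∀ {u v w : V n} → CrystalOn s T u (bar v) w → CrystalOn s T u v w
    on-bar₁ {u} {v} c = record { CrystalOn c ; is-a = trans (CrystalOn.is-a c) (sym (κ-bar T u v)) }

    on-bar₂ : ∀ {u v w : V n} → CrystalOn s T u v (bar w) → CrystalOn s T u v w
    on-bar₂ {u} {v} {w} c = record { CrystalOn c ; is-c = trans (CrystalOn.is-c c) (sym (κ-bar T u w)) }

    base : ∀ {u b d : V n} → Peak T u b d → τ T b d ≡ true → τ T (bar b) d ≡ true → CrystalOn s T u b d × CrystalOn s T u d b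
    base {u} {b} {d} p bd b̄d = go (τ T (bar b) b) refl
      where
      go : ∀ x → τ T (bar b) b ≡ x → CrystalOn s T u b d × CrystalOn s T u d b
      go true  eq = peak-crystal T scT u b d p bd b̄d eq
      go false eq = let c , c′ = peak-crystal T scT u (bar b) d (peak-bar p) b̄d
                                   (trans (cong (λ y → τ T y d) (bar-bar b)) bd)
                                   (trans (cong (λ y → τ T y (bar b)) (bar-bar b)) (opp (bar-≢ b ∘ sym) eq))
                    in on-bar₁ c , on-bar₂ c′

  -- v and v̄ either point both ways to the pair w, w̄ or the same way: one of the pairs lies below the other.
  peak-any : ∀ {u v w : V n} → Peak T u v w → CrystalOn s T u v w
  peak-any {u} {v} {w} p = go (τ T v w) (τ T v (bar w)) refl refl
    where
    open Peak p
    v̄w : ∀ {x} → τ T v (bar w) ≡ x → τ T w (bar v) ≡ x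
    v̄w eq = unbarˡ (mir (apart v≢w) eq)
    go : ∀ r r′ → τ T v w ≡ r → τ T v (bar w) ≡ r′ → CrystalOn s T u v w
    go true  true  e e′ = on-bar₁ (proj₂ (base (peak-swap (peak-bar p)) (v̄w e′) (mir (apart v≢w) e)))
    go false false e e′ = proj₂ (base (peak-swap p) (opp (apart v≢w) e) (opp (apart v≢w) e′))
    go true  false e e′ = proj₁ (base p e (opp (apart (v≢w ∘ sym)) (v̄w e′)))
    go false true  e e′ = on-bar₂ (proj₁ (base (peak-swap (peak-bar (peak-swap p))) e′ (mir (apart (v≢w ∘ sym)) (opp (apart v≢w) e))))

-- The fields `flips` and `keeps` separate the crystals of different indices: the game between u and
-- l is changed somewhere on the crystal for l, and nowhere on the crystal for another index.
record CrystalFor {n : ℕ} (s : Vec ℤ n) (T : Tournament n) (u v : V n) (l : Fin n) : Set where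
  open Graph s
  field
    H : SubGraph (IntGr n s)
    crystal : IsCrystal (IntGr n s) H
    p q : Fin (K n s)
    is-p : vertex p ≡ T
    is-q : vertex q ≡ T ⟲ κ u v
    pq : hasEdge (IntGr n s) H p q ≡ true
    double : IntGr n s p q ≡ 2
    flips : ∃ λ m → isVertex (IntGr n s) H m ≡ true × val (vertex m) (ed u (l , true)) ≡ not (val T (ed u (l , true)))
    keeps : ∀ m → isVertex (IntGr n s) H m ≡ true → ∀ l′ → l′ ≢ ix u → l′ ≢ ix v → l′ ≢ l →
            val (vertex m) (ed u (l′ , true)) ≡ val T (ed u (l′ , true))

module CrystalCount {n : ℕ} {s : Vec ℤ n} (T : Tournament n) (scT : score2 {n} T ≡ s) (u v : V n) (bits : CloverBits T u v) where

  open Graph s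
  open CloverBits bits

  private
    D₀ : Distinct v u (bar u)
    D₀ = apart (u≢v ∘ sym) , bar-≢ u , apart (u≢v ∘ sym)

    neutral₀ : neut T (κ u v) ≡ true
    neutral₀ = neutral-bits T D₀ (opposite T (apart u≢v) uv) (opposite T (bar-≢ u ∘ sym) ūu) (opposite T (apart (u≢v ∘ sym)) vū)

    T₂ : Tournament n
    T₂ = T ⟲ κ u v

    scT₂ : score2 {n} T₂ ≡ s
    scT₂ = ⟲-score T (κ u v) scT neutral₀

    uv̄ : τ T u (bar v) ≡ true
    uv̄ = trans (sym (τ-mirror T (apart u≢v))) (trans (cong (λ y → τ T y (bar u)) (bar-bar v)) vū)

    value : ∀ (t : Tournament n) (S : List (Edge n)) (x y : V n) → x ≢ y → val (t ⟲ S) (ed x y) ≡ (ed x y ∈E S) xor val t (ed x y)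
    value t S x y ne = val-⟲′ t S (ed-∈ n x y ne)
      where
      opaque
        unfolding _⟲_
        val-⟲′ : ∀ (t : Tournament n) (S : List (Edge n)) {e} → e ∈ edges n → val (t ⟲ S) e ≡ (e ∈E S) xor val t e
        val-⟲′ t S e∈ = at-flip (edges n) (_∈E S) t e∈

    off : ∀ l b → l ≢ ix u → l ≢ ix v → (ed u (l , b) ∈E κ u v) ≡ false
    off l b l≢u l≢v = ∉tr (apart-byʳ (apart (l≢u ∘ sym)) (apart (u≢v ∘ sym)) l≢v l≢u) (apart-byʳ (apart (l≢u ∘ sym)) (bar-≢ u) l≢u l≢u)
                          (apart-byʳ (apart (l≢u ∘ sym)) (apart (u≢v ∘ sym)) l≢v l≢u)

    stable : ∀ l b → l ≢ ix u → l ≢ ix v → val T₂ (ed u (l , b)) ≡ val T (ed u (l , b))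
    stable l b l≢u l≢v = trans (value T (κ u v) u (l , b) (apart (l≢u ∘ sym))) (cong (_xor val T (ed u (l , b))) (off l b l≢u l≢v))

  high : ∀ l → l ≢ ix u → l ≢ ix v → τ T u (l , true) ≡ true → τ T u (l , false) ≡ true → CrystalFor s T u v l
  high l l≢u l≢v t f = record
    { H = H ; crystal = crystal ; p = y ; q = a ; is-p = is-y ; is-q = is-a ; pq = ya ; double = double
    ; flips = c , c-vertex , trans (cong (λ t → val t (ed u w)) is-c) (trans (value T (κ u w) u w (apart (l≢u ∘ sym))) (cong (_xor val T (ed u w)) on))
    ; keeps = λ m m∈ l′ a b c → near m m∈ u (l′ , true) (apart (a ∘ sym)) a b c }
    where
    w : V n
    w = l , true
    peak : CrystalOn s T u v w
    peak = peak-any T scT {u} {v} {w} record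
      { u≢v = u≢v ; u≢w = l≢u ∘ sym ; v≢w = l≢v ∘ sym ; uv = uv ; uv̄ = uv̄ ; uw = t ; uw̄ = f ; ūu = ūu }
    open CrystalOn peak
    on : (ed u w ∈E κ u w) ≡ true
    on = trans (cong (_∈E κ u w) (ed-sym u w)) (∈tr₁ w u (bar u))

  -- Here both signed vertices of l point to u. Flipping `κ u v` makes the opposite of u a peak of
  -- T₂, so the crystal is built from the other end of the double edge.
  low : ∀ l → l ≢ ix u → l ≢ ix v → τ T u (l , true) ≡ false → τ T u (l , false) ≡ false → CrystalFor s T u v l
  low l l≢u l≢v t f = record
    { H = H ; crystal = crystal ; p = a ; q = y ; is-p = trans is-a returns ; is-q = is-y ; pq = ay ; double = double′
    ; flips = c , c-vertex , trans (cong (λ t → val t (ed u w)) is-c) (trans (value T₂ (κ (bar u) w) u w (apart (l≢u ∘ sym)))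
              (cong₂ _xor_ on (stable l true l≢u l≢v)))
    ; keeps = λ m m∈ l′ a b c → trans (near m m∈ u (l′ , true) (apart (a ∘ sym)) a b c) (stable l′ true a b) }
    where
    w : V n
    w = l , true
    returns : T₂ ⟲ κ (bar u) v ≡ T
    returns = trans (sym (κ-reverse T₂ u v)) (⟲-involutive T (κ u v))
    out : ∀ b → τ T₂ u (l , b) ≡ τ T u (l , b)
    out b = τ-out T (κ u v) (apart (l≢u ∘ sym)) (off l b l≢u l≢v)
    below-bar : ∀ b → τ T u (l , b) ≡ false → τ T₂ (bar u) (l , not b) ≡ true
    below-bar b eq = trans (τ-bar T₂ u (l , b)) (cong not (trans (out b) eq))
    flipped : ∀ {x y b} → x ≢ y → (ed x y ∈E κ u v) ≡ true → τ T x y ≡ b → τ T₂ x y ≡ not b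
    flipped ne on eq = trans (τ-in T (κ u v) ne on) (cong not eq)
    ūv₂ : τ T₂ (bar u) v ≡ true
    ūv₂ = opposite T₂ (apart (u≢v ∘ sym)) (flipped (apart (u≢v ∘ sym)) (∈tr₃ v u (bar u)) vū)
    vu₂ : τ T₂ v u ≡ true
    vu₂ = flipped (apart (u≢v ∘ sym)) (∈tr₁ v u (bar u)) (opposite T (apart u≢v) uv)
    uū₂ : τ T₂ u (bar u) ≡ true
    uū₂ = flipped (bar-≢ u) (∈tr₂ v u (bar u)) (opposite T (bar-≢ u ∘ sym) ūu)
    peak : CrystalOn s T₂ (bar u) v w
    peak = peak-any T₂ scT₂ {bar u} {v} {w} record
      { u≢v = u≢v ; u≢w = l≢u ∘ sym ; v≢w = l≢v ∘ sym ; uv = ūv₂ ; uv̄ = trans (τ-mirror T₂ (apart (u≢v ∘ sym))) vu₂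
      ; uw = below-bar false f ; uw̄ = below-bar true t
      ; ūu = trans (cong (λ y → τ T₂ y (bar u)) (bar-bar u)) uū₂ }
    open CrystalOn peak
    on : (ed u w ∈E κ (bar u) w) ≡ true
    on = trans (cong (_∈E κ (bar u) w) (trans (ed-sym u w) (cong (ed w) (sym (bar-bar u))))) (∈tr₃ w (bar u) (bar (bar u)))

  distinct-crystals : ∀ {l l′} → l ≢ ix u → l ≢ ix v → l ≢ l′ → (c : CrystalFor s T u v l) (c′ : CrystalFor s T u v l′) →
                      CrystalFor.H c ≢ CrystalFor.H c′
  distinct-crystals {l} {l′} l≢u l≢v l≢l′ c c′ eq = let m , m∈ , flip = CrystalFor.flips c in
    𝔹ₚ.not-¬ {val T (ed u (l , true))} refl
        (trans (sym (CrystalFor.keeps c′ m (subst (λ H → isVertex (IntGr n s) H m ≡ true) eq m∈) l l≢u l≢v l≢l′)) flip)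

  crystalFor : ∀ l → l ≢ ix u → l ≢ ix v → same (τ T u (l , true)) (τ T u (l , false)) ≡ true → CrystalFor s T u v l
  crystalFor l l≢u l≢v eq = go (τ T u (l , true)) (τ T u (l , false)) refl refl eq
    where
    go : ∀ x y → τ T u (l , true) ≡ x → τ T u (l , false) ≡ y → same x y ≡ true → CrystalFor s T u v l
    go true  true  p q _ = high l l≢u l≢v p q
    go false false p q _ = low l l≢u l≢v p q

  Gathered : List (Fin n) → Set
  Gathered R = ∃ λ (Hs : List (SubGraph (IntGr n s))) → Unique Hs × + length Hs ≡ crystals T u R ×
    (∀ {H} → H ∈ Hs → ∃ λ l → l ∈ R × ∃ λ (c : CrystalFor s T u v l) → CrystalFor.H c ≡ H)

  gather : ∀ R → Unique R → (∀ {l} → l ∈ R → l ≢ ix u × l ≢ ix v) → Gathered R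
  gather [] _ _ = [] , [] , refl , λ ()
  gather (l ∷ R) (l∉ ∷ uR) out = extend (gather R uR (out ∘ there)) (same (τ T u (l , true)) (τ T u (l , false))) refl
    where
    l≢u : l ≢ ix u
    l≢u = proj₁ (out (here refl))
    l≢v : l ≢ ix v
    l≢v = proj₂ (out (here refl))
    extend : Gathered R → ∀ b → same (τ T u (l , true)) (τ T u (l , false)) ≡ b → Gathered (l ∷ R)
    extend (Hs , uHs , len , from) false eq = Hs , uHs ,
      trans len (trans (sym (ℤₚ.+-identityˡ (crystals T u R))) (cong (λ b → ind b + crystals T u R) (sym eq))) ,
      λ H∈ → let l′ , l′∈ , c = from H∈ in l′ , there l′∈ , c
    extend (Hs , uHs , len , from) true eq = CrystalFor.H c ∷ Hs , fresh ∷ uHs ,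
      trans (ℤₚ.pos-+ 1 (length Hs)) (cong₂ (λ b z → ind b + z) (sym eq) len) , origin
      where
      c : CrystalFor s T u v l
      c = crystalFor l l≢u l≢v eq
      fresh : All (CrystalFor.H c ≢_) Hs
      fresh = All.tabulate λ {H} H∈ → let l′ , l′∈ , c′ , eq′ = from H∈ in
        λ same-H → distinct-crystals l≢u l≢v (All.lookup l∉ l′∈) c c′ (trans same-H (sym eq′))
      origin : ∀ {H} → H ∈ CrystalFor.H c ∷ Hs → ∃ λ l′ → l′ ∈ l ∷ R × ∃ λ (c : CrystalFor s T u v l′) → CrystalFor.H c ≡ H
      origin (here refl) = l , here refl , c , refl
      origin (there H∈)  = let l′ , l′∈ , c′ = from H∈ in l′ , there l′∈ , c′

  crystals≤ : ∀ {γ} → IsMaxCrystalDegree (IntGr n s) γ → ∀ R → allFin n ↭ ix u ∷ ix v ∷ R → crystals T u R ≤ + γ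
  crystals≤ {γ} (max , _) R perm = go (gather R uniqueR out)
    where
    unique : Unique (ix u ∷ ix v ∷ R)
    unique = Unique-↭ perm (Uniqueₚ.allFin⁺ n)
    uniqueR : Unique R
    uniqueR = unique-drop (unique-drop unique)
    out : ∀ {l} → l ∈ R → l ≢ ix u × l ≢ ix v
    out l∈ = unique-head unique (there l∈) ∘ sym , unique-head (unique-drop unique) l∈ ∘ sym
    go : Gathered R → crystals T u R ≤ + γ
    -- Without a crystal the count is zero; otherwise the first crystal supplies the names of the
    -- double edge to which maximality is applied.
    go ([] , _ , len , _) = subst (_≤ + γ) len (ℤ.+≤+ ℕ.z≤n)
    go (H₀ ∷ Hs , uHs , len , from) = subst (_≤ + γ) len (ℤ.+≤+ (ℕₚ.≤-trans (Unique-length (H₀ ∷ Hs) (crystalsThrough (IntGr n s) p₀ q₀) uHs through)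
        (max p₀ q₀ _ (CrystalFor.double c₀) (crystalDegree (IntGr n s) p₀ q₀))))
      where
      c₀ : CrystalFor s T u v (proj₁ (from (here refl)))
      c₀ = proj₁ (proj₂ (proj₂ (from (here refl))))
      p₀ q₀ : Fin (K n s)
      p₀ = CrystalFor.p c₀
      q₀ = CrystalFor.q c₀
      through : ∀ {H} → H ∈ H₀ ∷ Hs → H ∈ crystalsThrough (IntGr n s) p₀ q₀
      through H∈ = place (from H∈)
        where
        place : ∀ {H} → (∃ λ l → l ∈ R × ∃ λ (c : CrystalFor s T u v l) → CrystalFor.H c ≡ H) → H ∈ crystalsThrough (IntGr n s) p₀ q₀
        place (l , _ , c , refl) = ∈-crystalsThrough (IntGr n s) p₀ q₀ (CrystalFor.crystal c)
          (subst₂ (λ p q → hasEdge (IntGr n s) (CrystalFor.H c) p q ≡ true)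
          (vertex-injective (trans (CrystalFor.is-p c) (sym (CrystalFor.is-p c₀))))
          (vertex-injective (trans (CrystalFor.is-q c) (sym (CrystalFor.is-q c₀)))) (CrystalFor.pq c))

-- If β, β̄ → ξ → δ, δ̄ then one of the two clovers at ξ is neutral, and the other pair completes a crystal.
module _ {n : ℕ} {s : Vec ℤ n} (T : Tournament n) (scT : score2 {n} T ≡ s) where

  private
    opp : ∀ {a c : V n} {y} → a ≢ c → τ T a c ≡ y → τ T c a ≡ not y
    opp = opposite T

    unbarˡ : ∀ {x y : V n} {b} → τ T (bar (bar x)) y ≡ b → τ T x y ≡ b
    unbarˡ {x} {y} = trans (cong (λ z → τ T z y) (sym (bar-bar x)))

    ind≥0 : ∀ R (f : Fin n → Bool) → 0ℤ ≤ ∑ R (λ l → ind (f l))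
    ind≥0 []      f = ℤₚ.≤-refl
    ind≥0 (l ∷ R) f = 0≤+ (one (f l)) (ind≥0 R f)
      where one : ∀ b → 0ℤ ≤ ind b
            one true  = ℤ.+≤+ ℕ.z≤n
            one false = ℤₚ.≤-refl

    ind≥1 : ∀ R (f : Fin n → Bool) {l} → l ∈ R → f l ≡ true → 1ℤ ≤ ∑ R (λ l → ind (f l))
    ind≥1 (l ∷ R) f (here refl) eq rewrite eq = ℤₚ.+-monoʳ-≤ 1ℤ (ind≥0 R f)
    ind≥1 (l ∷ R) f (there l∈) eq = ℤₚ.≤-trans (ind≥1 R f l∈ eq) (subst (_≤ ind (f l) + ∑ R (λ l → ind (f l))) (ℤₚ.+-identityˡ _)
      (ℤₚ.+-monoˡ-≤ (∑ R (λ l → ind (f l))) (one (f l))))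
      where one : ∀ b → 0ℤ ≤ ind b
            one true  = ℤ.+≤+ ℕ.z≤n
            one false = ℤₚ.≤-refl

    witness : ∀ {γ} → IsMaxCrystalDegree (IntGr n s) γ → ∀ (u v x : V n) → CloverBits T u v → ix x ≢ ix u → ix x ≢ ix v →
              (∃ λ b → ∀ c → τ T u (ix x , c) ≡ b) → 1ℤ ≤ + γ
    witness max u v x bits x≢u x≢v (b , eq) =
      let L₁ , p₁ = extract (∈ₚ.∈-allFin (ix u)) ; L₂ , p₂ = extract (∈-tail p₁ (ix v) (CloverBits.u≢v bits ∘ sym))
          perm = Perm.trans p₁ (prep (ix u) p₂)
      in ℤₚ.≤-trans (ind≥1 L₂ (λ l → same (τ T u (l , true)) (τ T u (l , false))) (∈-tail₂ perm (ix x) x≢u x≢v)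
                      (trans (cong₂ same (eq true) (eq false)) (same-refl b)))
                    (CrystalCount.crystals≤ T scT u v bits max L₂ perm)
      where
      same-refl : ∀ b → same b b ≡ true
      same-refl true  = refl
      same-refl false = refl

  hub : ∀ {γ} → IsMaxCrystalDegree (IntGr n s) γ → ∀ (ξ β δ : V n) → ix ξ ≢ ix β → ix ξ ≢ ix δ → ix β ≢ ix δ →
        τ T β ξ ≡ true → τ T (bar β) ξ ≡ true → τ T ξ δ ≡ true → τ T ξ (bar δ) ≡ true → 1ℤ ≤ + γ
  hub max ξ β δ ξ≢β ξ≢δ β≢δ βξ β̄ξ ξδ ξδ̄ = go (τ T ξ (bar ξ)) refl
    where
    signs : ∀ (x y : V n) {b} → τ T x y ≡ b → τ T x (bar y) ≡ b → ∀ c → τ T x (ix y , c) ≡ b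
    signs x (i , true)  p q true  = p
    signs x (i , true)  p q false = q
    signs x (i , false) p q true  = q
    signs x (i , false) p q false = p
    mirror-up : ∀ {x y : V n} → ix x ≢ ix y → τ T x (bar y) ≡ true → τ T y (bar x) ≡ true
    mirror-up ne eq = unbarˡ (trans (τ-mirror T (apart ne)) eq)
    go : ∀ b → τ T ξ (bar ξ) ≡ b → _
    go false eq = witness max ξ δ β record { u≢v = ξ≢δ ; uv = ξδ ; vū = mirror-up ξ≢δ ξδ̄ ; ūu = opp (bar-≢ ξ) eq } (ξ≢β ∘ sym) β≢δ
      (false , signs ξ β (opp (apart (ξ≢β ∘ sym)) βξ) (opp (apart (ξ≢β ∘ sym)) β̄ξ))
    go true  eq = witness max (bar ξ) β δ record
        { u≢v = ξ≢β ; uv = trans (cong (τ T (bar ξ)) (sym (bar-bar β))) (trans (τ-mirror T (apart (ξ≢β ∘ sym))) β̄ξ)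
        ; vū = trans (cong (τ T β) (bar-bar ξ)) βξ ; ūu = trans (cong (λ y → τ T y (bar ξ)) (bar-bar ξ)) eq } (ξ≢δ ∘ sym) (β≢δ ∘ sym)
      (false , signs (bar ξ) δ (opp (apart (ξ≢δ ∘ sym)) (mirror-up ξ≢δ ξδ̄)) (opp (apart (ξ≢δ ∘ sym)) (trans (τ-mirror T (apart ξ≢δ)) ξδ)))

  -- If v also points to the opposite of w, then v is a hub between u and w; if not, w is a hub
  -- between v and u. Thus the lossy configuration at a triangle edge forces a crystal to exist.
  single-crystal : ∀ {γ} → IsMaxCrystalDegree (IntGr n s) γ → ∀ (u v w : V n) → TriangleBits T u v w →
                   τ T u (bar v) ≡ false → τ T w (bar u) ≡ true → 1ℤ ≤ + γ
  single-crystal max u v w bits uv̄ wū = go (τ T v (bar w)) refl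
    where
    open TriangleBits bits
    v̄u : τ T (bar v) u ≡ true
    v̄u = opp (apart u≢v) uv̄
    go : ∀ b → τ T v (bar w) ≡ b → _
    go true  vw̄ = hub max v u w (u≢v ∘ sym) v≢w u≢w uv (trans (cong (τ T (bar u)) (sym (bar-bar v))) (trans (τ-mirror T (apart (u≢v ∘ sym))) v̄u)) vw vw̄
    go false vw̄ = hub max w v u (v≢w ∘ sym) (u≢w ∘ sym) (u≢v ∘ sym) vw
      (trans (cong (τ T (bar v)) (sym (bar-bar w))) (trans (τ-mirror T (apart (v≢w ∘ sym))) (opp (apart v≢w) vw̄))) wu wū

module _ {n : ℕ} {s : Vec ℤ n} where

  crystal-bound₁ : ∀ {γ} → IsMaxCrystalDegree (IntGr n s) γ → CrystalBound s (+ γ) 1ℤ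
  CrystalBound.double (crystal-bound₁ {γ} max) T u v sc bits R perm =
    subst (_≤ + γ) (sym (ℤₚ.*-identityˡ (crystals T u R))) (CrystalCount.crystals≤ T sc u v bits max R perm)
  CrystalBound.single (crystal-bound₁ max) T u v w sc bits x z = ℤₚ.≤-refl

  -- With η = 0 both kinds of edges have the same constant and double edges lose nothing. The case
  -- of a triangle edge that would need unequal constants is contradictory, as it would give γ ≥ 1.
  crystal-bound₀ : IsMaxCrystalDegree (IntGr n s) 0 → CrystalBound s 1ℤ 0ℤ
  CrystalBound.double (crystal-bound₀ max) T u v sc bits R perm = subst (_≤ 1ℤ) (sym (ℤₚ.*-zeroˡ (crystals T u R))) (ℤ.+≤+ ℕ.z≤n)
  CrystalBound.single (crystal-bound₀ max) T u v w sc bits x z = single-crystal T sc max u v w bits x z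

-- Passage to the rationals, and numerical estimates

module ℚ∑ = ListSum ℚₚ.+-*-commutativeRing

ι : ℤ → ℚ
ι z = z ℚ./ 1

ι-ᵘ : ∀ z → ℚ.toℚᵘ (ι z) ℚᵘ.≃ mkℚᵘ z 0
ι-ᵘ z = ℚₚ.toℚᵘ-fromℚᵘ (mkℚᵘ z 0)

ι-+ : ∀ a b → ι (a + b) ≡ ι a ℚ.+ ι b
ι-+ a b = ℚₚ.toℚᵘ-injective (ℚᵘₚ.≃-trans (ι-ᵘ (a + b)) (ℚᵘₚ.≃-trans (*≡* (identity a b))
  (ℚᵘₚ.≃-sym (ℚᵘₚ.≃-trans (ℚₚ.toℚᵘ-homo-+ (ι a) (ι b)) (ℚᵘₚ.+-cong (ι-ᵘ a) (ι-ᵘ b))))))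
  where identity : ∀ a b → (a + b) * 1ℤ ≡ (a * 1ℤ + b * 1ℤ) * 1ℤ
        identity = solve-∀

ι-* : ∀ a b → ι (a * b) ≡ ι a ℚ.* ι b
ι-* a b = ℚₚ.toℚᵘ-injective (ℚᵘₚ.≃-trans (ι-ᵘ (a * b))
  (ℚᵘₚ.≃-sym (ℚᵘₚ.≃-trans (ℚₚ.toℚᵘ-homo-* (ι a) (ι b)) (ℚᵘₚ.*-cong (ι-ᵘ a) (ι-ᵘ b)))))

ι-neg : ∀ a → ι (- a) ≡ ℚ.- ι a
ι-neg a = ℚₚ.toℚᵘ-injective (ℚᵘₚ.≃-trans (ι-ᵘ (- a)) (ℚᵘₚ.≃-sym (ℚᵘₚ.≃-trans (ℚₚ.toℚᵘ-homo‿- (ι a)) (ℚᵘₚ.-‿cong (ι-ᵘ a)))))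

ι-≤ : ∀ {a b} → a ≤ b → ι a ℚ.≤ ι b
ι-≤ {a} {b} a≤b = ℚₚ.toℚᵘ-cancel-≤ (ℚᵘₚ.≤-respˡ-≃ (ℚᵘₚ.≃-sym (ι-ᵘ a)) (ℚᵘₚ.≤-respʳ-≃ (ℚᵘₚ.≃-sym (ι-ᵘ b))
  (*≤* (ℤₚ.*-monoʳ-≤-nonNeg 1ℤ a≤b))))

ι-frac : ∀ a m → ι (+ suc m) ℚ.* ((+ a) ℚ./ suc m) ≡ ι (+ a)
ι-frac a m = ℚₚ.toℚᵘ-injective (ℚᵘₚ.≃-trans (ℚₚ.toℚᵘ-homo-* (ι (+ suc m)) ((+ a) ℚ./ suc m))
  (ℚᵘₚ.≃-trans (ℚᵘₚ.*-cong (ι-ᵘ (+ suc m)) (ℚₚ.toℚᵘ-fromℚᵘ (mkℚᵘ (+ a) m))) (ℚᵘₚ.≃-trans (*≡* cross) (ℚᵘₚ.≃-sym (ι-ᵘ (+ a))))))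
  where
  cross : + suc m * + a * 1ℤ ≡ + a * + (1 ℕ.* suc m)
  cross = trans (ℤₚ.*-identityʳ (+ suc m * + a)) (trans (ℤₚ.*-comm (+ suc m) (+ a)) (cong (λ k → + a * + k) (sym (ℕₚ.*-identityˡ (suc m)))))

ι-positive : ∀ m → ℚ.Positive (ι (+ suc m))
ι-positive m = ℚₚ.normalize-pos (suc m) 1

∣∣-sign : ∀ p → ∃ λ b → ℚ.∣ p ∣ ≡ ι (sgn b) ℚ.* p
∣∣-sign p with 0ℚ ℚₚ.≤? p
... | yes 0≤p = true , trans (ℚₚ.0≤p⇒∣p∣≡p 0≤p) (sym (ℚₚ.*-identityˡ p))
... | no 0≰p  = false , trans (sym (ℚₚ.∣-p∣≡∣p∣ p)) (trans (ℚₚ.0≤p⇒∣p∣≡p (ℚₚ.neg-antimono-≤ (ℚₚ.<⇒≤ (ℚₚ.≰⇒> 0≰p))))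
  (trans (cong ℚ.-_ (sym (ℚₚ.*-identityˡ p))) (ℚₚ.neg-distribˡ-* 1ℚ p)))

-- Bernoulli's inequality (1 + 1/a)^j ≥ 1 + j/a with denominators cleared.
bernoulli : ∀ a j → (a ℕ.+ j) ℕ.* a ℕ.^ j ℕ.≤ a ℕ.* suc a ℕ.^ j
bernoulli a zero    = ℕₚ.≤-reflexive (cong (ℕ._* 1) (ℕₚ.+-identityʳ a))
bernoulli a (suc j) = begin
  (a ℕ.+ suc j) ℕ.* (a ℕ.* a ℕ.^ j)
    ≡⟨ left a j (a ℕ.^ j) ⟩
  a ℕ.* ((a ℕ.+ j) ℕ.* a ℕ.^ j) ℕ.+ a ℕ.* a ℕ.^ j
    ≤⟨ ℕₚ.+-mono-≤ (ℕₚ.*-monoʳ-≤ a (bernoulli a j)) (ℕₚ.≤-trans (ℕₚ.*-monoˡ-≤ (a ℕ.^ j) (ℕₚ.m≤m+n a j)) (bernoulli a j)) ⟩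
  a ℕ.* (a ℕ.* suc a ℕ.^ j) ℕ.+ a ℕ.* suc a ℕ.^ j
    ≡⟨ right a (suc a ℕ.^ j) ⟩
  a ℕ.* (suc a ℕ.* suc a ℕ.^ j) ∎
  where
  open ℕₚ.≤-Reasoning
  left : ∀ a j x → (a ℕ.+ suc j) ℕ.* (a ℕ.* x) ≡ a ℕ.* ((a ℕ.+ j) ℕ.* x) ℕ.+ a ℕ.* x
  left = ℕSolver.solve-∀
  right : ∀ a y → a ℕ.* (a ℕ.* y) ℕ.+ a ℕ.* y ≡ a ℕ.* (suc a ℕ.* y)
  right = ℕSolver.solve-∀

-- With m = a + 1 this is (1 - 1/m)^m ≤ 1/2; it follows from Bernoulli, as 1 + m/a ≥ 2.
halving : ∀ a → 2 ℕ.* a ℕ.^ suc a ℕ.≤ suc a ℕ.^ suc a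
halving zero    = ℕ.z≤n
halving (suc b) = ℕₚ.*-cancelˡ-≤ (suc b) (ℕₚ.≤-trans (ℕₚ.≤-trans (ℕₚ.≤-reflexive (assoc (suc b) (suc b ℕ.^ suc (suc b))))
  (ℕₚ.*-monoˡ-≤ (suc b ℕ.^ suc (suc b)) (ℕₚ.+-monoʳ-≤ (suc b) (ℕₚ.n≤1+n (suc b))))) (bernoulli (suc b) (suc (suc b))))
  where assoc : ∀ a x → a ℕ.* (2 ℕ.* x) ≡ (a ℕ.+ a) ℕ.* x
        assoc = ℕSolver.solve-∀

^-distrib-* : ∀ x y k → (x ℕ.* y) ℕ.^ k ≡ x ℕ.^ k ℕ.* y ℕ.^ k
^-distrib-* x y zero    = refl
^-distrib-* x y (suc k) = trans (cong (x ℕ.* y ℕ.*_) (^-distrib-* x y k)) (interchange x y (x ℕ.^ k) (y ℕ.^ k))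
  where interchange : ∀ x y a b → x ℕ.* y ℕ.* (a ℕ.* b) ≡ x ℕ.* a ℕ.* (y ℕ.* b)
        interchange = ℕSolver.solve-∀

decay : ∀ a k → 2 ℕ.^ k ℕ.* a ℕ.^ (suc a ℕ.* k) ℕ.≤ suc a ℕ.^ (suc a ℕ.* k)
decay a k = begin
  2 ℕ.^ k ℕ.* a ℕ.^ (suc a ℕ.* k)    ≡⟨ cong (2 ℕ.^ k ℕ.*_) (ℕₚ.^-*-assoc a (suc a) k) ⟨
  2 ℕ.^ k ℕ.* (a ℕ.^ suc a) ℕ.^ k    ≡⟨ ^-distrib-* 2 (a ℕ.^ suc a) k ⟨
  (2 ℕ.* a ℕ.^ suc a) ℕ.^ k          ≤⟨ ℕₚ.^-monoˡ-≤ k (halving a) ⟩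
  (suc a ℕ.^ suc a) ℕ.^ k            ≡⟨ ℕₚ.^-*-assoc (suc a) (suc a) k ⟩
  suc a ℕ.^ (suc a ℕ.* k)            ∎
  where open ℕₚ.≤-Reasoning

n≤2^log : ∀ n → n ℕ.≤ 2 ℕ.^ ⌈log₂ n ⌉
n≤2^log = <-rec (λ n → n ℕ.≤ 2 ℕ.^ ⌈log₂ n ⌉) go
  where
  go : ∀ n → (∀ {m} → m ℕ.< n → m ℕ.≤ 2 ℕ.^ ⌈log₂ m ⌉) → n ℕ.≤ 2 ℕ.^ ⌈log₂ n ⌉
  go zero          rec = ℕ.z≤n
  go (suc zero)    rec = ℕₚ.≤-refl
  go n@(suc (suc m)) rec = begin
    n                                      ≡⟨ ℕₚ.⌊n/2⌋+⌈n/2⌉≡n n ⟨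
    ℕ.⌊ n /2⌋ ℕ.+ ℕ.⌈ n /2⌉                ≤⟨ ℕₚ.+-monoˡ-≤ ℕ.⌈ n /2⌉ (ℕₚ.⌊n/2⌋≤⌈n/2⌉ n) ⟩
    ℕ.⌈ n /2⌉ ℕ.+ ℕ.⌈ n /2⌉                ≤⟨ ℕₚ.+-mono-≤ half≤ half≤ ⟩
    2 ℕ.^ (⌈log₂ n ⌉ ℕ.∸ 1) ℕ.+ 2 ℕ.^ (⌈log₂ n ⌉ ℕ.∸ 1)  ≡⟨ double (⌈log₂ n ⌉) (⌈log₂⌉-mono-≤ {2} {n} (ℕ.s≤s (ℕ.s≤s ℕ.z≤n))) ⟩
    2 ℕ.^ ⌈log₂ n ⌉                        ∎
    where
    open ℕₚ.≤-Reasoning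
    half≤ : ℕ.⌈ n /2⌉ ℕ.≤ 2 ℕ.^ (⌈log₂ n ⌉ ℕ.∸ 1)
    half≤ = subst (λ e → ℕ.⌈ n /2⌉ ℕ.≤ 2 ℕ.^ e) (⌈log₂⌈n/2⌉⌉≡⌈log₂n⌉∸1 n) (rec (ℕₚ.⌈n/2⌉<n m))
    double : ∀ L → 1 ℕ.≤ L → 2 ℕ.^ (L ℕ.∸ 1) ℕ.+ 2 ℕ.^ (L ℕ.∸ 1) ≡ 2 ℕ.^ L
    double (suc L) _ = cong (2 ℕ.^ L ℕ.+_) (sym (ℕₚ.+-identityʳ (2 ℕ.^ L)))

length-concatMap-≤ : ∀ {A B : Set} (xs : List A) (f : A → List B) c → (∀ x → length (f x) ℕ.≤ c) → length (concatMap f xs) ℕ.≤ length xs ℕ.* c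
length-concatMap-≤ []       f c p = ℕ.z≤n
length-concatMap-≤ (x ∷ xs) f c p = ℕₚ.≤-trans (ℕₚ.≤-reflexive (Listₚ.length-++ (f x))) (ℕₚ.+-mono-≤ (p x) (length-concatMap-≤ xs f c p))

M≤ : ∀ n → M n ℕ.≤ n ℕ.* (n ℕ.* 2) ℕ.+ n
M≤ n = ℕₚ.≤-trans (ℕₚ.≤-reflexive (Listₚ.length-++ (concatMap rows (allFin n))))
  (ℕₚ.+-mono-≤ (subst (λ k → length (concatMap rows (allFin n)) ℕ.≤ k ℕ.* (n ℕ.* 2)) count
      (length-concatMap-≤ (allFin n) rows (n ℕ.* 2) (λ i → subst (λ k → length (rows i) ℕ.≤ k ℕ.* 2) count
        (length-concatMap-≤ (allFin n) (row i) 2 (row≤ i)))))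
    (ℕₚ.≤-reflexive (trans (Listₚ.length-map loop (allFin n)) count)))
  where
  count : length (allFin n) ≡ n
  count = Listₚ.length-tabulate {n = n} (λ i → i)
  row : Fin n → Fin n → List (Edge n)
  row i j = if toℕ j <ᵇ toℕ i then neg i j ∷ pos i j ∷ [] else []
  rows : Fin n → List (Edge n)
  rows i = concatMap (row i) (allFin n)
  row≤ : ∀ i j → length (row i j) ℕ.≤ 2
  row≤ i j with toℕ j <ᵇ toℕ i
  ... | true  = ℕₚ.≤-refl
  ... | false = ℕ.z≤n

-- The origin of the constant 7: there are at most 4 n² games, so the left side is at most 32 n².
-- With L the rounded-up logarithm, n² costs 2 L in the exponent and 32 costs 5 ≤ 5 L.
8M≤ : ∀ n → 2 ℕ.≤ n → 8 ℕ.* M n ℕ.≤ 2 ℕ.^ (7 ℕ.* ⌈log₂ n ⌉)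
8M≤ n 2≤n = begin
  8 ℕ.* M n                                     ≤⟨ ℕₚ.*-monoʳ-≤ 8 (M≤ n) ⟩
  8 ℕ.* (n ℕ.* (n ℕ.* 2) ℕ.+ n)                 ≤⟨ ℕₚ.*-monoʳ-≤ 8 (ℕₚ.+-mono-≤ (ℕₚ.≤-reflexive (square n)) (ℕₚ.m≤n*m n (n ℕ.+ n) {{ℕ.>-nonZero (ℕₚ.≤-trans (ℕₚ.≤-trans (ℕ.s≤s ℕ.z≤n) 2≤n) (ℕₚ.m≤m+n n n))}})) ⟩
  8 ℕ.* ((n ℕ.+ n) ℕ.* n ℕ.+ (n ℕ.+ n) ℕ.* n)   ≡⟨ collect n ⟩
  32 ℕ.* (n ℕ.* n)                              ≤⟨ ℕₚ.*-mono-≤ {32} (ℕₚ.^-monoʳ-≤ 2 {5} (ℕₚ.*-monoʳ-≤ 5 1≤L)) (ℕₚ.*-mono-≤ (n≤2^log n) (n≤2^log n)) ⟩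
  2 ℕ.^ (5 ℕ.* L) ℕ.* (2 ℕ.^ L ℕ.* 2 ℕ.^ L)     ≡⟨ cong (2 ℕ.^ (5 ℕ.* L) ℕ.*_) (ℕₚ.^-distribˡ-+-* 2 L L) ⟨
  2 ℕ.^ (5 ℕ.* L) ℕ.* 2 ℕ.^ (L ℕ.+ L)           ≡⟨ ℕₚ.^-distribˡ-+-* 2 (5 ℕ.* L) (L ℕ.+ L) ⟨
  2 ℕ.^ (5 ℕ.* L ℕ.+ (L ℕ.+ L))                 ≡⟨ cong (2 ℕ.^_) (seven L) ⟩
  2 ℕ.^ (7 ℕ.* L)                               ∎
  where
  open ℕₚ.≤-Reasoning
  L : ℕ
  L = ⌈log₂ n ⌉
  1≤L : 1 ℕ.≤ L
  1≤L = ⌈log₂⌉-mono-≤ {2} {n} 2≤n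
  square : ∀ n → n ℕ.* (n ℕ.* 2) ≡ (n ℕ.+ n) ℕ.* n
  square = ℕSolver.solve-∀
  collect : ∀ n → 8 ℕ.* ((n ℕ.+ n) ℕ.* n ℕ.+ (n ℕ.+ n) ℕ.* n) ≡ 32 ℕ.* (n ℕ.* n)
  collect = ℕSolver.solve-∀
  seven : ∀ L → 5 ℕ.* L ℕ.+ (L ℕ.+ L) ≡ 7 ℕ.* L
  seven = ℕSolver.solve-∀

ι-pos : ∀ {m} → 1 ℕ.≤ m → ℚ.Positive (ι (+ m))
ι-pos {suc m} _ = ι-positive m

ι-∑ : ∀ {A : Set} (xs : List A) (f : A → ℤ) → ι (∑ xs f) ≡ ℚ∑.∑ xs (ι ∘ f)
ι-∑ []       f = refl
ι-∑ (x ∷ xs) f = trans (ι-+ (f x) (∑ xs f)) (cong (ι (f x) ℚ.+_) (ι-∑ xs f))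

ℚ∑-mono : ∀ {A : Set} (xs : List A) {f g : A → ℚ} → (∀ x → f x ℚ.≤ g x) → ℚ∑.∑ xs f ℚ.≤ ℚ∑.∑ xs g
ℚ∑-mono []       p = ℚₚ.≤-refl
ℚ∑-mono (x ∷ xs) p = ℚₚ.+-mono-≤ (p x) (ℚ∑-mono xs p)

open import Algebra.Properties.CommutativeSemigroup (CommutativeRing.*-commutativeSemigroup ℚₚ.+-*-commutativeRing) using () renaming (x∙yz≈y∙xz to ℚ-*-left-comm)

-- The lazy walk as an averaging operator, and total variation

module Chain {K : ℕ} (mult : Fin K → Fin K → ℕ) where

  X : List (Fin K)
  X = allFin K

  mean : (Fin K → ℚ) → (Fin K → ℚ) → ℚ
  mean a f = sumℚ (λ y → a y ℚ.* f y)

  step : (Fin K → ℚ) → Fin K → ℚ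
  step f x = mean (P mult x) f

  mean-cong : ∀ a {f g : Fin K → ℚ} → (∀ y → f y ≡ g y) → mean a f ≡ mean a g
  mean-cong a eq = ℚ∑.∑-cong X (λ y → cong (a y ℚ.*_) (eq y))

  mean-scale : ∀ c a f → c ℚ.* mean a f ≡ mean a (λ y → c ℚ.* f y)
  mean-scale c a f = trans (sym (ℚ∑.∑-*ˡ X c (λ y → a y ℚ.* f y))) (ℚ∑.∑-cong X (λ y → ℚ-*-left-comm c (a y) (f y)))

  mean-mean : ∀ a (p : Fin K → Fin K → ℚ) f → mean (λ y → mean a (λ z → p z y)) f ≡ mean a (λ z → mean (p z) f)
  mean-mean a p f = trans (ℚ∑.∑-cong X (λ y → trans (ℚₚ.*-comm (mean a (λ z → p z y)) (f y)) (sym (ℚ∑.∑-*ˡ X (f y) (λ z → a z ℚ.* p z y)))))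
    (trans (ℚ∑.∑-swap X X (λ y z → f y ℚ.* (a z ℚ.* p z y)))
      (ℚ∑.∑-cong X (λ z → trans (ℚ∑.∑-cong X (λ y → trans (ℚ-*-left-comm (f y) (a z) (p z y)) (cong (a z ℚ.*_) (ℚₚ.*-comm (f y) (p z y)))))
        (ℚ∑.∑-*ˡ X (a z) (λ y → p z y ℚ.* f y)))))

  mean-δ : ∀ x f → mean (δ mult x) f ≡ f x
  mean-δ x f = trans (ℚ∑.∑-single X (λ y → δ mult x y ℚ.* f y) (Uniqueₚ.allFin⁺ K) (∈ₚ.∈-allFin x) (λ {y} → off y)) on
    where
    on : δ mult x x ℚ.* f x ≡ f x
    on with x Finₚ.≟ x
    ... | yes _  = ℚₚ.*-identityˡ (f x)
    ... | no x≢x = contradiction refl x≢x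
    off : ∀ y → y ≢ x → δ mult x y ℚ.* f y ≡ 0ℚ
    off y y≢x with x Finₚ.≟ y
    ... | yes x≡y = contradiction (sym x≡y) y≢x
    ... | no _    = ℚₚ.*-zeroˡ (f y)

  mean-Pt-suc : ∀ t x f → mean (Pt mult (suc t) x) f ≡ mean (Pt mult t x) (step f)
  mean-Pt-suc t x f = mean-mean (Pt mult t x) (P mult) f

  P-suc : ∀ {k} x y → deg mult x ≡ suc k → P mult x y ≡ ½ ℚ.* δ mult x y ℚ.+ frac mult (mult x y) (2 ℕ.* suc k)
  P-suc {k} x y eq with deg mult x | eq
  ... | .(suc k) | refl = refl

  P-scaled : ∀ {k} x y → deg mult x ≡ suc k → ι (+ (2 ℕ.* suc k)) ℚ.* P mult x y ≡ ι (+ suc k) ℚ.* δ mult x y ℚ.+ ι (+ mult x y)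
  P-scaled {k} x y eq = trans (cong (ι (+ (2 ℕ.* suc k)) ℚ.*_) (P-suc x y eq))
    (trans (ℚₚ.*-distribˡ-+ (ι (+ (2 ℕ.* suc k))) (½ ℚ.* δ mult x y) (frac mult (mult x y) (2 ℕ.* suc k)))
      (cong₂ ℚ._+_ (trans (sym (ℚₚ.*-assoc (ι (+ (2 ℕ.* suc k))) ½ (δ mult x y))) (cong (ℚ._* δ mult x y) halve))
                   (ι-frac (mult x y) (k ℕ.+ suc (k ℕ.+ 0)))))
    where
    halve : ι (+ (2 ℕ.* suc k)) ℚ.* ½ ≡ ι (+ suc k)
    halve = trans (cong (ℚ._* ½) (trans (cong ι (trans (cong +_ (ℕₚ.*-comm 2 (suc k))) (ℤₚ.pos-* (suc k) 2))) (ι-* (+ suc k) (+ 2))))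
      (trans (ℚₚ.*-assoc (ι (+ suc k)) (ι (+ 2)) ½) (ℚₚ.*-identityʳ (ι (+ suc k))))

  -- Twice the degree clears both denominators of the lazy transition probabilities, so integer
  -- functions stay integer.
  step-scaled : ∀ {k} x (F : Fin K → ℤ) → deg mult x ≡ suc k →
    ι (+ (2 ℕ.* suc k)) ℚ.* step (ι ∘ F) x ≡ ι (+ suc k * F x + ∑ X (λ y → + mult x y * F y))
  step-scaled {k} x F eq = begin
    N ℚ.* step (ι ∘ F) x
      ≡⟨ ℚ∑.∑-*ˡ X N (λ y → P mult x y ℚ.* ι (F y)) ⟨
    ℚ∑.∑ X (λ y → N ℚ.* (P mult x y ℚ.* ι (F y)))
      ≡⟨ ℚ∑.∑-cong X pointwise ⟩
    ℚ∑.∑ X (λ y → ι (+ suc k) ℚ.* (δ mult x y ℚ.* ι (F y)) ℚ.+ ι (+ mult x y * F y))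
      ≡⟨ ℚ∑.∑-+ X (λ y → ι (+ suc k) ℚ.* (δ mult x y ℚ.* ι (F y))) (λ y → ι (+ mult x y * F y)) ⟩
    ℚ∑.∑ X (λ y → ι (+ suc k) ℚ.* (δ mult x y ℚ.* ι (F y))) ℚ.+ ℚ∑.∑ X (λ y → ι (+ mult x y * F y))
      ≡⟨ cong₂ ℚ._+_ (trans (ℚ∑.∑-*ˡ X (ι (+ suc k)) (λ y → δ mult x y ℚ.* ι (F y)))
           (trans (cong (ι (+ suc k) ℚ.*_) (mean-δ x (ι ∘ F))) (sym (ι-* (+ suc k) (F x)))))
           (sym (ι-∑ X (λ y → + mult x y * F y))) ⟩
    ι (+ suc k * F x) ℚ.+ ι (∑ X (λ y → + mult x y * F y))
      ≡⟨ ι-+ (+ suc k * F x) (∑ X (λ y → + mult x y * F y)) ⟨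
    ι (+ suc k * F x + ∑ X (λ y → + mult x y * F y)) ∎
    where
    open ≡-Reasoning
    N : ℚ
    N = ι (+ (2 ℕ.* suc k))
    pointwise : ∀ y → N ℚ.* (P mult x y ℚ.* ι (F y)) ≡ ι (+ suc k) ℚ.* (δ mult x y ℚ.* ι (F y)) ℚ.+ ι (+ mult x y * F y)
    pointwise y = trans (sym (ℚₚ.*-assoc N (P mult x y) (ι (F y))))
      (trans (cong (ℚ._* ι (F y)) (P-scaled x y eq))
      (trans (ℚₚ.*-distribʳ-+ (ι (F y)) (ι (+ suc k) ℚ.* δ mult x y) (ι (+ mult x y)))
      (cong₂ ℚ._+_ (ℚₚ.*-assoc (ι (+ suc k)) (δ mult x y) (ι (F y))) (sym (ι-* (+ mult x y) (F y))))))

  -- Testing against sign functions: σ·(P^t b − π b) is the π-average of Φ x − Φ z.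
  tv-bound : ∀ {π} → IsStationary mult π → ∀ t σ D → 1 ℕ.≤ σ → + 2 * D ≤ + σ →
    (∀ (b : Fin K → Bool) → ∃ λ (Φ : Fin K → ℤ) →
      (∀ x → ι (+ σ) ℚ.* mean (Pt mult t x) (ι ∘ sgn ∘ b) ≡ ι (Φ x)) ×
      (ι (+ σ) ℚ.* mean π (ι ∘ sgn ∘ b) ≡ mean π (ι ∘ Φ)) ×
      (∀ x z → Φ x - Φ z ≤ D)) →
    ∀ x → dTV mult π t x ℚ.≤ (+ 1 ℚ./ 4)
  tv-bound {π} (π≥0 , π-total , _) t σ D 1≤σ 2D≤σ test x = begin
    ½ ℚ.* sumℚ (λ y → ℚ.∣ Pt mult t x y ℚ.- π y ∣)
      ≡⟨ cong (½ ℚ.*_) signed ⟩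
    ½ ℚ.* W
      ≡⟨ ℚₚ.*-assoc (+ 1 ℚ./ 4) (ι (+ 2)) W ⟩
    (+ 1 ℚ./ 4) ℚ.* (ι (+ 2) ℚ.* W)
      ≤⟨ ℚₚ.*-monoˡ-≤-nonNeg (+ 1 ℚ./ 4) 2W≤1 ⟩
    (+ 1 ℚ./ 4) ∎
    where
    open ℚₚ.≤-Reasoning
    -- For this x, the signs of P^t(x,y) - π(y) turn the sum of absolute values into a difference of
    -- two means of a sign function.
    b : Fin K → Bool
    b y = proj₁ (∣∣-sign (Pt mult t x y ℚ.- π y))
    β : Fin K → ℚ
    β = ι ∘ sgn ∘ b
    Φ : Fin K → ℤ
    Φ = proj₁ (test b)
    W : ℚ
    W = mean (Pt mult t x) β ℚ.- mean π β
    minus-∑ : ∀ (f g : Fin K → ℚ) → ℚ∑.∑ X (λ y → f y ℚ.- g y) ≡ ℚ∑.∑ X f ℚ.- ℚ∑.∑ X g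
    minus-∑ f g = trans (ℚ∑.∑-+ X f (λ y → ℚ.- g y)) (cong (ℚ∑.∑ X f ℚ.+_)
      (trans (ℚ∑.∑-cong X (λ y → trans (cong ℚ.-_ (sym (ℚₚ.*-identityˡ (g y)))) (ℚₚ.neg-distribˡ-* 1ℚ (g y))))
      (trans (ℚ∑.∑-*ˡ X (ℚ.- 1ℚ) g) (trans (sym (ℚₚ.neg-distribˡ-* 1ℚ (ℚ∑.∑ X g))) (cong ℚ.-_ (ℚₚ.*-identityˡ (ℚ∑.∑ X g)))))))
    *-minus : ∀ c p q → c ℚ.* (p ℚ.- q) ≡ c ℚ.* p ℚ.- c ℚ.* q
    *-minus c p q = trans (ℚₚ.*-distribˡ-+ c p (ℚ.- q)) (cong (c ℚ.* p ℚ.+_) (sym (ℚₚ.neg-distribʳ-* c q)))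
    signed : sumℚ (λ y → ℚ.∣ Pt mult t x y ℚ.- π y ∣) ≡ W
    signed = trans (ℚ∑.∑-cong X (λ y → trans (proj₂ (∣∣-sign (Pt mult t x y ℚ.- π y)))
        (trans (*-minus (β y) (Pt mult t x y) (π y)) (cong₂ ℚ._-_ (ℚₚ.*-comm (β y) (Pt mult t x y)) (ℚₚ.*-comm (β y) (π y))))))
      (minus-∑ (λ y → Pt mult t x y ℚ.* β y) (λ y → π y ℚ.* β y))
    constant : ∀ c → mean π (λ _ → c) ≡ c
    constant c = trans (ℚ∑.∑-cong X (λ y → ℚₚ.*-comm (π y) c)) (trans (ℚ∑.∑-*ˡ X c π) (trans (cong (c ℚ.*_) π-total) (ℚₚ.*-identityʳ c)))
    σW : ι (+ σ) ℚ.* W ≡ mean π (λ z → ι (Φ x - Φ z))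
    σW = trans (*-minus (ι (+ σ)) (mean (Pt mult t x) β) (mean π β))
      (trans (cong₂ ℚ._-_ (trans (proj₁ (proj₂ (test b)) x) (sym (constant (ι (Φ x))))) (proj₁ (proj₂ (proj₂ (test b)))))
      (trans (sym (minus-∑ (λ z → π z ℚ.* ι (Φ x)) (λ z → π z ℚ.* ι (Φ z))))
        (ℚ∑.∑-cong X (λ z → trans (sym (*-minus (π z) (ι (Φ x)) (ι (Φ z))))
          (cong (π z ℚ.*_) (sym (trans (ι-+ (Φ x) (- Φ z)) (cong (ι (Φ x) ℚ.+_) (ι-neg (Φ z))))))))))
    σW≤ : ι (+ σ) ℚ.* W ℚ.≤ ι D
    σW≤ = begin
      ι (+ σ) ℚ.* W                 ≡⟨ σW ⟩
      mean π (λ z → ι (Φ x - Φ z))  ≤⟨ ℚ∑-mono X (λ z → ℚₚ.*-monoˡ-≤-nonNeg (π z) {{ℚ.nonNegative (π≥0 z)}} (ι-≤ (proj₂ (proj₂ (proj₂ (test b))) x z))) ⟩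
      mean π (λ _ → ι D)            ≡⟨ constant (ι D) ⟩
      ι D                           ∎
    2W≤1 : ι (+ 2) ℚ.* W ℚ.≤ 1ℚ
    2W≤1 = ℚₚ.*-cancelˡ-≤-pos (ι (+ σ)) {{ι-pos 1≤σ}} (begin
      ι (+ σ) ℚ.* (ι (+ 2) ℚ.* W)   ≡⟨ ℚ-*-left-comm (ι (+ σ)) (ι (+ 2)) W ⟩
      ι (+ 2) ℚ.* (ι (+ σ) ℚ.* W)   ≤⟨ ℚₚ.*-monoˡ-≤-nonNeg (ι (+ 2)) σW≤ ⟩
      ι (+ 2) ℚ.* ι D               ≡⟨ ι-* (+ 2) D ⟨
      ι (+ 2 * D)                   ≤⟨ ι-≤ 2D≤σ ⟩
      ι (+ σ)                       ≡⟨ ℚₚ.*-identityʳ (ι (+ σ)) ⟨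
      ι (+ σ) ℚ.* 1ℚ                ∎)

hamming≤M : ∀ {n} (T T′ : Tournament n) → hamming {n} T T′ ≤ + M n
hamming≤M {n} T T′ = go (edges n)
  where
  ind≤1 : ∀ b → ind b ≤ 1ℤ
  ind≤1 true  = ℤₚ.≤-refl
  ind≤1 false = ℤ.+≤+ ℕ.z≤n
  go : ∀ L → ∑ L (λ e → ind (differ {n} T T′ e)) ≤ + length L
  go []      = ℤₚ.≤-refl
  go (e ∷ L) = ℤₚ.+-mono-≤ (ind≤1 (differ {n} T T′ e)) (go L)

-- Mixing of the walk on the interchange graph

module Walk {n : ℕ} (s : Vec ℤ n) where

  open Graph {n} s
  open Chain (IntGr n s)

  -- After exchanging the sums, each neutral generator hits exactly one vertex: its flip keeps the
  -- score, and every tournament is listed once.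
  neighbours : ∀ x (H : Tournament n → ℤ) →
    ∑ X (λ y → + IntGr n s x y * H (vertex y)) ≡ ∑ (genShapes n) (λ p → + proj₁ p * gate (neut (vertex x) (proj₂ p)) (H (vertex x ⟲ proj₂ p)))
  neighbours x H = begin
    ∑ X (λ y → + IntGr n s x y * H (vertex y))
      ≡⟨ ∑-cong X (λ y → trans (cong (λ z → z * H (vertex y)) (multT-∑ {n} Tₓ (vertex y)))
           (trans (ℤₚ.*-comm (∑ (genShapes n) (hits {n} Tₓ (vertex y))) (H (vertex y))) (sym (∑-*ˡ (genShapes n) (H (vertex y)) (hits {n} Tₓ (vertex y)))))) ⟩
    ∑ X (λ y → ∑ (genShapes n) (λ p → H (vertex y) * hits {n} Tₓ (vertex y) p))
      ≡⟨ ∑-swap X (genShapes n) (λ y p → H (vertex y) * hits {n} Tₓ (vertex y) p) ⟩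
    ∑ (genShapes n) (λ p → ∑ X (λ y → H (vertex y) * hits {n} Tₓ (vertex y) p))
      ≡⟨ ∑-cong (genShapes n) (λ { (k , S) → shape k S (neut Tₓ S) refl }) ⟩
    ∑ (genShapes n) (λ p → + proj₁ p * gate (neut Tₓ (proj₂ p)) (H (Tₓ ⟲ proj₂ p))) ∎
    where
    open ≡-Reasoning
    Tₓ : Tournament n
    Tₓ = vertex x
    vanish : ∀ h k → h * (k * 0ℤ) ≡ 0ℤ
    vanish = solve-∀
    keep-one : ∀ h k → h * (k * 1ℤ) ≡ k * h
    keep-one = solve-∀
    term : ℕ → List (Edge n) → Bool → Fin (K n s) → ℤ
    term k S c y = H (vertex y) * (+ k * ind (c ∧ (_==T_ {n} (Tₓ ⟲ S) (vertex y))))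
    shape : ∀ k S c → neut Tₓ S ≡ c → ∑ X (λ y → H (vertex y) * hits {n} Tₓ (vertex y) (k , S)) ≡ + k * gate (neut Tₓ S) (H (Tₓ ⟲ S))
    shape k S false eq = trans (∑-cong X {g = λ _ → 0ℤ} (λ y → trans (cong (λ c → term k S c y) eq) (vanish (H (vertex y)) (+ k))))
      (trans (∑-zero X) (trans (sym (ℤₚ.*-zeroʳ (+ k))) (cong (λ c → + k * gate c (H (Tₓ ⟲ S))) (sym eq))))
    shape k S true  eq = go (index (Tₓ ⟲ S) (⟲-score Tₓ S (vertex-score x) eq))
      where
      go : (∃ λ z → vertex z ≡ Tₓ ⟲ S) → ∑ X (λ y → term k S (neut Tₓ S) y) ≡ + k * gate (neut Tₓ S) (H (Tₓ ⟲ S))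
      go (z , at-z) = trans (∑-cong X (λ y → cong (λ c → term k S c y) eq))
        (trans (∑-single X (term k S true) (Uniqueₚ.allFin⁺ (K n s)) (∈ₚ.∈-allFin z) (λ {y} y≢z → off y y≢z (_==T_ {n} (Tₓ ⟲ S) (vertex y)) refl))
        (trans (cong (λ c → H (vertex z) * (+ k * ind c)) (==T-complete {n} (sym at-z)))
        (trans (keep-one (H (vertex z)) (+ k)) (cong₂ (λ c T′ → + k * gate c (H T′)) (sym eq) at-z))))
        where
        off : ∀ y → y ≢ z → ∀ c → _==T_ {n} (Tₓ ⟲ S) (vertex y) ≡ c → term k S true y ≡ 0ℤ
        off y y≢z false ne = trans (cong (λ c → H (vertex y) * (+ k * ind c)) ne) (vanish (H (vertex y)) (+ k))
        off y y≢z true  e  = contradiction (vertex-injective (trans (sym (==T-sound {n} e)) (sym at-z))) y≢z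

  degree-vertex : ∀ x → degree {n} (vertex x) ≡ + deg (IntGr n s) x
  degree-vertex x = sym (trans (sum-∑ X (IntGr n s x)) (trans (∑-cong X (λ y → sym (ℤₚ.*-identityʳ (+ IntGr n s x y))))
    (trans (neighbours x (λ _ → 1ℤ)) (∑-cong (genShapes n) (λ { (k , S) → cong (λ z → + k * z) (refl {x = ind (neut (vertex x) S)}) })))))

  regular-degree : ∀ {d} → IsRegularOfDegree (IntGr n s) d → ∀ (T : Tournament n) → score2 {n} T ≡ s → degree {n} T ≡ + d
  regular-degree regular T sc with index T sc
  ... | x , refl = trans (degree-vertex x) (cong +_ (regular x))

  generator-sum : ∀ x (F : Tournament n → ℤ) → ∑ X (λ y → + IntGr n s x y * F (vertex y)) ≡ 𝓛 {n} F (vertex x) + F (vertex x) * degree {n} (vertex x)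
  generator-sum x F = trans (neighbours x F) (sym (trans
    (cong (λ z → 𝓛 {n} F Tₓ + z) (sym (∑-*ˡ (genShapes n) (F Tₓ) (multiplicity {n} Tₓ))))
    (trans (sym (∑-+ (genShapes n) (increment {n} F Tₓ) (λ p → F Tₓ * multiplicity {n} Tₓ p)))
      (∑-cong (genShapes n) (λ { (k , S) → pointwise (+ k) (neut Tₓ S) (F (Tₓ ⟲ S)) (F Tₓ) })))))
    where
    Tₓ : Tournament n
    Tₓ = vertex x
    pointwise : ∀ k b h f → k * gate b (h - f) + f * (k * ind b) ≡ k * gate b h
    pointwise k true  h f = identity k h f
      where identity : ∀ k h f → k * (h - f) + f * (k * 1ℤ) ≡ k * h
            identity = solve-∀
    pointwise k false h f = identity k f
      where identity : ∀ k f → k * 0ℤ + f * (k * 0ℤ) ≡ k * 0ℤ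
            identity = solve-∀

  -- Tournaments of another score get a junk value.
  mark′ : (Fin (K n s) → Bool) → (T : Tournament n) → Dec (score2 {n} T ≡ s) → Bool
  mark′ b T (yes sc) = b (proj₁ (index T sc))
  mark′ b T (no _)   = false

  mark : (Fin (K n s) → Bool) → Tournament n → Bool
  mark b T = mark′ b T (Vecₚ.≡-dec ℤ._≟_ (score2 {n} T) s)

  mark-vertex : ∀ b y → mark b (vertex y) ≡ b y
  mark-vertex b y = go (Vecₚ.≡-dec ℤ._≟_ (score2 {n} (vertex y)) s)
    where
    go : ∀ dec → mark′ b (vertex y) dec ≡ b y
    go (yes sc) = cong b (vertex-injective (proj₂ (index (vertex y) sc)))
    go (no ¬sc) = contradiction (vertex-score y) ¬sc

  -- A sign function varies by at most 2. The factor g brings this to the form c (g + η) and c g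
  -- with c = 2, from which the contraction can start.
  test : ℕ → (Fin (K n s) → Bool) → Tournament n → ℤ
  test g b T = + g * sgn (mark b T)

  test-vertex : ∀ g b y → ι (test g b (vertex y)) ≡ ι (+ g) ℚ.* ι (sgn (b y))
  test-vertex g b y = trans (cong (λ c → ι (+ g * sgn c)) (mark-vertex b y)) (ι-* (+ g) (sgn (b y)))

  test-difference : ∀ g b (T T′ : Tournament n) → test g b T - test g b T′ ≤ + 2 * + g
  test-difference g b T T′ = ≤-slack (+ g * (+ 2 - (sgn (mark b T) - sgn (mark b T′)))) (0≤* {+ g} {+ 2 - (sgn (mark b T) - sgn (mark b T′))} (ℤ.+≤+ ℕ.z≤n) (gap (signs (mark b T) (mark b T′))))
    (identity (+ g) (sgn (mark b T)) (sgn (mark b T′)))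
    where
    signs : ∀ c c′ → sgn c - sgn c′ ≤ + 2
    signs true  true  = ℤ.+≤+ ℕ.z≤n
    signs true  false = ℤₚ.≤-refl
    signs false true  = ℤ.-≤+
    signs false false = ℤ.+≤+ ℕ.z≤n
    identity : ∀ g a b → g * a - g * b + g * (+ 2 - (a - b)) ≡ + 2 * g
    identity = solve-∀

  module Stationary {π : Fin (K n s) → ℚ} (stationary : IsStationary (IntGr n s) π) where

    mean-π-step : ∀ f → mean π f ≡ mean π (step f)
    mean-π-step f = trans (ℚ∑.∑-cong X (λ y → cong (ℚ._* f y) (sym (proj₂ (proj₂ stationary) y)))) (mean-mean π (P (IntGr n s)) f)

    -- For d = 0 the bound allows no step at all. As no generator is neutral, every test function is
    -- Lipschitz with constant 0, and by connectedness it is constant on the vertices.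
    mixing₀ : IsRegularOfDegree (IntGr n s) 0 → ∀ x → dTV (IntGr n s) π 0 x ℚ.≤ (+ 1 ℚ./ 4)
    mixing₀ regular = tv-bound stationary 0 1 0ℤ ℕₚ.≤-refl (ℤ.+≤+ ℕ.z≤n) λ b →
      (λ x → test 1 b (vertex x)) ,
      (λ x → trans (cong (ι 1ℤ ℚ.*_) (mean-δ x (ι ∘ sgn ∘ b))) (sym (test-vertex 1 b x))) ,
      trans (mean-scale (ι 1ℤ) π (ι ∘ sgn ∘ b)) (mean-cong π (λ y → sym (test-vertex 1 b y))) ,
      (λ x z → Distance.distance (isolated b) ℤₚ.≤-refl ℤₚ.≤-refl (M n) (vertex x) (vertex z) (vertex-score x) (vertex-score z) (hamming≤M {n} (vertex x) (vertex z)))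
      where
      degree-0 : ∀ (T : Tournament n) → score2 {n} T ≡ s → degree {n} T ≡ 0ℤ
      degree-0 = regular-degree regular
      isolated : ∀ b → Lipschitz s (test 1 b) 0ℤ 0ℤ
      isolated b = record
        { triangle = λ T u v w p q r sc sc′ → contradiction
            (subst (1ℤ ≤_) (degree-0 T sc) (degree≥1 T u v w p q r (score⇒neut T (tr u v w) (trans sc′ (sym sc))))) λ { (ℤ.+≤+ ()) }
        ; clover = λ T u v p sc sc′ → contradiction
            (subst (+ 2 ≤_) (degree-0 T sc) (degree≥2 T u v p (score⇒neut T (κ u v) (trans sc′ (sym sc))))) λ { (ℤ.+≤+ ()) } }

    module Positive (d′ g a : ℕ) (η : ℤ) (1≤g : 1 ℕ.≤ g) (0≤η : 0ℤ ≤ η) (η≤1 : η ≤ 1ℤ) (m≡dg : suc a ≡ suc d′ ℕ.* g)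
                    (regular : IsRegularOfDegree (IntGr n s) (suc d′)) (cry : CrystalBound s (+ g) η) where

      d : ℕ
      d = suc d′

      open Contraction (+ d) (ℤ.+≤+ (ℕ.s≤s ℕ.z≤n)) (regular-degree regular) (+ g) η (ℤ.+≤+ 1≤g) 0≤η η≤1 cry

      -- As suc a = d g, N = 2 d g is the normalisation of `𝓠` and R = 2 d g - 2 its contraction
      -- factor.
      N R : ℕ
      N = suc a ℕ.+ suc a
      R = a ℕ.+ a

      𝓠-step : ∀ F x → ι (+ N) ℚ.* step (λ y → ι (F (vertex y))) x ≡ ι (𝓠 F (vertex x))
      𝓠-step F x = begin
        ι (+ N) ℚ.* S                                 ≡⟨ cong (λ k → ι k ℚ.* S) split ⟩
        ι (+ g * + (2 ℕ.* d)) ℚ.* S                   ≡⟨ cong (ℚ._* S) (ι-* (+ g) (+ (2 ℕ.* d))) ⟩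
        ι (+ g) ℚ.* ι (+ (2 ℕ.* d)) ℚ.* S             ≡⟨ ℚₚ.*-assoc (ι (+ g)) (ι (+ (2 ℕ.* d))) S ⟩
        ι (+ g) ℚ.* (ι (+ (2 ℕ.* d)) ℚ.* S)           ≡⟨ cong (ι (+ g) ℚ.*_) (step-scaled x (F ∘ vertex) (regular x)) ⟩
        ι (+ g) ℚ.* ι (+ d * f + ∑ X (λ y → + IntGr n s x y * F (vertex y)))  ≡⟨ ι-* (+ g) (+ d * f + ∑ X (λ y → + IntGr n s x y * F (vertex y))) ⟨
        ι (+ g * (+ d * f + ∑ X (λ y → + IntGr n s x y * F (vertex y))))      ≡⟨ cong ι (cong (λ z → + g * z) inner) ⟩
        ι (𝓠 F (vertex x)) ∎
        where
        open ≡-Reasoning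
        S : ℚ
        S = step (λ y → ι (F (vertex y))) x
        f : ℤ
        f = F (vertex x)
        double : ∀ d g → d ℕ.* g ℕ.+ d ℕ.* g ≡ g ℕ.* (2 ℕ.* d)
        double = ℕSolver.solve-∀
        split : + N ≡ + g * + (2 ℕ.* d)
        split = trans (cong +_ (trans (cong₂ ℕ._+_ m≡dg m≡dg) (double d g))) (ℤₚ.pos-* g (2 ℕ.* d))
        identity : ∀ d f l → d * f + (l + f * d) ≡ d * f + d * f + l
        identity = solve-∀
        inner : + d * f + ∑ X (λ y → + IntGr n s x y * F (vertex y)) ≡ twice (+ d * f) + 𝓛 {n} F (vertex x)
        inner = trans (cong (λ z → + d * f + z) (trans (generator-sum x F) (cong (λ z → 𝓛 {n} F (vertex x) + f * z) (regular-degree regular (vertex x) (vertex-score x)))))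
          (identity (+ d) f (𝓛 {n} F (vertex x)))

      iterate : ℕ → (Tournament n → ℤ) → Tournament n → ℤ
      iterate zero    F = F
      iterate (suc t) F = iterate t (𝓠 F)

      -- Spends one factor N on one step of the walk. Two laws p and q appear so that it serves both
      -- P^t, where p is one step after q, and the stationary law, where p = q.
      advance-step : ∀ t (p q : Fin (K n s) → ℚ) F → (∀ f → mean p f ≡ mean q (step f)) →
        ι (+ (N ℕ.^ suc t)) ℚ.* mean p (λ y → ι (F (vertex y))) ≡ ι (+ (N ℕ.^ t)) ℚ.* mean q (λ y → ι (𝓠 F (vertex y)))
      advance-step t p q F shift = begin
        ι (+ (N ℕ.^ suc t)) ℚ.* mean p f                    ≡⟨ cong₂ ℚ._*_ (trans (cong ι (trans (cong +_ (ℕₚ.*-comm N (N ℕ.^ t))) (ℤₚ.pos-* (N ℕ.^ t) N))) (ι-* (+ (N ℕ.^ t)) (+ N))) (shift f) ⟩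
        ι (+ (N ℕ.^ t)) ℚ.* ι (+ N) ℚ.* mean q (step f)     ≡⟨ ℚₚ.*-assoc (ι (+ (N ℕ.^ t))) (ι (+ N)) (mean q (step f)) ⟩
        ι (+ (N ℕ.^ t)) ℚ.* (ι (+ N) ℚ.* mean q (step f))   ≡⟨ cong (ι (+ (N ℕ.^ t)) ℚ.*_) (trans (mean-scale (ι (+ N)) q (step f)) (mean-cong q (𝓠-step F))) ⟩
        ι (+ (N ℕ.^ t)) ℚ.* mean q (λ y → ι (𝓠 F (vertex y))) ∎
        where
        open ≡-Reasoning
        f : Fin (K n s) → ℚ
        f y = ι (F (vertex y))

      iterate-Pt : ∀ t F x → ι (+ (N ℕ.^ t)) ℚ.* mean (Pt (IntGr n s) t x) (λ y → ι (F (vertex y))) ≡ ι (iterate t F (vertex x))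
      iterate-Pt zero    F x = trans (ℚₚ.*-identityˡ (mean (δ (IntGr n s) x) (λ y → ι (F (vertex y))))) (mean-δ x (λ y → ι (F (vertex y))))
      iterate-Pt (suc t) F x = trans (advance-step t (Pt (IntGr n s) (suc t) x) (Pt (IntGr n s) t x) F (mean-Pt-suc t x)) (iterate-Pt t (𝓠 F) x)

      iterate-π : ∀ t F → ι (+ (N ℕ.^ t)) ℚ.* mean π (λ y → ι (F (vertex y))) ≡ mean π (λ y → ι (iterate t F (vertex y)))
      iterate-π zero    F = ℚₚ.*-identityˡ (mean π (λ y → ι (F (vertex y))))
      iterate-π (suc t) F = trans (advance-step t π π F mean-π-step) (iterate-π t (𝓠 F))

      iterate-Lipschitz : ∀ t {F} c → Lipschitz s F (+ c * (+ g + η)) (+ c * + g) →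
        Lipschitz s (iterate t F) (+ (c ℕ.* R ℕ.^ t) * (+ g + η)) (+ (c ℕ.* R ℕ.^ t) * + g)
      iterate-Lipschitz zero    {F} c lip = subst (λ k → Lipschitz s F (+ k * (+ g + η)) (+ k * + g)) (sym (ℕₚ.*-identityʳ c)) lip
      iterate-Lipschitz (suc t) {F} c lip =
        subst (λ k → Lipschitz s (iterate t (𝓠 F)) (+ k * (+ g + η)) (+ k * + g)) (ℕₚ.*-assoc c R (R ℕ.^ t))
          (iterate-Lipschitz t (c ℕ.* R) (subst (λ k → Lipschitz s (𝓠 F) (k * (+ g + η)) (k * + g)) factor (Step.contract {F} {+ c} (ℤ.+≤+ ℕ.z≤n) lip)))
        where
        identity : ∀ x → 1ℤ + x + (1ℤ + x) - + 2 ≡ x + x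
        identity = solve-∀
        factor : + c * (twice (+ d * + g) - + 2) ≡ + (c ℕ.* R)
        factor = trans (cong (λ z → + c * z) (trans (cong (λ z → twice z - + 2) (trans (sym (ℤₚ.pos-* d g)) (cong +_ (sym m≡dg)))) (identity (+ a)))) (sym (ℤₚ.pos-* c R))

      -- The Lipschitz constant after t steps times the diameter bound M n controls the oscillation.
      -- The 8 is a product of three factors 2: from 2 D in `tv-bound`, from the range of a sign
      -- function, and from g + η ≤ 2 g.
      mixing : ∀ t → 8 ℕ.* M n ℕ.* R ℕ.^ t ℕ.≤ N ℕ.^ t → ∀ x → dTV (IntGr n s) π t x ℚ.≤ (+ 1 ℚ./ 4)
      mixing t small = tv-bound stationary t σ D 1≤σ 2D≤σ λ b →
        (λ x → iterate t (test g b) (vertex x)) ,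
        (λ x → trans (rescale b (Pt (IntGr n s) t x)) (iterate-Pt t (test g b) x)) ,
        trans (rescale b π) (iterate-π t (test g b)) ,
        (λ x z → Distance.distance (iterate-Lipschitz t 2 (start b)) 0≤A B≤A (M n) (vertex x) (vertex z) (vertex-score x) (vertex-score z) (hamming≤M {n} (vertex x) (vertex z)))
        where
        σ c : ℕ
        σ = N ℕ.^ t ℕ.* g
        c = 2 ℕ.* R ℕ.^ t
        D : ℤ
        D = + c * (+ g + η) * + M n
        0≤A : 0ℤ ≤ + c * (+ g + η)
        0≤A = 0≤* {+ c} {+ g + η} (ℤ.+≤+ ℕ.z≤n) (0≤+ {+ g} {η} (ℤ.+≤+ ℕ.z≤n) 0≤η)
        more : ∀ k → + k * + g ≤ + k * (+ g + η)
        more k = ℤₚ.*-monoˡ-≤-nonNeg (+ k) (≤-slack η 0≤η refl)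
        B≤A : + c * + g ≤ + c * (+ g + η)
        B≤A = more c
        1≤σ : 1 ℕ.≤ σ
        1≤σ = ℕₚ.*-mono-≤ (ℕₚ.m^n>0 N t) 1≤g
        start : ∀ b → Lipschitz s (test g b) (+ 2 * (+ g + η)) (+ 2 * + g)
        start b = record
          { triangle = λ T u v w _ _ _ _ _ → ℤₚ.≤-trans (test-difference g b T (T ⟲ tr u v w)) (more 2)
          ; clover   = λ T u v _ _ _ → test-difference g b T (T ⟲ κ u v) }
        rescale : ∀ b p → ι (+ σ) ℚ.* mean p (ι ∘ sgn ∘ b) ≡ ι (+ (N ℕ.^ t)) ℚ.* mean p (λ y → ι (test g b (vertex y)))
        rescale b p = trans (cong (ℚ._* mean p (ι ∘ sgn ∘ b)) (trans (cong ι (ℤₚ.pos-* (N ℕ.^ t) g)) (ι-* (+ (N ℕ.^ t)) (+ g))))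
          (trans (ℚₚ.*-assoc (ι (+ (N ℕ.^ t))) (ι (+ g)) (mean p (ι ∘ sgn ∘ b)))
          (cong (ι (+ (N ℕ.^ t)) ℚ.*_) (trans (mean-scale (ι (+ g)) p (ι ∘ sgn ∘ b)) (mean-cong p (λ y → sym (test-vertex g b y))))))
        η≤g : + g + η ≤ + (g ℕ.+ g)
        η≤g = ℤₚ.+-monoʳ-≤ (+ g) (ℤₚ.≤-trans η≤1 (ℤ.+≤+ 1≤g))
        collect : ∀ r g m → 2 ℕ.* (2 ℕ.* r ℕ.* (g ℕ.+ g) ℕ.* m) ≡ 8 ℕ.* m ℕ.* r ℕ.* g
        collect = ℕSolver.solve-∀
        2D≤σ : + 2 * D ≤ + σ
        2D≤σ = ℤₚ.≤-trans (ℤₚ.*-monoˡ-≤-nonNeg (+ 2) (ℤₚ.*-monoʳ-≤-nonNeg (+ M n) (ℤₚ.*-monoˡ-≤-nonNeg (+ c) η≤g)))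
          (ℤₚ.≤-trans (ℤₚ.≤-reflexive natural)
            (ℤ.+≤+ (ℕₚ.≤-trans (ℕₚ.≤-reflexive (collect (R ℕ.^ t) g (M n))) (ℕₚ.*-monoˡ-≤ g small))))
          where
          natural : + 2 * (+ c * + (g ℕ.+ g) * + M n) ≡ + (2 ℕ.* (c ℕ.* (g ℕ.+ g) ℕ.* M n))
          natural = trans (cong (λ z → + 2 * (z * + M n)) (sym (ℤₚ.pos-* c (g ℕ.+ g))))
            (trans (cong (λ z → + 2 * z) (sym (ℤₚ.pos-* (c ℕ.* (g ℕ.+ g)) (M n)))) (sym (ℤₚ.pos-* 2 (c ℕ.* (g ℕ.+ g) ℕ.* M n))))

-- There are no generators for n ≤ 1, so a positive degree forces n ≥ 2 and with it a positive
-- logarithm.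
few-vertices : ∀ {n} (T : Tournament n) → degree {n} T ≢ 0ℤ → 2 ℕ.≤ n
few-vertices {zero}        T ne = contradiction refl ne
few-vertices {suc zero}    T ne = contradiction refl ne
few-vertices {suc (suc n)} T ne = ℕ.s≤s (ℕ.s≤s ℕ.z≤n)

-- Every suc a steps halve the ratio (a / suc a)^t, and 7 times the rounded-up logarithm of n is the
-- number of halvings that bring it below 1 / (8 M n).
rapid : ∀ a n → 2 ℕ.≤ n → let t = suc a ℕ.* (7 ℕ.* ⌈log₂ n ⌉) in 8 ℕ.* M n ℕ.* (a ℕ.+ a) ℕ.^ t ℕ.≤ (suc a ℕ.+ suc a) ℕ.^ t
rapid a n 2≤n = begin
  8 ℕ.* M n ℕ.* (a ℕ.+ a) ℕ.^ t          ≡⟨ cong (8 ℕ.* M n ℕ.*_) (doubled a) ⟩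
  8 ℕ.* M n ℕ.* (2 ℕ.^ t ℕ.* a ℕ.^ t)    ≤⟨ ℕₚ.*-monoˡ-≤ (2 ℕ.^ t ℕ.* a ℕ.^ t) (8M≤ n 2≤n) ⟩
  2 ℕ.^ k ℕ.* (2 ℕ.^ t ℕ.* a ℕ.^ t)      ≡⟨ exchange (2 ℕ.^ k) (2 ℕ.^ t) (a ℕ.^ t) ⟩
  2 ℕ.^ t ℕ.* (2 ℕ.^ k ℕ.* a ℕ.^ t)      ≤⟨ ℕₚ.*-monoʳ-≤ (2 ℕ.^ t) (decay a k) ⟩
  2 ℕ.^ t ℕ.* suc a ℕ.^ t                ≡⟨ doubled (suc a) ⟨
  (suc a ℕ.+ suc a) ℕ.^ t                ∎
  where
  open ℕₚ.≤-Reasoning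
  k t : ℕ
  k = 7 ℕ.* ⌈log₂ n ⌉
  t = suc a ℕ.* k
  doubled : ∀ b → (b ℕ.+ b) ℕ.^ t ≡ 2 ℕ.^ t ℕ.* b ℕ.^ t
  doubled b = trans (cong (λ c → (b ℕ.+ c) ℕ.^ t) (sym (ℕₚ.+-identityʳ b))) (^-distrib-* 2 b t)
  exchange : ∀ x y z → x ℕ.* (y ℕ.* z) ≡ y ℕ.* (x ℕ.* z)
  exchange = ℕSolver.solve-∀

mixes : ∀ n (s : Vec ℤ n) → InScore2 n s → ∀ d g η π → IsRegularOfDegree (IntGr n s) d → 1 ℕ.≤ g → 0ℤ ≤ η → η ≤ 1ℤ →
        CrystalBound s (+ g) η → IsStationary (IntGr n s) π → TmixAtMost (IntGr n s) π (d ℕ.* g ℕ.* (7 ℕ.* ⌈log₂ n ⌉))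
mixes n s _ zero g η π regular 1≤g 0≤η η≤1 cry stationary = 0 , ℕ.z≤n , Walk.Stationary.mixing₀ s stationary regular
mixes n s (T , sc) (suc d) (suc g) η π regular 1≤g 0≤η η≤1 cry stationary =
  suc d ℕ.* suc g ℕ.* (7 ℕ.* ⌈log₂ n ⌉) , ℕₚ.≤-refl ,
  Walk.Stationary.Positive.mixing s stationary d (suc g) (g ℕ.+ d ℕ.* suc g) η 1≤g 0≤η η≤1 refl regular cry
    (suc d ℕ.* suc g ℕ.* (7 ℕ.* ⌈log₂ n ⌉))
    (rapid (g ℕ.+ d ℕ.* suc g) n (few-vertices {n} T (λ eq → case trans (sym eq) (Walk.regular-degree s regular T sc) of λ ())))

theorem26 : Σ ℕ λ C →
  (n : ℕ) (s : Vec ℤ n) → InScore2 n s →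
  (d γ : ℕ) (π : Fin (K n s) → ℚ) →
  IsRegularOfDegree (IntGr n s) d →
  IsMaxCrystalDegree (IntGr n s) γ →
  IsStationary (IntGr n s) π →
    ((γ ≡ 0) → TmixAtMost (IntGr n s) π (C ℕ.* d ℕ.* ⌈log₂ n ⌉))
  × ((0 ℕ.< γ) → TmixAtMost (IntGr n s) π (C ℕ.* γ ℕ.* d ℕ.* ⌈log₂ n ⌉))
theorem26 = 7 , λ n s inScore d γ π regular maximal stationary →
  -- The weight g has to be at least 1, so γ = 0 is replaced by g = 1, with η = 0 making the two
  -- constants equal.
  (λ { refl → subst (TmixAtMost (IntGr n s) π) (calm d ⌈log₂ n ⌉)
         (mixes n s inScore d 1 0ℤ π regular ℕₚ.≤-refl ℤₚ.≤-refl (ℤ.+≤+ ℕ.z≤n) (crystal-bound₀ maximal) stationary) }) ,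
  (λ 0<γ → subst (TmixAtMost (IntGr n s) π) (crystalline d γ ⌈log₂ n ⌉)
         (mixes n s inScore d γ 1ℤ π regular 0<γ (ℤ.+≤+ ℕ.z≤n) ℤₚ.≤-refl (crystal-bound₁ maximal) stationary))
  where
  calm : ∀ d L → d ℕ.* 1 ℕ.* (7 ℕ.* L) ≡ 7 ℕ.* d ℕ.* L
  calm = ℕSolver.solve-∀
  crystalline : ∀ d γ L → d ℕ.* γ ℕ.* (7 ℕ.* L) ≡ 7 ℕ.* γ ℕ.* d ℕ.* L
  crystalline = ℕSolver.solve-∀
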